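{- Let $p(n)$ denote the number of integer partitions of $n$, and for $n \geq 1$ let $u_n = \frac{p(n+1)p(n-1)}{p(n)^2}$. Then for all integers $n \geq 2$, $$4(1-u_n)(1-u_{n+1}) < \left(1 + \frac{\pi}{\sqrt{24}\, n^{3/2}}\right)(1 - u_n u_{n+1})^2.$$
   Context: $p(0)=1$, and $p(n)$ is the number of partitions of the nonnegative integer $n$. -}

module Defs where

open import Data.Nat as ℕ using (ℕ; zero; suc; _≤ᵇ_; _∸_)
open import Data.Bool using (if_then_else_)
open import Data.List using (upTo; map)
open import Data.Nat.ListAction using (sum)
open import Data.Integer using (+_)
open import Data.Rational using (ℚ; _/_; 0ℚ; _+_; _*_; _<_)
open import Data.Product using (∃-syntax)

-- Pc n k = number of partitions of n into parts of size ≤ k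
-- (for k ≥ 1: choose the multiplicity j of the part k, then partition the
-- remainder n - j*k into parts of size ≤ k-1).
Pc : ℕ → ℕ → ℕ
Pc zero    zero    = 1
Pc (suc n) zero    = 0
Pc n       (suc k) =
  sum (map (λ j → if j ℕ.* suc k ≤ᵇ n then Pc (n ∸ j ℕ.* suc k) k else 0)
           (upTo (suc n)))

p : ℕ → ℕ
p n = Pc n n

-- natural-number fraction a / b as a rational (b = 0 never occurs below
-- since p n ≥ 1; the zero case is a harmless default)
frac : ℕ → ℕ → ℚ
frac a zero    = 0ℚ
frac a (suc b) = (+ a) / suc b

ℕ→ℚ : ℕ → ℚ
ℕ→ℚ n = (+ n) / 1

u : ℕ → ℚ
u n = frac (p (suc n) ℕ.* p (n ∸ 1)) (p n ℕ.* p n)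

-- Basel partial sums  S K = Σ_{k=1}^{K} 1/k^2 ; increasing with limit π²/6
basel : ℕ → ℚ
basel zero    = 0ℚ
basel (suc k) = basel k + frac 1 (suc k ℕ.* suc k)

-- "x < π²" : since 6·(basel K) increases strictly to π², x < π² iff some
-- partial sum 6·(basel K) exceeds x.
_<π² : ℚ → Set
x <π² = ∃[ K ] (x < ℕ→ℚ 6 * basel K)

{-# OPTIONS --safe #-}
-- Let A approximate π²/6 and let Δ be the backward difference.  Comparing n p(n) = ∑ σ(k) p(n - k)
-- with σ(k) ≈ A k - 1/2 gives
--   (N + 1) Δp(N + 1) = (N - 3/2) Δp(N) + A p(N) + ε,   ε = ∑ R(k) Δ⁵p(N - k),
-- where R is the error of the threefold sum of σ; the hyperbola method (and a table for x < 1600)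
-- yields |R(x)| ≤ (x + 1)(x + 2)/20.  Put s = p(N)/Δp(N).  By induction on N ≥ 2490,
--   N = A s² - (2 + A) s + g with 1.2 ≤ g ≤ 1.69,
--   |Δⁱp(m)| ≤ Bᵢ s⁻ⁱ (1 - ν/s)^(N - m) p(N) for i ≤ 5 and m ≤ N.
-- The second line bounds ε, and then the recurrence carries s and g from N to N + 1.  It renews
-- itself because σ is the sum over m of the sequences d ↦ d placed at the multiples dm: the part
-- m = 1 can be summed by parts and lowers the order of the difference by two, and the parts m ≥ 2
-- carry only the weight A - 1 < 1.  If s′ belongs to N + 1, then
-- 1/u(N) - 1 = (s′ - s)/((s - 1) s′) ≈ 1/(2 A s³), whence 4 N³ (1/u(N) - 1)² < π²/6.  For
-- 45 ≤ N < 2490 the same is read off a table.  The theorem follows with c the larger of 1/u - 1 at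
-- n and n + 1, and for n ≤ 44 with explicit c.
module Submission where

open import Defs using (Pc; p)
open import Data.Bool using (Bool; true; false; if_then_else_; _∧_)
open import Data.Bool.Properties using (T-≡)
open import Data.Empty using (⊥-elim)
open import Data.Fin using (Fin; zero; suc)
open import Data.Integer as ℤ using (ℤ) renaming (+_ to nat; -[1+_] to negsuc)
import Data.Integer.Properties as ℤₚ
open import Data.List using (List; []; _∷_; applyUpTo; drop; length; map)
open import Data.List.Properties using (map-upTo)
open import Data.Nat as ℕ using (ℕ; zero; suc; z≤n; s≤s; _∸_; _/_; _%_; _≡ᵇ_; _≤ᵇ_; _<ᵇ_)
import Data.Nat.DivMod as DM
open import Data.Nat.Induction using (<-rec)
open import Data.Nat.ListAction using (sum)
import Data.Nat.Properties as ℕₚ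
open import Data.Product using (_×_; _,_; proj₁; proj₂; ∃-syntax)
open import Data.Rational as ℚ using (toℚᵘ)
import Data.Rational.Properties as ℚₚ
open import Data.Rational.Unnormalised using (mkℚᵘ; _≃_; *≡*; *≤*)
import Data.Rational.Unnormalised.Properties as ℚᵘₚ
open import Data.Sum using (_⊎_; inj₁; inj₂)
open import Data.Unit using (⊤; tt)
open import Data.Vec using (Vec; []; _∷_; lookup)
open import Function.Bundles using (Equivalence)
open import Relation.Nullary using (Dec; yes; no; ¬_)
open import Relation.Binary.PropositionalEquality using (_≡_; _≢_; refl; sym; trans; cong; cong₂; subst; subst₂)

-- The field has no π², so A is an Euler-Maclaurin value `A L` built from the first L reciprocal
-- squares, and L stays fixed throughout one induction. The induction ends with 4 N³ (1/u(N) - 1)² ≤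
-- A - 1/(2s). For L = 2N + 1 the spare 1/(2s) exceeds 1/L, hence the distance from A to the L-th
-- partial sum, and that sum witnesses the comparison with π². The coefficient 2 + A of the
-- quadratic is forced: with it A s² - (2 + A) s grows by 1 per step to leading order. The rest g
-- then drifts by about (7/2 - 1/A + 2θ - 2g)/s, where θ = ε s²/p(N), and is pulled towards 1.446 +
-- θ; |θ| ≤ 0.21 keeps this point inside the interval allowed for g. The start at 2490 reflects s ≥
-- 40: passing to N + 1 costs up to five factors s′/s, about 1.75/s² in all, and ν = 0.955 pays
-- 0.045/s. The order has only ≤, so a strict inequality appears as a refutation of the reverse one.

-- Working over an abstract field keeps the normal forms of rational numbers out of the proofs.
record OrderedField : Set₁ where
  infixl 6 _+_ _-_
  infixl 7 _*_
  infix 8 -_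
  infix 4 _≤_
  field
    F : Set
    _+_ _*_ : F → F → F
    -_ inv : F → F
    fromℤ : ℤ → F
    _≤_ : F → F → Set
    +-assoc : ∀ x y z → (x + y) + z ≡ x + (y + z)
    +-comm : ∀ x y → x + y ≡ y + x
    *-assoc : ∀ x y z → (x * y) * z ≡ x * (y * z)
    *-comm : ∀ x y → x * y ≡ y * x
    *-distribˡ : ∀ x y z → x * (y + z) ≡ x * y + x * z
    fromℤ-+ : ∀ a b → fromℤ (a ℤ.+ b) ≡ fromℤ a + fromℤ b
    fromℤ-* : ∀ a b → fromℤ (a ℤ.* b) ≡ fromℤ a * fromℤ b
    fromℤ-neg : ∀ a → fromℤ (ℤ.- a) ≡ - fromℤ a
    0+ : ∀ x → fromℤ (nat 0) + x ≡ x
    1* : ∀ x → fromℤ (nat 1) * x ≡ x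
    -‿inverse : ∀ x → - x + x ≡ fromℤ (nat 0)
    -- Every denominator of the proof is at least 1, so `1 ≤ x` serves as the condition for
    -- invertibility and the order can be given by `≤` alone.
    inv-inverse : ∀ x → fromℤ (nat 1) ≤ x → x * inv x ≡ fromℤ (nat 1)
    inv-nonneg : ∀ x → fromℤ (nat 1) ≤ x → fromℤ (nat 0) ≤ inv x
    ≤-refl : ∀ {x} → x ≤ x
    ≤-trans : ∀ {x y z} → x ≤ y → y ≤ z → x ≤ z
    ≤-total : ∀ x y → (x ≤ y) ⊎ (y ≤ x)
    +-mono : ∀ {x y u v} → x ≤ y → u ≤ v → x + u ≤ y + v
    *-nonneg : ∀ {x y} → fromℤ (nat 0) ≤ x → fromℤ (nat 0) ≤ y → fromℤ (nat 0) ≤ x * y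
    fromℤ-nonneg : ∀ n → fromℤ (nat 0) ≤ fromℤ (nat n)
    -- Refutations in `F` end here: an absurd inequality is carried back to the naturals.
    fromℤ-reflects : ∀ m n → fromℤ (nat m) ≤ fromℤ (nat n) → m ℕ.≤ n

  _-_ : F → F → F
  x - y = x + (- y)

  ι : ℕ → F
  ι n = fromℤ (nat n)

module Development (𝔽 : OrderedField) where

  -- Polynomial identities and inequalities

  open OrderedField 𝔽 public

  +-0 : ∀ x → x + ι 0 ≡ x
  +-0 x = trans (+-comm x (ι 0)) (0+ x)

  +-cancelˡ : ∀ x {y z} → x + y ≡ x + z → y ≡ z
  +-cancelˡ x {y} {z} e = trans (sym (h y)) (trans (cong (λ t → - x + t) e) (h z))
    where
    h : ∀ t → - x + (x + t) ≡ t
    h t = trans (sym (+-assoc (- x) x t)) (trans (cong (_+ t) (-‿inverse x)) (0+ t))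

  *-0 : ∀ x → x * ι 0 ≡ ι 0
  *-0 x = +-cancelˡ (x * ι 0)
    (trans (sym (*-distribˡ x (ι 0) (ι 0))) (trans (cong (x *_) (0+ (ι 0))) (sym (+-0 (x * ι 0)))))

  0* : ∀ x → ι 0 * x ≡ ι 0
  0* x = trans (*-comm (ι 0) x) (*-0 x)

  *-1 : ∀ x → x * ι 1 ≡ x
  *-1 x = trans (*-comm x (ι 1)) (1* x)

  *-distribʳ : ∀ x y z → (y + z) * x ≡ y * x + z * x
  *-distribʳ x y z = trans (*-comm (y + z) x)
    (trans (*-distribˡ x y z) (cong₂ _+_ (*-comm x y) (*-comm x z)))

  +-swap : ∀ a b c d → (a + b) + (c + d) ≡ (a + c) + (b + d)
  +-swap a b c d = trans (+-assoc a b (c + d)) (trans (cong (_+_ a)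
    (trans (sym (+-assoc b c d)) (trans (cong (_+ d) (+-comm b c)) (+-assoc c b d))))
    (sym (+-assoc a c (b + d))))

  neg-unique : ∀ {x y} → x + y ≡ ι 0 → x ≡ - y
  neg-unique {x} {y} e = trans (sym (+-0 x)) (trans (cong (x +_) (sym (trans (+-comm y (- y)) (-‿inverse y))))
    (trans (sym (+-assoc x y (- y))) (trans (cong (_+ - y) e) (0+ (- y)))))

  neg-+ : ∀ x y → - (x + y) ≡ - x + - y
  neg-+ x y = sym (neg-unique (trans (+-swap (- x) (- y) x y)
    (trans (cong₂ _+_ (-‿inverse x) (-‿inverse y)) (0+ (ι 0)))))

  neg-*ʳ : ∀ x y → - (x * y) ≡ x * - y
  neg-*ʳ x y = sym (neg-unique (trans (sym (*-distribˡ x (- y) y))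
    (trans (cong (x *_) (-‿inverse y)) (*-0 x))))

  neg-0 : - ι 0 ≡ ι 0
  neg-0 = sym (neg-unique (0+ (ι 0)))

  data Expr (n : ℕ) : Set where
    con : ℤ → Expr n
    var : Fin n → Expr n
    _⊕_ _⊗_ : Expr n → Expr n → Expr n
    ⊝_ : Expr n → Expr n

  infixl 6 _⊕_ _⊖_
  infixl 7 _⊗_
  infix 8 ⊝_

  _⊖_ : ∀ {n} → Expr n → Expr n → Expr n
  a ⊖ b = a ⊕ (⊝ b)

  # : ∀ {n} → ℕ → Expr n
  # k = con (nat k)

  ⟦_⟧ : ∀ {n} → Expr n → Vec F n → F
  ⟦ con c ⟧ ρ = fromℤ c
  ⟦ var i ⟧ ρ = lookup ρ i
  ⟦ a ⊕ b ⟧ ρ = ⟦ a ⟧ ρ + ⟦ b ⟧ ρ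
  ⟦ a ⊗ b ⟧ ρ = ⟦ a ⟧ ρ * ⟦ b ⟧ ρ
  ⟦ ⊝ a ⟧ ρ = - ⟦ a ⟧ ρ

  -- Dense recursive polynomials in Horner form.
  Poly : ℕ → Set
  Poly zero = ℤ
  Poly (suc n) = List (Poly n)

  evalP : ∀ n → Poly n → Vec F n → F
  horner : ∀ n → List (Poly n) → F → Vec F n → F
  evalP zero c ρ = fromℤ c
  evalP (suc n) p (x ∷ ρ) = horner n p x ρ
  horner n [] x ρ = ι 0
  horner n (c ∷ p) x ρ = evalP n c ρ + x * horner n p x ρ

  conP : ∀ n → ℤ → Poly n
  conP zero c = c
  conP (suc n) c = conP n c ∷ []

  varP : ∀ n → Fin n → Poly n
  varP (suc n) zero = conP n (nat 0) ∷ conP n (nat 1) ∷ []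
  varP (suc n) (suc i) = varP n i ∷ []

  addP : ∀ n → Poly n → Poly n → Poly n
  addL : ∀ n → List (Poly n) → List (Poly n) → List (Poly n)
  addP zero a b = a ℤ.+ b
  addP (suc n) p q = addL n p q
  addL n [] q = q
  addL n (a ∷ p) [] = a ∷ p
  addL n (a ∷ p) (b ∷ q) = addP n a b ∷ addL n p q

  negP : ∀ n → Poly n → Poly n
  negL : ∀ n → List (Poly n) → List (Poly n)
  negP zero a = ℤ.- a
  negP (suc n) p = negL n p
  negL n [] = []
  negL n (a ∷ p) = negP n a ∷ negL n p

  mulP : ∀ n → Poly n → Poly n → Poly n
  scaleL : ∀ n → Poly n → List (Poly n) → List (Poly n)
  mulL : ∀ n → List (Poly n) → List (Poly n) → List (Poly n)
  mulP zero a b = a ℤ.* b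
  mulP (suc n) p q = mulL n p q
  scaleL n a [] = []
  scaleL n a (b ∷ q) = mulP n a b ∷ scaleL n a q
  mulL n [] q = []
  mulL n (a ∷ []) q = scaleL n a q
  mulL n (a ∷ p) q = addL n (scaleL n a q) (conP n (nat 0) ∷ mulL n p q)

  norm : ∀ {n} → Expr n → Poly n
  norm (con c) = conP _ c
  norm (var i) = varP _ i
  norm (a ⊕ b) = addP _ (norm a) (norm b)
  norm (a ⊗ b) = mulP _ (norm a) (norm b)
  norm (⊝ a) = negP _ (norm a)

  evalP-con : ∀ n c ρ → evalP n (conP n c) ρ ≡ fromℤ c
  evalP-con zero c [] = refl
  evalP-con (suc n) c (x ∷ ρ) = trans (cong₂ _+_ (evalP-con n c ρ) (*-0 x)) (+-0 _)

  evalP-var : ∀ n i ρ → evalP n (varP n i) ρ ≡ lookup ρ i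
  evalP-var (suc n) zero (x ∷ ρ) = trans (cong₂ _+_ (evalP-con n (nat 0) ρ)
    (cong (x *_) (trans (cong₂ _+_ (evalP-con n (nat 1) ρ) (*-0 x)) (+-0 _)))) (trans (0+ _) (*-1 x))
  evalP-var (suc n) (suc i) (x ∷ ρ) = trans (cong₂ _+_ (evalP-var n i ρ) (*-0 x)) (+-0 _)

  evalP-add : ∀ n p q ρ → evalP n (addP n p q) ρ ≡ evalP n p ρ + evalP n q ρ
  horner-add : ∀ n p q x ρ → horner n (addL n p q) x ρ ≡ horner n p x ρ + horner n q x ρ
  evalP-add zero a b ρ = fromℤ-+ a b
  evalP-add (suc n) p q (x ∷ ρ) = horner-add n p q x ρ
  horner-add n [] q x ρ = sym (0+ _)
  horner-add n (a ∷ p) [] x ρ = sym (+-0 _)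
  horner-add n (a ∷ p) (b ∷ q) x ρ = trans (cong₂ _+_ (evalP-add n a b ρ)
    (trans (cong (x *_) (horner-add n p q x ρ)) (*-distribˡ x _ _))) (+-swap _ _ _ _)

  evalP-neg : ∀ n p ρ → evalP n (negP n p) ρ ≡ - evalP n p ρ
  horner-neg : ∀ n p x ρ → horner n (negL n p) x ρ ≡ - horner n p x ρ
  evalP-neg zero a ρ = fromℤ-neg a
  evalP-neg (suc n) p (x ∷ ρ) = horner-neg n p x ρ
  horner-neg n [] x ρ = sym neg-0
  horner-neg n (a ∷ p) x ρ = trans (cong₂ _+_ (evalP-neg n a ρ)
    (trans (cong (x *_) (horner-neg n p x ρ)) (sym (neg-*ʳ x _)))) (sym (neg-+ _ _))

  *-left-swap : ∀ a b c → a * (b * c) ≡ b * (a * c)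
  *-left-swap a b c = trans (sym (*-assoc a b c)) (trans (cong (_* c) (*-comm a b)) (*-assoc b a c))

  evalP-mul : ∀ n p q ρ → evalP n (mulP n p q) ρ ≡ evalP n p ρ * evalP n q ρ
  horner-scale : ∀ n a q x ρ → horner n (scaleL n a q) x ρ ≡ evalP n a ρ * horner n q x ρ
  horner-mul : ∀ n p q x ρ → horner n (mulL n p q) x ρ ≡ horner n p x ρ * horner n q x ρ
  evalP-mul zero a b ρ = fromℤ-* a b
  evalP-mul (suc n) p q (x ∷ ρ) = horner-mul n p q x ρ
  horner-scale n a [] x ρ = sym (*-0 _)
  horner-scale n a (b ∷ q) x ρ = trans (cong₂ _+_ (evalP-mul n a b ρ)
    (trans (cong (x *_) (horner-scale n a q x ρ)) (*-left-swap x _ _))) (sym (*-distribˡ _ _ _))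
  horner-mul n [] q x ρ = sym (0* _)
  horner-mul n (a ∷ []) q x ρ = trans (horner-scale n a q x ρ)
    (cong (_* _) (sym (trans (cong (evalP n a ρ +_) (*-0 x)) (+-0 _))))
  horner-mul n (a ∷ b ∷ p) q x ρ = trans (horner-add n (scaleL n a q) _ x ρ)
    (trans (cong₂ _+_ (horner-scale n a q x ρ)
      (trans (cong₂ _+_ (evalP-con n (nat 0) ρ)
        (trans (cong (x *_) (horner-mul n (b ∷ p) q x ρ)) (sym (*-assoc x _ _)))) (0+ _)))
      (sym (*-distribʳ _ _ _)))

  norm-correct : ∀ {n} (e : Expr n) ρ → evalP n (norm e) ρ ≡ ⟦ e ⟧ ρ
  norm-correct (con c) ρ = evalP-con _ c ρ
  norm-correct (var i) ρ = evalP-var _ i ρ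
  norm-correct (a ⊕ b) ρ = trans (evalP-add _ (norm a) (norm b) ρ) (cong₂ _+_ (norm-correct a ρ) (norm-correct b ρ))
  norm-correct (a ⊗ b) ρ = trans (evalP-mul _ (norm a) (norm b) ρ) (cong₂ _*_ (norm-correct a ρ) (norm-correct b ρ))
  norm-correct (⊝ a) ρ = trans (evalP-neg _ (norm a) ρ) (cong -_ (norm-correct a ρ))

  zeroℤ nonnegℤ : ℤ → Bool
  zeroℤ (nat zero) = true
  zeroℤ _ = false
  nonnegℤ (nat _) = true
  nonnegℤ (negsuc _) = false

  allP : (ℤ → Bool) → ∀ n → Poly n → Bool
  allL : (ℤ → Bool) → ∀ n → List (Poly n) → Bool
  allP f zero c = f c
  allP f (suc n) p = allL f n p
  allL f n [] = true
  allL f n (c ∷ p) = allP f n c ∧ allL f n p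

  ∧-true : ∀ {a b} → a ∧ b ≡ true → (a ≡ true) × (b ≡ true)
  ∧-true {true} {true} e = refl , refl

  evalP-zero : ∀ n p ρ → allP zeroℤ n p ≡ true → evalP n p ρ ≡ ι 0
  horner-zero : ∀ n p x ρ → allL zeroℤ n p ≡ true → horner n p x ρ ≡ ι 0
  evalP-zero zero (nat zero) ρ e = refl
  evalP-zero (suc n) p (x ∷ ρ) e = horner-zero n p x ρ e
  horner-zero n [] x ρ e = refl
  horner-zero n (c ∷ p) x ρ e with ∧-true e
  ... | e₁ , e₂ = trans (cong₂ _+_ (evalP-zero n c ρ e₁)
    (trans (cong (x *_) (horner-zero n p x ρ e₂)) (*-0 x))) (0+ _)

  Nonneg : ∀ {n} → Vec F n → Set
  Nonneg [] = ⊤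
  Nonneg (x ∷ ρ) = (ι 0 ≤ x) × Nonneg ρ

  ≡⇒≤ : ∀ {x y} → x ≡ y → x ≤ y
  ≡⇒≤ refl = ≤-refl

  +-nonneg : ∀ {x y} → ι 0 ≤ x → ι 0 ≤ y → ι 0 ≤ x + y
  +-nonneg p q = ≤-trans (≡⇒≤ (sym (0+ (ι 0)))) (+-mono p q)

  evalP-nonneg : ∀ n p ρ → Nonneg ρ → allP nonnegℤ n p ≡ true → ι 0 ≤ evalP n p ρ
  horner-nonneg : ∀ n p x ρ → ι 0 ≤ x → Nonneg ρ → allL nonnegℤ n p ≡ true → ι 0 ≤ horner n p x ρ
  evalP-nonneg zero (nat k) ρ h e = fromℤ-nonneg k
  evalP-nonneg (suc n) p (x ∷ ρ) (hx , h) e = horner-nonneg n p x ρ hx h e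
  horner-nonneg n [] x ρ hx h e = ≤-refl
  horner-nonneg n (c ∷ p) x ρ hx h e with ∧-true e
  ... | e₁ , e₂ = +-nonneg (evalP-nonneg n c ρ h e₁) (*-nonneg hx (horner-nonneg n p x ρ hx h e₂))

  -‿cancel : ∀ {x y} → x - y ≡ ι 0 → x ≡ y
  -‿cancel {x} {y} e = trans (sym (+-0 x)) (trans (cong (x +_) (sym (-‿inverse y)))
    (trans (sym (+-assoc x (- y) y)) (trans (cong (_+ y) e) (0+ y))))

  0≤-⇒≤ : ∀ {x y} → ι 0 ≤ y - x → x ≤ y
  0≤-⇒≤ {x} {y} h = ≤-trans (≡⇒≤ (sym (0+ x)))
    (≤-trans (+-mono h (≤-refl {x}))
      (≡⇒≤ (trans (+-assoc y (- x) x) (trans (cong (y +_) (-‿inverse x)) (+-0 y)))))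

  ≤⇒0≤- : ∀ {x y} → x ≤ y → ι 0 ≤ y - x
  ≤⇒0≤- {x} {y} h = ≤-trans (≡⇒≤ (sym (trans (+-comm x (- x)) (-‿inverse x)))) (+-mono h ≤-refl)

  -- Normal forms may keep vanishing coefficients and are not unique, so the difference is tested
  -- coefficient by coefficient instead of comparing two normal forms.
  ring : ∀ {n} (a b : Expr n) (ρ : Vec F n) → allP zeroℤ n (norm (a ⊖ b)) ≡ true → ⟦ a ⟧ ρ ≡ ⟦ b ⟧ ρ
  ring a b ρ e = -‿cancel (trans (sym (norm-correct (a ⊖ b) ρ)) (evalP-zero _ (norm (a ⊖ b)) ρ e))

  -- The engine for all numerical inequalities: the variables are slacks such as s - 40, chosen so
  -- that every coefficient of the difference comes out nonnegative. Where this fails, a product of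
  -- known nonnegative quantities is first moved to the smaller side.
  pos : ∀ {n} (a b : Expr n) (ρ : Vec F n) → Nonneg ρ → allP nonnegℤ n (norm (b ⊖ a)) ≡ true → ⟦ a ⟧ ρ ≤ ⟦ b ⟧ ρ
  pos a b ρ h e = 0≤-⇒≤ (≤-trans (evalP-nonneg _ (norm (b ⊖ a)) ρ h e) (≡⇒≤ (norm-correct (b ⊖ a) ρ)))

  -- Sequences, convolution and iterated sums

  pattern v0 = var zero
  pattern v1 = var (suc zero)
  pattern v2 = var (suc (suc zero))
  pattern v3 = var (suc (suc (suc zero)))
  pattern v4 = var (suc (suc (suc (suc zero))))
  pattern v5 = var (suc (suc (suc (suc (suc zero)))))
  pattern v6 = var (suc (suc (suc (suc (suc (suc zero))))))
  pattern v7 = var (suc (suc (suc (suc (suc (suc (suc zero)))))))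
  pattern v8 = var (suc (suc (suc (suc (suc (suc (suc (suc zero))))))))
  pattern v9 = var (suc (suc (suc (suc (suc (suc (suc (suc (suc zero)))))))))
  pattern v10 = var (suc (suc (suc (suc (suc (suc (suc (suc (suc (suc zero))))))))))

  +-congʳ : ∀ {x y z} → x ≡ y → x + z ≡ y + z
  +-congʳ refl = refl

  +-congˡ : ∀ {x y z} → x ≡ y → z + x ≡ z + y
  +-congˡ refl = refl

  Sq : Set
  Sq = ℕ → F

  ∑ : ℕ → Sq → F
  ∑ zero f = ι 0
  ∑ (suc n) f = ∑ n f + f (suc n)

  ∑-cong : ∀ n {f g} → (∀ i → 1 ℕ.≤ i → i ℕ.≤ n → f i ≡ g i) → ∑ n f ≡ ∑ n g
  ∑-cong zero h = refl
  ∑-cong (suc n) h = cong₂ _+_ (∑-cong n (λ i p q → h i p (ℕₚ.m≤n⇒m≤1+n q))) (h (suc n) (s≤s z≤n) ℕₚ.≤-refl)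

  ∑-cong' : ∀ n {f g} → (∀ i → f i ≡ g i) → ∑ n f ≡ ∑ n g
  ∑-cong' n h = ∑-cong n (λ i _ _ → h i)

  ∑-0 : ∀ n → ∑ n (λ _ → ι 0) ≡ ι 0
  ∑-0 zero = refl
  ∑-0 (suc n) = trans (cong (_+ ι 0) (∑-0 n)) (0+ _)

  ∑-+ : ∀ n f g → ∑ n (λ i → f i + g i) ≡ ∑ n f + ∑ n g
  ∑-+ zero f g = sym (0+ _)
  ∑-+ (suc n) f g = trans (+-congʳ (∑-+ n f g)) (+-swap _ _ _ _)

  ∑-* : ∀ n c f → ∑ n (λ i → c * f i) ≡ c * ∑ n f
  ∑-* zero c f = sym (*-0 c)
  ∑-* (suc n) c f = trans (+-congʳ (∑-* n c f)) (sym (*-distribˡ c _ _))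

  ∑-swap : ∀ m n (f : ℕ → ℕ → F) → ∑ m (λ i → ∑ n (f i)) ≡ ∑ n (λ j → ∑ m (λ i → f i j))
  ∑-swap zero n f = sym (∑-0 n)
  ∑-swap (suc m) n f = trans (+-congʳ (∑-swap m n f)) (sym (∑-+ n _ _))

  ∑-split : ∀ m n f → ∑ (m ℕ.+ n) f ≡ ∑ m f + ∑ n (λ i → f (m ℕ.+ i))
  ∑-split m zero f = trans (cong (λ k → ∑ k f) (ℕₚ.+-identityʳ m)) (sym (+-0 _))
  ∑-split m (suc n) f rewrite ℕₚ.+-suc m n = trans (cong (_+ f (suc (m ℕ.+ n))) (∑-split m n f)) (+-assoc _ _ _)

  ∑-head : ∀ n f → ∑ (suc n) f ≡ f 1 + ∑ n (λ i → f (suc i))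
  ∑-head n f = trans (∑-split 1 n f) (+-congʳ (0+ _))

  ∑-mono : ∀ n {f g} → (∀ i → 1 ℕ.≤ i → i ℕ.≤ n → f i ≤ g i) → ∑ n f ≤ ∑ n g
  ∑-mono zero h = ≤-refl
  ∑-mono (suc n) h = +-mono (∑-mono n (λ i p q → h i p (ℕₚ.m≤n⇒m≤1+n q))) (h (suc n) (s≤s z≤n) ℕₚ.≤-refl)

  -- On generating series this is multiplication by the k-th power of z.
  sh : ℕ → Sq → Sq
  sh zero b n = b n
  sh (suc k) b zero = ι 0
  sh (suc k) b (suc n) = sh k b n

  sh-+ : ∀ i j b n → sh (i ℕ.+ j) b n ≡ sh i (sh j b) n
  sh-+ zero j b n = refl
  sh-+ (suc i) j b zero = refl
  sh-+ (suc i) j b (suc n) = sh-+ i j b n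

  sh-big : ∀ k b n → n ℕ.< k → sh k b n ≡ ι 0
  sh-big (suc k) b zero p = refl
  sh-big (suc k) b (suc n) (s≤s p) = sh-big k b n p

  sh-at : ∀ k b n → sh k b (k ℕ.+ n) ≡ b n
  sh-at zero b n = refl
  sh-at (suc k) b n = sh-at k b n

  sh-cong : ∀ k {a b} n → (∀ m → m ℕ.≤ n → a m ≡ b m) → sh k a n ≡ sh k b n
  sh-cong zero n h = h n ℕₚ.≤-refl
  sh-cong (suc k) zero h = refl
  sh-cong (suc k) (suc n) h = sh-cong k n (λ m p → h m (ℕₚ.m≤n⇒m≤1+n p))

  sh-add : ∀ k a b n → sh k (λ m → a m + b m) n ≡ sh k a n + sh k b n
  sh-add zero a b n = refl
  sh-add (suc k) a b zero = sym (0+ _)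
  sh-add (suc k) a b (suc n) = sh-add k a b n

  sh-* : ∀ k c b n → sh k (λ m → c * b m) n ≡ c * sh k b n
  sh-* zero c b n = refl
  sh-* (suc k) c b zero = sym (*-0 c)
  sh-* (suc k) c b (suc n) = sh-* k c b n

  sh-∑ : ∀ k L (f : ℕ → Sq) n → sh k (λ m → ∑ L (λ i → f i m)) n ≡ ∑ L (λ i → sh k (f i) n)
  sh-∑ zero L f n = refl
  sh-∑ (suc k) L f zero = sym (∑-0 L)
  sh-∑ (suc k) L f (suc n) = sh-∑ k L f n

  sh-comm : ∀ i j b n → sh i (sh j b) n ≡ sh j (sh i b) n
  sh-comm i j b n = trans (sym (sh-+ i j b n)) (trans (cong (λ k → sh k b n) (ℕₚ.+-comm i j)) (sh-+ j i b n))

  -- On generating series `Δ` is multiplication by 1 - z and `S` division by it. Keeping `a 0` at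
  -- index 0 amounts to a value 0 at index -1, and this removes all boundary terms from summation by
  -- parts.
  Δ : Sq → Sq
  Δ a zero = a 0
  Δ a (suc n) = a (suc n) - a n

  S : Sq → Sq
  S a zero = a 0
  S a (suc n) = S a n + a (suc n)

  Δ^ : ℕ → Sq → Sq
  Δ^ zero a = a
  Δ^ (suc i) a = Δ (Δ^ i a)

  Δ-cong : ∀ {a b} n → (∀ m → m ℕ.≤ n → a m ≡ b m) → Δ a n ≡ Δ b n
  Δ-cong zero h = h 0 z≤n
  Δ-cong (suc n) h = cong₂ _-_ (h (suc n) ℕₚ.≤-refl) (h n (ℕₚ.n≤1+n n))

  S-cong : ∀ {a b} n → (∀ m → m ℕ.≤ n → a m ≡ b m) → S a n ≡ S b n
  S-cong zero h = h 0 z≤n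
  S-cong (suc n) h = cong₂ _+_ (S-cong n (λ m p → h m (ℕₚ.m≤n⇒m≤1+n p))) (h (suc n) ℕₚ.≤-refl)

  ΔS : ∀ a n → Δ (S a) n ≡ a n
  ΔS a zero = refl
  ΔS a (suc n) = ring (v0 ⊕ v1 ⊖ v0) v1 (S a n ∷ a (suc n) ∷ []) refl

  S-sh : ∀ k b n → S (sh k b) n ≡ sh k (S b) n
  S-sh zero b n = refl
  S-sh (suc k) b zero = refl
  S-sh (suc k) b (suc zero) = trans (0+ _) (S-sh k b zero)
  S-sh (suc k) b (suc (suc n)) = trans (+-congʳ (S-sh (suc k) b (suc n)))
    (trans (+-congʳ (sym (S-sh k b n))) (S-sh k b (suc n)))

  S-* : ∀ c b n → S (λ m → c * b m) n ≡ c * S b n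
  S-* c b zero = refl
  S-* c b (suc n) = trans (+-congʳ (S-* c b n)) (sym (*-distribˡ c _ _))

  S-∑ : ∀ L (f : ℕ → Sq) n → S (λ m → ∑ L (λ i → f i m)) n ≡ ∑ L (λ i → S (f i) n)
  S-∑ L f zero = refl
  S-∑ L f (suc n) = trans (+-congʳ (S-∑ L f n)) (sym (∑-+ L _ _))

  tail : Sq → Sq
  tail a n = a (suc n)

  conv : Sq → Sq → Sq
  conv a b zero = a 0 * b 0
  conv a b (suc n) = a 0 * b (suc n) + conv (tail a) b n

  conv-congˡ : ∀ {a a'} b n → (∀ m → m ℕ.≤ n → a m ≡ a' m) → conv a b n ≡ conv a' b n
  conv-congˡ b zero h = cong (_* b 0) (h 0 z≤n)
  conv-congˡ b (suc n) h = cong₂ _+_ (cong (_* b (suc n)) (h 0 z≤n)) (conv-congˡ b n (λ m p → h (suc m) (s≤s p)))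

  conv-+ˡ : ∀ a a' b n → conv (λ m → a m + a' m) b n ≡ conv a b n + conv a' b n
  conv-+ˡ a a' b zero = *-distribʳ _ _ _
  conv-+ˡ a a' b (suc n) = trans (cong₂ _+_ (*-distribʳ _ _ _) (conv-+ˡ (tail a) (tail a') b n)) (+-swap _ _ _ _)

  conv-*ˡ : ∀ c a b n → conv (λ m → c * a m) b n ≡ c * conv a b n
  conv-*ˡ c a b zero = *-assoc _ _ _
  conv-*ˡ c a b (suc n) = trans (cong₂ _+_ (*-assoc _ _ _) (conv-*ˡ c (tail a) b n)) (sym (*-distribˡ c _ _))

  conv-0ˡ : ∀ b n → conv (λ _ → ι 0) b n ≡ ι 0
  conv-0ˡ b zero = 0* _
  conv-0ˡ b (suc n) = trans (cong₂ _+_ (0* _) (conv-0ˡ b n)) (0+ _)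

  conv-∑ˡ : ∀ L (f : ℕ → Sq) b n → conv (λ m → ∑ L (λ i → f i m)) b n ≡ ∑ L (λ i → conv (f i) b n)
  conv-∑ˡ zero f b n = conv-0ˡ b n
  conv-∑ˡ (suc L) f b n = trans (conv-+ˡ _ _ b n) (+-congʳ (conv-∑ˡ L f b n))

  conv-Δˡ : ∀ a b n → conv (Δ a) b n ≡ Δ (conv a b) n
  conv-Δˡ a b zero = refl
  conv-Δˡ a b (suc n) = trans (+-congˡ (trans (conv-congˡ b n (λ m _ → h m))
      (trans (conv-+ˡ (tail a) (λ m → - ι 1 * a m) b n) (+-congˡ (conv-*ˡ (- ι 1) a b n)))))
    (ring (v0 ⊕ (v1 ⊕ (⊝ # 1) ⊗ v2)) (v0 ⊕ v1 ⊖ v2) (a 0 * b (suc n) ∷ conv (tail a) b n ∷ conv a b n ∷ []) refl)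
    where
    h : ∀ m → a (suc m) - a m ≡ a (suc m) + - ι 1 * a m
    h m = ring (v0 ⊖ v1) (v0 ⊕ (⊝ # 1) ⊗ v1) (a (suc m) ∷ a m ∷ []) refl

  conv-Δʳ : ∀ a b n → conv a (Δ b) n ≡ Δ (conv a b) n
  conv-Δʳ a b zero = refl
  conv-Δʳ a b (suc zero) = trans (+-congˡ (conv-Δʳ (tail a) b zero))
    (ring (v0 ⊗ (v1 ⊖ v2) ⊕ v3) (v0 ⊗ v1 ⊕ v3 ⊖ v0 ⊗ v2) (a 0 ∷ b 1 ∷ b 0 ∷ a 1 * b 0 ∷ []) refl)
  conv-Δʳ a b (suc (suc n)) = trans (+-congˡ (conv-Δʳ (tail a) b (suc n)))
    (ring (v0 ⊗ (v1 ⊖ v2) ⊕ (v3 ⊖ v4)) (v0 ⊗ v1 ⊕ v3 ⊖ (v0 ⊗ v2 ⊕ v4))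
      (a 0 ∷ b (suc (suc n)) ∷ b (suc n) ∷ conv (tail a) b (suc n) ∷ conv (tail a) b n ∷ []) refl)

  -- Summation by parts: the factors 1/(1 - z) and 1 - z cancel.
  conv-S-Δ : ∀ a b n → conv (S a) (Δ b) n ≡ conv a b n
  conv-S-Δ a b n = trans (conv-Δʳ (S a) b n) (trans (sym (conv-Δˡ (S a) b n)) (conv-congˡ b n (λ m _ → ΔS a m)))

  conv-Δ-swap : ∀ a b n → conv (Δ a) b n ≡ conv a (Δ b) n
  conv-Δ-swap a b n = trans (conv-Δˡ a b n) (sym (conv-Δʳ a b n))

  δ₀ : Sq
  δ₀ zero = ι 1
  δ₀ (suc n) = ι 0

  conv-sh : ∀ k b n → conv (sh k δ₀) b n ≡ sh k b n
  conv-sh zero b zero = 1* _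
  conv-sh zero b (suc n) = trans (cong₂ _+_ (1* _) (conv-0ˡ b n)) (+-0 _)
  conv-sh (suc k) b zero = 0* _
  conv-sh (suc k) b (suc n) = trans (cong₂ _+_ (0* _) (conv-sh k b n)) (0+ _)

  ι-+ : ∀ m n → ι (m ℕ.+ n) ≡ ι m + ι n
  ι-+ m n = fromℤ-+ _ _

  ι-suc : ∀ n → ι (suc n) ≡ ι 1 + ι n
  ι-suc n = ι-+ 1 n

  ι-* : ∀ m n → ι (m ℕ.* n) ≡ ι m * ι n
  ι-* m n = trans (cong fromℤ (ℤₚ.pos-* m n)) (fromℤ-* _ _)

  ι-mono : ∀ {m n} → m ℕ.≤ n → ι m ≤ ι n
  ι-mono {m} {n} p = ≤-trans (≡⇒≤ (sym (+-0 _)))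
    (≤-trans (+-mono (≤-refl {ι m}) (fromℤ-nonneg (n ℕ.∸ m)))
      (≡⇒≤ (trans (sym (ι-+ m (n ℕ.∸ m))) (cong ι (ℕₚ.m+[n∸m]≡n p)))))

  -- Cauchy product with the divisor sum, over a box large enough to hold every term.
  K : ℕ → Sq → Sq
  K L b n = ∑ L (λ j → ι j * ∑ L (λ m → sh (j ℕ.* m) b n))

  σ : ℕ → Sq
  σ L = K L δ₀

  conv-σ : ∀ L b n → conv (σ L) b n ≡ K L b n
  conv-σ L b n = trans (conv-∑ˡ L _ b n) (∑-cong' L (λ j → trans (conv-*ˡ (ι j) _ b n)
    (cong (ι j *_) (trans (conv-∑ˡ L _ b n) (∑-cong' L (λ m → conv-sh (j ℕ.* m) b n))))))

  S-K : ∀ L b n → S (K L b) n ≡ K L (S b) n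
  S-K L b n = trans (S-∑ L _ n) (∑-cong' L (λ j → trans (S-* (ι j) _ n)
    (cong (ι j *_) (trans (S-∑ L _ n) (∑-cong' L (λ m → S-sh (j ℕ.* m) b n))))))

  -- Partitions and the divisor sum

  ≤ᵇ-true : ∀ {m n} → m ℕ.≤ n → (m ≤ᵇ n) ≡ true
  ≤ᵇ-true q = Equivalence.to T-≡ (ℕₚ.≤⇒≤ᵇ q)

  ≤ᵇ-false : ∀ {m n} → n ℕ.< m → (m ≤ᵇ n) ≡ false
  ≤ᵇ-false {m} {n} q with m ≤ᵇ n in e
  ... | false = refl
  ... | true = ⊥-elim (ℕₚ.<⇒≱ q (ℕₚ.≤ᵇ⇒≤ m n (Equivalence.from T-≡ e)))

  ≤ᵇ-+ : ∀ a x y → (a ℕ.+ x ≤ᵇ a ℕ.+ y) ≡ (x ≤ᵇ y)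
  ≤ᵇ-+ a x y with x ℕ.≤? y
  ... | yes q = trans (≤ᵇ-true (ℕₚ.+-monoʳ-≤ a q)) (sym (≤ᵇ-true q))
  ... | no q = trans (≤ᵇ-false (ℕₚ.+-monoʳ-< a (ℕₚ.≰⇒> q))) (sym (≤ᵇ-false (ℕₚ.≰⇒> q)))

  sumTo : (ℕ → ℕ) → ℕ → ℕ
  sumTo f n = sum (applyUpTo f n)

  sumTo-cong : ∀ {f g} n → (∀ j → f j ≡ g j) → sumTo f n ≡ sumTo g n
  sumTo-cong zero h = refl
  sumTo-cong (suc n) h = cong₂ ℕ._+_ (h 0) (sumTo-cong n (λ j → h (suc j)))

  sumTo-0 : ∀ {f} n → (∀ j → f j ≡ 0) → sumTo f n ≡ 0
  sumTo-0 zero h = refl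
  sumTo-0 (suc n) h = cong₂ ℕ._+_ (h 0) (sumTo-0 n (λ j → h (suc j)))

  sumTo-drop : ∀ {f} m k → (∀ j → m ℕ.≤ j → f j ≡ 0) → sumTo f (m ℕ.+ k) ≡ sumTo f m
  sumTo-drop zero k h = sumTo-0 k (λ j → h j z≤n)
  sumTo-drop {f} (suc m) k h = cong (f 0 ℕ.+_) (sumTo-drop m k (λ j q → h (suc j) (s≤s q)))

  summand : ℕ → ℕ → ℕ → ℕ
  summand k n j = if j ℕ.* suc k ≤ᵇ n then Pc (n ∸ j ℕ.* suc k) k else 0

  Pc-sumTo : ∀ n k → Pc n (suc k) ≡ sumTo (summand k n) (suc n)
  Pc-sumTo zero k = cong sum (map-upTo (summand k 0) 1)
  Pc-sumTo (suc n) k = cong sum (map-upTo (summand k (suc n)) (suc (suc n)))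

  summand-big : ∀ k n j → n ℕ.< j → summand k n j ≡ 0
  summand-big k n j q rewrite ≤ᵇ-false (ℕₚ.<-≤-trans q (ℕₚ.m≤m*n j (suc k))) = refl

  Pc-small : ∀ n k → n ℕ.< suc k → Pc n (suc k) ≡ Pc n k
  Pc-small n k q = trans (Pc-sumTo n k) (trans (cong (Pc n k ℕ.+_) (sumTo-0 n h)) (ℕₚ.+-identityʳ _))
    where
    h : ∀ j → summand k n (suc j) ≡ 0
    h j rewrite ≤ᵇ-false {suc k ℕ.+ j ℕ.* suc k} (ℕₚ.<-≤-trans q (ℕₚ.m≤m+n _ _)) = refl

  -- Multiplicity 0 of the part `suc k` gives the first summand; lowering every other multiplicity
  -- by one gives the second.
  Pc-step : ∀ n k → Pc (suc k ℕ.+ n) (suc k) ≡ Pc (suc k ℕ.+ n) k ℕ.+ Pc n (suc k)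
  Pc-step n k = trans (Pc-sumTo (suc k ℕ.+ n) k) (cong (Pc (suc k ℕ.+ n) k ℕ.+_)
    (trans (sumTo-cong (suc k ℕ.+ n) h) (trans (cong (sumTo (summand k n)) (cong suc (ℕₚ.+-comm k n)))
      (trans (sumTo-drop (suc n) k (summand-big k n)) (sym (Pc-sumTo n k))))))
    where
    h : ∀ j → summand k (suc k ℕ.+ n) (suc j) ≡ summand k n j
    h j rewrite ≤ᵇ-+ (suc k) (j ℕ.* suc k) n | ℕₚ.[m+n]∸[m+o]≡n∸o k n (j ℕ.* suc k) = refl

  Pc-stable : ∀ n k → n ℕ.≤ k → Pc n k ≡ p n
  Pc-stable n k q = trans (cong (Pc n) (sym (ℕₚ.m+[n∸m]≡n q))) (go (k ∸ n))
    where
    go : ∀ d → Pc n (n ℕ.+ d) ≡ p n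
    go zero = cong (Pc n) (ℕₚ.+-identityʳ n)
    go (suc d) = trans (cong (Pc n) (ℕₚ.+-suc n d)) (trans (Pc-small n (n ℕ.+ d) (s≤s (ℕₚ.m≤m+n n d))) (go d))

  P : Sq
  P n = ι (p n)

  parts≤ : ℕ → Sq
  parts≤ k n = ι (Pc n k)

  parts≤-suc : ∀ k n → parts≤ (suc k) n ≡ parts≤ k n + sh (suc k) (parts≤ (suc k)) n
  parts≤-suc k n with suc k ℕ.≤? n
  ... | no q = trans (cong ι (Pc-small n k (ℕₚ.≰⇒> q))) (sym (trans (+-congˡ (sh-big (suc k) _ n (ℕₚ.≰⇒> q))) (+-0 _)))
  ... | yes q = subst (λ n → parts≤ (suc k) n ≡ parts≤ k n + sh (suc k) (parts≤ (suc k)) n) (ℕₚ.m+[n∸m]≡n q)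
    (trans (trans (cong ι (Pc-step (n ∸ suc k) k)) (ι-+ _ _)) (+-congˡ (sym (sh-at (suc k) _ (n ∸ suc k)))))

  module _ (L : ℕ) where

    multiples : ℕ → Sq → Sq
    multiples j b n = ∑ L (λ m → sh (j ℕ.* m) b n)

    multiples-add : ∀ j a b n → multiples j (λ m → a m + b m) n ≡ multiples j a n + multiples j b n
    multiples-add j a b n = trans (∑-cong' L (λ m → sh-add (j ℕ.* m) a b n)) (∑-+ L _ _)

    multiples-cong : ∀ j {a b} n → (∀ m → m ℕ.≤ n → a m ≡ b m) → multiples j a n ≡ multiples j b n
    multiples-cong j n h = ∑-cong' L (λ m → sh-cong (j ℕ.* m) n h)

    sh-multiples : ∀ k j b n → multiples j (sh k b) n ≡ sh k (multiples j b) n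
    sh-multiples k j b n = trans (∑-cong' L (λ m → sh-comm (j ℕ.* m) k b n)) (sym (sh-∑ k L (λ m → sh (j ℕ.* m) b) n))

    -- The geometric series x + x² + ... equals x + x (x + x² + ...) for x = z^(k+1). Cutting both
    -- sides at `L` is harmless, because the term `suc L` shifts beyond `n`.
    multiples-unroll : ∀ k b n → n ℕ.≤ L → multiples (suc k) b n ≡ sh (suc k) b n + sh (suc k) (multiples (suc k) b) n
    multiples-unroll k b n q = trans (sym (+-0 _)) (trans (+-congˡ (sym last)) (trans (∑-head L _)
      (cong₂ _+_ (cong (λ i → sh i b n) (ℕₚ.*-identityʳ (suc k)))
        (trans (∑-cong' L (λ i → trans (cong (λ t → sh t b n) (ℕₚ.*-suc (suc k) i)) (sh-+ (suc k) (suc k ℕ.* i) b n)))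
          (sym (sh-∑ (suc k) L (λ m → sh (suc k ℕ.* m) b) n))))))
      where
      last : sh (suc k ℕ.* suc L) b n ≡ ι 0
      last = sh-big (suc k ℕ.* suc L) b n (ℕₚ.≤-trans (s≤s q) (ℕₚ.m≤n*m (suc L) (suc k)))

    weighted : ℕ → Sq → Sq
    weighted k b n = ∑ k (λ j → ι j * multiples j b n)

    weighted-add : ∀ k a b n → weighted k (λ m → a m + b m) n ≡ weighted k a n + weighted k b n
    weighted-add k a b n = trans (∑-cong' k (λ j → trans (cong (ι j *_) (multiples-add j a b n)) (*-distribˡ _ _ _))) (∑-+ k _ _)

    weighted-cong : ∀ k {a b} n → (∀ m → m ℕ.≤ n → a m ≡ b m) → weighted k a n ≡ weighted k b n
    weighted-cong k n h = ∑-cong' k (λ j → cong (ι j *_) (multiples-cong j n h))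

    sh-weighted : ∀ i k b n → weighted k (sh i b) n ≡ sh i (weighted k b) n
    sh-weighted i k b n = trans (∑-cong' k (λ j → trans (cong (ι j *_) (sh-multiples i j b n)) (sym (sh-* i (ι j) _ n))))
      (sym (sh-∑ i k (λ j m → ι j * multiples j b m) n))

    -- The logarithmic derivative of ∏_{j ≤ k} 1/(1 - z^j), read off coefficientwise.
    parts≤-log : ∀ k n → n ℕ.≤ L → ι n * parts≤ k n ≡ weighted k (parts≤ k) n
    parts≤-log zero zero q = 0* _
    parts≤-log zero (suc n) q = *-0 _
    parts≤-log (suc k) = <-rec _ step
      where
      f g : Sq
      f = parts≤ k
      g = parts≤ (suc k)
      κ = suc k
      -- Weights up to k see `g` through its recursion, which brings in the induction hypothesis for
      -- `f`; the weight `κ` is unrolled once.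
      expand : ∀ n → n ℕ.≤ L → weighted κ g n ≡ ι n * f n + (sh κ (weighted κ g) n + ι κ * sh κ g n)
      expand n q = trans
        (cong₂ _+_
          (trans (weighted-cong k n (λ m _ → parts≤-suc k m)) (trans (weighted-add k f (sh κ g) n)
            (cong₂ _+_ (sym (parts≤-log k n q)) (sh-weighted κ k g n))))
          (cong (ι κ *_) (multiples-unroll k g n q)))
        (trans (ring ((v0 ⊕ v1) ⊕ v2 ⊗ (v3 ⊕ v4)) (v0 ⊕ ((v1 ⊕ v2 ⊗ v4) ⊕ v2 ⊗ v3))
            (ι n * f n ∷ sh κ (weighted k g) n ∷ ι κ ∷ sh κ g n ∷ sh κ (multiples κ g) n ∷ []) refl)
          (+-congˡ (+-congʳ (trans (+-congˡ (sym (sh-* κ (ι κ) (multiples κ g) n))) (sym (sh-add κ (weighted k g) _ n))))))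
      step : ∀ n → (∀ {m} → m ℕ.< n → m ℕ.≤ L → ι m * g m ≡ weighted κ g m) → n ℕ.≤ L → ι n * g n ≡ weighted κ g n
      step n ih q with κ ℕ.≤? n
      ... | no r = trans (cong (ι n *_) (trans (parts≤-suc k n) (trans (+-congˡ (sh-big κ g n (ℕₚ.≰⇒> r))) (+-0 _))))
        (sym (trans (expand n q) (trans (+-congˡ (trans (cong₂ _+_ (sh-big κ _ n (ℕₚ.≰⇒> r))
          (trans (cong (ι κ *_) (sh-big κ g n (ℕₚ.≰⇒> r))) (*-0 _))) (0+ _))) (+-0 _))))
      ... | yes r = trans (cong (ι n *_) (parts≤-suc k n))
        (trans (*-distribˡ _ _ _) (sym (trans (expand n q) (+-congˡ tailEq))))
        where
        d = n ∸ κ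
        n≡ : κ ℕ.+ d ≡ n
        n≡ = ℕₚ.m+[n∸m]≡n r
        d<n : d ℕ.< n
        d<n = subst (d ℕ.<_) n≡ (s≤s (ℕₚ.m≤n+m d k))
        at : ∀ b → sh κ b n ≡ b d
        at b = trans (cong (sh κ b) (sym n≡)) (sh-at κ b d)
        tailEq : sh κ (weighted κ g) n + ι κ * sh κ g n ≡ ι n * sh κ g n
        tailEq = trans (cong₂ _+_ (trans (at (weighted κ g)) (sym (ih d<n (ℕₚ.≤-trans (ℕₚ.<⇒≤ d<n) q)))) (cong (ι κ *_) (at g)))
          (trans (ring (v0 ⊗ v2 ⊕ v1 ⊗ v2) ((v1 ⊕ v0) ⊗ v2) (ι d ∷ ι κ ∷ g d ∷ []) refl)
            (cong₂ _*_ (trans (sym (ι-+ κ d)) (cong ι n≡)) (sym (at g))))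

    -- Euler's recurrence n p(n) = ∑ σ(k) p(n - k): up to index `L`, parts of size at most `L`
    -- already give all partitions.
    P-log : ∀ n → n ℕ.≤ L → ι n * P n ≡ K L P n
    P-log n q = trans (cong (ι n *_) (sym (agree n q))) (trans (parts≤-log L n q)
      (weighted-cong L n (λ m r → agree m (ℕₚ.≤-trans r q))))
      where
      agree : ∀ m → m ℕ.≤ L → parts≤ L m ≡ P m
      agree m r = cong ι (Pc-stable m L r)

  -- Bounds on absolute values

  0≤ι : ∀ n → ι 0 ≤ ι n
  0≤ι = fromℤ-nonneg

  1≤ιsuc : ∀ n → ι 1 ≤ ι (suc n)
  1≤ιsuc n = ι-mono (s≤s z≤n)

  ≤-reflexiveˡ : ∀ {x y z} → x ≡ y → y ≤ z → x ≤ z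
  ≤-reflexiveˡ refl q = q

  ≤-reflexiveʳ : ∀ {x y z} → x ≤ y → y ≡ z → x ≤ z
  ≤-reflexiveʳ q refl = q

  neg-mono : ∀ {x y} → x ≤ y → - y ≤ - x
  neg-mono {x} {y} q = 0≤-⇒≤ (≤-reflexiveʳ (≤⇒0≤- q) (ring (v1 ⊖ v0) (⊝ v0 ⊖ (⊝ v1)) (x ∷ y ∷ []) refl))

  sq-nonneg : ∀ x → ι 0 ≤ x * x
  sq-nonneg x with ≤-total (ι 0) x
  ... | inj₁ q = *-nonneg q q
  ... | inj₂ q = ≤-reflexiveʳ (*-nonneg h h) (ring (⊝ v0 ⊗ ⊝ v0) (v0 ⊗ v0) (x ∷ []) refl)
    where
    h : ι 0 ≤ - x
    h = ≤-reflexiveˡ (sym neg-0) (neg-mono q)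

  *-monoˡ : ∀ {c x y} → ι 0 ≤ c → x ≤ y → c * x ≤ c * y
  *-monoˡ {c} {x} {y} p q = 0≤-⇒≤ (≤-reflexiveʳ (*-nonneg p (≤⇒0≤- q)) (ring (v0 ⊗ (v2 ⊖ v1)) (v0 ⊗ v2 ⊖ v0 ⊗ v1) (c ∷ x ∷ y ∷ []) refl))

  *-monoʳ : ∀ {c x y} → ι 0 ≤ c → x ≤ y → x * c ≤ y * c
  *-monoʳ {c} {x} {y} p q = ≤-reflexiveˡ (*-comm x c) (≤-reflexiveʳ (*-monoˡ p q) (*-comm c y))

  *-mono : ∀ {x y u v} → ι 0 ≤ x → ι 0 ≤ v → x ≤ y → u ≤ v → x * u ≤ y * v
  *-mono p r q s = ≤-trans (*-monoˡ p s) (*-monoʳ r q)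

  *-cancel : ∀ {c x y} → ι 1 ≤ c → c * x ≤ c * y → x ≤ y
  *-cancel {c} {x} {y} p q = ≤-reflexiveˡ (sym (h x)) (≤-reflexiveʳ (*-monoˡ (inv-nonneg c p) q) (h y))
    where
    h : ∀ z → inv c * (c * z) ≡ z
    h z = trans (sym (*-assoc _ _ _)) (trans (cong (_* z) (trans (*-comm _ _) (inv-inverse c p))) (1* z))

  *-cancel-≡ : ∀ {c x y} → ι 1 ≤ c → c * x ≡ c * y → x ≡ y
  *-cancel-≡ {c} {x} {y} p q = trans (sym (h x)) (trans (cong (inv c *_) q) (h y))
    where
    h : ∀ z → inv c * (c * z) ≡ z
    h z = trans (sym (*-assoc _ _ _)) (trans (cong (_* z) (trans (*-comm _ _) (inv-inverse c p))) (1* z))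

  infix 4 ∣_∣≤_
  ∣_∣≤_ : F → F → Set
  ∣ x ∣≤ b = (x ≤ b) × (- x ≤ b)

  abs-nonneg : ∀ {x} → ι 0 ≤ x → ∣ x ∣≤ x
  abs-nonneg {x} p = ≤-refl , ≤-trans (≤-reflexiveʳ (neg-mono p) neg-0) p

  abs-weaken : ∀ {x b c} → ∣ x ∣≤ b → b ≤ c → ∣ x ∣≤ c
  abs-weaken (p , q) r = ≤-trans p r , ≤-trans q r

  abs-subst : ∀ {x y b} → x ≡ y → ∣ x ∣≤ b → ∣ y ∣≤ b
  abs-subst refl p = p

  abs-0 : ∣ ι 0 ∣≤ ι 0
  abs-0 = ≤-refl , ≡⇒≤ neg-0

  abs-neg : ∀ {x b} → ∣ x ∣≤ b → ∣ - x ∣≤ b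
  abs-neg {x} (p , q) = q , ≤-reflexiveˡ (ring (⊝ ⊝ v0) v0 (x ∷ []) refl) p

  abs-+ : ∀ {x y b c} → ∣ x ∣≤ b → ∣ y ∣≤ c → ∣ x + y ∣≤ b + c
  abs-+ (p , q) (r , s) = +-mono p r , ≤-reflexiveˡ (neg-+ _ _) (+-mono q s)

  abs-*ˡ : ∀ {c x b} → ι 0 ≤ c → ∣ x ∣≤ b → ∣ c * x ∣≤ c * b
  abs-*ˡ p (q , r) = *-monoˡ p q , ≤-reflexiveˡ (neg-*ʳ _ _) (*-monoˡ p r)

  abs⇒nonneg : ∀ {x b} → ∣ x ∣≤ b → ι 0 ≤ b
  abs⇒nonneg {x} {b} (p , q) with ≤-total (ι 0) x
  ... | inj₁ r = ≤-trans r p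
  ... | inj₂ r = ≤-trans (≤-reflexiveˡ (sym neg-0) (neg-mono r)) q

  abs-* : ∀ {x y b c} → ∣ x ∣≤ b → ∣ y ∣≤ c → ∣ x * y ∣≤ b * c
  abs-* {x} {y} {b} {c} p q with ≤-total (ι 0) x
  ... | inj₁ r = abs-weaken (abs-*ˡ r q) (*-monoʳ (abs⇒nonneg q) (proj₁ p))
  ... | inj₂ r = abs-subst (ring (⊝ v0 ⊗ ⊝ v1) (v0 ⊗ v1) (x ∷ y ∷ []) refl)
    (abs-weaken (abs-*ˡ (≤-reflexiveˡ (sym neg-0) (neg-mono r)) (abs-neg q)) (*-monoʳ (abs⇒nonneg q) (proj₂ p)))

  abs-∑ : ∀ n {f g} → (∀ i → 1 ℕ.≤ i → i ℕ.≤ n → ∣ f i ∣≤ g i) → ∣ ∑ n f ∣≤ ∑ n g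
  abs-∑ zero h = abs-0
  abs-∑ (suc n) h = abs-+ (abs-∑ n (λ i p q → h i p (ℕₚ.m≤n⇒m≤1+n q))) (h (suc n) (s≤s z≤n) ℕₚ.≤-refl)

  ∑-nonneg : ∀ n {f} → (∀ i → ι 0 ≤ f i) → ι 0 ≤ ∑ n f
  ∑-nonneg n {f} h = ≤-reflexiveˡ (sym (∑-0 n)) (∑-mono n (λ i _ _ → h i))

  ∑-trunc : ∀ {D L} f → D ℕ.≤ L → (∀ i → D ℕ.< i → f i ≡ ι 0) → ∑ L f ≡ ∑ D f
  ∑-trunc {D} {L} f q h = trans (cong (λ k → ∑ k f) (sym (ℕₚ.m+[n∸m]≡n q))) (trans (∑-split D (L ℕ.∸ D) f)
    (trans (+-congˡ (trans (∑-cong (L ℕ.∸ D) (λ { (suc i) _ _ → h (D ℕ.+ suc i) (subst (ℕ._≤ D ℕ.+ suc i) (ℕₚ.+-comm D 1) (ℕₚ.+-monoʳ-≤ D (s≤s z≤n))) })) (∑-0 (L ℕ.∸ D)))) (+-0 _)))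

  ∑-extend : ∀ {D L f} → D ℕ.≤ L → (∀ i → ι 0 ≤ f i) → ∑ D f ≤ ∑ L f
  ∑-extend {D} {L} {f} q h = ≤-reflexiveˡ (sym (+-0 _)) (≤-reflexiveʳ (+-mono ≤-refl (∑-nonneg (L ℕ.∸ D) (λ i → h (D ℕ.+ i))))
    (trans (sym (∑-split D (L ℕ.∸ D) f)) (cong (λ k → ∑ k f) (ℕₚ.m+[n∸m]≡n q))))

  -- Antidifferences for the hyperbola method

  Q : Sq
  Q = S (S (S δ₀))

  -- This variable centres the quadratic (y + 1)(y + 2)/2 at its axis of symmetry, so that `8 Q`
  -- becomes a square minus 1.
  odd : ℕ → F
  odd y = ι 2 * ι y + ι 3

  Q-closed : ∀ y → ι 8 * Q y ≡ odd y * odd y - ι 1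
  Q-closed = go
    where
    S1 : ∀ n → S δ₀ n ≡ ι 1
    S1 zero = refl
    S1 (suc n) = trans (+-0 _) (S1 n)
    S2 : ∀ n → S (S δ₀) n ≡ ι n + ι 1
    S2 zero = sym (0+ _)
    S2 (suc n) = trans (cong₂ _+_ (S2 n) (S1 (suc n))) (+-congʳ (trans (+-comm _ _) (sym (ι-suc n))))
    go : ∀ n → ι 8 * Q n ≡ odd n * odd n - ι 1
    go zero = ring (# 8 ⊗ # 1) ((# 2 ⊗ # 0 ⊕ # 3) ⊗ (# 2 ⊗ # 0 ⊕ # 3) ⊖ # 1) [] refl
    go (suc n) = trans (*-distribˡ _ _ _) (trans (cong₂ _+_ (go n) (cong (ι 8 *_) (S2 (suc n))))
      (subst (λ s → odd n * odd n - ι 1 + ι 8 * (s + ι 1) ≡ (ι 2 * s + ι 3) * (ι 2 * s + ι 3) - ι 1) (sym (ι-suc n))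
        (ring ((# 2 ⊗ v0 ⊕ # 3) ⊗ (# 2 ⊗ v0 ⊕ # 3) ⊖ # 1 ⊕ # 8 ⊗ (# 1 ⊕ v0 ⊕ # 1))
              ((# 2 ⊗ (# 1 ⊕ v0) ⊕ # 3) ⊗ (# 2 ⊗ (# 1 ⊕ v0) ⊕ # 3) ⊖ # 1) (ι n ∷ []) refl)))

  0≤odd : ∀ y → ι 0 ≤ odd y
  0≤odd y = +-nonneg (*-nonneg (0≤ι 2) (0≤ι y)) (0≤ι 3)

  odd-+ : ∀ m y → odd (m ℕ.+ y) ≡ odd y + ι 2 * ι m
  odd-+ m y = trans (cong (λ s → ι 2 * s + ι 3) (ι-+ m y))
    (ring (# 2 ⊗ (v0 ⊕ v1) ⊕ # 3) (# 2 ⊗ v1 ⊕ # 3 ⊕ # 2 ⊗ v0) (ι m ∷ ι y ∷ []) refl)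

  -- The weight of a shift becomes a polynomial in the index where `b` is evaluated, and an
  -- antidifference can then absorb it.
  sh-weight : ∀ k b x → ι k * sh k b x ≡ sh k (λ y → (ι x - ι y) * b y) x
  sh-weight k b x with k ℕ.≤? x
  ... | no q = trans (cong (ι k *_) (sh-big k b x (ℕₚ.≰⇒> q))) (trans (*-0 _) (sym (sh-big k _ x (ℕₚ.≰⇒> q))))
  ... | yes q = subst (λ x' → ι k * sh k b x' ≡ sh k (λ y → (ι x - ι y) * b y) x') e
    (trans (cong (ι k *_) (sh-at k b d)) (sym (trans (sh-at k _ d) (cong (_* b d)
      (trans (cong (λ t → ι t - ι d) (sym e)) (trans (cong (_- ι d) (ι-+ k d)) (ring (v0 ⊕ v1 ⊖ v1) v0 (ι k ∷ ι d ∷ []) refl)))))))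
    where
    d = x ∸ k
    e : k ℕ.+ d ≡ x
    e = ℕₚ.m+[n∸m]≡n q

  -- Induction on the quotient: each unrolling lowers the argument by one period, until only the
  -- remainder `r` is left.
  multiples-telescope : ∀ L m' (b β : Sq) → (∀ y → β (suc m' ℕ.+ y) ≡ β y + b y) → ∀ J r → r ℕ.< suc m' → J ℕ.* suc m' ℕ.+ r ℕ.≤ L →
    multiples L (suc m') b (J ℕ.* suc m' ℕ.+ r) ≡ β (J ℕ.* suc m' ℕ.+ r) - β r
  multiples-telescope L m' b β h zero r p q = trans (trans (∑-cong L (λ { (suc i) _ _ → sh-big (suc m' ℕ.* suc i) b r
    (ℕₚ.<-≤-trans p (ℕₚ.m≤m*n (suc m') (suc i))) })) (∑-0 L)) (sym (ring (v0 ⊖ v0) (# 0) (β r ∷ []) refl))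
  multiples-telescope L m' b β h (suc J) r p q = trans (multiples-unroll L m' b (suc J ℕ.* suc m' ℕ.+ r) q)
    (subst (λ x → sh (suc m') b x + sh (suc m') (multiples L (suc m') b) x ≡ β x - β r) (sym (ℕₚ.+-assoc (suc m') (J ℕ.* suc m') r))
      (trans (cong₂ _+_ (sh-at (suc m') b n) (trans (sh-at (suc m') _ n)
        (multiples-telescope L m' b β h J r p (ℕₚ.≤-trans (ℕₚ.+-monoˡ-≤ r (ℕₚ.m≤n+m (J ℕ.* suc m') (suc m'))) q))))
        (trans (ring (v0 ⊕ (v1 ⊖ v2)) (v1 ⊕ v0 ⊖ v2) (b n ∷ β n ∷ β r ∷ []) refl) (cong (_- β r) (sym (h n))))))
    where
    n = J ℕ.* suc m' ℕ.+ r

  multiples-eval : ∀ L m' (b β : Sq) → (∀ y → β (suc m' ℕ.+ y) ≡ β y + b y) → ∀ x → x ℕ.≤ L →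
    multiples L (suc m') b x ≡ β x - β (x % suc m')
  multiples-eval L m' b β h x q = subst (λ z → multiples L (suc m') b z ≡ β z - β (x % suc m')) (sym e)
    (multiples-telescope L m' b β h (x / suc m') (x % suc m') (DM.m%n<n x (suc m')) (subst (ℕ._≤ L) e q))
    where
    e : x ≡ (x / suc m') ℕ.* suc m' ℕ.+ x % suc m'
    e = trans (DM.m≡m%n+[m/n]*n x (suc m')) (ℕₚ.+-comm (x % suc m') _)

  -- Antidifferences of the summands below, as functions of Z = 2y + 3; each is a combination
  -- of Bernoulli polynomials scaled to the step of the sum.
  ϖ : F → F → F
  ϖ d Z = (Z - d) * (Z * (Z - ι 2 * d) - ι 3)

  Low : F → F → F → F
  Low X m Z = ι 40 * X * ϖ m Z - ι 30 * (τ * τ) + ι 60 * τ + ι 16 * (m * m * m * m) + ι 40 * (m * m)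
    where τ = Z * (Z - ι 2 * m)

  -- Syntactic copies of the two formulas, as `ring` and `pos` require; their interpretations agree
  -- with the originals by computation.
  ϖᴱ : ∀ {n} → Expr n → Expr n → Expr n
  ϖᴱ d Z = (Z ⊖ d) ⊗ (Z ⊗ (Z ⊖ # 2 ⊗ d) ⊖ # 3)

  Lowᴱ : ∀ {n} → Expr n → Expr n → Expr n → Expr n
  Lowᴱ X m Z = # 40 ⊗ X ⊗ ϖᴱ m Z ⊖ # 30 ⊗ (τ ⊗ τ) ⊕ # 60 ⊗ τ ⊕ # 16 ⊗ (m ⊗ m ⊗ m ⊗ m) ⊕ # 40 ⊗ (m ⊗ m)
    where τ = Z ⊗ (Z ⊖ # 2 ⊗ m)

  ϖ-step : ∀ d y → ϖ (ι d) (odd (d ℕ.+ y)) ≡ ϖ (ι d) (odd y) + ι 48 * (ι d * Q y)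
  ϖ-step d y = trans (cong (ϖ (ι d)) (odd-+ d y)) (trans
    (ring (ϖᴱ v0 (v1 ⊕ # 2 ⊗ v0)) (ϖᴱ v0 v1 ⊕ # 6 ⊗ (v0 ⊗ (v1 ⊗ v1 ⊖ # 1))) (ι d ∷ odd y ∷ []) refl)
    (+-congˡ (trans (cong (λ q → ι 6 * (ι d * q)) (sym (Q-closed y)))
      (ring (# 6 ⊗ (v0 ⊗ (# 8 ⊗ v1))) (# 48 ⊗ (v0 ⊗ v1)) (ι d ∷ Q y ∷ []) refl))))

  Low-step : ∀ x m y → Low (odd x) (ι m) (odd (m ℕ.+ y)) ≡ Low (odd x) (ι m) (odd y) + ι 3840 * ι m * ((ι x - ι y) * Q y)
  Low-step x m y = trans (cong (Low (odd x) (ι m)) (odd-+ m y)) (trans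
    (ring (Lowᴱ (# 2 ⊗ v0 ⊕ # 3) v1 (# 2 ⊗ v2 ⊕ # 3 ⊕ # 2 ⊗ v1))
      (Lowᴱ (# 2 ⊗ v0 ⊕ # 3) v1 (# 2 ⊗ v2 ⊕ # 3) ⊕ # 480 ⊗ v1 ⊗ ((v0 ⊖ v2) ⊗ ((# 2 ⊗ v2 ⊕ # 3) ⊗ (# 2 ⊗ v2 ⊕ # 3) ⊖ # 1)))
      (ι x ∷ ι m ∷ ι y ∷ []) refl)
    (+-congˡ (trans (cong (λ q → ι 480 * ι m * ((ι x - ι y) * q)) (sym (Q-closed y)))
      (ring (# 480 ⊗ v0 ⊗ (v1 ⊗ (# 8 ⊗ v2))) (# 3840 ⊗ v0 ⊗ (v1 ⊗ v2)) (ι m ∷ ι x - ι y ∷ Q y ∷ []) refl))))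

  -- One of the two factors m turns the weight `j` into the shift `jm`, to which `sh-weight`
  -- applies.
  low-sum : ∀ L m' x → x ℕ.≤ L → let m = suc m' in
    ι 3840 * (ι m * ι m) * ∑ L (λ j → ι j * sh (j ℕ.* m) Q x)
      ≡ Low (odd x) (ι m) (odd x) - Low (odd x) (ι m) (odd (x % m))
  low-sum L m' x q = trans (trans (sym (∑-* L _ _)) (∑-cong' L term))
    (multiples-eval L m' _ (λ y → Low (odd x) (ι m) (odd y)) (Low-step x m) x q)
    where
    m = suc m'
    term : ∀ j → ι 3840 * (ι m * ι m) * (ι j * sh (j ℕ.* m) Q x) ≡ sh (m ℕ.* j) (λ y → ι 3840 * ι m * ((ι x - ι y) * Q y)) x
    term j = trans (ring (# 3840 ⊗ (v0 ⊗ v0) ⊗ (v1 ⊗ v2)) (# 3840 ⊗ v0 ⊗ (v1 ⊗ v0 ⊗ v2)) (ι m ∷ ι j ∷ sh (j ℕ.* m) Q x ∷ []) refl)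
      (trans (cong (λ c → ι 3840 * ι m * (c * sh (j ℕ.* m) Q x)) (sym (ι-* j m)))
      (trans (cong (ι 3840 * ι m *_) (sh-weight (j ℕ.* m) Q x))
      (trans (sym (sh-* (j ℕ.* m) _ _ x)) (cong (λ k → sh k (λ y → ι 3840 * ι m * ((ι x - ι y) * Q y)) x) (ℕₚ.*-comm j m)))))

  high-sum : ∀ L j' y → y ℕ.≤ L → let j = suc j' in
    ι 48 * (ι j * multiples L j Q y) ≡ ϖ (ι j) (odd y) - ϖ (ι j) (odd (y % j))
  high-sum L j' y q = trans (trans (ring (# 48 ⊗ (v0 ⊗ v1)) (# 48 ⊗ v0 ⊗ v1) (ι j ∷ multiples L j Q y ∷ []) refl)
    (trans (sym (∑-* L _ _)) (∑-cong' L (λ i → trans (sym (sh-* (j ℕ.* i) (ι 48 * ι j) Q y))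
      (sh-cong (j ℕ.* i) y (λ z _ → *-assoc _ _ _))))))
    (multiples-eval L j' (λ z → ι 48 * (ι j * Q z)) (λ z → ϖ (ι j) (odd z)) (ϖ-step j) y q)
    where j = suc j'

  -- Antidifference, with step M, of 240 M times the function `G` below. It performs the second
  -- summation, over j, for the part of the hyperbola with m > M.
  Ψ : F → F → F → F
  Ψ X M Z = ι 10 * (X * X) * (ι 3 * τ + ι 2 * (M * M)) - ι 60 * (M * X) * ϖ M Z
    + ι 30 * (M * M) * (τ * τ) - ι 16 * (M * M * M * M * M * M)
    + ι 45 * M * (τ * τ) - ι 40 * X * (Z * (Z - M) * (Z - ι 2 * M))
    + ι 15 * (Z * Z * Z * Z) - ι 60 * M * (Z * Z * Z) - ι 120 * (M * M) * (Z * Z) + ι 360 * (M * M * M) * Z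
    - ι 90 * M * (Z * Z) + ι 180 * (M * M) * Z
    - ι 24 * (M * M * M * M * M) - ι 128 * (M * M * M * M) - ι 60 * (M * M * M)
    where τ = Z * (Z - ι 2 * M)

  Ψᴱ : ∀ {n} → Expr n → Expr n → Expr n → Expr n
  Ψᴱ X M Z = # 10 ⊗ (X ⊗ X) ⊗ (# 3 ⊗ τ ⊕ # 2 ⊗ (M ⊗ M)) ⊖ # 60 ⊗ (M ⊗ X) ⊗ ϖᴱ M Z
    ⊕ # 30 ⊗ (M ⊗ M) ⊗ (τ ⊗ τ) ⊖ # 16 ⊗ (M ⊗ M ⊗ M ⊗ M ⊗ M ⊗ M)
    ⊕ # 45 ⊗ M ⊗ (τ ⊗ τ) ⊖ # 40 ⊗ X ⊗ (Z ⊗ (Z ⊖ M) ⊗ (Z ⊖ # 2 ⊗ M))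
    ⊕ # 15 ⊗ (Z ⊗ Z ⊗ Z ⊗ Z) ⊖ # 60 ⊗ M ⊗ (Z ⊗ Z ⊗ Z) ⊖ # 120 ⊗ (M ⊗ M) ⊗ (Z ⊗ Z) ⊕ # 360 ⊗ (M ⊗ M ⊗ M) ⊗ Z
    ⊖ # 90 ⊗ M ⊗ (Z ⊗ Z) ⊕ # 180 ⊗ (M ⊗ M) ⊗ Z
    ⊖ # 24 ⊗ (M ⊗ M ⊗ M ⊗ M ⊗ M) ⊖ # 128 ⊗ (M ⊗ M ⊗ M ⊗ M) ⊖ # 60 ⊗ (M ⊗ M ⊗ M)
    where τ = Z ⊗ (Z ⊖ # 2 ⊗ M)

  -- M² ϖ d Z at the point where d M = x - y.
  G : ℕ → F → Sq
  G x M y = M * M * (Z * Z * Z - ι 3 * Z) - ι 3 * M * (ι x - ι y) * (Z * Z - ι 1) + ι 2 * ((ι x - ι y) * (ι x - ι y)) * Z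
    where Z = odd y

  Gᴱ : ∀ {n} → Expr n → Expr n → Expr n → Expr n
  Gᴱ x M y = M ⊗ M ⊗ (Z ⊗ Z ⊗ Z ⊖ # 3 ⊗ Z) ⊖ # 3 ⊗ M ⊗ (x ⊖ y) ⊗ (Z ⊗ Z ⊖ # 1) ⊕ # 2 ⊗ ((x ⊖ y) ⊗ (x ⊖ y)) ⊗ Z
    where Z = # 2 ⊗ y ⊕ # 3

  Ψ-step : ∀ x M y → Ψ (odd x) (ι M) (odd (M ℕ.+ y)) ≡ Ψ (odd x) (ι M) (odd y) + ι 240 * ι M * G x (ι M) y
  Ψ-step x M y = trans (cong (Ψ (odd x) (ι M)) (odd-+ M y))
    (ring (Ψᴱ (# 2 ⊗ v0 ⊕ # 3) v1 (# 2 ⊗ v2 ⊕ # 3 ⊕ # 2 ⊗ v1))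
      (Ψᴱ (# 2 ⊗ v0 ⊕ # 3) v1 (# 2 ⊗ v2 ⊕ # 3) ⊕ # 240 ⊗ v1 ⊗ Gᴱ v0 v1 v2)
      (ι x ∷ ι M ∷ ι y ∷ []) refl)

  -- To leading order ϖ is d³ t (t - 1)(t - 2) with t = Z/d between 0 and 2, whose largest absolute
  -- value 2/(3√3) is just below 2/5. This is the origin of the factor 5 in the bound and of the
  -- coefficient 2 here.
  ϖ̂ : F → F
  ϖ̂ d = ι 2 * (d * d * d) + ι 10 * (d * d) + ι 34 * d + ι 5

  remainder-split : ∀ {n r} → r ℕ.< suc n → ι (suc n) ≡ ι r + ι (n ∸ r) + ι 1
  remainder-split {n} {r} (s≤s q) = trans (ι-suc n) (trans (+-comm _ _) (+-congʳ (trans (cong ι (sym (ℕₚ.m+[n∸m]≡n q))) (ι-+ r (n ∸ r)))))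

  -- The cubic is bounded by completing a square in the larger of the two gaps.
  ϖ-bound : ∀ m' r → r ℕ.< suc m' → ∣ ι 5 * ϖ (ι (suc m')) (odd r) ∣≤ ϖ̂ (ι (suc m'))
  ϖ-bound m' r q = subst (λ d → ∣ ι 5 * ϖ d (odd r) ∣≤ ϖ̂ d) (sym (remainder-split q)) (*-cancel two upper , *-cancel two lower)
    where
    two : ι 1 ≤ ι 2
    two = 1≤ιsuc 1
    a = ι r
    t = ι (m' ∸ r)
    d = a + t + ι 1
    -- The leading part 4at(t - a) peaks, for fixed a + t, at the ratio t/a = 2 + √3; the square
    -- vanishes near the close ratio 7/2.
    s₁ = ι 2 * t - ι 7 * a - ι 7
    s₂ = ι 2 * a - ι 7 * t + ι 7
    upper : ι 2 * (ι 5 * ϖ d (odd r)) ≤ ι 2 * ϖ̂ d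
    upper = ≤-trans (≤-reflexiveˡ (sym (+-0 _)) (+-mono ≤-refl (*-nonneg (0≤ι (m' ∸ r)) (sq-nonneg s₁))))
      (pos (# 2 ⊗ (# 5 ⊗ ϖᴱ (v0 ⊕ v1 ⊕ # 1) (# 2 ⊗ v0 ⊕ # 3)) ⊕ v1 ⊗ ((# 2 ⊗ v1 ⊖ # 7 ⊗ v0 ⊖ # 7) ⊗ (# 2 ⊗ v1 ⊖ # 7 ⊗ v0 ⊖ # 7)))
        (# 2 ⊗ (# 2 ⊗ (D ⊗ D ⊗ D) ⊕ # 10 ⊗ (D ⊗ D) ⊕ # 34 ⊗ D ⊕ # 5)) (a ∷ t ∷ []) (0≤ι r , 0≤ι (m' ∸ r) , tt) refl)
      where
      D : Expr 2
      D = v0 ⊕ v1 ⊕ # 1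
    lower : ι 2 * (- (ι 5 * ϖ d (odd r))) ≤ ι 2 * ϖ̂ d
    lower = ≤-trans (≤-reflexiveˡ (sym (+-0 _)) (+-mono ≤-refl (*-nonneg (0≤ι r) (sq-nonneg s₂))))
      (pos (# 2 ⊗ (⊝ (# 5 ⊗ ϖᴱ (v0 ⊕ v1 ⊕ # 1) (# 2 ⊗ v0 ⊕ # 3))) ⊕ v0 ⊗ ((# 2 ⊗ v0 ⊖ # 7 ⊗ v1 ⊕ # 7) ⊗ (# 2 ⊗ v0 ⊖ # 7 ⊗ v1 ⊕ # 7)))
        (# 2 ⊗ (# 2 ⊗ (D ⊗ D ⊗ D) ⊕ # 10 ⊗ (D ⊗ D) ⊕ # 34 ⊗ D ⊕ # 5)) (a ∷ t ∷ []) (0≤ι r , 0≤ι (m' ∸ r) , tt) refl)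
      where
      D : Expr 2
      D = v0 ⊕ v1 ⊕ # 1

  -- The term with `X` is 8X times the quantity in `ϖ-bound`; the others are bounded coefficientwise
  -- in r and m - 1 - r. The factor m² is split off for the later division by m², and 392 = 8 (10 +
  -- 34 + 5) uses m ≥ 1.
  Low-bound : ∀ x m' r → r ℕ.< suc m' → let m = ι (suc m') in
    ∣ Low (odd x) m (odd r) ∣≤ m * m * (odd x * (ι 16 * m + ι 392) + ι 100 * (m * m) + ι 100 * m + ι 400)
  Low-bound x m' r q = abs-weaken (abs-subst split (abs-+ (abs-*ˡ 8X (ϖ-bound m' r q)) rest))
    (subst (λ d → ι 8 * odd x * ϖ̂ d + d * d * (ι 100 * (d * d) + ι 100 * d + ι 400)
        ≤ d * d * (odd x * (ι 16 * d + ι 392) + ι 100 * (d * d) + ι 100 * d + ι 400)) (sym (ι-suc m'))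
      (pos (# 8 ⊗ v0 ⊗ (# 2 ⊗ (D ⊗ D ⊗ D) ⊕ # 10 ⊗ (D ⊗ D) ⊕ # 34 ⊗ D ⊕ # 5) ⊕ D ⊗ D ⊗ (# 100 ⊗ (D ⊗ D) ⊕ # 100 ⊗ D ⊕ # 400))
        (D ⊗ D ⊗ (v0 ⊗ (# 16 ⊗ D ⊕ # 392) ⊕ # 100 ⊗ (D ⊗ D) ⊕ # 100 ⊗ D ⊕ # 400))
        (odd x ∷ ι m' ∷ []) (0≤odd x , 0≤ι m' , tt) refl))
    where
    D : Expr 2
    D = # 1 ⊕ v1
    m = ι (suc m')
    Z = odd r
    8X : ι 0 ≤ ι 8 * odd x
    8X = *-nonneg (0≤ι 8) (0≤odd x)
    part : F → F → F
    part m Z = ι 16 * (m * m * m * m) + ι 40 * (m * m) + ι 60 * (Z * (Z - ι 2 * m)) - ι 30 * (Z * (Z - ι 2 * m) * (Z * (Z - ι 2 * m)))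
    partᴱ : ∀ {n} → Expr n → Expr n → Expr n
    partᴱ m Z = # 16 ⊗ (m ⊗ m ⊗ m ⊗ m) ⊕ # 40 ⊗ (m ⊗ m) ⊕ # 60 ⊗ (Z ⊗ (Z ⊖ # 2 ⊗ m)) ⊖ # 30 ⊗ (Z ⊗ (Z ⊖ # 2 ⊗ m) ⊗ (Z ⊗ (Z ⊖ # 2 ⊗ m)))
    split : ι 8 * odd x * (ι 5 * ϖ m Z) + part m Z ≡ Low (odd x) m Z
    split = ring (# 8 ⊗ v0 ⊗ (# 5 ⊗ ϖᴱ v1 v2) ⊕ partᴱ v1 v2) (Lowᴱ v0 v1 v2) (odd x ∷ m ∷ Z ∷ []) refl
    rest : ∣ part m Z ∣≤ m * m * (ι 100 * (m * m) + ι 100 * m + ι 400)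
    rest = subst (λ d → ∣ part d Z ∣≤ d * d * (ι 100 * (d * d) + ι 100 * d + ι 400)) (sym (remainder-split q))
      ( pos (partᴱ E (# 2 ⊗ v0 ⊕ # 3)) (E ⊗ E ⊗ (# 100 ⊗ (E ⊗ E) ⊕ # 100 ⊗ E ⊕ # 400)) ρ h refl
      , pos (⊝ partᴱ E (# 2 ⊗ v0 ⊕ # 3)) (E ⊗ E ⊗ (# 100 ⊗ (E ⊗ E) ⊕ # 100 ⊗ E ⊕ # 400)) ρ h refl)
      where
      ρ = ι r ∷ ι (m' ∸ r) ∷ []
      h = 0≤ι r , 0≤ι (m' ∸ r) , tt
      E : Expr 2
      E = v0 ⊕ v1 ⊕ # 1

  Ψ̂ : F → F → F
  Ψ̂ X M = ι 10 * (X * X) * (ι 4 * (M * M) + ι 6 * M + ι 3) + ι 12 * (M * X) * ϖ̂ M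
    + ι 80 * (M * M) * (N * N * N * N) + ι 16 * (M * M * M * M * M * M)
    + ι 120 * M * (N * N * N * N) + ι 100 * X * (N * N * N) + ι 1000 * (N * N * N * N) + ι 100 * (N * N * N * N * N)
    where N = M + ι 1

  Ψ-bound : ∀ x m' r → r ℕ.< suc m' → ∣ Ψ (odd x) (ι (suc m')) (odd r) ∣≤ Ψ̂ (odd x) (ι (suc m'))
  Ψ-bound x m' r q = subst (λ d → ∣ Ψ X d Z ∣≤ Ψ̂ X d) (sym e)
    (abs-weaken (abs-subst split (abs-+ (abs-neg (abs-*ˡ 12MX (subst (λ d → ∣ ι 5 * ϖ d Z ∣≤ ϖ̂ d) e (ϖ-bound m' r q)))) rest))
      (≡⇒≤ (ring (# 12 ⊗ (v0 ⊗ v1) ⊗ v2 ⊕ (v3 ⊖ # 12 ⊗ (v0 ⊗ v1) ⊗ v2)) v3 (d ∷ X ∷ ϖ̂ d ∷ Ψ̂ X d ∷ []) refl)))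
    where
    e = remainder-split {m'} {r} q
    X = odd x
    Z = odd r
    d = ι r + ι (m' ∸ r) + ι 1
    12MX : ι 0 ≤ ι 12 * (d * X)
    12MX = *-nonneg (0≤ι 12) (*-nonneg (+-nonneg (+-nonneg (0≤ι r) (0≤ι (m' ∸ r))) (0≤ι 1)) (0≤odd x))
    split : - (ι 12 * (d * X) * (ι 5 * ϖ d Z)) + (Ψ X d Z + ι 60 * (d * X) * ϖ d Z) ≡ Ψ X d Z
    split = ring (⊝ (# 12 ⊗ v0 ⊗ (# 5 ⊗ v1)) ⊕ (v2 ⊕ # 60 ⊗ v0 ⊗ v1)) v2 (d * X ∷ ϖ d Z ∷ Ψ X d Z ∷ []) refl
    rest : ∣ Ψ X d Z + ι 60 * (d * X) * ϖ d Z ∣≤ Ψ̂ X d - ι 12 * (d * X) * ϖ̂ d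
    rest = pos (Ψᴱ v0 D Y ⊕ # 60 ⊗ (D ⊗ v0) ⊗ ϖᴱ D Y) (hat ⊖ # 12 ⊗ (D ⊗ v0) ⊗ ϖh) ρ h refl
         , pos (⊝ (Ψᴱ v0 D Y ⊕ # 60 ⊗ (D ⊗ v0) ⊗ ϖᴱ D Y)) (hat ⊖ # 12 ⊗ (D ⊗ v0) ⊗ ϖh) ρ h refl
      where
      ρ = X ∷ ι r ∷ ι (m' ∸ r) ∷ []
      h = 0≤odd x , 0≤ι r , 0≤ι (m' ∸ r) , tt
      D Y N ϖh hat : Expr 3
      D = v1 ⊕ v2 ⊕ # 1
      Y = # 2 ⊗ v1 ⊕ # 3
      N = D ⊕ # 1
      ϖh = # 2 ⊗ (D ⊗ D ⊗ D) ⊕ # 10 ⊗ (D ⊗ D) ⊕ # 34 ⊗ D ⊕ # 5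
      hat = # 10 ⊗ (v0 ⊗ v0) ⊗ (# 4 ⊗ (D ⊗ D) ⊕ # 6 ⊗ D ⊕ # 3) ⊕ # 12 ⊗ (D ⊗ v0) ⊗ ϖh
        ⊕ # 80 ⊗ (D ⊗ D) ⊗ (N ⊗ N ⊗ N ⊗ N) ⊕ # 16 ⊗ (D ⊗ D ⊗ D ⊗ D ⊗ D ⊗ D)
        ⊕ # 120 ⊗ D ⊗ (N ⊗ N ⊗ N ⊗ N) ⊕ # 100 ⊗ v0 ⊗ (N ⊗ N ⊗ N) ⊕ # 1000 ⊗ (N ⊗ N ⊗ N ⊗ N) ⊕ # 100 ⊗ (N ⊗ N ⊗ N ⊗ N ⊗ N)

  rsq : ℕ → F
  rsq m = inv (ι m) * inv (ι m)

  basel₂ : ℕ → F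
  basel₂ M = ∑ M rsq

  low-main low-err : F → F → F
  low-main X m = ι 16 * (m * m) + ι 40 - ι 40 * (X * X)
  low-err X m = X * (ι 16 * m + ι 392) + ι 100 * (m * m) + ι 100 * m + ι 400

  -- After division by m² the upper endpoint of `low-sum` splits into a multiple of 1/m², which
  -- builds up the partial sums of ∑ 1/m², and the polynomial `low-main`. The endpoint at the
  -- remainder is the error.
  low-term : ∀ L m' x → x ℕ.≤ L → let m = suc m' ; X = odd x in
    ∣ ι 3840 * ∑ L (λ j → ι j * sh (j ℕ.* m) Q x) - ((ι 10 * (X * X * X * X) - ι 60 * (X * X)) * rsq m + low-main X (ι m)) ∣≤ low-err X (ι m)
  low-term L m' x q = abs-subst eq (abs-neg (abs-weaken (abs-*ˡ r0 (Low-bound x m' (x % m) (DM.m%n<n x m))) (≡⇒≤ simp)))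
    where
    m = suc m'
    X = odd x
    μ = ι m
    I = inv μ
    t = ∑ L (λ j → ι j * sh (j ℕ.* m) Q x)
    μI : μ * I ≡ ι 1
    μI = inv-inverse μ (1≤ιsuc m')
    r0 : ι 0 ≤ rsq m
    r0 = *-nonneg (inv-nonneg μ (1≤ιsuc m')) (inv-nonneg μ (1≤ιsuc m'))
    unit : ∀ z → I * I * (μ * μ * z) ≡ z
    unit z = trans (ring (v1 ⊗ v1 ⊗ (v0 ⊗ v0 ⊗ v2)) ((v0 ⊗ v1) ⊗ (v0 ⊗ v1) ⊗ v2) (μ ∷ I ∷ z ∷ []) refl)
      (trans (cong (λ u → u * u * z) μI) (ring (# 1 ⊗ # 1 ⊗ v0) v0 (z ∷ []) refl))
    simp : I * I * (μ * μ * (X * (ι 16 * μ + ι 392) + ι 100 * (μ * μ) + ι 100 * μ + ι 400)) ≡ low-err X μ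
    simp = unit _
    Low-top : Low X μ X ≡ ι 10 * (X * X * X * X) - ι 60 * (X * X) + μ * μ * low-main X μ
    Low-top = ring (# 40 ⊗ v0 ⊗ ((v0 ⊖ v1) ⊗ (v0 ⊗ (v0 ⊖ # 2 ⊗ v1) ⊖ # 3)) ⊖ # 30 ⊗ (T ⊗ T) ⊕ # 60 ⊗ T ⊕ # 16 ⊗ (v1 ⊗ v1 ⊗ v1 ⊗ v1) ⊕ # 40 ⊗ (v1 ⊗ v1))
      (# 10 ⊗ (v0 ⊗ v0 ⊗ v0 ⊗ v0) ⊖ # 60 ⊗ (v0 ⊗ v0) ⊕ v1 ⊗ v1 ⊗ (# 16 ⊗ (v1 ⊗ v1) ⊕ # 40 ⊖ # 40 ⊗ (v0 ⊗ v0)))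
      (X ∷ μ ∷ []) refl
      where
      T : Expr 2
      T = v0 ⊗ (v0 ⊖ # 2 ⊗ v1)
    eq : - (I * I * Low X μ (odd (x % m))) ≡ ι 3840 * t - ((ι 10 * (X * X * X * X) - ι 60 * (X * X)) * rsq m + low-main X μ)
    eq = trans (cong (λ z → - (I * I * z)) (trans (ring v1 (v0 ⊖ (v0 ⊖ v1)) (Low X μ X ∷ Low X μ (odd (x % m)) ∷ []) refl)
        (cong₂ _-_ Low-top (sym (low-sum L m' x q)))))
      (trans (ring (⊝ (v0 ⊗ v0 ⊗ (v1 ⊕ v2 ⊗ v2 ⊗ v3 ⊖ # 3840 ⊗ (v2 ⊗ v2) ⊗ v4)))
          (v0 ⊗ v0 ⊗ (v2 ⊗ v2 ⊗ (# 3840 ⊗ v4 ⊖ v3)) ⊖ v1 ⊗ (v0 ⊗ v0))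
          (I ∷ (ι 10 * (X * X * X * X) - ι 60 * (X * X)) ∷ μ ∷ low-main X μ ∷ t ∷ []) refl)
        (trans (+-congʳ (unit _)) (ring (v0 ⊖ v1 ⊖ v2) (v0 ⊖ (v2 ⊕ v1)) (ι 3840 * t ∷ low-main X μ ∷ (ι 10 * (X * X * X * X) - ι 60 * (X * X)) * rsq m ∷ []) refl)))

  -- Multiples of j beyond jM are counted from y = x - jM, where `high-sum` applies. Replacing jM by
  -- x - y turns the main term into the polynomial `G`, which can be summed over j.
  high-term : ∀ L M' j' x → x ℕ.≤ L → suc j' ℕ.* suc M' ℕ.≤ x → let M = suc M' ; j = suc j' ; μ = ι M in
    ∣ ι 11520 * (μ * μ * μ) * (ι j * ∑ (L ∸ M) (λ i → sh (j ℕ.* (M ℕ.+ i)) Q x)) - sh (M ℕ.* j) (λ y → ι 240 * μ * G x μ y) x ∣≤ ι 48 * (μ * μ * μ) * ϖ̂ (ι j)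
  high-term L M' j' x q r = abs-subst eq (abs-neg (abs-*ˡ c0 (ϖ-bound j' (y % j) (DM.m%n<n y j))))
    where
    M = suc M'
    j = suc j'
    μ = ι M
    y = x ∸ j ℕ.* M
    x≡ : j ℕ.* M ℕ.+ y ≡ x
    x≡ = ℕₚ.m+[n∸m]≡n r
    y≤ : y ℕ.≤ L ∸ M
    y≤ = ℕₚ.≤-trans (ℕₚ.∸-monoˡ-≤ (j ℕ.* M) q) (ℕₚ.∸-monoʳ-≤ L (ℕₚ.m≤m+n M (j' ℕ.* M)))
    c0 : ι 0 ≤ ι 48 * (μ * μ * μ)
    c0 = *-nonneg (0≤ι 48) (*-nonneg (*-nonneg (0≤ι M) (0≤ι M)) (0≤ι M))
    W = ∑ (L ∸ M) (λ i → sh (j ℕ.* (M ℕ.+ i)) Q x)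
    W≡ : W ≡ multiples (L ∸ M) j Q y
    W≡ = ∑-cong' (L ∸ M) (λ i → trans (cong (λ k → sh k Q x) (ℕₚ.*-distribˡ-+ j M i))
      (trans (sh-+ (j ℕ.* M) (j ℕ.* i) Q x) (trans (cong (sh (j ℕ.* M) (sh (j ℕ.* i) Q)) (sym x≡)) (sh-at (j ℕ.* M) (sh (j ℕ.* i) Q) y))))
    dist : ι x - ι y ≡ ι j * μ
    dist = trans (cong (_- ι y) (trans (cong ι (sym x≡)) (trans (ι-+ (j ℕ.* M) y) (+-congʳ (ι-* j M)))))
      (ring (v0 ⊕ v1 ⊖ v1) v0 (ι j * μ ∷ ι y ∷ []) refl)
    G≡ : G x μ y ≡ μ * μ * ϖ (ι j) (odd y)
    G≡ = trans (cong (λ u → μ * μ * (odd y * odd y * odd y - ι 3 * odd y) - ι 3 * μ * u * (odd y * odd y - ι 1) + ι 2 * (u * u) * odd y) dist)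
      (ring (v1 ⊗ v1 ⊗ (v2 ⊗ v2 ⊗ v2 ⊖ # 3 ⊗ v2) ⊖ # 3 ⊗ v1 ⊗ (v0 ⊗ v1) ⊗ (v2 ⊗ v2 ⊖ # 1) ⊕ # 2 ⊗ ((v0 ⊗ v1) ⊗ (v0 ⊗ v1)) ⊗ v2)
        (v1 ⊗ v1 ⊗ ((v2 ⊖ v0) ⊗ (v2 ⊗ (v2 ⊖ # 2 ⊗ v0) ⊖ # 3))) (ι j ∷ μ ∷ odd y ∷ []) refl)
    shG : sh (M ℕ.* j) (λ y → ι 240 * μ * G x μ y) x ≡ ι 240 * μ * (μ * μ * ϖ (ι j) (odd y))
    shG = trans (cong (λ k → sh k (λ y → ι 240 * μ * G x μ y) x) (ℕₚ.*-comm M j))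
      (trans (cong (sh (j ℕ.* M) (λ y → ι 240 * μ * G x μ y)) (sym x≡)) (trans (sh-at (j ℕ.* M) _ y) (cong (ι 240 * μ *_) G≡)))
    ρ = odd (y % j)
    eq : - (ι 48 * (μ * μ * μ) * (ι 5 * ϖ (ι j) ρ)) ≡ ι 11520 * (μ * μ * μ) * (ι j * W) - sh (M ℕ.* j) (λ y → ι 240 * μ * G x μ y) x
    eq = trans (ring (⊝ (# 48 ⊗ (v0 ⊗ v0 ⊗ v0) ⊗ (# 5 ⊗ v1))) (# 240 ⊗ (v0 ⊗ v0 ⊗ v0) ⊗ (v2 ⊖ v1) ⊖ # 240 ⊗ v0 ⊗ (v0 ⊗ v0 ⊗ v2))
        (μ ∷ ϖ (ι j) ρ ∷ ϖ (ι j) (odd y) ∷ []) refl)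
      (cong₂ _-_ (trans (cong (ι 240 * (μ * μ * μ) *_) (trans (sym (high-sum (L ∸ M) j' y y≤)) (cong (λ w → ι 48 * (ι j * w)) (sym W≡))))
        (ring (# 240 ⊗ (v0 ⊗ v0 ⊗ v0) ⊗ (# 48 ⊗ (v1 ⊗ v2))) (# 11520 ⊗ (v0 ⊗ v0 ⊗ v0) ⊗ (v1 ⊗ v2)) (μ ∷ ι j ∷ W ∷ []) refl)) (sym shG))

  -- The hyperbola method: for m ≤ M the sum over j is evaluated in closed form, and for m > M the
  -- sum over m. M will be the integer square root of x.
  K-split : ∀ L M x → M ℕ.≤ L →
    K L Q x ≡ ∑ M (λ m → ∑ L (λ j → ι j * sh (j ℕ.* m) Q x)) + ∑ L (λ j → ι j * ∑ (L ∸ M) (λ i → sh (j ℕ.* (M ℕ.+ i)) Q x))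
  K-split L M x q = trans (∑-cong' L (λ j → trans (cong (ι j *_) (trans (cong (λ k → ∑ k (λ m → sh (j ℕ.* m) Q x)) (sym (ℕₚ.m+[n∸m]≡n q)))
      (∑-split M (L ∸ M) _))) (*-distribˡ (ι j) _ _)))
    (trans (∑-+ L _ _) (+-congʳ (trans (∑-cong' L (λ j → sym (∑-* M (ι j) _))) (∑-swap L M (λ j m → ι j * sh (j ℕ.* m) Q x)))))

  low-total : ∀ L M x → x ℕ.≤ L → let X = odd x in
    ∣ ι 3840 * ∑ M (λ m → ∑ L (λ j → ι j * sh (j ℕ.* m) Q x)) - ((ι 10 * (X * X * X * X) - ι 60 * (X * X)) * basel₂ M + ∑ M (λ m → low-main X (ι m))) ∣≤ ∑ M (λ m → low-err X (ι m))
  low-total L M x q = abs-subst eq (abs-∑ M {f = λ m → ι 3840 * t m - (c * rsq m + low-main X (ι m))} (λ { (suc m') _ _ → low-term L m' x q }))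
    where
    X = odd x
    c = ι 10 * (X * X * X * X) - ι 60 * (X * X)
    t : ℕ → F
    t m = ∑ L (λ j → ι j * sh (j ℕ.* m) Q x)
    eq : ∑ M (λ m → ι 3840 * t m - (c * rsq m + low-main X (ι m))) ≡ ι 3840 * ∑ M t - (c * basel₂ M + ∑ M (λ m → low-main X (ι m)))
    eq = trans (∑-cong' M (λ m → ring (# 3840 ⊗ v0 ⊖ (v1 ⊗ v2 ⊕ v3)) (# 3840 ⊗ v0 ⊕ (⊝ # 1) ⊗ (v1 ⊗ v2 ⊕ v3)) (t m ∷ c ∷ rsq m ∷ low-main X (ι m) ∷ []) refl))
      (trans (∑-+ M _ _) (trans (cong₂ _+_ (∑-* M (ι 3840) t) (trans (∑-* M (- ι 1) _) (cong (- ι 1 *_) (trans (∑-+ M _ _) (+-congʳ (∑-* M c rsq))))))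
        (ring (# 3840 ⊗ v0 ⊕ (⊝ # 1) ⊗ (v1 ⊗ v2 ⊕ v3)) (# 3840 ⊗ v0 ⊖ (v1 ⊗ v2 ⊕ v3)) (∑ M t ∷ c ∷ basel₂ M ∷ ∑ M (λ m → low-main X (ι m)) ∷ []) refl)))

  -- Only j ≤ x/M contributes, and x ≤ M (M + 2) makes this at most M + 2. The errors of the single
  -- j are added; the main terms telescope through `Ψ`, whose endpoint at the remainder is a further
  -- error.
  high-total : ∀ L M' x → x ℕ.≤ L → let M = suc M' ; μ = ι M ; X = odd x in x ℕ.≤ (M ℕ.+ 2) ℕ.* M → M ℕ.+ 2 ℕ.≤ L →
    ∣ ι 11520 * (μ * μ * μ) * ∑ L (λ j → ι j * ∑ (L ∸ M) (λ i → sh (j ℕ.* (M ℕ.+ i)) Q x)) - Ψ X μ X ∣≤ ι 48 * (μ * μ * μ) * ∑ (M ℕ.+ 2) (λ j → ϖ̂ (ι j)) + Ψ̂ X μ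
  high-total L M' x q r s = abs-subst eq (abs-+ main (abs-neg (Ψ-bound x M' (x % M) (DM.m%n<n x M))))
    where
    M = suc M'
    μ = ι M
    X = odd x
    D = x / M
    c = ι 11520 * (μ * μ * μ)
    D≤ : D ℕ.≤ M ℕ.+ 2
    D≤ = ℕₚ.≤-trans (DM./-monoˡ-≤ M r) (ℕₚ.≤-reflexive (DM.m*n/n≡m (M ℕ.+ 2) M))
    h : ℕ → F
    h j = ι j * ∑ (L ∸ M) (λ i → sh (j ℕ.* (M ℕ.+ i)) Q x)
    b : Sq
    b y = ι 240 * μ * G x μ y
    beyond : ∀ j → D ℕ.< j → x ℕ.< j ℕ.* M
    beyond j p = ℕₚ.≰⇒> (λ u → ℕₚ.<⇒≱ p (ℕₚ.≤-trans (ℕₚ.≤-reflexive (sym (DM.m*n/n≡m j M))) (DM./-monoˡ-≤ M u)))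
    h0 : ∀ j → D ℕ.< j → h j ≡ ι 0
    h0 j p = trans (cong (ι j *_) (trans (∑-cong' (L ∸ M) (λ i → sh-big (j ℕ.* (M ℕ.+ i)) Q x
      (ℕₚ.<-≤-trans (beyond j p) (ℕₚ.*-monoʳ-≤ j (ℕₚ.m≤m+n M i))))) (∑-0 (L ∸ M)))) (*-0 _)
    b0 : ∀ j → D ℕ.< j → sh (M ℕ.* j) b x ≡ ι 0
    b0 j p = sh-big (M ℕ.* j) b x (subst (x ℕ.<_) (ℕₚ.*-comm j M) (beyond j p))
    within : ∀ j → j ℕ.≤ D → j ℕ.* M ℕ.≤ x
    within j p = ℕₚ.≤-trans (ℕₚ.*-monoˡ-≤ M p) (DM.m/n*n≤m x M)
    D≤L = ℕₚ.≤-trans D≤ s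
    telescoped : ∑ D (λ j → sh (M ℕ.* j) b x) ≡ Ψ X μ X - Ψ X μ (odd (x % M))
    telescoped = trans (sym (∑-trunc (λ j → sh (M ℕ.* j) b x) D≤L b0)) (multiples-eval L M' b (λ y → Ψ X μ (odd y)) (Ψ-step x M) x q)
    main : ∣ c * ∑ L h - ∑ D (λ j → sh (M ℕ.* j) b x) ∣≤ ι 48 * (μ * μ * μ) * ∑ (M ℕ.+ 2) (λ j → ϖ̂ (ι j))
    main = abs-subst (trans (∑-cong' D (λ j → ring (v0 ⊗ v1 ⊖ v2) (v0 ⊗ v1 ⊕ (⊝ # 1) ⊗ v2) (c ∷ h j ∷ sh (M ℕ.* j) b x ∷ []) refl))
        (trans (∑-+ D _ _) (trans (cong₂ _+_ (trans (∑-* D c h) (cong (c *_) (sym (∑-trunc h D≤L h0)))) (∑-* D (- ι 1) _))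
          (ring (v0 ⊕ (⊝ # 1) ⊗ v1) (v0 ⊖ v1) (c * ∑ L h ∷ ∑ D (λ j → sh (M ℕ.* j) b x) ∷ []) refl))))
      (abs-weaken (abs-∑ D {f = λ j → c * h j - sh (M ℕ.* j) b x} (λ { (suc j') _ p → high-term L M' j' x q (within (suc j') p) }))
        (≤-reflexiveˡ (∑-* D _ _) (*-monoˡ (*-nonneg (0≤ι 48) (*-nonneg (*-nonneg (0≤ι M) (0≤ι M)) (0≤ι M)))
          (∑-extend D≤ (λ j → pos (# 0) (# 2 ⊗ (v0 ⊗ v0 ⊗ v0) ⊕ # 10 ⊗ (v0 ⊗ v0) ⊕ # 34 ⊗ v0 ⊕ # 5) (ι j ∷ []) (0≤ι j , tt) refl)))))
    eq : c * ∑ L h - ∑ D (λ j → sh (M ℕ.* j) b x) + - Ψ X μ (odd (x % M)) ≡ c * ∑ L h - Ψ X μ X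
    eq = trans (cong (λ u → c * ∑ L h - u + - Ψ X μ (odd (x % M))) telescoped)
      (ring (v0 ⊖ (v1 ⊖ v2) ⊕ (⊝ v2)) (v0 ⊖ v1) (c * ∑ L h ∷ Ψ X μ X ∷ Ψ X μ (odd (x % M)) ∷ []) refl)

  -- The third iterated sum of σ

  low-mainᴱ low-errᴱ : ∀ {n} → Expr n → Expr n → Expr n
  low-mainᴱ X m = # 16 ⊗ (m ⊗ m) ⊕ # 40 ⊖ # 40 ⊗ (X ⊗ X)
  low-errᴱ X m = X ⊗ (# 16 ⊗ m ⊕ # 392) ⊕ # 100 ⊗ (m ⊗ m) ⊕ # 100 ⊗ m ⊕ # 400

  ϖ̂ᴱ : ∀ {n} → Expr n → Expr n
  ϖ̂ᴱ d = # 2 ⊗ (d ⊗ d ⊗ d) ⊕ # 10 ⊗ (d ⊗ d) ⊕ # 34 ⊗ d ⊕ # 5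

  low-main-sumᴱ low-err-sumᴱ : ∀ {n} → Expr n → Expr n → Expr n
  low-main-sumᴱ X M = # 8 ⊗ (M ⊗ (M ⊕ # 1) ⊗ (# 2 ⊗ M ⊕ # 1)) ⊕ # 120 ⊗ M ⊖ # 120 ⊗ (M ⊗ (X ⊗ X))
  low-err-sumᴱ X M = X ⊗ (# 24 ⊗ (M ⊗ (M ⊕ # 1)) ⊕ # 1176 ⊗ M) ⊕ # 50 ⊗ (M ⊗ (M ⊕ # 1) ⊗ (# 2 ⊗ M ⊕ # 1)) ⊕ # 150 ⊗ (M ⊗ (M ⊕ # 1)) ⊕ # 1200 ⊗ M

  ϖ̂-sumᴱ : ∀ {n} → Expr n → Expr n
  ϖ̂-sumᴱ n = # 24 ⊗ (n ⊗ n ⊗ ((n ⊕ # 1) ⊗ (n ⊕ # 1))) ⊕ # 80 ⊗ (n ⊗ (n ⊕ # 1) ⊗ (# 2 ⊗ n ⊕ # 1)) ⊕ # 816 ⊗ (n ⊗ (n ⊕ # 1)) ⊕ # 240 ⊗ n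

  Ψ̂ᴱ : ∀ {n} → Expr n → Expr n → Expr n
  Ψ̂ᴱ X M = # 10 ⊗ (X ⊗ X) ⊗ (# 4 ⊗ (M ⊗ M) ⊕ # 6 ⊗ M ⊕ # 3) ⊕ # 12 ⊗ (M ⊗ X) ⊗ ϖ̂ᴱ M
    ⊕ # 80 ⊗ (M ⊗ M) ⊗ (N ⊗ N ⊗ N ⊗ N) ⊕ # 16 ⊗ (M ⊗ M ⊗ M ⊗ M ⊗ M ⊗ M)
    ⊕ # 120 ⊗ M ⊗ (N ⊗ N ⊗ N ⊗ N) ⊕ # 100 ⊗ X ⊗ (N ⊗ N ⊗ N) ⊕ # 1000 ⊗ (N ⊗ N ⊗ N ⊗ N) ⊕ # 100 ⊗ (N ⊗ N ⊗ N ⊗ N ⊗ N)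
    where N = M ⊕ # 1

  low-main-sum : ∀ X M → ι 3 * ∑ M (λ m → low-main X (ι m)) ≡ ⟦ low-main-sumᴱ v0 v1 ⟧ (X ∷ ι M ∷ [])
  low-main-sum X zero = ring (# 3 ⊗ # 0) (low-main-sumᴱ v0 (# 0)) (X ∷ []) refl
  low-main-sum X (suc M) = trans (*-distribˡ _ _ _) (trans (+-congʳ (low-main-sum X M))
    (subst (λ s → ⟦ low-main-sumᴱ v0 v1 ⟧ (X ∷ ι M ∷ []) + ι 3 * low-main X s ≡ ⟦ low-main-sumᴱ v0 v1 ⟧ (X ∷ s ∷ [])) (sym (ι-suc M))
      (ring (low-main-sumᴱ v0 v1 ⊕ # 3 ⊗ low-mainᴱ v0 (# 1 ⊕ v1)) (low-main-sumᴱ v0 (# 1 ⊕ v1)) (X ∷ ι M ∷ []) refl)))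

  low-err-sum : ∀ X M → ι 3 * ∑ M (λ m → low-err X (ι m)) ≡ ⟦ low-err-sumᴱ v0 v1 ⟧ (X ∷ ι M ∷ [])
  low-err-sum X zero = ring (# 3 ⊗ # 0) (low-err-sumᴱ v0 (# 0)) (X ∷ []) refl
  low-err-sum X (suc M) = trans (*-distribˡ _ _ _) (trans (+-congʳ (low-err-sum X M))
    (subst (λ s → ⟦ low-err-sumᴱ v0 v1 ⟧ (X ∷ ι M ∷ []) + ι 3 * low-err X s ≡ ⟦ low-err-sumᴱ v0 v1 ⟧ (X ∷ s ∷ [])) (sym (ι-suc M))
      (ring (low-err-sumᴱ v0 v1 ⊕ # 3 ⊗ low-errᴱ v0 (# 1 ⊕ v1)) (low-err-sumᴱ v0 (# 1 ⊕ v1)) (X ∷ ι M ∷ []) refl)))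

  ϖ̂-sum : ∀ n → ι 48 * ∑ n (λ d → ϖ̂ (ι d)) ≡ ⟦ ϖ̂-sumᴱ v0 ⟧ (ι n ∷ [])
  ϖ̂-sum zero = ring (# 48 ⊗ # 0) (ϖ̂-sumᴱ (# 0)) [] refl
  ϖ̂-sum (suc n) = trans (*-distribˡ _ _ _) (trans (+-congʳ (ϖ̂-sum n))
    (subst (λ s → ⟦ ϖ̂-sumᴱ v0 ⟧ (ι n ∷ []) + ι 48 * ϖ̂ s ≡ ⟦ ϖ̂-sumᴱ v0 ⟧ (s ∷ [])) (sym (ι-suc n))
      (ring (ϖ̂-sumᴱ v0 ⊕ # 48 ⊗ ϖ̂ᴱ (# 1 ⊕ v0)) (ϖ̂-sumᴱ (# 1 ⊕ v0)) (ι n ∷ []) refl)))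

  -- Main term and error of 11520 M³ ∑_{dm ≤ x} d Q(x - dm), in terms of X = 2x + 3, M and ∑_{m ≤ M} m⁻².
  mainᴱ : ∀ {n} → Expr n → Expr n → Expr n → Expr n
  mainᴱ X M s = # 3 ⊗ (M ⊗ M ⊗ M) ⊗ ((# 10 ⊗ (X ⊗ X ⊗ X ⊗ X) ⊖ # 60 ⊗ (X ⊗ X)) ⊗ s) ⊕ M ⊗ M ⊗ M ⊗ low-main-sumᴱ X M ⊕ Ψᴱ X M X

  errᴱ : ∀ {n} → Expr n → Expr n → Expr n
  errᴱ X M = M ⊗ M ⊗ M ⊗ (low-err-sumᴱ X M ⊕ ϖ̂-sumᴱ (M ⊕ # 2)) ⊕ Ψ̂ᴱ X M

  -- The common factor is 11520 = 3 · 3840 for the low part and 240 · 48 for the high part; the 3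
  -- also clears the denominators of the power sums.
  T-estimate : ∀ L M' x → x ℕ.≤ L → let M = suc M' ; μ = ι M ; X = odd x in x ℕ.≤ (M ℕ.+ 2) ℕ.* M → M ℕ.+ 2 ℕ.≤ L →
    ∣ ι 11520 * (μ * μ * μ) * K L Q x - ⟦ mainᴱ v0 v1 v2 ⟧ (X ∷ μ ∷ basel₂ M ∷ []) ∣≤ ⟦ errᴱ v0 v1 ⟧ (X ∷ μ ∷ [])
  T-estimate L M' x q r s = abs-subst eq (abs-weaken (abs-+ (abs-*ˡ c0 (low-total L M x q)) (high-total L M' x q r s)) (≡⇒≤ err≡))
    where
    M = suc M'
    μ = ι M
    X = odd x
    c0 : ι 0 ≤ ι 3 * (μ * μ * μ)
    c0 = *-nonneg (0≤ι 3) (*-nonneg (*-nonneg (0≤ι M) (0≤ι M)) (0≤ι M))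
    lo = ∑ M (λ m → ∑ L (λ j → ι j * sh (j ℕ.* m) Q x))
    hi = ∑ L (λ j → ι j * ∑ (L ∸ M) (λ i → sh (j ℕ.* (M ℕ.+ i)) Q x))
    c = ι 10 * (X * X * X * X) - ι 60 * (X * X)
    lm = ∑ M (λ m → low-main X (ι m))
    le = ∑ M (λ m → low-err X (ι m))
    eq : ι 3 * (μ * μ * μ) * (ι 3840 * lo - (c * basel₂ M + lm)) + (ι 11520 * (μ * μ * μ) * hi - Ψ X μ X)
       ≡ ι 11520 * (μ * μ * μ) * K L Q x - ⟦ mainᴱ v0 v1 v2 ⟧ (X ∷ μ ∷ basel₂ M ∷ [])
    eq = trans (ring (# 3 ⊗ v0 ⊗ (# 3840 ⊗ v1 ⊖ (v2 ⊕ v3)) ⊕ (# 11520 ⊗ v0 ⊗ v4 ⊖ v5))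
        (# 11520 ⊗ v0 ⊗ (v1 ⊕ v4) ⊖ (# 3 ⊗ v0 ⊗ v2 ⊕ v0 ⊗ (# 3 ⊗ v3) ⊕ v5)) (μ * μ * μ ∷ lo ∷ c * basel₂ M ∷ lm ∷ hi ∷ Ψ X μ X ∷ []) refl)
      (cong₂ (λ t l → ι 11520 * (μ * μ * μ) * t - (ι 3 * (μ * μ * μ) * (c * basel₂ M) + μ * μ * μ * l + Ψ X μ X))
        (sym (K-split L M x (ℕₚ.≤-trans (ℕₚ.m≤m+n M 2) s))) (low-main-sum X M))
    err≡ : ι 3 * (μ * μ * μ) * le + (ι 48 * (μ * μ * μ) * ∑ (M ℕ.+ 2) (λ j → ϖ̂ (ι j)) + Ψ̂ X μ) ≡ ⟦ errᴱ v0 v1 ⟧ (X ∷ μ ∷ [])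
    err≡ = trans (ring (# 3 ⊗ v0 ⊗ v1 ⊕ (# 48 ⊗ v0 ⊗ v2 ⊕ v3)) (v0 ⊗ (# 3 ⊗ v1 ⊕ # 48 ⊗ v2) ⊕ v3) (μ * μ * μ ∷ le ∷ ∑ (M ℕ.+ 2) (λ j → ϖ̂ (ι j)) ∷ Ψ̂ X μ ∷ []) refl)
      (+-congʳ (cong (μ * μ * μ *_) (cong₂ _+_ (low-err-sum X M) (trans (ϖ̂-sum (M ℕ.+ 2)) (cong (λ n → ⟦ ϖ̂-sumᴱ v0 ⟧ (n ∷ [])) (ι-+ M 2))))))

  -- Comparison of σ with the line A l - 1/2

  module _ (A : F) where

    half : F
    half = inv (ι 2)

    2half : ι 2 * half ≡ ι 1
    2half = inv-inverse (ι 2) (1≤ιsuc 1)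

    -- As t tends to 0, ∑ σ(l) exp(-lt) = ζ(2)/t² - 1/(2t) + 1/24 + ..., and the line A l - 1/2
    -- reproduces both singular terms. The value at 0 is that of σ.
    τ : Sq
    τ zero = ι 0
    τ (suc l) = A * ι (suc l) - half

    S³τᴱ : ∀ {n} → Expr n → Expr n → Expr n
    S³τᴱ a n = a ⊗ (n ⊗ (n ⊕ # 1) ⊗ (n ⊕ # 2) ⊗ (n ⊕ # 3)) ⊖ # 2 ⊗ (n ⊗ (n ⊕ # 1) ⊗ (n ⊕ # 2))

    S³τ : ∀ n → ι 24 * S (S (S τ)) n ≡ ⟦ S³τᴱ v0 v1 ⟧ (A ∷ ι n ∷ [])
    S³τ = s3
      where
      τ2 : ∀ n → ι 2 * τ (suc n) ≡ ι 2 * A * (ι 1 + ι n) - ι 1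
      τ2 n = trans (cong (λ s → ι 2 * (A * s - half)) (ι-suc n))
        (trans (ring (# 2 ⊗ (v0 ⊗ (# 1 ⊕ v1) ⊖ v2)) (# 2 ⊗ v0 ⊗ (# 1 ⊕ v1) ⊖ # 2 ⊗ v2) (A ∷ ι n ∷ half ∷ []) refl) (cong (_-_ _) 2half))
      s1 : ∀ n → ι 2 * S τ n ≡ A * (ι n * (ι n + ι 1)) - ι n
      s1 zero = ring (# 2 ⊗ # 0) (v0 ⊗ (# 0 ⊗ (# 0 ⊕ # 1)) ⊖ # 0) (A ∷ []) refl
      s1 (suc n) = trans (*-distribˡ _ _ _) (trans (cong₂ _+_ (s1 n) (τ2 n))
        (subst (λ s → A * (ι n * (ι n + ι 1)) - ι n + (ι 2 * A * (ι 1 + ι n) - ι 1) ≡ A * (s * (s + ι 1)) - s) (sym (ι-suc n))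
          (ring (v0 ⊗ (v1 ⊗ (v1 ⊕ # 1)) ⊖ v1 ⊕ (# 2 ⊗ v0 ⊗ (# 1 ⊕ v1) ⊖ # 1)) (v0 ⊗ ((# 1 ⊕ v1) ⊗ (# 1 ⊕ v1 ⊕ # 1)) ⊖ (# 1 ⊕ v1)) (A ∷ ι n ∷ []) refl)))
      s2 : ∀ n → ι 12 * S (S τ) n ≡ ι 2 * A * (ι n * (ι n + ι 1) * (ι n + ι 2)) - ι 3 * (ι n * (ι n + ι 1))
      s2 zero = ring (# 12 ⊗ # 0) (# 2 ⊗ v0 ⊗ (# 0 ⊗ (# 0 ⊕ # 1) ⊗ (# 0 ⊕ # 2)) ⊖ # 3 ⊗ (# 0 ⊗ (# 0 ⊕ # 1))) (A ∷ []) refl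
      s2 (suc n) = trans (*-distribˡ _ _ _) (trans (cong₂ _+_ (s2 n) (trans (ring (# 12 ⊗ v0) (# 6 ⊗ (# 2 ⊗ v0)) (S τ (suc n) ∷ []) refl) (cong (ι 6 *_) (s1 (suc n)))))
        (subst (λ s → ι 2 * A * (ι n * (ι n + ι 1) * (ι n + ι 2)) - ι 3 * (ι n * (ι n + ι 1)) + ι 6 * (A * (s * (s + ι 1)) - s)
            ≡ ι 2 * A * (s * (s + ι 1) * (s + ι 2)) - ι 3 * (s * (s + ι 1))) (sym (ι-suc n))
          (ring (# 2 ⊗ v0 ⊗ (v1 ⊗ (v1 ⊕ # 1) ⊗ (v1 ⊕ # 2)) ⊖ # 3 ⊗ (v1 ⊗ (v1 ⊕ # 1)) ⊕ # 6 ⊗ (v0 ⊗ ((# 1 ⊕ v1) ⊗ (# 1 ⊕ v1 ⊕ # 1)) ⊖ (# 1 ⊕ v1)))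
            (# 2 ⊗ v0 ⊗ ((# 1 ⊕ v1) ⊗ (# 1 ⊕ v1 ⊕ # 1) ⊗ (# 1 ⊕ v1 ⊕ # 2)) ⊖ # 3 ⊗ ((# 1 ⊕ v1) ⊗ (# 1 ⊕ v1 ⊕ # 1))) (A ∷ ι n ∷ []) refl)))
      s3 : ∀ n → ι 24 * S (S (S τ)) n ≡ ⟦ S³τᴱ v0 v1 ⟧ (A ∷ ι n ∷ [])
      s3 zero = ring (# 24 ⊗ # 0) (S³τᴱ v0 (# 0)) (A ∷ []) refl
      s3 (suc n) = trans (*-distribˡ _ _ _) (trans (cong₂ _+_ (s3 n) (trans (ring (# 24 ⊗ v0) (# 2 ⊗ (# 12 ⊗ v0)) (S (S τ) (suc n) ∷ []) refl) (cong (ι 2 *_) (s2 (suc n)))))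
        (subst (λ s → ⟦ S³τᴱ v0 v1 ⟧ (A ∷ ι n ∷ []) + ι 2 * (ι 2 * A * (s * (s + ι 1) * (s + ι 2)) - ι 3 * (s * (s + ι 1))) ≡ ⟦ S³τᴱ v0 v1 ⟧ (A ∷ s ∷ [])) (sym (ι-suc n))
          (ring (S³τᴱ v0 v1 ⊕ # 2 ⊗ (# 2 ⊗ v0 ⊗ ((# 1 ⊕ v1) ⊗ (# 1 ⊕ v1 ⊕ # 1) ⊗ (# 1 ⊕ v1 ⊕ # 2)) ⊖ # 3 ⊗ ((# 1 ⊕ v1) ⊗ (# 1 ⊕ v1 ⊕ # 1))))
            (S³τᴱ v0 (# 1 ⊕ v1)) (A ∷ ι n ∷ []) refl)))

    -- The threefold sum of σ - τ. The sum of σ is written as `K L Q`, the form that the hyperbola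
    -- method evaluates.
    R : ℕ → Sq
    R L x = K L Q x - S (S (S τ)) x

    -- 6M³ times the defect of the Euler–Maclaurin expansion A - 1/M + 1/2M² - 1/6M³ of ∑_{m ≤ M} m⁻².
    defect : ℕ → F
    defect M = ι 6 * (μ * μ * μ) * (basel₂ M - A) + ι 6 * (μ * μ) - ι 3 * μ + ι 1
      where μ = ι M

    -- The next Euler-Maclaurin term is 1/(30 M⁵); times 6M³ it is 1/(5M²), the upper bound required
    -- of the defect.
    record BaselBounds (M : ℕ) : Set where
      field
        A-lower : ι 164493406 ≤ ι 100000000 * A
        A-upper : ι 100000000 * A ≤ ι 164493407
        defect-nonneg : ι 0 ≤ defect M
        defect-small : ι 5 * (ι M * ι M) * defect M ≤ ι 1

  oddᴱ : ∀ {n} → Expr n → Expr n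
  oddᴱ x = # 2 ⊗ x ⊕ # 3

  -- The main term with the partial sum eliminated: 6M³ ∑ 1/m² is replaced by 6M³ a - 6M² + 3M - 1
  -- plus the defect `d`.
  main′ᴱ : ∀ {n} → Expr n → Expr n → Expr n → Expr n → Expr n
  main′ᴱ X M a d = (# 5 ⊗ (X ⊗ X ⊗ X ⊗ X) ⊖ # 30 ⊗ (X ⊗ X)) ⊗ (# 6 ⊗ (M ⊗ M ⊗ M) ⊗ a ⊖ # 6 ⊗ (M ⊗ M) ⊕ # 3 ⊗ M ⊖ # 1 ⊕ d)
    ⊕ M ⊗ M ⊗ M ⊗ low-main-sumᴱ X M ⊕ Ψᴱ X M X

  defectᴱ : ∀ {n} → Expr n → Expr n → Expr n → Expr n
  defectᴱ M s a = # 6 ⊗ (M ⊗ M ⊗ M) ⊗ (s ⊖ a) ⊕ # 6 ⊗ (M ⊗ M) ⊖ # 3 ⊗ M ⊕ # 1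

  11520RM³ᴱ : ∀ {n} → Expr n → Expr n → Expr n → Expr n → Expr n → Expr n
  11520RM³ᴱ M x a d D = main′ᴱ (oddᴱ x) M a d ⊕ D ⊖ # 480 ⊗ (M ⊗ M ⊗ M) ⊗ S³τᴱ₀ a x
    where
    S³τᴱ₀ : ∀ {n} → Expr n → Expr n → Expr n
    S³τᴱ₀ a n = a ⊗ (n ⊗ (n ⊕ # 1) ⊗ (n ⊕ # 2) ⊗ (n ⊕ # 3)) ⊖ # 2 ⊗ (n ⊗ (n ⊕ # 1) ⊗ (n ⊕ # 2))

  11520QM³ᴱ : ∀ {n} → Expr n → Expr n → Expr n
  11520QM³ᴱ M x = # 1440 ⊗ (M ⊗ M ⊗ M) ⊗ (oddᴱ x ⊗ oddᴱ x ⊖ # 1)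

  module _ (A : F) where

    -- With M = 40 + y and x = M² + j both halves become polynomial inequalities in nonnegative
    -- slacks, one of which is the distance of `D` from its error bound.
    R-bound-large : ∀ L M x y j → BaselBounds A M → M ≡ 40 ℕ.+ y → x ≡ M ℕ.* M ℕ.+ j → j ℕ.≤ 2 ℕ.* M → x ℕ.≤ L → M ℕ.+ 2 ℕ.≤ L →
      ∣ ι 10 * R A L x ∣≤ Q x
    R-bound-large L M x y j bb refl refl q r s = upper , lower
      where
      open BaselBounds bb
      μ = ι M
      ξ = ι x
      X = odd x
      b = basel₂ M
      T = K L Q x
      S3 = S (S (S (τ A))) x
      η = ι y
      κ = ι j
      δ = defect A M
      D = ι 11520 * (μ * μ * μ) * T - ⟦ mainᴱ v0 v1 v2 ⟧ (X ∷ μ ∷ b ∷ [])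
      err = ⟦ errᴱ v0 v1 ⟧ (X ∷ μ ∷ [])
      Dbound : ∣ D ∣≤ err
      Dbound = T-estimate L (39 ℕ.+ y) x r x≤ s
        where
        x≤ : x ℕ.≤ (M ℕ.+ 2) ℕ.* M
        x≤ = subst (x ℕ.≤_) (sym (ℕₚ.*-distribʳ-+ M M 2)) (ℕₚ.+-monoʳ-≤ (M ℕ.* M) q)
      μ≡ : μ ≡ ι 40 + η
      μ≡ = ι-+ 40 y
      ξ≡ : ξ ≡ μ * μ + κ
      ξ≡ = trans (ι-+ (M ℕ.* M) j) (+-congʳ (ι-* M M))
      R≡ : ι 11520 * (μ * μ * μ) * R A L x ≡ ⟦ 11520RM³ᴱ v0 v1 v2 v3 v4 ⟧ (μ ∷ ξ ∷ A ∷ δ ∷ D ∷ [])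
      R≡ = trans (ring (# 11520 ⊗ v0 ⊗ (v1 ⊖ v2)) (# 11520 ⊗ v0 ⊗ v1 ⊖ # 480 ⊗ v0 ⊗ (# 24 ⊗ v2)) (μ * μ * μ ∷ T ∷ S3 ∷ []) refl)
        (trans (cong (λ z → ι 11520 * (μ * μ * μ) * T - ι 480 * (μ * μ * μ) * z) (S³τ A x))
          (ring (# 11520 ⊗ (v0 ⊗ v0 ⊗ v0) ⊗ v3 ⊖ # 480 ⊗ (v0 ⊗ v0 ⊗ v0) ⊗ (v2 ⊗ (v1 ⊗ (v1 ⊕ # 1) ⊗ (v1 ⊕ # 2) ⊗ (v1 ⊕ # 3)) ⊖ # 2 ⊗ (v1 ⊗ (v1 ⊕ # 1) ⊗ (v1 ⊕ # 2))))
            (11520RM³ᴱ v0 v1 v2 (defectᴱ v0 v4 v2) (# 11520 ⊗ (v0 ⊗ v0 ⊗ v0) ⊗ v3 ⊖ mainᴱ (oddᴱ v1) v0 v4)) (μ ∷ ξ ∷ A ∷ T ∷ b ∷ []) refl))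
      Q≡ : ι 11520 * (μ * μ * μ) * Q x ≡ ⟦ 11520QM³ᴱ v0 v1 ⟧ (μ ∷ ξ ∷ [])
      Q≡ = trans (ring (# 11520 ⊗ v0 ⊗ v1) (# 1440 ⊗ v0 ⊗ (# 8 ⊗ v1)) (μ * μ * μ ∷ Q x ∷ []) refl) (cong (ι 1440 * (μ * μ * μ) *_) (Q-closed x))
      0≤A : ι 0 ≤ A
      0≤A = *-cancel (1≤ιsuc 99999999) (≤-trans (≤-reflexiveˡ (*-0 _) (0≤ι 164493406)) A-lower)
      -- In the scaled remainder `A` survives only in the term 300 M³ (4X² - 9) A, so the coarse
      -- bounds 41/25 and 33/20 are enough.
      A₁ : ι 0 ≤ ι 25 * A - ι 41
      A₁ = *-cancel (1≤ιsuc 3999999) (≤-trans (≤-reflexiveˡ (*-0 _) (≤⇒0≤- (≤-trans (ι-mono (ℕₚ.m≤m+n 164000000 493406)) A-lower)))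
        (≡⇒≤ (ring (# 100000000 ⊗ v0 ⊖ # 164000000) (# 4000000 ⊗ (# 25 ⊗ v0 ⊖ # 41)) (A ∷ []) refl)))
      A₂ : ι 0 ≤ ι 33 - ι 20 * A
      A₂ = *-cancel (1≤ιsuc 4999999) (≤-trans (≤-reflexiveˡ (*-0 _) (≤⇒0≤- (≤-trans A-upper (ι-mono (ℕₚ.m≤m+n 164493407 506593)))))
        (≡⇒≤ (ring (# 165000000 ⊖ # 100000000 ⊗ v0) (# 5000000 ⊗ (# 33 ⊖ # 20 ⊗ v0)) (A ∷ []) refl)))
      Mᴱ xᴱ Xᴱ : Expr 5
      Mᴱ = # 40 ⊕ v0
      xᴱ = Mᴱ ⊗ Mᴱ ⊕ v1
      Xᴱ = oddᴱ xᴱ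
      slack : F → Vec F 5
      slack D′ = η ∷ κ ∷ A ∷ δ ∷ D′ ∷ []
      M³X : F
      M³X = ⟦ (# 12 ⊗ (Mᴱ ⊗ Mᴱ ⊗ Mᴱ) ⊗ (# 4 ⊗ (Xᴱ ⊗ Xᴱ) ⊖ # 9)) ⟧ (slack (ι 0))
      M³X≥0 : ι 0 ≤ M³X
      M³X≥0 = pos (# 0) (# 12 ⊗ (Mᴱ ⊗ Mᴱ ⊗ Mᴱ) ⊗ (# 4 ⊗ (Xᴱ ⊗ Xᴱ) ⊖ # 9)) (slack (ι 0)) (0≤ι y , 0≤ι j , 0≤A , defect-nonneg , 0≤ι 0 , tt) refl
      scale : ι 1 ≤ ι 11520 * (μ * μ * μ)
      scale = subst (λ m → ι 1 ≤ ι 11520 * (m * m * m)) (sym μ≡) (pos (# 1) (# 11520 ⊗ ((# 40 ⊕ v0) ⊗ (# 40 ⊕ v0) ⊗ (# 40 ⊕ v0))) (η ∷ []) (0≤ι y , tt) refl)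
      at : ∀ (e : Expr 5) {z} → ⟦ e ⟧ (ι 40 + η ∷ ((ι 40 + η) * (ι 40 + η) + κ) ∷ A ∷ δ ∷ z ∷ []) ≡ ⟦ e ⟧ (μ ∷ ξ ∷ A ∷ δ ∷ z ∷ [])
      at e {z} = trans (cong (λ m → ⟦ e ⟧ (m ∷ (m * m + κ) ∷ A ∷ δ ∷ z ∷ [])) (sym μ≡)) (cong (λ u → ⟦ e ⟧ (μ ∷ u ∷ A ∷ δ ∷ z ∷ [])) (sym ξ≡))
      low-poly : ι 0 ≤ ⟦ 11520QM³ᴱ v0 v1 ⊕ # 10 ⊗ 11520RM³ᴱ v0 v1 v2 v3 (v4 ⊖ errᴱ (oddᴱ v1) v0) ⟧ (μ ∷ ξ ∷ A ∷ δ ∷ (D + err) ∷ [])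
      low-poly = ≤-reflexiveʳ (≤-trans (*-nonneg M³X≥0 A₁)
          (pos (# 12 ⊗ (Mᴱ ⊗ Mᴱ ⊗ Mᴱ) ⊗ (# 4 ⊗ (Xᴱ ⊗ Xᴱ) ⊖ # 9) ⊗ (# 25 ⊗ v2 ⊖ # 41))
            (11520QM³ᴱ Mᴱ xᴱ ⊕ # 10 ⊗ 11520RM³ᴱ Mᴱ xᴱ v2 v3 (v4 ⊖ errᴱ Xᴱ Mᴱ)) (slack (D + err))
            (0≤ι y , 0≤ι j , 0≤A , defect-nonneg , nn , tt) refl))
        (at (11520QM³ᴱ v0 v1 ⊕ # 10 ⊗ 11520RM³ᴱ v0 v1 v2 v3 (v4 ⊖ errᴱ (oddᴱ v1) v0)) {D + err})
        where
        nn : ι 0 ≤ D + err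
        nn = ≤-reflexiveʳ (≤⇒0≤- (proj₂ Dbound)) (ring (v1 ⊖ (⊝ v0)) (v0 ⊕ v1) (D ∷ err ∷ []) refl)
      lower : - (ι 10 * R A L x) ≤ Q x
      lower = 0≤-⇒≤ (*-cancel scale (≤-reflexiveˡ (*-0 _) (≤-reflexiveʳ low-poly
        (trans (cong (λ z → ⟦ 11520QM³ᴱ v0 v1 ⊕ # 10 ⊗ 11520RM³ᴱ v0 v1 v2 v3 v4 ⟧ (μ ∷ ξ ∷ A ∷ δ ∷ z ∷ [])) (ring (v0 ⊕ v1 ⊖ v1) v0 (D ∷ err ∷ []) refl))
          (trans (cong₂ (λ q r → q + ι 10 * r) (sym Q≡) (sym R≡))
            (ring (v0 ⊗ v1 ⊕ # 10 ⊗ (v0 ⊗ v2)) (v0 ⊗ (v1 ⊖ (⊝ (# 10 ⊗ v2)))) (ι 11520 * (μ * μ * μ) ∷ Q x ∷ R A L x ∷ []) refl))))))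
      k : F
      k = ι (2 ℕ.* M ∸ j)
      k≡ : κ + k ≡ ι 2 * μ
      k≡ = trans (sym (ι-+ j (2 ℕ.* M ∸ j))) (trans (cong ι (ℕₚ.m+[n∸m]≡n q)) (ι-* 2 M))
      Top : Expr 5
      Top = # 2 ⊗ (Mᴱ ⊗ Mᴱ) ⊕ # 4 ⊗ Mᴱ ⊕ # 3
      ρ₀ = slack (ι 0)
      top-gap : ι 0 ≤ ⟦ Top ⊖ Xᴱ ⟧ ρ₀
      top-gap = ≤-reflexiveʳ (*-nonneg (0≤ι 2) (fromℤ-nonneg (2 ℕ.* M ∸ j)))
        (trans (ring (# 2 ⊗ v1) (# 2 ⊗ (v0 ⊕ v1) ⊖ # 2 ⊗ v0) (κ ∷ k ∷ []) refl)
          (trans (cong (λ u → ι 2 * u - ι 2 * κ) (trans k≡ (cong (ι 2 *_) μ≡)))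
            (ring (# 2 ⊗ (# 2 ⊗ (# 40 ⊕ v0)) ⊖ # 2 ⊗ v1) (# 2 ⊗ ((# 40 ⊕ v0) ⊗ (# 40 ⊕ v0)) ⊕ # 4 ⊗ (# 40 ⊕ v0) ⊕ # 3 ⊖ (# 2 ⊗ ((# 40 ⊕ v0) ⊗ (# 40 ⊕ v0) ⊕ v1) ⊕ # 3)) (η ∷ κ ∷ []) refl)))
      top-term : ι 0 ≤ ⟦ # 10 ⊗ (Xᴱ ⊗ Xᴱ ⊗ (Top ⊕ Xᴱ)) ⊗ (Top ⊖ Xᴱ) ⟧ ρ₀
      top-term = *-nonneg (pos (# 0) (# 10 ⊗ (Xᴱ ⊗ Xᴱ ⊗ (Top ⊕ Xᴱ))) ρ₀ (0≤ι y , 0≤ι j , 0≤A , defect-nonneg , 0≤ι 0 , tt) refl) top-gap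
      δ-term : ι 0 ≤ ⟦ # 10 ⊗ (Xᴱ ⊗ Xᴱ ⊗ Xᴱ ⊗ Xᴱ) ⊗ (# 1 ⊖ # 5 ⊗ (Mᴱ ⊗ Mᴱ) ⊗ v3) ⟧ ρ₀
      δ-term = *-nonneg (pos (# 0) (# 10 ⊗ (Xᴱ ⊗ Xᴱ ⊗ Xᴱ ⊗ Xᴱ)) ρ₀ (0≤ι y , 0≤ι j , 0≤A , defect-nonneg , 0≤ι 0 , tt) refl)
        (≤⇒0≤- (subst (λ m → ι 5 * (m * m) * δ ≤ ι 1) μ≡ defect-small))
      A-term : ι 0 ≤ ⟦ # 15 ⊗ (Mᴱ ⊗ Mᴱ ⊗ Mᴱ ⊗ Mᴱ ⊗ Mᴱ) ⊗ (# 4 ⊗ (Xᴱ ⊗ Xᴱ) ⊖ # 9) ⊗ (# 33 ⊖ # 20 ⊗ v2) ⟧ ρ₀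
      A-term = *-nonneg (pos (# 0) (# 15 ⊗ (Mᴱ ⊗ Mᴱ ⊗ Mᴱ ⊗ Mᴱ ⊗ Mᴱ) ⊗ (# 4 ⊗ (Xᴱ ⊗ Xᴱ) ⊖ # 9)) ρ₀ (0≤ι y , 0≤ι j , 0≤A , defect-nonneg , 0≤ι 0 , tt) refl) A₂
      -- The extra factor M² lets the defect be removed through 5M²δ ≤ 1. In `top-term` the
      -- hypothesis j ≤ 2M enters as X ≤ 2M² + 4M + 3.
      up-poly : ι 0 ≤ ⟦ v0 ⊗ v0 ⊗ (11520QM³ᴱ v0 v1 ⊖ # 10 ⊗ 11520RM³ᴱ v0 v1 v2 v3 (errᴱ (oddᴱ v1) v0 ⊖ v4)) ⟧ (μ ∷ ξ ∷ A ∷ δ ∷ (err - D) ∷ [])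
      up-poly = ≤-reflexiveʳ (≤-trans (+-nonneg (+-nonneg A-term top-term) δ-term)
          (pos (# 15 ⊗ (Mᴱ ⊗ Mᴱ ⊗ Mᴱ ⊗ Mᴱ ⊗ Mᴱ) ⊗ (# 4 ⊗ (Xᴱ ⊗ Xᴱ) ⊖ # 9) ⊗ (# 33 ⊖ # 20 ⊗ v2)
              ⊕ # 10 ⊗ (Xᴱ ⊗ Xᴱ ⊗ (Top ⊕ Xᴱ)) ⊗ (Top ⊖ Xᴱ)
              ⊕ # 10 ⊗ (Xᴱ ⊗ Xᴱ ⊗ Xᴱ ⊗ Xᴱ) ⊗ (# 1 ⊖ # 5 ⊗ (Mᴱ ⊗ Mᴱ) ⊗ v3))
            (Mᴱ ⊗ Mᴱ ⊗ (11520QM³ᴱ Mᴱ xᴱ ⊖ # 10 ⊗ 11520RM³ᴱ Mᴱ xᴱ v2 v3 (errᴱ Xᴱ Mᴱ ⊖ v4))) (slack (err - D))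
            (0≤ι y , 0≤ι j , 0≤A , defect-nonneg , ≤⇒0≤- (proj₁ Dbound) , tt) refl))
        (at (v0 ⊗ v0 ⊗ (11520QM³ᴱ v0 v1 ⊖ # 10 ⊗ 11520RM³ᴱ v0 v1 v2 v3 (errᴱ (oddᴱ v1) v0 ⊖ v4))) {err - D})
      scale₂ : ι 1 ≤ μ * μ
      scale₂ = subst (λ m → ι 1 ≤ m * m) (sym μ≡) (pos (# 1) ((# 40 ⊕ v0) ⊗ (# 40 ⊕ v0)) (η ∷ []) (0≤ι y , tt) refl)
      upper : ι 10 * R A L x ≤ Q x
      upper = 0≤-⇒≤ (*-cancel scale (*-cancel scale₂ (≤-reflexiveˡ (trans (cong (μ * μ *_) (*-0 _)) (*-0 _)) (≤-reflexiveʳ up-poly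
        (trans (cong (λ z → ⟦ v0 ⊗ v0 ⊗ (11520QM³ᴱ v0 v1 ⊖ # 10 ⊗ 11520RM³ᴱ v0 v1 v2 v3 v4) ⟧ (μ ∷ ξ ∷ A ∷ δ ∷ z ∷ [])) (ring (v1 ⊖ (v1 ⊖ v0)) v0 (D ∷ err ∷ []) refl))
          (trans (cong₂ (λ q r → μ * μ * (q - ι 10 * r)) (sym Q≡) (sym R≡))
            (ring (v3 ⊗ (v0 ⊗ v1 ⊖ # 10 ⊗ (v0 ⊗ v2))) (v3 ⊗ (v0 ⊗ (v1 ⊖ # 10 ⊗ v2))) (ι 11520 * (μ * μ * μ) ∷ Q x ∷ R A L x ∷ μ * μ ∷ []) refl)))))))

  -- Geometrically decaying sequences

  pow : F → ℕ → F
  pow x zero = ι 1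
  pow x (suc n) = x * pow x n

  pow-nonneg : ∀ {x} n → ι 0 ≤ x → ι 0 ≤ pow x n
  pow-nonneg zero p = 0≤ι 1
  pow-nonneg (suc n) p = *-nonneg p (pow-nonneg n p)

  pow-≤1 : ∀ {x} n → ι 0 ≤ x → x ≤ ι 1 → pow x n ≤ ι 1
  pow-≤1 zero p q = ≤-refl
  pow-≤1 (suc n) p q = ≤-reflexiveʳ (*-mono p (0≤ι 1) q (pow-≤1 n p q)) (1* _)

  pow-mono : ∀ {x y} n → ι 0 ≤ x → x ≤ y → pow x n ≤ pow y n
  pow-mono zero p q = ≤-refl
  pow-mono (suc n) p q = *-mono p (pow-nonneg n (≤-trans p q)) q (pow-mono n p q)

  pow-+ : ∀ x m n → pow x (m ℕ.+ n) ≡ pow x m * pow x n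
  pow-+ x zero n = sym (1* _)
  pow-+ x (suc m) n = trans (cong (x *_) (pow-+ x m n)) (sym (*-assoc _ _ _))

  pow-* : ∀ x m n → pow x (m ℕ.* n) ≡ pow (pow x n) m
  pow-* x zero n = refl
  pow-* x (suc m) n = trans (pow-+ x n (m ℕ.* n)) (cong (pow x n *_) (pow-* x m n))

  pow-mul : ∀ x y n → pow (x * y) n ≡ pow x n * pow y n
  pow-mul x y zero = sym (1* _)
  pow-mul x y (suc n) = trans (cong (x * y *_) (pow-mul x y n)) (ring (v0 ⊗ v1 ⊗ (v2 ⊗ v3)) (v0 ⊗ v2 ⊗ (v1 ⊗ v3)) (x ∷ y ∷ pow x n ∷ pow y n ∷ []) refl)

  -- `t k` majorises the tail ∑ α(k + i) Vⁱ. A supersolution of its one-step recursion replaces the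
  -- infinite series, which cannot be formed here.
  conv-geom : ∀ n (a b α t : Sq) V C → ι 0 ≤ V → ι 0 ≤ C → (∀ k → k ℕ.≤ n → ∣ a k ∣≤ α k) → (∀ k → α k + V * t (suc k) ≤ t k) → (∀ k → ι 0 ≤ t k) →
    (∀ m → m ℕ.≤ n → ∣ b m ∣≤ C * pow V (n ∸ m)) → ∣ conv a b n ∣≤ C * t 0
  conv-geom zero a b α t V C V0 C0 ha ht t0 hb = abs-weaken (abs-* (ha 0 z≤n) (hb 0 z≤n))
    (≤-reflexiveˡ (ring (v0 ⊗ (v1 ⊗ # 1)) (v1 ⊗ v0) (α 0 ∷ C ∷ []) refl)
      (*-monoˡ C0 (≤-trans (≤-reflexiveˡ (sym (+-0 _)) (+-mono ≤-refl (*-nonneg V0 (t0 1)))) (ht 0))))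
  conv-geom (suc n) a b α t V C V0 C0 ha ht t0 hb = abs-weaken
    (abs-+ (abs-* (ha 0 z≤n) (subst (λ k → ∣ b (suc n) ∣≤ C * pow V k) (ℕₚ.n∸n≡0 (suc n)) (hb (suc n) ℕₚ.≤-refl)))
      (conv-geom n (tail a) b (λ k → α (suc k)) (λ k → t (suc k)) V (C * V) V0 (*-nonneg C0 V0) (λ k q → ha (suc k) (s≤s q)) (λ k → ht (suc k)) (λ k → t0 (suc k))
        (λ m p → abs-weaken (hb m (ℕₚ.m≤n⇒m≤1+n p)) (≡⇒≤ (trans (cong (λ k → C * pow V k) (ℕₚ.+-∸-assoc 1 p)) (sym (*-assoc _ _ _)))))))
    (≤-reflexiveˡ (ring (v0 ⊗ (v1 ⊗ # 1) ⊕ v1 ⊗ v2 ⊗ v3) (v1 ⊗ (v0 ⊕ v2 ⊗ v3)) (α 0 ∷ C ∷ V ∷ t 1 ∷ []) refl) (*-monoˡ C0 (ht 0)))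

  module Geometric (V : F) (0≤V : ι 0 ≤ V) (V≤1 : V ≤ ι 1) where

    geo : ℕ → F
    geo zero = ι 0
    geo (suc m) = ι 1 + V * geo m

    geo-closed : ∀ m → geo m * (ι 1 - V) ≡ ι 1 - pow V m
    geo-closed zero = ring (# 0 ⊗ (# 1 ⊖ v0)) (# 1 ⊖ # 1) (V ∷ []) refl
    geo-closed (suc m) = trans (ring ((# 1 ⊕ v0 ⊗ v1) ⊗ (# 1 ⊖ v0)) (# 1 ⊖ v0 ⊕ v0 ⊗ (v1 ⊗ (# 1 ⊖ v0))) (V ∷ geo m ∷ []) refl)
      (trans (cong (λ u → ι 1 - V + V * u) (geo-closed m)) (ring (# 1 ⊖ v0 ⊕ v0 ⊗ (# 1 ⊖ v1)) (# 1 ⊖ v0 ⊗ v1) (V ∷ pow V m ∷ []) refl))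

    -- In the product of the two factors, pair Vⁱ with the power 2m - i for i < m: each pair is at
    -- least twice the m-th power of V.
    gap : ∀ m → ι 0 ≤ geo m * (ι 1 + V * pow V m) - ι 2 * ι m * pow V m
    gap zero = ≡⇒≤ (ring (# 0) (# 0 ⊗ (# 1 ⊕ v0 ⊗ # 1) ⊖ # 2 ⊗ # 0 ⊗ # 1) (V ∷ []) refl)
    gap (suc m) = ≤-reflexiveʳ (+-nonneg (*-nonneg 0≤V (gap m)) (sq-nonneg (ι 1 - V * pow V m)))
      (subst (λ s → V * (geo m * (ι 1 + V * pow V m) - ι 2 * ι m * pow V m) + (ι 1 - V * pow V m) * (ι 1 - V * pow V m)
          ≡ geo (suc m) * (ι 1 + V * pow V (suc m)) - ι 2 * s * pow V (suc m)) (sym (ι-suc m))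
        (trans (ring (v0 ⊗ (v1 ⊗ (# 1 ⊕ v0 ⊗ v2) ⊖ # 2 ⊗ v3 ⊗ v2) ⊕ (# 1 ⊖ v0 ⊗ v2) ⊗ (# 1 ⊖ v0 ⊗ v2))
            ((# 1 ⊕ v0 ⊗ v1) ⊗ (# 1 ⊕ v0 ⊗ (v0 ⊗ v2)) ⊖ # 2 ⊗ (# 1 ⊕ v3) ⊗ (v0 ⊗ v2) ⊕ v0 ⊗ v0 ⊗ v2 ⊗ (v1 ⊗ (# 1 ⊖ v0) ⊖ (# 1 ⊖ v2)))
            (V ∷ geo m ∷ pow V m ∷ ι m ∷ []) refl)
          (trans (cong (λ u → geo (suc m) * (ι 1 + V * pow V (suc m)) - ι 2 * (ι 1 + ι m) * pow V (suc m) + V * V * pow V m * (u - (ι 1 - pow V m))) (geo-closed m))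
            (ring (v0 ⊕ v1 ⊗ (v2 ⊖ v2)) v0 (geo (suc m) * (ι 1 + V * pow V (suc m)) - ι 2 * (ι 1 + ι m) * pow V (suc m) ∷ V * V * pow V m ∷ ι 1 - pow V m ∷ []) refl))))

    -- AM–GM for 1, V, …, V^m.
    geo-amgm : ∀ m → ι (suc m) * ι (suc m) * pow V m ≤ geo (suc m) * geo (suc m)
    geo-amgm m = 0≤-⇒≤ (go m)
      where
      go : ∀ m → ι 0 ≤ geo (suc m) * geo (suc m) - ι (suc m) * ι (suc m) * pow V m
      go zero = ≡⇒≤ (ring (# 0) ((# 1 ⊕ v0 ⊗ # 0) ⊗ (# 1 ⊕ v0 ⊗ # 0) ⊖ # 1 ⊗ # 1 ⊗ # 1) (V ∷ []) refl)
      go (suc m) = ≤-reflexiveʳ (+-nonneg (*-nonneg 0≤V (go m)) (gap (suc m)))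
        (subst (λ s → V * (geo (suc m) * geo (suc m) - ι (suc m) * ι (suc m) * pow V m) + (geo (suc m) * (ι 1 + V * pow V (suc m)) - ι 2 * ι (suc m) * pow V (suc m))
            ≡ geo (suc (suc m)) * geo (suc (suc m)) - s * s * pow V (suc m)) (sym (ι-suc (suc m)))
          (trans (ring (v0 ⊗ (v1 ⊗ v1 ⊖ v3 ⊗ v3 ⊗ v2) ⊕ (v1 ⊗ (# 1 ⊕ v0 ⊗ (v0 ⊗ v2)) ⊖ # 2 ⊗ v3 ⊗ (v0 ⊗ v2)))
              ((# 1 ⊕ v0 ⊗ v1) ⊗ (# 1 ⊕ v0 ⊗ v1) ⊖ (# 1 ⊕ v3) ⊗ (# 1 ⊕ v3) ⊗ (v0 ⊗ v2) ⊕ (v0 ⊗ v1 ⊕ # 1) ⊗ (v1 ⊗ (# 1 ⊖ v0) ⊖ (# 1 ⊖ v0 ⊗ v2)))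
              (V ∷ geo (suc m) ∷ pow V m ∷ ι (suc m) ∷ []) refl)
            (trans (cong (λ u → geo (suc (suc m)) * geo (suc (suc m)) - (ι 1 + ι (suc m)) * (ι 1 + ι (suc m)) * pow V (suc m) + (V * geo (suc m) + ι 1) * (u - (ι 1 - pow V (suc m)))) (geo-closed (suc m)))
              (ring (v0 ⊕ v1 ⊗ (v2 ⊖ v2)) v0 (geo (suc (suc m)) * geo (suc (suc m)) - (ι 1 + ι (suc m)) * (ι 1 + ι (suc m)) * pow V (suc m) ∷ V * geo (suc m) + ι 1 ∷ ι 1 - pow V (suc m) ∷ []) refl))))

    arith : F → Sq
    arith U zero = ι 0
    arith U (suc j) = ι (suc j) * pow U j

    -- The finite sum has the closed form 1 - (J + 1) Uᴶ + J U Uᴶ after multiplication by (1 - U)²,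
    -- and 1 minus this is Uᴶ (J (1 - U) + 1).
    weighted-geo : ∀ U → ι 0 ≤ U → U ≤ ι 1 → ∀ J → (ι 1 - U) * (ι 1 - U) * ∑ J (arith U) ≤ ι 1
    weighted-geo U 0≤U U≤1 J = ≤-reflexiveˡ (closed J) (0≤-⇒≤ (≤-reflexiveʳ
        (*-nonneg (pow-nonneg J 0≤U) (+-nonneg (*-nonneg (0≤ι J) (≤⇒0≤- U≤1)) (0≤ι 1)))
        (ring (v1 ⊗ (v2 ⊗ (# 1 ⊖ v0) ⊕ # 1)) (# 1 ⊖ (# 1 ⊖ (v2 ⊕ # 1) ⊗ v1 ⊕ v2 ⊗ (v0 ⊗ v1))) (U ∷ pow U J ∷ ι J ∷ []) refl)))
      where
      f : Sq
      f = arith U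
      closed : ∀ J → (ι 1 - U) * (ι 1 - U) * ∑ J f ≡ ι 1 - (ι J + ι 1) * pow U J + ι J * (U * pow U J)
      closed zero = ring ((# 1 ⊖ v0) ⊗ (# 1 ⊖ v0) ⊗ # 0) (# 1 ⊖ (# 0 ⊕ # 1) ⊗ # 1 ⊕ # 0 ⊗ (v0 ⊗ # 1)) (U ∷ []) refl
      closed (suc J) = trans (*-distribˡ _ _ _) (trans (+-congʳ (closed J))
        (subst (λ s → ι 1 - (ι J + ι 1) * pow U J + ι J * (U * pow U J) + (ι 1 - U) * (ι 1 - U) * (s * pow U J) ≡ ι 1 - (s + ι 1) * pow U (suc J) + s * (U * pow U (suc J))) (sym (ι-suc J))
          (ring (# 1 ⊖ (v2 ⊕ # 1) ⊗ v1 ⊕ v2 ⊗ (v0 ⊗ v1) ⊕ (# 1 ⊖ v0) ⊗ (# 1 ⊖ v0) ⊗ ((# 1 ⊕ v2) ⊗ v1)) (# 1 ⊖ (# 1 ⊕ v2 ⊕ # 1) ⊗ (v0 ⊗ v1) ⊕ (# 1 ⊕ v2) ⊗ (v0 ⊗ (v0 ⊗ v1))) (U ∷ pow U J ∷ ι J ∷ []) refl)))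

    -- ∑_j j V^(jm - 1) ≤ m⁻² (1 - V)⁻²
    Lambert-bound : ∀ m' J → ι (suc m') * ι (suc m') * ((ι 1 - V) * (ι 1 - V)) * ∑ J (λ j → ι j * pow V (j ℕ.* suc m' ∸ 1)) ≤ ι 1
    Lambert-bound m' J = ≤-trans (≤-reflexiveˡ eq₁ (*-monoʳ s0 (*-monoˡ h0 (geo-amgm m'))))
      (≤-reflexiveˡ eq₂ (weighted-geo U (pow-nonneg (suc m') 0≤V) (pow-≤1 (suc m') 0≤V V≤1) J))
      where
      m = ι (suc m')
      U = pow V (suc m')
      g = geo (suc m')
      h = (ι 1 - V) * (ι 1 - V)
      h0 : ι 0 ≤ h
      h0 = sq-nonneg (ι 1 - V)
      f : Sq
      f = arith U
      s0 : ι 0 ≤ ∑ J f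
      s0 = ∑-nonneg J (λ { zero → 0≤ι 0 ; (suc j) → *-nonneg (0≤ι (suc j)) (pow-nonneg j (pow-nonneg (suc m') 0≤V)) })
      terms : ∑ J (λ j → ι j * pow V (j ℕ.* suc m' ∸ 1)) ≡ pow V m' * ∑ J f
      terms = trans (∑-cong J (λ { (suc j) _ _ → trans (cong (ι (suc j) *_) (trans (pow-+ V m' (j ℕ.* suc m')) (cong (pow V m' *_) (pow-* V j (suc m')))))
        (*-left-swap _ _ _) })) (∑-* J _ f)
      eq₁ : m * m * h * ∑ J (λ j → ι j * pow V (j ℕ.* suc m' ∸ 1)) ≡ h * (m * m * pow V m') * ∑ J f
      eq₁ = trans (cong (m * m * h *_) terms) (ring (v0 ⊗ v0 ⊗ v1 ⊗ (v2 ⊗ v3)) (v1 ⊗ (v0 ⊗ v0 ⊗ v2) ⊗ v3) (m ∷ h ∷ pow V m' ∷ ∑ J f ∷ []) refl)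
      eq₂ : h * (g * g) * ∑ J f ≡ (ι 1 - U) * (ι 1 - U) * ∑ J f
      eq₂ = trans (ring ((v0 ⊗ v0) ⊗ (v1 ⊗ v1) ⊗ v2) ((v1 ⊗ v0) ⊗ (v1 ⊗ v0) ⊗ v2) (ι 1 - V ∷ g ∷ ∑ J f ∷ []) refl)
        (cong (λ u → u * u * ∑ J f) (geo-closed (suc m')))

  -- Recurrences for differences of p

  S-sub : ∀ a b n → S (λ m → a m - b m) n ≡ S a n - S b n
  S-sub a b zero = refl
  S-sub a b (suc n) = trans (+-congʳ (S-sub a b n)) (ring (v0 ⊖ v1 ⊕ (v2 ⊖ v3)) (v0 ⊕ v2 ⊖ (v1 ⊕ v3)) (S a n ∷ S b n ∷ a (suc n) ∷ b (suc n) ∷ []) refl)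

  nP : Sq
  nP m = ι m * P m

  Δ^-cong : ∀ i {a b} n → (∀ m → m ℕ.≤ n → a m ≡ b m) → Δ^ i a n ≡ Δ^ i b n
  Δ^-cong zero n h = h n ℕₚ.≤-refl
  Δ^-cong (suc i) n h = Δ-cong n (λ m p → Δ^-cong i m (λ k q → h k (ℕₚ.≤-trans q p)))

  conv-Δ^ : ∀ i a b n → conv a (Δ^ i b) n ≡ Δ^ i (conv a b) n
  conv-Δ^ zero a b n = refl
  conv-Δ^ (suc i) a b n = trans (conv-Δʳ a (Δ^ i b) n) (Δ-cong n (λ m _ → conv-Δ^ i a b m))

  sh₁-Δ^ : ∀ i b n → Δ^ i (sh 1 b) n ≡ sh 1 (Δ^ i b) n
  sh₁-Δ^ zero b n = refl
  sh₁-Δ^ (suc i) b n = trans (Δ-cong n (λ m _ → sh₁-Δ^ i b m)) (go n)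
    where
    go : ∀ n → Δ (sh 1 (Δ^ i b)) n ≡ sh 1 (Δ (Δ^ i b)) n
    go zero = refl
    go (suc zero) = trans (+-congˡ neg-0) (+-0 _)
    go (suc (suc n)) = refl

  Δ-add : ∀ a b n → Δ (λ m → a m - b m) n ≡ Δ a n - Δ b n
  Δ-add a b zero = refl
  Δ-add a b (suc n) = ring (v0 ⊖ v1 ⊖ (v2 ⊖ v3)) (v0 ⊖ v2 ⊖ (v1 ⊖ v3)) (a (suc n) ∷ b (suc n) ∷ a n ∷ b n ∷ []) refl

  Δ-* : ∀ c b n → Δ (λ m → c * b m) n ≡ c * Δ b n
  Δ-* c b zero = refl
  Δ-* c b (suc n) = ring (v0 ⊗ v1 ⊖ v0 ⊗ v2) (v0 ⊗ (v1 ⊖ v2)) (c ∷ b (suc n) ∷ b n ∷ []) refl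

  index-Δ : ∀ b n → ι n * Δ b n ≡ Δ (λ m → ι m * b m) n - sh 1 b n
  index-Δ b zero = ring (# 0 ⊗ v0) (# 0 ⊗ v0 ⊖ # 0) (b 0 ∷ []) refl
  index-Δ b (suc n) = subst (λ s → s * Δ b (suc n) ≡ s * b (suc n) - ι n * b n - b n) (sym (ι-suc n))
    (ring ((# 1 ⊕ v0) ⊗ (v1 ⊖ v2)) ((# 1 ⊕ v0) ⊗ v1 ⊖ v0 ⊗ v2 ⊖ v2) (ι n ∷ b (suc n) ∷ b n ∷ []) refl)

  -- D((1 - z)^i P) = (1 - z)^i D P - i z (1 - z)^(i-1) P with D = z d/dz.
  index-Δ^ : ∀ i b n → ι n * Δ^ (suc i) b n ≡ Δ^ (suc i) (λ m → ι m * b m) n - ι (suc i) * sh 1 (Δ^ i b) n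
  index-Δ^ zero b n = trans (index-Δ b n) (ring (v0 ⊖ v1) (v0 ⊖ # 1 ⊗ v1) (Δ (λ m → ι m * b m) n ∷ sh 1 b n ∷ []) refl)
  index-Δ^ (suc i) b n = trans (index-Δ (Δ^ (suc i) b) n)
    (trans (+-congʳ (trans (Δ-cong n (λ m _ → index-Δ^ i b m)) (trans (Δ-add (Δ^ (suc i) (λ m → ι m * b m)) _ n)
        (cong (_-_ _) (trans (Δ-* (ι (suc i)) _ n) (cong (ι (suc i) *_) (sh₁-Δ^ 1 (Δ^ i b) n)))))))
      (subst (λ s → Δ^ (suc (suc i)) (λ m → ι m * b m) n - ι (suc i) * sh 1 (Δ^ (suc i) b) n - sh 1 (Δ^ (suc i) b) n
            ≡ Δ^ (suc (suc i)) (λ m → ι m * b m) n - s * sh 1 (Δ^ (suc i) b) n) (sym (ι-suc (suc i)))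
        (ring (v0 ⊖ v1 ⊗ v2 ⊖ v2) (v0 ⊖ (# 1 ⊕ v1) ⊗ v2) (Δ^ (suc (suc i)) (λ m → ι m * b m) n ∷ ι (suc i) ∷ sh 1 (Δ^ (suc i) b) n ∷ []) refl)))

  module _ (L : ℕ) where

    nP-conv : ∀ m → m ℕ.≤ L → nP m ≡ conv (σ L) P m
    nP-conv m p = trans (P-log L m p) (sym (conv-σ L P m))

    -- On generating series z/(1 - z)² cancels (1 - z)² and leaves z. The truncated sum is evaluated
    -- by the antidifference `β`, whose value at 0 is the empty one.
    identity-part : ∀ c n → n ℕ.≤ L → ∑ L (λ j → ι j * sh (j ℕ.* 1) (Δ (Δ c)) n) ≡ sh 1 c n
    identity-part c n p = trans (∑-cong' L (λ j → trans (sh-weight' j) (cong (λ k → sh k b n) (sym (ℕₚ.*-identityˡ j)))))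
      (trans (multiples-eval L 0 b β step n p) (trans (cong (λ k → β n - β k) (Data.Nat.DivMod.n%1≡0 n)) (top n refl)))
      where
      import Data.Nat.DivMod
      b : Sq
      b y = (ι n - ι y) * Δ (Δ c) y
      sh-weight' : ∀ j → ι j * sh (j ℕ.* 1) (Δ (Δ c)) n ≡ sh j b n
      sh-weight' j = trans (cong (λ k → ι j * sh k (Δ (Δ c)) n) (ℕₚ.*-identityʳ j)) (sh-weight j (Δ (Δ c)) n)
      β : Sq
      β zero = ι 0
      β (suc y) = (ι n - ι (suc y)) * Δ c y + c y
      step : ∀ y → β (suc y) ≡ β y + b y
      step zero = ring ((v0 ⊖ # 1) ⊗ v1 ⊕ v1) (# 0 ⊕ (v0 ⊖ # 0) ⊗ v1) (ι n ∷ c 0 ∷ []) refl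
      step (suc y) = trans (cong (λ s → (ι n - s) * Δ c (suc y) + c (suc y)) (ι-suc (suc y)))
        (ring ((v0 ⊖ (# 1 ⊕ v1)) ⊗ (v2 ⊖ v3) ⊕ v2) ((v0 ⊖ v1) ⊗ v4 ⊕ v3 ⊕ (v0 ⊖ v1) ⊗ (v2 ⊖ v3 ⊖ v4)) (ι n ∷ ι (suc y) ∷ c (suc y) ∷ c y ∷ Δ c y ∷ []) refl)
      top : ∀ k → k ≡ n → β k - β 0 ≡ sh 1 c k
      top zero e = trans (+-congˡ neg-0) (+-0 _)
      top (suc k) e = trans (cong (λ z → (z - ι (suc k)) * Δ c k + c k - ι 0) (sym (cong ι e)))
        (ring ((v0 ⊖ v0) ⊗ v1 ⊕ v2 ⊖ # 0) v2 (ι (suc k) ∷ Δ c k ∷ c k ∷ []) refl)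

    higher : Sq → Sq
    higher b n = ∑ L (λ j → ι j * ∑ (L ∸ 1) (λ m → sh (j ℕ.* suc m) b n))

    -- The last term is the price of exchanging multiplication by the index with the differences, as
    -- given by `index-Δ^`.
    Δ^-recurrence : ∀ i N → suc N ℕ.≤ L → ι (suc N) * Δ^ (suc (suc i)) P (suc N)
      ≡ Δ^ i P N + higher (Δ^ (suc (suc i)) P) (suc N) - ι (suc (suc i)) * Δ^ (suc i) P N
    Δ^-recurrence i N p = trans (index-Δ^ (suc i) P (suc N)) (+-congʳ
      (trans (Δ^-cong (suc (suc i)) (suc N) (λ m q → nP-conv m (ℕₚ.≤-trans q p)))
      (trans (sym (conv-Δ^ (suc (suc i)) (σ L) P (suc N))) (trans (conv-σ L b (suc N))
        (trans (∑-cong' L (λ j → trans (cong (ι j *_) (trans (cong (λ k → ∑ k (λ m → sh (j ℕ.* m) b (suc N))) (sym L≡)) (∑-head (L ∸ 1) (λ m → sh (j ℕ.* m) b (suc N))))) (*-distribˡ (ι j) _ _)))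
          (trans (∑-+ L _ _) (+-congʳ (identity-part (Δ^ i P) (suc N) p))))))))
      where
      b = Δ^ (suc (suc i)) P
      L≡ : suc (L ∸ 1) ≡ L
      L≡ = ℕₚ.m+[n∸m]≡n (ℕₚ.≤-trans (s≤s z≤n) p)

    -- By `Lambert-bound` the multiples belonging to m contribute at most H/m², where H = (1 - V)⁻²,
    -- and summing over m ≥ 2 gives A - 1. All shifts are positive, so `b` is needed only up to N.
    higher-bound : ∀ A b N V C H → basel₂ L ≤ A → suc N ℕ.≤ L → ι 0 ≤ V → V ≤ ι 1 → ι 0 ≤ C → ι 0 ≤ H → H * ((ι 1 - V) * (ι 1 - V)) ≡ ι 1 →
      (∀ m → m ℕ.≤ N → ∣ b m ∣≤ C * pow V (N ∸ m)) → ∣ higher b (suc N) ∣≤ C * (H * (A - ι 1))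
    higher-bound A b N V C H bA p V0 V1 C0 H0 HV hb = abs-weaken
      (abs-∑ L {g = λ j → ι j * ∑ (L ∸ 1) (λ m → C * pow V (j ℕ.* suc m ∸ 1))} (λ { (suc j) _ _ → abs-*ˡ (0≤ι (suc j)) (abs-∑ (L ∸ 1) (λ m _ _ → term (m ℕ.+ j ℕ.* suc m))) }))
      (≤-reflexiveˡ reorder (*-monoˡ C0 (≤-trans (∑-mono (L ∸ 1) (λ m _ _ → inner m)) (≤-reflexiveˡ (∑-* (L ∸ 1) H _) (*-monoˡ H0 tailSum)))))
      where
      open Geometric V V0 V1
      term : ∀ k → ∣ sh (suc k) b (suc N) ∣≤ C * pow V k
      term k with k ℕ.≤? N
      ... | no q = abs-subst (sym (sh-big (suc k) b (suc N) (s≤s (ℕₚ.≰⇒> q)))) (abs-weaken abs-0 (*-nonneg C0 (pow-nonneg k V0)))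
      ... | yes q = abs-subst (sym (trans (cong (sh k b) (sym (ℕₚ.m+[n∸m]≡n q))) (sh-at k b (N ∸ k))))
        (subst (λ d → ∣ b (N ∸ k) ∣≤ C * pow V d) (ℕₚ.m∸[m∸n]≡n q) (hb (N ∸ k) (ℕₚ.m∸n≤m N k)))
      w : ℕ → F
      w m = ∑ L (λ j → ι j * pow V (j ℕ.* suc m ∸ 1))
      reorder : ∑ L (λ j → ι j * ∑ (L ∸ 1) (λ m → C * pow V (j ℕ.* suc m ∸ 1))) ≡ C * ∑ (L ∸ 1) w
      reorder = trans (∑-cong' L (λ j → trans (cong (ι j *_) (∑-* (L ∸ 1) C _)) (trans (*-left-swap _ _ _) (cong (C *_) (sym (∑-* (L ∸ 1) (ι j) _))))))
        (trans (∑-* L C _) (cong (C *_) (∑-swap L (L ∸ 1) _)))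
      inner : ∀ m → w m ≤ H * rsq (suc m)
      inner m = ≤-reflexiveˡ (sym eq) (≤-reflexiveʳ (*-monoˡ c0 (Lambert-bound m L)) (*-1 _))
        where
        μ = ι (suc m)
        I = inv μ
        μI : μ * I ≡ ι 1
        μI = inv-inverse μ (1≤ιsuc m)
        c0 : ι 0 ≤ H * rsq (suc m)
        c0 = *-nonneg H0 (*-nonneg (inv-nonneg μ (1≤ιsuc m)) (inv-nonneg μ (1≤ιsuc m)))
        eq : H * rsq (suc m) * (μ * μ * ((ι 1 - V) * (ι 1 - V)) * w m) ≡ w m
        eq = trans (ring (v0 ⊗ (v1 ⊗ v1) ⊗ (v2 ⊗ v2 ⊗ v3 ⊗ v4)) (v0 ⊗ v3 ⊗ ((v2 ⊗ v1) ⊗ (v2 ⊗ v1)) ⊗ v4) (H ∷ I ∷ μ ∷ (ι 1 - V) * (ι 1 - V) ∷ w m ∷ []) refl)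
          (trans (cong₂ (λ h u → h * (u * u) * w m) HV μI) (ring (# 1 ⊗ (# 1 ⊗ # 1) ⊗ v0) v0 (w m ∷ []) refl))
      tailSum : ∑ (L ∸ 1) (λ m → rsq (suc m)) ≤ A - ι 1
      tailSum = ≤-reflexiveˡ (trans (ring v0 (# 1 ⊗ # 1 ⊕ v0 ⊖ # 1) (∑ (L ∸ 1) (λ m → rsq (suc m)) ∷ []) refl)
          (+-congʳ (trans (+-congʳ (cong (λ u → u * u) (sym inv1))) (trans (sym (∑-head (L ∸ 1) rsq)) (cong (λ k → ∑ k rsq) (ℕₚ.m+[n∸m]≡n (ℕₚ.≤-trans (s≤s z≤n) p)))))))
        (+-mono bA ≤-refl)
        where
        inv1 : inv (ι 1) ≡ ι 1
        inv1 = trans (sym (1* _)) (inv-inverse (ι 1) ≤-refl)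

    module _ (A : F) where

      private
        hf = half A

      excess : Sq
      excess m = σ L m - τ A m

      S³e : ∀ m → S (S (S excess)) m ≡ R A L m
      S³e m = trans (S-cong m (λ k _ → trans (S-cong k (λ l _ → S-sub (σ L) (τ A) l)) (S-sub (S (σ L)) (S (τ A)) k)))
        (trans (S-sub (S (S (σ L))) (S (S (τ A))) m) (+-congʳ
          (trans (S-cong m (λ k _ → trans (S-cong k (λ l _ → S-K L δ₀ l)) (S-K L (S δ₀) k))) (S-K L (S (S δ₀)) m))))

      R-0 : R A L 0 ≡ ι 0
      R-0 = trans (+-congʳ (trans (∑-cong L (λ { (suc j) _ _ → trans (cong (ι (suc j) *_) (trans (∑-cong L (λ { (suc m) _ _ → refl })) (∑-0 L))) (*-0 _) })) (∑-0 L)))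
        (trans (+-congˡ neg-0) (+-0 _))

      ε : ℕ → F
      ε N = conv (tail (R A L)) (Δ^ 5 P) N

      -- Two differences annihilate a line, so only its corner at the origin survives.
      ΔΔτ : ∀ m → Δ (Δ (τ A)) m ≡ (A - hf) * sh 1 δ₀ m + hf * sh 2 δ₀ m
      ΔΔτ zero = ring (# 0) ((v0 ⊖ v1) ⊗ # 0 ⊕ v1 ⊗ # 0) (A ∷ hf ∷ []) refl
      ΔΔτ (suc zero) = ring (v0 ⊗ # 1 ⊖ v1 ⊖ # 0 ⊖ # 0) ((v0 ⊖ v1) ⊗ # 1 ⊕ v1 ⊗ # 0) (A ∷ hf ∷ []) refl
      ΔΔτ (suc (suc zero)) = ring (v0 ⊗ # 2 ⊖ v1 ⊖ (v0 ⊗ # 1 ⊖ v1) ⊖ (v0 ⊗ # 1 ⊖ v1 ⊖ # 0)) ((v0 ⊖ v1) ⊗ # 0 ⊕ v1 ⊗ # 1) (A ∷ hf ∷ []) refl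
      ΔΔτ (suc (suc (suc m))) = trans (cong₂ (λ s t → A * s - hf - (A * t - hf) - (A * t - hf - (A * ι (suc m) - hf))) (trans (ι-suc (suc (suc m))) (+-congˡ (ι-suc (suc m)))) (ι-suc (suc m)))
        (ring (v0 ⊗ (# 1 ⊕ (# 1 ⊕ v2)) ⊖ v1 ⊖ (v0 ⊗ (# 1 ⊕ v2) ⊖ v1) ⊖ (v0 ⊗ (# 1 ⊕ v2) ⊖ v1 ⊖ (v0 ⊗ v2 ⊖ v1))) ((v0 ⊖ v1) ⊗ # 0 ⊕ v1 ⊗ # 0) (A ∷ hf ∷ ι (suc m) ∷ []) refl)

      -- Apply Δ² to n p(n) = (σ * p)(n). The line τ leaves two values of p; the excess σ - τ is
      -- summed three times while p is differenced three more times, which is why Δ⁵ enters.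
      main-recurrence : ∀ N₀ → let N = suc N₀ in suc N ℕ.≤ L →
        ι 2 * ι (suc N) * Δ P (suc N) ≡ (ι 2 * ι N - ι 3) * Δ P N + ι 2 * A * P N + ι 2 * ε N
      main-recurrence N₀ p = trans lhs (trans (cong (λ u → ι 2 * u + ι (suc N) * ι 2 * Δ P N - ι 4 * Δ P N) rhs)
          (trans (cong (λ s → ι 2 * ((A - hf) * P N + hf * P N₀ + ε N) + s * ι 2 * Δ P N - ι 4 * Δ P N) (ι-suc N))
            (trans (ring (# 2 ⊗ ((v0 ⊖ v1) ⊗ v2 ⊕ v1 ⊗ v3 ⊕ v4) ⊕ (# 1 ⊕ v5) ⊗ # 2 ⊗ (v2 ⊖ v3) ⊖ # 4 ⊗ (v2 ⊖ v3))
                (# 2 ⊗ v0 ⊗ v2 ⊖ (# 2 ⊗ v1) ⊗ (v2 ⊖ v3) ⊕ # 2 ⊗ v4 ⊕ (# 2 ⊗ v5 ⊖ # 2) ⊗ (v2 ⊖ v3)) (A ∷ hf ∷ P N ∷ P N₀ ∷ ε N ∷ ι N ∷ []) refl)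
              (trans (cong (λ u → ι 2 * A * P N - u * (P N - P N₀) + ι 2 * ε N + (ι 2 * ι N - ι 2) * (P N - P N₀)) (2half A))
                (ring (# 2 ⊗ v0 ⊗ v1 ⊖ # 1 ⊗ v2 ⊕ # 2 ⊗ v3 ⊕ (# 2 ⊗ v4 ⊖ # 2) ⊗ v2) ((# 2 ⊗ v4 ⊖ # 3) ⊗ v2 ⊕ # 2 ⊗ v0 ⊗ v1 ⊕ # 2 ⊗ v3) (A ∷ P N ∷ Δ P N ∷ ε N ∷ ι N ∷ []) refl)))))
        where
        N = suc N₀
        n = suc N
        lhs : ι 2 * ι (suc N) * Δ P (suc N) ≡ ι 2 * Δ^ 2 nP n + ι (suc N) * ι 2 * Δ P N - ι 4 * Δ P N
        lhs = subst₂ (λ s t → ι 2 * s * (P n - P N) ≡ ι 2 * (s * P n - t * P N - (t * P N - ι N₀ * P N₀)) + s * ι 2 * (P N - P N₀) - ι 4 * (P N - P N₀))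
          (sym (trans (ι-suc N) (+-congˡ (ι-suc N₀)))) (sym (ι-suc N₀))
          (ring (# 2 ⊗ (# 1 ⊕ (# 1 ⊕ v0)) ⊗ (v1 ⊖ v2)) (# 2 ⊗ ((# 1 ⊕ (# 1 ⊕ v0)) ⊗ v1 ⊖ (# 1 ⊕ v0) ⊗ v2 ⊖ ((# 1 ⊕ v0) ⊗ v2 ⊖ v0 ⊗ v3)) ⊕ (# 1 ⊕ (# 1 ⊕ v0)) ⊗ # 2 ⊗ (v2 ⊖ v3) ⊖ # 4 ⊗ (v2 ⊖ v3))
            (ι N₀ ∷ P n ∷ P N ∷ P N₀ ∷ []) refl)
        τ-part : conv (τ A) (Δ^ 2 P) n ≡ (A - hf) * P N + hf * P N₀
        τ-part = trans (sym (conv-Δ-swap (τ A) (Δ P) n)) (trans (sym (conv-Δ-swap (Δ (τ A)) P n))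
          (trans (conv-congˡ P n (λ m _ → ΔΔτ m)) (trans (conv-+ˡ (λ m → (A - hf) * sh 1 δ₀ m) (λ m → hf * sh 2 δ₀ m) P n) (cong₂ _+_
            (trans (conv-*ˡ (A - hf) (sh 1 δ₀) P n) (cong ((A - hf) *_) (conv-sh 1 P n))) (trans (conv-*ˡ hf (sh 2 δ₀) P n) (cong (hf *_) (conv-sh 2 P n)))))))
        e-part : conv excess (Δ^ 2 P) n ≡ ε N
        e-part = trans (sym (conv-S-Δ excess (Δ^ 2 P) n)) (trans (sym (conv-S-Δ (S excess) (Δ^ 3 P) n)) (trans (sym (conv-S-Δ (S (S excess)) (Δ^ 4 P) n))
          (trans (conv-congˡ (Δ^ 5 P) n (λ m _ → S³e m)) (trans (+-congʳ (trans (cong (_* Δ^ 5 P n) R-0) (0* _))) (0+ _)))))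
        rhs : Δ^ 2 nP n ≡ (A - hf) * P N + hf * P N₀ + ε N
        rhs = trans (Δ^-cong 2 n (λ m q → nP-conv m (ℕₚ.≤-trans q p))) (trans (sym (conv-Δ^ 2 (σ L) P n))
          (trans (conv-congˡ (Δ^ 2 P) n (λ m _ → ring v0 (v1 ⊕ (v0 ⊖ v1)) (σ L m ∷ τ A m ∷ []) refl))
            (trans (conv-+ˡ (τ A) excess (Δ^ 2 P) n) (cong₂ _+_ τ-part e-part))))

  -- One step of the induction

  Pc-pos : ∀ k n → 1 ℕ.≤ Pc n (suc k)
  Pc-pos zero zero = ℕₚ.≤-refl
  Pc-pos zero (suc n) = subst (1 ℕ.≤_) (sym (Pc-step n 0)) (ℕₚ.≤-trans (Pc-pos zero n) (ℕₚ.m≤n+m _ _))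
  Pc-pos (suc k) n with suc (suc k) ℕ.≤? n
  ... | no q = subst (1 ℕ.≤_) (sym (Pc-small n (suc k) (ℕₚ.≰⇒> q))) (Pc-pos k n)
  ... | yes q = subst (λ n → 1 ℕ.≤ Pc n (suc (suc k))) (ℕₚ.m+[n∸m]≡n q)
    (subst (1 ℕ.≤_) (sym (Pc-step (n ∸ suc (suc k)) (suc k))) (ℕₚ.≤-trans (Pc-pos k (suc (suc k) ℕ.+ (n ∸ suc (suc k)))) (ℕₚ.m≤m+n (Pc (suc (suc k) ℕ.+ (n ∸ suc (suc k))) (suc k)) _)))

  p-pos : ∀ n → 1 ℕ.≤ p n
  p-pos zero = ℕₚ.≤-refl
  p-pos (suc n) = Pc-pos n (suc n)

  1≤P : ∀ n → ι 1 ≤ P n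
  1≤P n = ι-mono (p-pos n)

  -- 191/200 and the table b are numerically chosen: every inequality of the module Numeric
  -- must hold with them, and they leave some slack.
  ν κ : F
  ν = ι 191 * inv (ι 200)
  κ = ι 200 * inv (ι 191)

  200ν : ι 200 * ν ≡ ι 191
  200ν = trans (*-left-swap _ _ _) (trans (cong (ι 191 *_) (inv-inverse _ (1≤ιsuc 199))) (*-1 _))

  191κ : ι 191 * κ ≡ ι 200
  191κ = trans (*-left-swap _ _ _) (trans (cong (ι 200 *_) (inv-inverse _ (1≤ιsuc 190))) (*-1 _))

  0≤ν : ι 0 ≤ ν
  0≤ν = *-nonneg (0≤ι 191) (inv-nonneg _ (1≤ιsuc 199))

  0≤κ : ι 0 ≤ κ
  0≤κ = *-nonneg (0≤ι 200) (inv-nonneg _ (1≤ιsuc 190))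

  ν≤1 : ν ≤ ι 1
  ν≤1 = *-cancel (1≤ιsuc 199) (≤-reflexiveˡ 200ν (≤-reflexiveʳ (ι-mono (ℕₚ.m≤m+n 191 9)) (sym (*-1 _))))

  νκ : ν * κ ≡ ι 1
  νκ = *-cancel-≡ (1≤ιsuc 199) (trans (sym (*-assoc _ _ _)) (trans (cong (_* κ) 200ν) (trans 191κ (sym (*-1 _)))))

  b : ℕ → ℕ
  b 0 = 100
  b 1 = 100
  b 2 = 124
  b 3 = 129
  b 4 = 162
  b 5 = 176
  b _ = 0

  B : ℕ → F
  B i = ι (b i) * inv (ι 100)

  100B : ∀ i → ι 100 * B i ≡ ι (b i)
  100B i = trans (*-left-swap _ _ _) (trans (cong (ι (b i) *_) (inv-inverse _ (1≤ιsuc 99))) (*-1 _))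

  0≤B : ∀ i → ι 0 ≤ B i
  0≤B i = *-nonneg (0≤ι (b i)) (inv-nonneg _ (1≤ιsuc 99))

  -- The induction knows A only through these facts, so A may depend on L.
  record Setting (L : ℕ) (A : F) : Set where
    field
      A-lower : ι 164493406 ≤ ι 100000000 * A
      A-upper : ι 100000000 * A ≤ ι 164493407
      basel≤A : basel₂ L ≤ A
      R-small : ∀ x → x ℕ.≤ L → ∣ ι 10 * R A L x ∣≤ Q x

  -- s is P N / Δ P N, the reciprocal logarithmic derivative; up to the bounded term `shift`,
  -- N is a quadratic polynomial in s.
  record State (A : F) (N : ℕ) : Set where
    field
      s w : F
      w*s : w * s ≡ ι 1
      ΔP : Δ P N ≡ w * P N
      40≤s : ι 40 ≤ s
      0≤w : ι 0 ≤ w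
    shift : F
    shift = ι N - (A * (s * s) - (ι 2 + A) * s)
    V : F
    V = ι 1 - ν * w
    field
      shift-lower : ι 120 ≤ ι 100 * shift
      shift-upper : ι 100 * shift ≤ ι 169
      smooth : ∀ i m → i ℕ.≤ 5 → m ℕ.≤ N → ∣ Δ^ i P m ∣≤ B i * (pow w i * pow V (N ∸ m) * P N)

  -- With P(N) = s ΔP(N) and θ = ε s²/P(N), the main recurrence reads 2 s² (N + 1) ΔP(N + 1) = D
  -- P(N). Hence s′ - 1 = 2 s² (N + 1)/D, and subtracting s - 1 leaves s′ - s = n/D.
  Dᴱ nᴱ : ∀ {k} → Expr k → Expr k → Expr k → Expr k → Expr k
  Dᴱ s g θ A = # 2 ⊗ A ⊗ (s ⊗ s ⊗ s) ⊖ # 4 ⊗ (s ⊗ s) ⊕ (# 2 ⊗ g ⊖ # 3) ⊗ s ⊕ # 2 ⊗ θ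
  nᴱ s g θ A = s ⊗ s ⊕ (# 2 ⊗ g ⊖ # 3 ⊖ # 2 ⊗ θ) ⊗ s ⊕ # 2 ⊗ θ

  -- The same with g and θ scaled by 100 and A scaled by 10⁸.
  D̂ n̂ : ∀ {k} → Expr k → Expr k → Expr k → Expr k → Expr k
  D̂ s g θ A = # 2 ⊗ A ⊗ (s ⊗ s ⊗ s) ⊖ # 400000000 ⊗ (s ⊗ s) ⊕ (# 2000000 ⊗ g ⊖ # 300000000) ⊗ s ⊕ # 2000000 ⊗ θ
  n̂ s g θ A = # 100 ⊗ (s ⊗ s) ⊕ (# 2 ⊗ g ⊖ # 300 ⊖ # 2 ⊗ θ) ⊗ s ⊕ # 2 ⊗ θ

  -- All inequalities are proved in the slacks y, g₋, g₊, θ₋, θ₊, A₋, A₊. For each variable the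
  -- slack is taken at the end of its interval where the inequality is tightest.
  module Numeric (s g θ A : F) (s≥ : ι 40 ≤ s) (g≥ : ι 120 ≤ ι 100 * g) (g≤ : ι 100 * g ≤ ι 169) (θ-bound : ∣ ι 100 * θ ∣≤ ι 21)
    (A≥ : ι 164493406 ≤ ι 100000000 * A) (A≤ : ι 100000000 * A ≤ ι 164493407) where

    D n y g₋ g₊ θ₋ θ₊ A₋ A₊ : F
    D = ⟦ Dᴱ v0 v1 v2 v3 ⟧ (s ∷ g ∷ θ ∷ A ∷ [])
    n = ⟦ nᴱ v0 v1 v2 v3 ⟧ (s ∷ g ∷ θ ∷ A ∷ [])
    y = s - ι 40
    g₋ = ι 100 * g - ι 120
    g₊ = ι 169 - ι 100 * g
    θ₋ = ι 100 * θ + ι 21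
    θ₊ = ι 21 - ι 100 * θ
    A₋ = ι 100000000 * A - ι 164493406
    A₊ = ι 164493407 - ι 100000000 * A

    y0 : ι 0 ≤ y
    y0 = ≤⇒0≤- s≥
    g₋0 : ι 0 ≤ g₋
    g₋0 = ≤⇒0≤- g≥
    g₊0 : ι 0 ≤ g₊
    g₊0 = ≤⇒0≤- g≤
    θ₋0 : ι 0 ≤ θ₋
    θ₋0 = ≤-reflexiveʳ (≤⇒0≤- (proj₂ θ-bound)) (ring (# 21 ⊖ (⊝ v0)) (v0 ⊕ # 21) (ι 100 * θ ∷ []) refl)
    θ₊0 : ι 0 ≤ θ₊
    θ₊0 = ≤⇒0≤- (proj₁ θ-bound)
    A₋0 : ι 0 ≤ A₋
    A₋0 = ≤⇒0≤- A≥
    A₊0 : ι 0 ≤ A₊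
    A₊0 = ≤⇒0≤- A≤

    private
      ρ : Vec F 4
      ρ = s ∷ g ∷ θ ∷ A ∷ []
      yᴱ g₋ᴱ g₊ᴱ θ₋ᴱ θ₊ᴱ A₋ᴱ : Expr 4
      yᴱ = v0 ⊖ # 40
      g₋ᴱ = # 100 ⊗ v1 ⊖ # 120
      g₊ᴱ = # 169 ⊖ # 100 ⊗ v1
      θ₋ᴱ = # 100 ⊗ v2 ⊕ # 21
      θ₊ᴱ = # 21 ⊖ # 100 ⊗ v2
      A₋ᴱ = # 100000000 ⊗ v3 ⊖ # 164493406
      big : ∀ k {x} → ι 0 ≤ ι (suc k) * x → ι 0 ≤ x
      big k h = *-cancel (1≤ιsuc k) (≤-reflexiveˡ (*-0 _) h)

    n≥1 : ι 1 ≤ n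
    n≥1 = 0≤-⇒≤ (big 99 (≤-reflexiveʳ
      (pos (# 0) (n̂ (# 40 ⊕ v0) (# 120 ⊕ v1) (# 21 ⊖ v2) (# 0) ⊖ # 100) (y ∷ g₋ ∷ θ₊ ∷ []) (y0 , g₋0 , θ₊0 , tt) refl)
      (ring (n̂ (# 40 ⊕ yᴱ) (# 120 ⊕ g₋ᴱ) (# 21 ⊖ θ₊ᴱ) (# 0) ⊖ # 100) (# 100 ⊗ (nᴱ v0 v1 v2 v3 ⊖ # 1)) ρ refl)))

    n≥0 : ι 0 ≤ n
    n≥0 = ≤-trans (0≤ι 1) n≥1

    D≥1 : ι 1 ≤ D
    D≥1 = 0≤-⇒≤ (big 99999999 (≤-reflexiveʳ
      (pos (# 0) (D̂ (# 40 ⊕ v0) (# 120 ⊕ v1) (v2 ⊖ # 21) (# 164493406 ⊕ v3) ⊖ # 100000000) (y ∷ g₋ ∷ θ₋ ∷ A₋ ∷ []) (y0 , g₋0 , θ₋0 , A₋0 , tt) refl)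
      (ring (D̂ (# 40 ⊕ yᴱ) (# 120 ⊕ g₋ᴱ) (θ₋ᴱ ⊖ # 21) (# 164493406 ⊕ A₋ᴱ) ⊖ # 100000000) (# 100000000 ⊗ (Dᴱ v0 v1 v2 v3 ⊖ # 1)) ρ refl)))

    -- s n/D tends to 1/(2A), about 0.304; the bound 7/20 leaves room for the lower terms at s = 40.
    increment : ι 20 * s * n ≤ ι 7 * D
    increment = 0≤-⇒≤ (big 99999999 (≤-reflexiveʳ
      (pos (# 0) (e (# 40 ⊕ v0) (# 169 ⊖ v1) (v2 ⊖ # 21) (# 164493406 ⊕ v3)) (y ∷ g₊ ∷ θ₋ ∷ A₋ ∷ []) (y0 , g₊0 , θ₋0 , A₋0 , tt) refl)
      (ring (e (# 40 ⊕ yᴱ) (# 169 ⊖ g₊ᴱ) (θ₋ᴱ ⊖ # 21) (# 164493406 ⊕ A₋ᴱ)) (# 100000000 ⊗ (# 7 ⊗ Dᴱ v0 v1 v2 v3 ⊖ # 20 ⊗ v0 ⊗ nᴱ v0 v1 v2 v3)) ρ refl)))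
      where
      e : ∀ {k} → Expr k → Expr k → Expr k → Expr k → Expr k
      e s g θ A = # 7 ⊗ D̂ s g θ A ⊖ # 20000000 ⊗ s ⊗ n̂ s g θ A

    -- This says 100 g′ ≤ 169 after multiplication by D, with the favourable term A δ² of g′
    -- dropped. It holds because g = 1.69 lies above the equilibrium 7/4 - 1/(2A) + θ, at most 1.66.
    shift-up : ι 0 ≤ D * (g₊ - ι 100) + ι 100 * ((ι 2 * A * s - ι 2 - A) * n)
    shift-up = big 99999999 (≤-reflexiveʳ (≤-trans (+-nonneg (+-nonneg t₁ t₂) t₃)
        (pos (# 200 ⊗ (# 1 ⊖ v3) ⊗ ((# 40 ⊕ v0) ⊗ (# 40 ⊕ v0)) ⊕ # 2000000 ⊗ (v1 ⊗ (# 49 ⊖ v1)) ⊗ (# 40 ⊕ v0) ⊕ # 2000000 ⊗ (v1 ⊗ (# 42 ⊖ v2)))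
          (e (# 40 ⊕ v0) (# 169 ⊖ v1) (# 21 ⊖ v2) (# 164493406 ⊕ v3) v1) (y ∷ g₊ ∷ θ₊ ∷ A₋ ∷ []) (y0 , g₊0 , θ₊0 , A₋0 , tt) refl))
      (ring (e (# 40 ⊕ yᴱ) (# 169 ⊖ g₊ᴱ) (# 21 ⊖ θ₊ᴱ) (# 164493406 ⊕ A₋ᴱ) g₊ᴱ)
        (# 100000000 ⊗ (Dᴱ v0 v1 v2 v3 ⊗ (g₊ᴱ ⊖ # 100) ⊕ # 100 ⊗ ((# 2 ⊗ v3 ⊗ v0 ⊖ # 2 ⊖ v3) ⊗ nᴱ v0 v1 v2 v3))) ρ refl))
      where
      e : ∀ {k} → Expr k → Expr k → Expr k → Expr k → Expr k → Expr k
      e s g θ A a = D̂ s g θ A ⊗ (a ⊖ # 100) ⊕ (# 2 ⊗ A ⊗ s ⊖ # 200000000 ⊖ A) ⊗ n̂ s g θ A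
      40+y : ι 0 ≤ ι 40 + y
      40+y = +-nonneg (0≤ι 40) y0
      -- The multipliers pair complementary slacks: 1 - A₋ is A₊, 49 - g₊ is g₋ and 42 - θ₊ is θ₋.
      -- They absorb the monomials with negative coefficients.
      t₁ : ι 0 ≤ ι 200 * (ι 1 - A₋) * ((ι 40 + y) * (ι 40 + y))
      t₁ = *-nonneg (*-nonneg (0≤ι 200) (≤-reflexiveʳ A₊0 (ring (# 164493407 ⊖ v0) (# 1 ⊖ (v0 ⊖ # 164493406)) (ι 100000000 * A ∷ []) refl))) (*-nonneg 40+y 40+y)
      t₂ : ι 0 ≤ ι 2000000 * (g₊ * (ι 49 - g₊)) * (ι 40 + y)
      t₂ = *-nonneg (*-nonneg (0≤ι 2000000) (*-nonneg g₊0 (≤-reflexiveʳ g₋0 (ring (v0 ⊖ # 120) (# 49 ⊖ (# 169 ⊖ v0)) (ι 100 * g ∷ []) refl)))) 40+y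
      t₃ : ι 0 ≤ ι 2000000 * (g₊ * (ι 42 - θ₊))
      t₃ = *-nonneg (0≤ι 2000000) (*-nonneg g₊0 (≤-reflexiveʳ θ₋0 (ring (v0 ⊕ # 21) (# 42 ⊖ (# 21 ⊖ v0)) (ι 100 * θ ∷ []) refl)))

    -- The lower end 1.2 against an equilibrium of at least 1.23. Here A δ² is harmful; it is
    -- charged through δ ≤ 7/(20 s), whence the factor 20 s and the last term.
    shift-low : ι 0 ≤ ι 20 * s * (D * (g₋ + ι 100) - ι 100 * ((ι 2 * A * s - ι 2 - A) * n)) - ι 700 * (A * n)
    shift-low = big 99999999 (≤-reflexiveʳ
        (pos (# 0) (e (# 40 ⊕ v0) (# 120 ⊕ v1) (v2 ⊖ # 21) (# 164493406 ⊕ v3) v1) (y ∷ g₋ ∷ θ₋ ∷ A₋ ∷ []) (y0 , g₋0 , θ₋0 , A₋0 , tt) refl)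
      (ring (e (# 40 ⊕ yᴱ) (# 120 ⊕ g₋ᴱ) (θ₋ᴱ ⊖ # 21) (# 164493406 ⊕ A₋ᴱ) g₋ᴱ)
        (# 100000000 ⊗ (# 20 ⊗ v0 ⊗ (Dᴱ v0 v1 v2 v3 ⊗ (g₋ᴱ ⊕ # 100) ⊖ # 100 ⊗ ((# 2 ⊗ v3 ⊗ v0 ⊖ # 2 ⊖ v3) ⊗ nᴱ v0 v1 v2 v3)) ⊖ # 700 ⊗ (v3 ⊗ nᴱ v0 v1 v2 v3))) ρ refl))
      where
      e : ∀ {k} → Expr k → Expr k → Expr k → Expr k → Expr k → Expr k
      e s g θ A a = # 20 ⊗ s ⊗ (D̂ s g θ A ⊗ (a ⊕ # 100) ⊖ (# 2 ⊗ A ⊗ s ⊖ # 200000000 ⊖ A) ⊗ n̂ s g θ A) ⊖ # 7 ⊗ (A ⊗ n̂ s g θ A)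

    private
      ctr : ∀ {k} → Expr k → Expr k → Expr k → Expr k → Expr k → Expr k → Expr k → Expr k
      ctr i b₀ b₁ b₂ s g A = ((A ⊗ (s ⊗ s) ⊖ (# 200000000 ⊕ A) ⊗ s ⊕ # 1000000 ⊗ g ⊕ # 100000000) ⊗ b₂
        ⊖ # 100000000 ⊗ (b₀ ⊗ (s ⊗ s)) ⊖ # 100000000 ⊗ (i ⊗ (b₁ ⊗ s))) ⊗ # 36481 ⊖ # 40000 ⊗ (b₂ ⊗ ((A ⊖ # 100000000) ⊗ (s ⊗ s)))

    -- To leading order this asks b₀ + b₂ (A - 1) κ² ≤ A b₂, possible because (A - 1) κ² < A. At s =
    -- 40 and g = 1.2 each of `b 2` to `b 5` is the least integer that its predecessors allow.
    contraction : ∀ i b₀ b₁ b₂ → allP nonnegℤ 3 (norm (ctr (# i) (# b₀) (# b₁) (# b₂) (# 40 ⊕ v0) (# 120 ⊕ v1) (# 164493407 ⊖ v2) ⊖ # 0)) ≡ true →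
      ι b₀ * (s * s) + ι i * (ι b₁ * s) + ι b₂ * ((A - ι 1) * (κ * κ * (s * s))) ≤ (A * (s * s) - (ι 2 + A) * s + g + ι 1) * ι b₂
    contraction i b₀ b₁ b₂ h = 0≤-⇒≤ (big 99999999 (big 36480 (≤-reflexiveʳ
      (pos (# 0) (ctr (# i) (# b₀) (# b₁) (# b₂) (# 40 ⊕ v0) (# 120 ⊕ v1) (# 164493407 ⊖ v2)) (y ∷ g₋ ∷ A₊ ∷ []) (y0 , g₋0 , A₊0 , tt) h)
      (trans (ring (ctr v4 v5 v6 v7 (# 40 ⊕ (v0 ⊖ # 40)) (# 120 ⊕ (# 100 ⊗ v1 ⊖ # 120)) (# 164493407 ⊖ (# 164493407 ⊖ # 100000000 ⊗ v3)))
          (# 3648100000000 ⊗ ((v3 ⊗ (v0 ⊗ v0) ⊖ (# 2 ⊕ v3) ⊗ v0 ⊕ v1 ⊕ # 1) ⊗ v7 ⊖ (v5 ⊗ (v0 ⊗ v0) ⊕ v4 ⊗ (v6 ⊗ v0)))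
            ⊖ # 100000000 ⊗ ((# 200 ⊗ # 200) ⊗ (v7 ⊗ ((v3 ⊖ # 1) ⊗ (v0 ⊗ v0)))))
          (s ∷ g ∷ θ ∷ A ∷ ι i ∷ ι b₀ ∷ ι b₁ ∷ ι b₂ ∷ []) refl)
        (trans (cong (λ u → ι 3648100000000 * ((A * (s * s) - (ι 2 + A) * s + g + ι 1) * ι b₂ - (ι b₀ * (s * s) + ι i * (ι b₁ * s)))
            - ι 100000000 * ((u * u) * (ι b₂ * ((A - ι 1) * (s * s))))) (sym 191κ))
          (ring (# 3648100000000 ⊗ (v0 ⊖ v1) ⊖ # 100000000 ⊗ (((# 191 ⊗ v2) ⊗ (# 191 ⊗ v2)) ⊗ (v3 ⊗ (v4 ⊗ v5))))
            (# 36481 ⊗ (# 100000000 ⊗ (v0 ⊖ (v1 ⊕ v3 ⊗ (v4 ⊗ (v2 ⊗ v2 ⊗ v5))))))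
            ((A * (s * s) - (ι 2 + A) * s + g + ι 1) * ι b₂ ∷ (ι b₀ * (s * s) + ι i * (ι b₁ * s)) ∷ κ ∷ ι b₂ ∷ A - ι 1 ∷ s * s ∷ []) refl))))))

    -- The five factors (s + z)/s cost about 5 · 7/(20 s²) = 1.75/s², while replacing 1 by ν gains
    -- 0.045/s; since 40 · 0.045 = 1.8, the gain prevails from s = 40 on.
    step-shrink : ∀ z → ι 0 ≤ z → ι 20 * s * z ≤ ι 7 →
      ι 200 * ((s + z - ι 1) * ((s + z) * (s + z) * (s + z) * (s + z) * (s + z))) ≤ (ι 200 * (s + z) - ι 191) * (s * s * s * s * s)
    step-shrink z z0 h = 0≤-⇒≤ (≤-reflexiveʳ (≤-trans (*-nonneg (≤⇒0≤- h') f0)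
        (pos ((# 7 ⊖ # 20 ⊗ (# 40 ⊕ v0) ⊗ v1) ⊗ f (# 40 ⊕ v0) v1) (e (# 40 ⊕ v0) v1) (y ∷ z ∷ []) (y0 , z0 , tt) refl))
      (ring (e (# 40 ⊕ (v0 ⊖ # 40)) v1) (e v0 v1) (s ∷ z ∷ []) refl))
      where
      e f : ∀ {k} → Expr k → Expr k → Expr k
      e s z = (# 200 ⊗ (s ⊕ z) ⊖ # 191) ⊗ (s ⊗ s ⊗ s ⊗ s ⊗ s) ⊖ # 200 ⊗ ((s ⊕ z ⊖ # 1) ⊗ ((s ⊕ z) ⊗ (s ⊕ z) ⊗ (s ⊕ z) ⊗ (s ⊕ z) ⊗ (s ⊕ z)))
      f s z = # 50 ⊗ (s ⊗ s ⊗ s ⊗ s) ⊕ # 200 ⊗ z ⊗ (s ⊗ s ⊗ s) ⊕ # 400 ⊗ (z ⊗ z) ⊗ (s ⊗ s) ⊕ # 400 ⊗ (z ⊗ z ⊗ z) ⊗ s ⊕ # 200 ⊗ (z ⊗ z ⊗ z ⊗ z) ⊕ # 20 ⊗ (z ⊗ z ⊗ z ⊗ z ⊗ z)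
      h' : ι 20 * (ι 40 + y) * z ≤ ι 7
      h' = ≤-reflexiveˡ (ring (# 20 ⊗ (# 40 ⊕ (v0 ⊖ # 40)) ⊗ v1) (# 20 ⊗ v0 ⊗ v1) (s ∷ z ∷ []) refl) h
      f0 : ι 0 ≤ ⟦ f (# 40 ⊕ v0) v1 ⟧ (y ∷ z ∷ [])
      f0 = pos (# 0) (f (# 40 ⊕ v0) v1) (y ∷ z ∷ []) (y0 , z0 , tt) refl

    N : F
    N = A * (s * s) - (ι 2 + A) * s + g

    N≥s : s ≤ N
    N≥s = 0≤-⇒≤ (big 99999999 (≤-reflexiveʳ
      (pos (# 0) (e (# 40 ⊕ v0) (# 120 ⊕ v1) (# 164493406 ⊕ v2)) (y ∷ g₋ ∷ A₋ ∷ []) (y0 , g₋0 , A₋0 , tt) refl)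
      (ring (e (# 40 ⊕ yᴱ) (# 120 ⊕ g₋ᴱ) (# 164493406 ⊕ A₋ᴱ)) (# 100000000 ⊗ (v3 ⊗ (v0 ⊗ v0) ⊖ (# 2 ⊕ v3) ⊗ v0 ⊕ v1 ⊖ v0)) ρ refl)))
      where
      e : ∀ {k} → Expr k → Expr k → Expr k → Expr k
      e s g A = A ⊗ (s ⊗ s) ⊖ (# 200000000 ⊕ A) ⊗ s ⊕ # 1000000 ⊗ g ⊖ # 100000000 ⊗ s

    -- 4N³ (n/D)² ≤ (A - 1/2s) (s - 1)² s²
    criterion : ι 8 * s * (N * N * N * (n * n)) ≤ (ι 2 * A * s - ι 1) * ((s - ι 1) * (s - ι 1) * (s * s)) * (D * D)
    criterion = *-cancel (1≤ιsuc 9999999999999999999999999999) (≤-trans (≤-reflexiveˡ eq₁ (*-monoˡ 8s0 (*-mono (*-nonneg (*-nonneg N̂0 N̂0) N̂0) (*-nonneg nu≥0 nu≥0)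
        (*-mono (*-nonneg N̂0 N̂0) Nu0 (*-mono N̂0 Nu0 N̂≤ N̂≤) N̂≤) (*-mono n̂0 nu≥0 n̂≤ n̂≤))))
      (≤-trans mid (≤-reflexiveʳ (*-monoˡ lead0 (*-mono Dl0 (≤-trans Dl0 Dl≤) Dl≤ Dl≤)) eq₂)))
      where
      σ₂ : Vec F 2
      σ₂ = y ∷ A₋ ∷ []
      h₂ : Nonneg σ₂
      h₂ = y0 , A₋0 , tt
      Sᴱ Aᴱ Nuᴱ nuᴱ Dlᴱ leadᴱ : Expr 2
      Sᴱ = # 40 ⊕ v0
      Aᴱ = # 164493406 ⊕ v1
      Nuᴱ = Aᴱ ⊗ Sᴱ ⊗ Sᴱ ⊖ (# 200000000 ⊕ Aᴱ) ⊗ Sᴱ ⊕ # 169000000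
      nuᴱ = # 100 ⊗ Sᴱ ⊗ Sᴱ ⊕ # 80 ⊗ Sᴱ ⊕ # 42
      Dlᴱ = # 2 ⊗ Aᴱ ⊗ (Sᴱ ⊗ Sᴱ ⊗ Sᴱ) ⊖ # 400000000 ⊗ (Sᴱ ⊗ Sᴱ) ⊖ # 60000000 ⊗ Sᴱ ⊖ # 42000000
      leadᴱ = # 10000 ⊗ ((# 2 ⊗ Aᴱ ⊗ Sᴱ ⊖ # 100000000) ⊗ ((Sᴱ ⊖ # 1) ⊗ (Sᴱ ⊖ # 1) ⊗ (Sᴱ ⊗ Sᴱ)))
      Nu nu Dl lead N̂ n̂' D̂' 8s : F
      Nu = ⟦ Nuᴱ ⟧ σ₂
      nu = ⟦ nuᴱ ⟧ σ₂
      Dl = ⟦ Dlᴱ ⟧ σ₂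
      lead = ⟦ leadᴱ ⟧ σ₂
      N̂ = ι 100000000 * N
      n̂' = ι 100 * n
      D̂' = ι 100000000 * D
      8s = ⟦ # 8 ⊗ Sᴱ ⟧ σ₂
      8s0 : ι 0 ≤ 8s
      8s0 = pos (# 0) (# 8 ⊗ Sᴱ) σ₂ h₂ refl
      N̂0 : ι 0 ≤ N̂
      N̂0 = *-nonneg (0≤ι 100000000) (≤-trans (≤-trans (0≤ι 40) s≥) N≥s)
      n̂0 : ι 0 ≤ n̂'
      n̂0 = *-nonneg (0≤ι 100) n≥0
      Nu0 : ι 0 ≤ Nu
      Nu0 = pos (# 0) Nuᴱ σ₂ h₂ refl
      nu≥0 : ι 0 ≤ nu
      nu≥0 = pos (# 0) nuᴱ σ₂ h₂ refl
      Dl0 : ι 0 ≤ Dl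
      Dl0 = pos (# 0) Dlᴱ σ₂ h₂ refl
      lead0 : ι 0 ≤ lead
      lead0 = pos (# 0) leadᴱ σ₂ h₂ refl
      sub : ∀ (e : ∀ {k} → Expr k → Expr k → Expr k) → Expr 4
      sub e = e (# 40 ⊕ yᴱ) (# 164493406 ⊕ A₋ᴱ)
      N̂≤ : N̂ ≤ Nu
      N̂≤ = 0≤-⇒≤ (≤-reflexiveʳ (*-nonneg (0≤ι 1000000) g₊0)
        (ring (# 1000000 ⊗ g₊ᴱ) (sub (λ S A → A ⊗ S ⊗ S ⊖ (# 200000000 ⊕ A) ⊗ S ⊕ # 169000000) ⊖ # 100000000 ⊗ (v3 ⊗ (v0 ⊗ v0) ⊖ (# 2 ⊕ v3) ⊗ v0 ⊕ v1)) ρ refl))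
      n̂≤ : n̂' ≤ nu
      n̂≤ = 0≤-⇒≤ (≤-reflexiveʳ (+-nonneg (*-nonneg (0≤ι 2) (*-nonneg (+-nonneg g₊0 θ₋0) (≤-trans (0≤ι 40) s≥))) (*-nonneg (0≤ι 2) θ₊0))
        (ring (# 2 ⊗ ((g₊ᴱ ⊕ θ₋ᴱ) ⊗ v0) ⊕ # 2 ⊗ θ₊ᴱ) (sub (λ S A → # 100 ⊗ S ⊗ S ⊕ # 80 ⊗ S ⊕ # 42) ⊖ # 100 ⊗ nᴱ v0 v1 v2 v3) ρ refl))
      Dl≤ : Dl ≤ D̂'
      Dl≤ = 0≤-⇒≤ (≤-reflexiveʳ (+-nonneg (*-nonneg (0≤ι 2000000) (*-nonneg g₋0 (≤-trans (0≤ι 40) s≥))) (*-nonneg (0≤ι 2000000) θ₋0))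
        (ring (# 2000000 ⊗ (g₋ᴱ ⊗ v0) ⊕ # 2000000 ⊗ θ₋ᴱ) (# 100000000 ⊗ Dᴱ v0 v1 v2 v3 ⊖ sub (λ S A → # 2 ⊗ A ⊗ (S ⊗ S ⊗ S) ⊖ # 400000000 ⊗ (S ⊗ S) ⊖ # 60000000 ⊗ S ⊖ # 42000000)) ρ refl))
      -- Both sides agree in the leading term 8A³ s¹¹ (up to scaling), so the margin is of order
      -- s¹⁰. The multiplier uses A₋ ≤ 1 to absorb negative coefficients there.
      mid : 8s * (Nu * Nu * Nu * (nu * nu)) ≤ lead * (Dl * Dl)
      mid = 0≤-⇒≤ (≤-trans (*-nonneg A₊0' (pos (# 0) (# 200000 ⊗ (# 10000000000000000 ⊕ # 100000000 ⊗ v1 ⊕ v1 ⊗ v1) ⊗ S¹⁰) σ₂ h₂ refl))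
        (pos ((# 1 ⊖ v1) ⊗ (# 200000 ⊗ (# 10000000000000000 ⊕ # 100000000 ⊗ v1 ⊕ v1 ⊗ v1) ⊗ S¹⁰)) (leadᴱ ⊗ (Dlᴱ ⊗ Dlᴱ) ⊖ # 8 ⊗ Sᴱ ⊗ (Nuᴱ ⊗ Nuᴱ ⊗ Nuᴱ ⊗ (nuᴱ ⊗ nuᴱ))) σ₂ h₂ refl))
        where
        S¹⁰ : Expr 2
        S¹⁰ = Sᴱ ⊗ Sᴱ ⊗ Sᴱ ⊗ Sᴱ ⊗ Sᴱ ⊗ Sᴱ ⊗ Sᴱ ⊗ Sᴱ ⊗ Sᴱ ⊗ Sᴱ
        A₊0' : ι 0 ≤ ι 1 - A₋
        A₊0' = ≤-reflexiveʳ A₊0 (ring (# 164493407 ⊖ v0) (# 1 ⊖ (v0 ⊖ # 164493406)) (ι 100000000 * A ∷ []) refl)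
      eq₁ : ι 10000000000000000000000000000 * (ι 8 * s * (N * N * N * (n * n))) ≡ 8s * (N̂ * N̂ * N̂ * (n̂' * n̂'))
      eq₁ = ring (# 10000000000000000000000000000 ⊗ (# 8 ⊗ v0 ⊗ (v1 ⊗ v1 ⊗ v1 ⊗ (v2 ⊗ v2))))
        (# 8 ⊗ (# 40 ⊕ (v0 ⊖ # 40)) ⊗ (# 100000000 ⊗ v1 ⊗ (# 100000000 ⊗ v1) ⊗ (# 100000000 ⊗ v1) ⊗ (# 100 ⊗ v2 ⊗ (# 100 ⊗ v2)))) (s ∷ N ∷ n ∷ []) refl
      eq₂ : lead * (D̂' * D̂') ≡ ι 10000000000000000000000000000 * ((ι 2 * A * s - ι 1) * ((s - ι 1) * (s - ι 1) * (s * s)) * (D * D))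
      eq₂ = ring (# 10000 ⊗ ((# 2 ⊗ A' ⊗ S′ ⊖ # 100000000) ⊗ ((S′ ⊖ # 1) ⊗ (S′ ⊖ # 1) ⊗ (S′ ⊗ S′))) ⊗ (# 100000000 ⊗ v1 ⊗ (# 100000000 ⊗ v1)))
        (# 10000000000000000000000000000 ⊗ ((# 2 ⊗ v2 ⊗ v0 ⊖ # 1) ⊗ ((v0 ⊖ # 1) ⊗ (v0 ⊖ # 1) ⊗ (v0 ⊗ v0)) ⊗ (v1 ⊗ v1))) (s ∷ D ∷ A ∷ []) refl
        where
        S′ A' : Expr 3
        S′ = # 40 ⊕ (v0 ⊖ # 40)
        A' = # 164493406 ⊕ (# 100000000 ⊗ v2 ⊖ # 164493406)

  Q-nonneg : ∀ y → ι 0 ≤ Q y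
  Q-nonneg y = *-cancel (1≤ιsuc 7) (≤-reflexiveˡ (*-0 _) (≤-reflexiveʳ
    (pos (# 0) ((# 2 ⊗ v0 ⊕ # 3) ⊗ (# 2 ⊗ v0 ⊕ # 3) ⊖ # 1) (ι y ∷ []) (0≤ι y , tt) refl) (sym (Q-closed y))))

  Q-suc : ∀ k → Q (suc (suc k)) ≡ Q (suc k) + (ι k + ι 3)
  Q-suc k = *-cancel-≡ (1≤ιsuc 7) (trans (Q-closed (suc (suc k))) (trans (trans
    (cong (λ s → (ι 2 * s + ι 3) * (ι 2 * s + ι 3) - ι 1) (trans (ι-suc (suc k)) (+-congˡ (ι-suc k))))
    (trans (ring ((# 2 ⊗ (# 1 ⊕ (# 1 ⊕ v0)) ⊕ # 3) ⊗ (# 2 ⊗ (# 1 ⊕ (# 1 ⊕ v0)) ⊕ # 3) ⊖ # 1)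
        (((# 2 ⊗ (# 1 ⊕ v0) ⊕ # 3) ⊗ (# 2 ⊗ (# 1 ⊕ v0) ⊕ # 3) ⊖ # 1) ⊕ # 8 ⊗ (v0 ⊕ # 3)) (ι k ∷ []) refl)
      (+-congʳ (sym (trans (Q-closed (suc k)) (cong (λ s → (ι 2 * s + ι 3) * (ι 2 * s + ι 3) - ι 1) (ι-suc k)))))))
    (sym (*-distribˡ _ _ _))))

  Q-1 : Q 1 ≡ ι 3
  Q-1 = *-cancel-≡ (1≤ιsuc 7) (trans (Q-closed 1) (ring ((# 2 ⊗ # 1 ⊕ # 3) ⊗ (# 2 ⊗ # 1 ⊕ # 3) ⊖ # 1) (# 8 ⊗ # 3) [] refl))

  1≰0 : ¬ (ι 1 ≤ ι 0)
  1≰0 h with fromℤ-reflects 1 0 h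
  ... | ()

  module Next (L : ℕ) (A : F) (set : Setting L A) (N₀ : ℕ) (st : State A (suc N₀)) (p : suc (suc N₀) ℕ.≤ L) where

    open Setting set
    open State st renaming (shift to g)

    N N′ : ℕ
    N = suc N₀
    N′ = suc N

    q Γ H : F
    q = Δ P N
    Γ = κ * s
    H = Γ - ι 1

    0≤s : ι 0 ≤ s
    0≤s = ≤-trans (0≤ι 40) 40≤s

    40w≤1 : ι 40 * w ≤ ι 1
    40w≤1 = ≤-reflexiveʳ (*-monoʳ 0≤w 40≤s) (trans (*-comm s w) w*s)

    w≤1 : w ≤ ι 1
    w≤1 = *-cancel (1≤ιsuc 39) (≤-trans 40w≤1 (≤-reflexiveʳ (ι-mono (ℕₚ.m≤m+n 1 39)) (sym (*-1 _))))

    νw≤1 : ν * w ≤ ι 1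
    νw≤1 = ≤-reflexiveʳ (*-mono 0≤ν (0≤ι 1) ν≤1 w≤1) (1* _)

    0≤V : ι 0 ≤ V
    0≤V = ≤⇒0≤- νw≤1

    V≤1 : V ≤ ι 1
    V≤1 = 0≤-⇒≤ (≤-reflexiveʳ (*-nonneg 0≤ν 0≤w) (ring v0 (# 1 ⊖ (# 1 ⊖ v0)) (ν * w ∷ []) refl))

    νwΓ : ν * w * Γ ≡ ι 1
    νwΓ = trans (ring (v0 ⊗ v1 ⊗ (v2 ⊗ v3)) ((v0 ⊗ v2) ⊗ (v1 ⊗ v3)) (ν ∷ w ∷ κ ∷ s ∷ []) refl) (trans (cong₂ _*_ νκ w*s) (1* _))

    VΓ : V * Γ ≡ H
    VΓ = trans (ring ((# 1 ⊖ v0) ⊗ v1) (v1 ⊖ v0 ⊗ v1) (ν * w ∷ Γ ∷ []) refl) (cong (_-_ Γ) νwΓ)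

    0≤Γ : ι 0 ≤ Γ
    0≤Γ = *-nonneg 0≤κ 0≤s

    0≤H : ι 0 ≤ H
    0≤H = ≤-reflexiveʳ (*-nonneg 0≤V 0≤Γ) VΓ

    0≤P : ∀ n → ι 0 ≤ P n
    0≤P n = ≤-trans (0≤ι 1) (1≤P n)

    P≡ : P N ≡ s * q
    P≡ = sym (trans (cong (s *_) ΔP) (trans (ring (v0 ⊗ (v1 ⊗ v2)) (v1 ⊗ v0 ⊗ v2) (s ∷ w ∷ P N ∷ []) refl) (trans (cong (_* P N) w*s) (1* _))))

    w^ : ℕ → F
    w^ = pow w

    ε₁₀-bound : ∣ ι 10 * ε L A N ∣≤ B 5 * (w^ 5 * P N) * (Γ * Γ * Γ + Γ * Γ + Γ)
    ε₁₀-bound = abs-subst (conv-*ˡ (ι 10) (tail (R A L)) (Δ^ 5 P) N)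
      (abs-weaken (conv-geom N (λ k → ι 10 * tail (R A L) k) (Δ^ 5 P) (λ k → Q (suc k)) t V (B 5 * (w^ 5 * P N)) 0≤V
          (*-nonneg (0≤B 5) (*-nonneg (pow-nonneg 5 0≤w) (0≤P N))) (λ k r → R-small (suc k) (ℕₚ.≤-trans (s≤s r) p)) (λ k → ≡⇒≤ (t-step k)) t0
          (λ m r → abs-weaken (smooth 5 m ℕₚ.≤-refl r) (≡⇒≤ (ring (v0 ⊗ (v1 ⊗ v2 ⊗ v3)) (v0 ⊗ (v1 ⊗ v3) ⊗ v2) (B 5 ∷ w^ 5 ∷ pow V (N ∸ m) ∷ P N ∷ []) refl))))
        (≡⇒≤ (cong (B 5 * (w^ 5 * P N) *_) (trans (cong (λ z → z * Γ + (ι 0 + ι 3) * (Γ * H) + Γ * (H * H)) Q-1)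
          (ring (# 3 ⊗ v0 ⊕ (# 0 ⊕ # 3) ⊗ (v0 ⊗ (v0 ⊖ # 1)) ⊕ v0 ⊗ ((v0 ⊖ # 1) ⊗ (v0 ⊖ # 1))) (v0 ⊗ v0 ⊗ v0 ⊕ v0 ⊗ v0 ⊕ v0) (Γ ∷ []) refl)))))
      where
      t : Sq
      -- The exact sum of Q(k + 1 + i) Vⁱ over all i ≥ 0, written with Γ = 1/(1 - V) and H = V Γ.
      t k = Q (suc k) * Γ + (ι k + ι 3) * (Γ * H) + Γ * (H * H)
      t0 : ∀ k → ι 0 ≤ t k
      t0 k = +-nonneg (+-nonneg (*-nonneg (Q-nonneg (suc k)) 0≤Γ) (*-nonneg (+-nonneg (0≤ι k) (0≤ι 3)) (*-nonneg 0≤Γ 0≤H))) (*-nonneg 0≤Γ (*-nonneg 0≤H 0≤H))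
      t-step : ∀ k → Q (suc k) + V * t (suc k) ≡ t k
      t-step k = trans (cong₂ (λ a c → Q (suc k) + V * (a * Γ + (c + ι 3) * (Γ * H) + Γ * (H * H))) (Q-suc k) (ι-suc k))
        (trans (ring (v0 ⊕ v1 ⊗ ((v0 ⊕ (v2 ⊕ # 3)) ⊗ v3 ⊕ (# 1 ⊕ v2 ⊕ # 3) ⊗ (v3 ⊗ v4) ⊕ v3 ⊗ (v4 ⊗ v4)))
            (v0 ⊕ ((v0 ⊕ (v2 ⊕ # 3)) ⊗ (v1 ⊗ v3) ⊕ (# 1 ⊕ v2 ⊕ # 3) ⊗ (v1 ⊗ v3 ⊗ v4) ⊕ v1 ⊗ v3 ⊗ (v4 ⊗ v4))) (Q (suc k) ∷ V ∷ ι k ∷ Γ ∷ H ∷ []) refl)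
          (trans (cong (λ z → Q (suc k) + ((Q (suc k) + (ι k + ι 3)) * z + (ι 1 + ι k + ι 3) * (z * H) + z * (H * H))) VΓ)
            (ring (v0 ⊕ ((v0 ⊕ (v1 ⊕ # 3)) ⊗ (v2 ⊖ # 1) ⊕ (# 1 ⊕ v1 ⊕ # 3) ⊗ ((v2 ⊖ # 1) ⊗ (v2 ⊖ # 1)) ⊕ (v2 ⊖ # 1) ⊗ ((v2 ⊖ # 1) ⊗ (v2 ⊖ # 1))))
              (v0 ⊗ v2 ⊕ (v1 ⊕ # 3) ⊗ (v2 ⊗ (v2 ⊖ # 1)) ⊕ v2 ⊗ ((v2 ⊖ # 1) ⊗ (v2 ⊖ # 1))) (Q (suc k) ∷ ι k ∷ Γ ∷ []) refl)))

    PI : P N * inv (P N) ≡ ι 1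
    PI = inv-inverse (P N) (1≤P N)

    θ : F
    θ = ε L A N * (s * s) * inv (P N)

    θP : θ * P N ≡ ε L A N * (s * s)
    θP = trans (ring (v0 ⊗ v1 ⊗ v2) (v0 ⊗ (v2 ⊗ v1)) (ε L A N * (s * s) ∷ inv (P N) ∷ P N ∷ []) refl) (trans (cong (ε L A N * (s * s) *_) PI) (*-1 _))

    X : F
    X = κ * κ * κ + κ * κ * w + κ * (w * w)

    -- `B 5` is 1.76, so this yields |10 θ| ≤ 2.1. The factor 6967871 = 191³ clears the denominators
    -- of κ, and the multiplier brings in w ≤ 1/40.
    X-bound : ι 176 * X ≤ ι 210
    X-bound = *-cancel (1≤ιsuc 6967870) (≤-reflexiveˡ scaled (0≤-⇒≤ (≤-reflexiveʳ (≤-trans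
        (*-nonneg (≤⇒0≤- 40w≤1) (pos (# 0) (# 34418582 ⊕ # 32103280 ⊗ v0) (w ∷ []) (0≤w , tt) refl))
        (pos ((# 1 ⊖ # 40 ⊗ v0) ⊗ (# 34418582 ⊕ # 32103280 ⊗ v0)) (# 1463252910 ⊖ # 176 ⊗ f v0) (w ∷ []) (0≤w , tt) refl))
      (ring (# 1463252910 ⊖ # 176 ⊗ f v0) (# 6967871 ⊗ # 210 ⊖ # 176 ⊗ f v0) (w ∷ []) refl))))
      where
      f : ∀ {k} → Expr k → Expr k
      f w = # 200 ⊗ # 200 ⊗ # 200 ⊕ # 191 ⊗ (# 200 ⊗ # 200) ⊗ w ⊕ # 36481 ⊗ # 200 ⊗ (w ⊗ w)
      scaled : ι 6967871 * (ι 176 * X) ≡ ι 176 * ⟦ f v0 ⟧ (w ∷ [])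
      scaled = trans (ring (# 6967871 ⊗ (# 176 ⊗ (v0 ⊗ v0 ⊗ v0 ⊕ v0 ⊗ v0 ⊗ v1 ⊕ v0 ⊗ (v1 ⊗ v1))))
          (# 176 ⊗ ((# 191 ⊗ v0) ⊗ (# 191 ⊗ v0) ⊗ (# 191 ⊗ v0) ⊕ # 191 ⊗ ((# 191 ⊗ v0) ⊗ (# 191 ⊗ v0)) ⊗ v1 ⊕ # 36481 ⊗ (# 191 ⊗ v0) ⊗ (v1 ⊗ v1))) (κ ∷ w ∷ []) refl)
        (cong (λ z → ι 176 * (z * z * z + ι 191 * (z * z) * w + ι 36481 * z * (w * w))) 191κ)

    θ-bound : ∣ ι 100 * θ ∣≤ ι 21
    θ-bound = lift (proj₁ b₁) , ≤-reflexiveˡ (ring (⊝ (# 100 ⊗ v0)) (# 100 ⊗ (⊝ v0)) (θ ∷ []) refl) (lift (≤-reflexiveˡ (ring (# 10 ⊗ (⊝ v0)) (⊝ (# 10 ⊗ v0)) (θ ∷ []) refl) (proj₂ b₁)))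
      where
      I = inv (P N)
      b₁ : ∣ ι 10 * θ ∣≤ B 5 * X
      b₁ = abs-subst (ring (v1 ⊗ v2 ⊗ (# 10 ⊗ v0)) (# 10 ⊗ (v0 ⊗ v1 ⊗ v2)) (ε L A N ∷ s * s ∷ I ∷ []) refl)
        (abs-weaken (abs-*ˡ (*-nonneg (*-nonneg 0≤s 0≤s) (inv-nonneg _ (1≤P N))) ε₁₀-bound) (≡⇒≤
          (trans (ring (v2 ⊗ v2 ⊗ v4 ⊗ (v0 ⊗ ((v1 ⊗ (v1 ⊗ (v1 ⊗ (v1 ⊗ (v1 ⊗ # 1))))) ⊗ v3) ⊗ (v5 ⊗ v2 ⊗ (v5 ⊗ v2) ⊗ (v5 ⊗ v2) ⊕ v5 ⊗ v2 ⊗ (v5 ⊗ v2) ⊕ v5 ⊗ v2)))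
              (v0 ⊗ (v3 ⊗ v4) ⊗ (((v1 ⊗ v2) ⊗ (v1 ⊗ v2) ⊗ (v1 ⊗ v2) ⊗ (v1 ⊗ v2) ⊗ (v1 ⊗ v2)) ⊗ (v5 ⊗ v5 ⊗ v5) ⊕ ((v1 ⊗ v2) ⊗ (v1 ⊗ v2) ⊗ (v1 ⊗ v2) ⊗ (v1 ⊗ v2)) ⊗ (v5 ⊗ v5 ⊗ v1) ⊕ ((v1 ⊗ v2) ⊗ (v1 ⊗ v2) ⊗ (v1 ⊗ v2)) ⊗ (v5 ⊗ (v1 ⊗ v1))))
              (B 5 ∷ w ∷ s ∷ P N ∷ I ∷ κ ∷ []) refl)
            (trans (cong₂ (λ a c → B 5 * a * ((c * c * c * c * c) * (κ * κ * κ) + (c * c * c * c) * (κ * κ * w) + (c * c * c) * (κ * (w * w)))) PI w*s)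
              (ring (v0 ⊗ # 1 ⊗ ((# 1 ⊗ # 1 ⊗ # 1 ⊗ # 1 ⊗ # 1) ⊗ v1 ⊕ (# 1 ⊗ # 1 ⊗ # 1 ⊗ # 1) ⊗ v2 ⊕ (# 1 ⊗ # 1 ⊗ # 1) ⊗ v3)) (v0 ⊗ (v1 ⊕ v2 ⊕ v3)) (B 5 ∷ κ * κ * κ ∷ κ * κ * w ∷ κ * (w * w) ∷ []) refl)))))
      lift : ∀ {z} → ι 10 * z ≤ B 5 * X → ι 100 * z ≤ ι 21
      lift {z} h = *-cancel (1≤ιsuc 9) (≤-reflexiveˡ (ring (# 10 ⊗ (# 100 ⊗ v0)) (# 100 ⊗ (# 10 ⊗ v0)) (z ∷ []) refl)
        (≤-trans (*-monoˡ (0≤ι 100) h) (≤-reflexiveˡ (trans (sym (*-assoc _ _ _)) (cong (_* X) (100B 5))) (≤-reflexiveʳ X-bound (ring (# 210) (# 10 ⊗ # 21) [] refl)))))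

    open Numeric s g θ A 40≤s shift-lower shift-upper θ-bound A-lower A-upper renaming (N to Nˢ) public

    ιN : ι N ≡ Nˢ
    ιN = ring v0 (v1 ⊖ v2 ⊕ (v0 ⊖ (v1 ⊖ v2))) (ι N ∷ A * (s * s) ∷ (ι 2 + A) * s ∷ []) refl

    δ s′ w′ q′ : F
    δ = n * inv D
    s′ = s + δ
    w′ = inv s′
    q′ = Δ P N′

    Dδ : D * δ ≡ n
    Dδ = trans (*-left-swap _ _ _) (trans (cong (n *_) (inv-inverse D D≥1)) (*-1 _))

    δ≥0 : ι 0 ≤ δ
    δ≥0 = *-nonneg n≥0 (inv-nonneg D D≥1)

    s≤s′ : s ≤ s′
    s≤s′ = ≤-reflexiveˡ (sym (+-0 s)) (+-mono ≤-refl δ≥0)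

    40≤s′ : ι 40 ≤ s′
    40≤s′ = ≤-trans 40≤s s≤s′

    1≤s′ : ι 1 ≤ s′
    1≤s′ = ≤-trans (ι-mono (ℕₚ.m≤m+n 1 39)) 40≤s′

    0≤s′ : ι 0 ≤ s′
    0≤s′ = ≤-trans (0≤ι 1) 1≤s′

    0≤w′ : ι 0 ≤ w′
    0≤w′ = inv-nonneg s′ 1≤s′

    s′w′ : s′ * w′ ≡ ι 1
    s′w′ = inv-inverse s′ 1≤s′

    s′-1 : (s′ - ι 1) * D ≡ ι 2 * (s * s) * (ι N + ι 1)
    s′-1 = trans (ring ((v0 ⊕ v1 ⊖ # 1) ⊗ v2) ((v0 ⊖ # 1) ⊗ v2 ⊕ v2 ⊗ v1) (s ∷ δ ∷ D ∷ []) refl) (trans (+-congˡ Dδ)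
      (trans (ring ((v0 ⊖ # 1) ⊗ Dᴱ v0 v1 v2 v3 ⊕ nᴱ v0 v1 v2 v3) (# 2 ⊗ (v0 ⊗ v0) ⊗ (v3 ⊗ (v0 ⊗ v0) ⊖ (# 2 ⊕ v3) ⊗ v0 ⊕ v1 ⊕ # 1)) (s ∷ g ∷ θ ∷ A ∷ []) refl)
        (cong (λ z → ι 2 * (s * s) * (z + ι 1)) (sym ιN))))

    q′-D : ι 2 * (s * s) * (ι N + ι 1) * q′ ≡ D * P N
    q′-D = trans (ring (# 2 ⊗ v0 ⊗ (v1 ⊕ # 1) ⊗ v2) (v0 ⊗ (# 2 ⊗ (# 1 ⊕ v1) ⊗ v2)) (s * s ∷ ι N ∷ q′ ∷ []) refl)
      (trans (cong (s * s *_) (trans (cong (λ z → ι 2 * z * q′) (sym (ι-suc N))) (trans (main-recurrence L A N₀ p) (cong (λ z → (ι 2 * ι N - ι 3) * z + ι 2 * A * P N + ι 2 * ε L A N) ΔP))))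
        (trans (ring (v0 ⊗ v0 ⊗ ((# 2 ⊗ v1 ⊖ # 3) ⊗ (v2 ⊗ v3) ⊕ # 2 ⊗ v4 ⊗ v3 ⊕ # 2 ⊗ v5)) ((# 2 ⊗ v1 ⊖ # 3) ⊗ (v2 ⊗ v0) ⊗ (v0 ⊗ v3) ⊕ # 2 ⊗ v4 ⊗ (v0 ⊗ v0) ⊗ v3 ⊕ # 2 ⊗ (v5 ⊗ (v0 ⊗ v0)))
            (s ∷ ι N ∷ w ∷ P N ∷ A ∷ ε L A N ∷ []) refl)
          (trans (cong₂ (λ u e → (ι 2 * ι N - ι 3) * u * (s * P N) + ι 2 * A * (s * s) * P N + ι 2 * e) w*s (sym θP))
            (trans (cong (λ z → (ι 2 * z - ι 3) * ι 1 * (s * P N) + ι 2 * A * (s * s) * P N + ι 2 * (θ * P N)) ιN)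
              (ring ((# 2 ⊗ (v3 ⊗ (v0 ⊗ v0) ⊖ (# 2 ⊕ v3) ⊗ v0 ⊕ v1) ⊖ # 3) ⊗ # 1 ⊗ (v0 ⊗ v4) ⊕ # 2 ⊗ v3 ⊗ (v0 ⊗ v0) ⊗ v4 ⊕ # 2 ⊗ (v2 ⊗ v4)) (Dᴱ v0 v1 v2 v3 ⊗ v4) (s ∷ g ∷ θ ∷ A ∷ P N ∷ []) refl)))))

    P-s′ : (s′ - ι 1) * q′ ≡ P N
    P-s′ = *-cancel-≡ D≥1 (trans (ring (v0 ⊗ (v1 ⊗ v2)) (v1 ⊗ v0 ⊗ v2) (D ∷ s′ - ι 1 ∷ q′ ∷ []) refl) (trans (cong (_* q′) s′-1) q′-D))

    P′≡ : P N′ ≡ s′ * q′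
    P′≡ = trans (ring v0 (v1 ⊕ (v0 ⊖ v1)) (P N′ ∷ P N ∷ []) refl) (trans (+-congʳ (sym P-s′)) (ring ((v0 ⊖ # 1) ⊗ v1 ⊕ v1) (v0 ⊗ v1) (s′ ∷ q′ ∷ []) refl))

    ΔP′ : q′ ≡ w′ * P N′
    ΔP′ = sym (trans (cong (w′ *_) P′≡) (trans (ring (v0 ⊗ (v1 ⊗ v2)) (v1 ⊗ v0 ⊗ v2) (w′ ∷ s′ ∷ q′ ∷ []) refl) (trans (cong (_* q′) s′w′) (1* _))))

    P-w′ : P N ≡ (ι 1 - w′) * P N′
    P-w′ = trans (ring v0 (v1 ⊖ (v1 ⊖ v0)) (P N ∷ P N′ ∷ []) refl) (trans (cong (_-_ (P N′)) ΔP′) (ring (v0 ⊖ v1 ⊗ v0) ((# 1 ⊖ v1) ⊗ v0) (P N′ ∷ w′ ∷ []) refl))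

    g′ : F
    g′ = ι N′ - (A * (s′ * s′) - (ι 2 + A) * s′)

    0≤A : ι 0 ≤ A
    0≤A = *-cancel (1≤ιsuc 99999999) (≤-trans (≤-reflexiveˡ (*-0 _) (0≤ι 164493406)) A-lower)

    20sδ≤7 : ι 20 * s * δ ≤ ι 7
    20sδ≤7 = *-cancel D≥1 (≤-reflexiveˡ (trans (ring (v0 ⊗ (v1 ⊗ v2)) (v1 ⊗ (v0 ⊗ v2)) (D ∷ ι 20 * s ∷ δ ∷ []) refl) (cong (ι 20 * s *_) Dδ)) (≤-reflexiveʳ increment (*-comm _ _)))

    g′≡ : g′ ≡ g + ι 1 - ι 2 * A * s * δ - A * δ * δ + (ι 2 + A) * δ
    g′≡ = trans (cong (_- (A * (s′ * s′) - (ι 2 + A) * s′)) (trans (ι-suc N) (+-congˡ ιN)))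
      (ring (# 1 ⊕ (v2 ⊗ (v0 ⊗ v0) ⊖ (# 2 ⊕ v2) ⊗ v0 ⊕ v1) ⊖ (v2 ⊗ ((v0 ⊕ v3) ⊗ (v0 ⊕ v3)) ⊖ (# 2 ⊕ v2) ⊗ (v0 ⊕ v3)))
        (v1 ⊕ # 1 ⊖ # 2 ⊗ v2 ⊗ v0 ⊗ v3 ⊖ v2 ⊗ v3 ⊗ v3 ⊕ (# 2 ⊕ v2) ⊗ v3) (s ∷ g ∷ A ∷ δ ∷ []) refl)

    g′≤ : ι 100 * g′ ≤ ι 169
    g′≤ = 0≤-⇒≤ (*-cancel D≥1 (≤-reflexiveˡ (*-0 _) (≤-reflexiveʳ
      (+-nonneg shift-up (*-nonneg (*-nonneg (0≤ι 100) 0≤A) (*-nonneg n≥0 δ≥0)))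
      (trans (cong (λ n → D * (g₊ - ι 100) + ι 100 * ((ι 2 * A * s - ι 2 - A) * n) + ι 100 * A * (n * δ)) (sym Dδ))
        (trans (ring (v0 ⊗ (# 169 ⊖ # 100 ⊗ v1 ⊖ # 100) ⊕ # 100 ⊗ ((# 2 ⊗ v2 ⊗ v3 ⊖ # 2 ⊖ v2) ⊗ (v0 ⊗ v4)) ⊕ # 100 ⊗ v2 ⊗ (v0 ⊗ v4 ⊗ v4))
            (v0 ⊗ (# 169 ⊖ # 100 ⊗ (v1 ⊕ # 1 ⊖ # 2 ⊗ v2 ⊗ v3 ⊗ v4 ⊖ v2 ⊗ v4 ⊗ v4 ⊕ (# 2 ⊕ v2) ⊗ v4))) (D ∷ g ∷ A ∷ s ∷ δ ∷ []) refl)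
          (cong (λ z → D * (ι 169 - ι 100 * z)) (sym g′≡)))))))

    g′≥ : ι 120 ≤ ι 100 * g′
    g′≥ = 0≤-⇒≤ (*-cancel D≥1 (*-cancel 20s≥1 (≤-reflexiveˡ (trans (cong (ι 20 * s *_) (*-0 _)) (*-0 _)) (≤-reflexiveʳ
      (+-nonneg shift-low (*-nonneg (*-nonneg (*-nonneg (0≤ι 100) 0≤A) n≥0) (≤⇒0≤- 20sδ≤7)))
      (trans (cong (λ n → ι 20 * s * (D * (g₋ + ι 100) - ι 100 * ((ι 2 * A * s - ι 2 - A) * n)) - ι 700 * (A * n) + ι 100 * A * n * (ι 7 - ι 20 * s * δ)) (sym Dδ))
        (trans (ring (# 20 ⊗ v3 ⊗ (v0 ⊗ (# 100 ⊗ v1 ⊖ # 120 ⊕ # 100) ⊖ # 100 ⊗ ((# 2 ⊗ v2 ⊗ v3 ⊖ # 2 ⊖ v2) ⊗ (v0 ⊗ v4))) ⊖ # 700 ⊗ (v2 ⊗ (v0 ⊗ v4)) ⊕ # 100 ⊗ v2 ⊗ (v0 ⊗ v4) ⊗ (# 7 ⊖ # 20 ⊗ v3 ⊗ v4))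
            (# 20 ⊗ v3 ⊗ (v0 ⊗ (# 100 ⊗ (v1 ⊕ # 1 ⊖ # 2 ⊗ v2 ⊗ v3 ⊗ v4 ⊖ v2 ⊗ v4 ⊗ v4 ⊕ (# 2 ⊕ v2) ⊗ v4) ⊖ # 120))) (D ∷ g ∷ A ∷ s ∷ δ ∷ []) refl)
          (cong (λ z → ι 20 * s * (D * (ι 100 * z - ι 120))) (sym g′≡))))))))
      where
      20s≥1 : ι 1 ≤ ι 20 * s
      20s≥1 = ≤-trans (≤-reflexiveʳ (ι-mono (ℕₚ.m≤m+n 1 799)) (ι-* 20 40)) (*-monoˡ (0≤ι 20) 40≤s)

    r : F
    r = s * w′

    0≤r : ι 0 ≤ r
    0≤r = *-nonneg 0≤s 0≤w′

    r≤1 : r ≤ ι 1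
    r≤1 = ≤-reflexiveʳ (*-monoʳ 0≤w′ s≤s′) s′w′

    w′≡ : w′ ≡ r * w
    w′≡ = sym (trans (ring (v0 ⊗ v1 ⊗ v2) (v2 ⊗ v0 ⊗ v1) (s ∷ w′ ∷ w ∷ []) refl) (trans (cong (_* w′) w*s) (1* _)))

    V′ : F
    V′ = ι 1 - ν * w′

    V≤V′ : V ≤ V′
    V≤V′ = +-mono ≤-refl (neg-mono (*-monoˡ 0≤ν (≤-reflexiveˡ w′≡ (≤-reflexiveʳ (*-monoʳ 0≤w r≤1) (1* _)))))

    0≤V′ : ι 0 ≤ V′
    0≤V′ = ≤-trans 0≤V V≤V′

    V′≤1 : V′ ≤ ι 1
    V′≤1 = 0≤-⇒≤ (≤-reflexiveʳ (*-nonneg 0≤ν 0≤w′) (ring v0 (# 1 ⊖ (# 1 ⊖ v0)) (ν * w′ ∷ []) refl))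

    shrink : ι 1 - w′ ≤ pow r 5 * V′
    shrink = *-cancel scale (≤-reflexiveˡ lhs (≤-reflexiveʳ (step-shrink δ δ≥0 20sδ≤7) rhs))
      where
      s⁶ = s′ * s′ * s′ * s′ * s′ * s′
      scale : ι 1 ≤ ι 200 * s⁶
      scale = ≤-reflexiveʳ (pos (# 1) (# 200 ⊗ (T ⊗ T ⊗ T ⊗ T ⊗ T ⊗ T)) (s′ - ι 1 ∷ []) (≤⇒0≤- 1≤s′ , tt) refl)
          (ring (# 200 ⊗ (U ⊗ U ⊗ U ⊗ U ⊗ U ⊗ U)) (# 200 ⊗ (v0 ⊗ v0 ⊗ v0 ⊗ v0 ⊗ v0 ⊗ v0)) (s′ ∷ []) refl)
        where
        T U : Expr 1
        T = # 1 ⊕ v0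
        U = # 1 ⊕ (v0 ⊖ # 1)
      lhs : ι 200 * s⁶ * (ι 1 - w′) ≡ ι 200 * ((s′ - ι 1) * (s′ * s′ * s′ * s′ * s′))
      lhs = trans (ring (# 200 ⊗ (v0 ⊗ v0 ⊗ v0 ⊗ v0 ⊗ v0 ⊗ v0) ⊗ (# 1 ⊖ v1)) (# 200 ⊗ ((v0 ⊖ v0 ⊗ v1) ⊗ (v0 ⊗ v0 ⊗ v0 ⊗ v0 ⊗ v0))) (s′ ∷ w′ ∷ []) refl)
        (cong (λ z → ι 200 * ((s′ - z) * (s′ * s′ * s′ * s′ * s′))) s′w′)
      rhs : (ι 200 * s′ - ι 191) * (s * s * s * s * s) ≡ ι 200 * s⁶ * (pow r 5 * V′)
      rhs = trans (cong (λ z → (ι 200 * s′ - z) * (s * s * s * s * s)) (sym 200ν))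
        (trans (ring ((# 200 ⊗ v0 ⊖ # 200 ⊗ v1) ⊗ (v2 ⊗ v2 ⊗ v2 ⊗ v2 ⊗ v2)) (# 200 ⊗ ((v0 ⊖ v1 ⊗ # 1) ⊗ (# 1 ⊗ v2 ⊗ (# 1 ⊗ v2) ⊗ (# 1 ⊗ v2) ⊗ (# 1 ⊗ v2) ⊗ (# 1 ⊗ v2)))) (s′ ∷ ν ∷ s ∷ []) refl)
          (trans (cong (λ z → ι 200 * ((s′ - ν * z) * (z * s * (z * s) * (z * s) * (z * s) * (z * s)))) (sym s′w′))
            (ring (# 200 ⊗ ((v0 ⊖ v1 ⊗ (v0 ⊗ v3)) ⊗ (v0 ⊗ v3 ⊗ v2 ⊗ (v0 ⊗ v3 ⊗ v2) ⊗ (v0 ⊗ v3 ⊗ v2) ⊗ (v0 ⊗ v3 ⊗ v2) ⊗ (v0 ⊗ v3 ⊗ v2))))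
              (# 200 ⊗ (v0 ⊗ v0 ⊗ v0 ⊗ v0 ⊗ v0 ⊗ v0) ⊗ ((v2 ⊗ v3 ⊗ (v2 ⊗ v3 ⊗ (v2 ⊗ v3 ⊗ (v2 ⊗ v3 ⊗ (v2 ⊗ v3 ⊗ # 1))))) ⊗ (# 1 ⊖ v1 ⊗ v3))) (s′ ∷ ν ∷ s ∷ w′ ∷ []) refl)))

    -- Translates bounds relative to N into bounds relative to N + 1. The factor `V′` is kept
    -- because the distance from an old index m to the top has grown by one; P(N) = (1 - w′) P(N +
    -- 1) supplies it through `shrink`.
    rescale : ∀ i → i ℕ.≤ 5 → w^ i * P N ≤ pow w′ i * (V′ * P N′)
    rescale i h = ≤-reflexiveˡ (trans (cong (w^ i *_) P-w′) (ring (v0 ⊗ (v1 ⊗ v2)) (v0 ⊗ v2 ⊗ v1) (w^ i ∷ ι 1 - w′ ∷ P N′ ∷ []) refl))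
      (≤-reflexiveʳ (*-monoˡ (*-nonneg (pow-nonneg i 0≤w) (0≤P N′)) (≤-trans shrink (*-monoʳ 0≤V′ r⁵≤)))
        (trans (ring (v0 ⊗ v1 ⊗ (v2 ⊗ v3)) (v2 ⊗ v0 ⊗ (v3 ⊗ v1)) (w^ i ∷ P N′ ∷ pow r i ∷ V′ ∷ []) refl)
          (cong (_* (V′ * P N′)) (trans (sym (pow-mul r w i)) (cong (λ z → pow z i) (sym w′≡))))))
      where
      r⁵≤ : pow r 5 ≤ pow r i
      r⁵≤ = ≤-reflexiveˡ (trans (cong (pow r) (sym (ℕₚ.m+[n∸m]≡n h))) (pow-+ r i (5 ∸ i)))
        (≤-reflexiveʳ (*-monoˡ (pow-nonneg i 0≤r) (pow-≤1 (5 ∸ i) 0≤r r≤1)) (*-1 _))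

    rescale₁ : ∀ i → i ℕ.≤ 5 → w^ i * P N ≤ pow w′ i * P N′
    rescale₁ i h = ≤-trans (rescale i h) (*-monoˡ (pow-nonneg i 0≤w′) (≤-reflexiveʳ (*-monoʳ (0≤P N′) V′≤1) (1* _)))

    at-N : ∀ i → i ℕ.≤ 5 → ∣ Δ^ i P N ∣≤ B i * (w^ i * P N)
    at-N i h = abs-weaken (smooth i N h ℕₚ.≤-refl) (≡⇒≤ (trans (cong (λ k → B i * (w^ i * pow V k * P N)) (ℕₚ.n∸n≡0 N)) (ring (v0 ⊗ (v1 ⊗ # 1 ⊗ v2)) (v0 ⊗ (v1 ⊗ v2)) (B i ∷ w^ i ∷ P N ∷ []) refl)))

    -- At the new index the three terms of `Δ^-recurrence` are bounded by the old state. Dividing by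
    -- N + 1 reproduces the same constant, exactly by `contraction`.
    higher-order : ∀ i → suc (suc i) ℕ.≤ 5 →
      ι (b i) * (s * s) + ι (suc (suc i)) * (ι (b (suc i)) * s) + ι (b (suc (suc i))) * ((A - ι 1) * (κ * κ * (s * s))) ≤ (A * (s * s) - (ι 2 + A) * s + g + ι 1) * ι (b (suc (suc i))) →
      ∣ Δ^ (suc (suc i)) P N′ ∣≤ B (suc (suc i)) * (pow w′ (suc (suc i)) * P N′)
    higher-order i h c = cancel (abs-subst (sym (Δ^-recurrence L i N p)) (abs-weaken
        (abs-+ (abs-+ (at-N i (ℕₚ.≤-trans (ℕₚ.≤-trans (ℕₚ.n≤1+n i) (ℕₚ.n≤1+n (suc i))) h)) (higher-bound L A (Δ^ i₂ P) N V C (Γ * Γ) basel≤A p 0≤V V≤1 C0 (*-nonneg 0≤Γ 0≤Γ) ΓV smooth-i₂))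
          (abs-neg (abs-*ˡ (0≤ι i₂) (at-N (suc i) (ℕₚ.≤-trans (ℕₚ.n≤1+n (suc i)) h)))))
        (≤-reflexiveˡ collect (≤-trans (*-monoˡ (*-nonneg (pow-nonneg i₂ 0≤w) (0≤P N)) bound)
          (≤-reflexiveˡ (ring (v0 ⊗ (v1 ⊗ v2)) (v1 ⊗ (v2 ⊗ v0)) (w^ i₂ * P N ∷ ι N′ ∷ B i₂ ∷ []) refl) (*-monoˡ (0≤ι N′) (*-monoˡ (0≤B i₂) (rescale₁ i₂ h))))))))
      where
      i₂ = suc (suc i)
      C = B i₂ * (w^ i₂ * P N)
      C0 : ι 0 ≤ C
      C0 = *-nonneg (0≤B i₂) (*-nonneg (pow-nonneg i₂ 0≤w) (0≤P N))
      ΓV : Γ * Γ * ((ι 1 - V) * (ι 1 - V)) ≡ ι 1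
      ΓV = trans (ring (v0 ⊗ v0 ⊗ ((# 1 ⊖ (# 1 ⊖ v1)) ⊗ (# 1 ⊖ (# 1 ⊖ v1)))) ((v1 ⊗ v0) ⊗ (v1 ⊗ v0)) (Γ ∷ ν * w ∷ []) refl) (trans (cong (λ z → z * z) νwΓ) (1* _))
      smooth-i₂ : ∀ m → m ℕ.≤ N → ∣ Δ^ i₂ P m ∣≤ C * pow V (N ∸ m)
      smooth-i₂ m r = abs-weaken (smooth i₂ m h r) (≡⇒≤ (ring (v0 ⊗ (v1 ⊗ v2 ⊗ v3)) (v0 ⊗ (v1 ⊗ v3) ⊗ v2) (B i₂ ∷ w^ i₂ ∷ pow V (N ∸ m) ∷ P N ∷ []) refl))
      K₀ = B i * (s * s) + ι i₂ * (B (suc i) * s) + B i₂ * ((A - ι 1) * (κ * κ * (s * s)))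
      collect : B i * (w^ i * P N) + C * (Γ * Γ * (A - ι 1)) + ι i₂ * (B (suc i) * (w^ (suc i) * P N)) ≡ w^ i₂ * P N * K₀
      collect = sym (trans (ring (v0 ⊗ (v0 ⊗ v2) ⊗ v3 ⊗ (v4 ⊗ (v1 ⊗ v1) ⊕ v5 ⊗ (v6 ⊗ v1) ⊕ v7 ⊗ (v8 ⊗ (v9 ⊗ v9 ⊗ (v1 ⊗ v1)))))
          (v4 ⊗ ((v0 ⊗ v1) ⊗ (v0 ⊗ v1) ⊗ v2 ⊗ v3) ⊕ v7 ⊗ (v0 ⊗ (v0 ⊗ v2) ⊗ v3) ⊗ (v9 ⊗ v1 ⊗ (v9 ⊗ v1) ⊗ v8) ⊕ v5 ⊗ (v6 ⊗ ((v0 ⊗ v1) ⊗ (v0 ⊗ v2) ⊗ v3)))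
          (w ∷ s ∷ w^ i ∷ P N ∷ B i ∷ ι i₂ ∷ B (suc i) ∷ B i₂ ∷ A - ι 1 ∷ κ ∷ []) refl)
        (trans (cong (λ u → B i * (u * u * w^ i * P N) + C * (Γ * Γ * (A - ι 1)) + ι i₂ * (B (suc i) * (u * w^ (suc i) * P N))) w*s)
          (ring (v0 ⊗ (# 1 ⊗ # 1 ⊗ v1 ⊗ v2) ⊕ v3 ⊕ v4 ⊗ (v5 ⊗ (# 1 ⊗ v6 ⊗ v2))) (v0 ⊗ (v1 ⊗ v2) ⊕ v3 ⊕ v4 ⊗ (v5 ⊗ (v6 ⊗ v2)))
            (B i ∷ w^ i ∷ P N ∷ C * (Γ * Γ * (A - ι 1)) ∷ ι i₂ ∷ B (suc i) ∷ w^ (suc i) ∷ []) refl)))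
      bound : K₀ ≤ ι N′ * B i₂
      bound = *-cancel (1≤ιsuc 99) (≤-reflexiveˡ (trans (ring (# 100 ⊗ (v0 ⊗ v1 ⊕ v2 ⊗ (v3 ⊗ v4) ⊕ v5 ⊗ v6)) (# 100 ⊗ v0 ⊗ v1 ⊕ v2 ⊗ (# 100 ⊗ v3 ⊗ v4) ⊕ # 100 ⊗ v5 ⊗ v6)
            (B i ∷ s * s ∷ ι i₂ ∷ B (suc i) ∷ s ∷ B i₂ ∷ (A - ι 1) * (κ * κ * (s * s)) ∷ []) refl)
          (trans (cong₂ (λ x y → x * (s * s) + ι i₂ * (y * s) + ι 100 * B i₂ * ((A - ι 1) * (κ * κ * (s * s)))) (100B i) (100B (suc i)))
            (cong (λ z → ι (b i) * (s * s) + ι i₂ * (ι (b (suc i)) * s) + z * ((A - ι 1) * (κ * κ * (s * s)))) (100B i₂))))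
        (≤-reflexiveʳ c (trans (cong₂ _*_ (trans (+-congʳ (sym ιN)) (trans (+-comm _ _) (sym (ι-suc N)))) (sym (100B i₂))) (*-left-swap _ _ _))))
      cancel : ∀ {z y} → ∣ ι N′ * z ∣≤ ι N′ * y → ∣ z ∣≤ y
      cancel (a , c) = *-cancel (1≤ιsuc N) a , *-cancel (1≤ιsuc N) (≤-reflexiveˡ (sym (neg-*ʳ _ _)) c)

    smooth-N′ : ∀ i → i ℕ.≤ 5 → ∣ Δ^ i P N′ ∣≤ B i * (pow w′ i * P N′)
    smooth-N′ 0 _ = abs-weaken (abs-nonneg (0≤P N′)) (≡⇒≤ (sym (trans (cong (_* (ι 1 * P N′)) B0) (trans (1* _) (1* _)))))
      where
      B0 : B 0 ≡ ι 1
      B0 = inv-inverse (ι 100) (1≤ιsuc 99)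
    smooth-N′ 1 _ = abs-weaken (abs-nonneg (≤-reflexiveʳ (*-nonneg 0≤w′ (0≤P N′)) (sym ΔP′)))
      (≡⇒≤ (trans ΔP′ (sym (trans (cong (_* (w′ * ι 1 * P N′)) (inv-inverse (ι 100) (1≤ιsuc 99))) (ring (# 1 ⊗ (v0 ⊗ # 1 ⊗ v1)) (v0 ⊗ v1) (w′ ∷ P N′ ∷ []) refl)))))
    smooth-N′ 2 h = higher-order 0 h (contraction 2 100 100 124 refl)
    smooth-N′ 3 h = higher-order 1 h (contraction 3 100 124 129 refl)
    smooth-N′ 4 h = higher-order 2 h (contraction 4 124 129 162 refl)
    smooth-N′ 5 h = higher-order 3 h (contraction 5 129 162 176 refl)
    smooth-N′ (suc (suc (suc (suc (suc (suc _)))))) (s≤s (s≤s (s≤s (s≤s (s≤s ())))))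

    next : State A N′
    next = record
      { s = s′ ; w = w′ ; w*s = trans (*-comm w′ s′) s′w′ ; ΔP = ΔP′ ; 40≤s = 40≤s′ ; 0≤w = 0≤w′
      ; shift-lower = g′≥ ; shift-upper = g′≤ ; smooth = smooth′ }
      where
      smooth′ : ∀ i m → i ℕ.≤ 5 → m ℕ.≤ N′ → ∣ Δ^ i P m ∣≤ B i * (pow w′ i * pow V′ (N′ ∸ m) * P N′)
      smooth′ i m h q with ℕₚ.m≤n⇒m<n∨m≡n q
      ... | inj₁ (s≤s m≤N) = abs-weaken (smooth i m h m≤N) (*-monoˡ (0≤B i)
        (≤-reflexiveˡ (ring (v0 ⊗ v1 ⊗ v2) (v1 ⊗ (v0 ⊗ v2)) (w^ i ∷ pow V (N ∸ m) ∷ P N ∷ []) refl)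
          (≤-trans (*-mono (pow-nonneg (N ∸ m) 0≤V) (*-nonneg (pow-nonneg i 0≤w′) (*-nonneg 0≤V′ (0≤P N′))) (pow-mono (N ∸ m) 0≤V V≤V′) (rescale i h))
            (≡⇒≤ (trans (ring (v0 ⊗ (v1 ⊗ (v2 ⊗ v3))) (v1 ⊗ (v2 ⊗ v0) ⊗ v3) (pow V′ (N ∸ m) ∷ pow w′ i ∷ V′ ∷ P N′ ∷ []) refl)
              (cong (λ k → pow w′ i * pow V′ k * P N′) (sym (ℕₚ.+-∸-assoc 1 m≤N))))))))
      ... | inj₂ refl = abs-weaken (smooth-N′ i h) (≡⇒≤ (trans (cong (B i *_) (ring (v0 ⊗ v1) (v0 ⊗ # 1 ⊗ v1) (pow w′ i ∷ P N′ ∷ []) refl))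
        (cong (λ k → B i * (pow w′ i * pow V′ k * P N′)) (sym (ℕₚ.n∸n≡0 N′)))))

    Y≡ : P N₀ * P N′ ≡ (s - ι 1) * s′ * (q * q′)
    Y≡ = trans (cong₂ _*_ (trans (ring v0 (v1 ⊖ (v1 ⊖ v0)) (P N₀ ∷ P N ∷ []) refl) (cong (_- q) P≡)) P′≡)
      (ring ((v0 ⊗ v2 ⊖ v2) ⊗ (v1 ⊗ v3)) ((v0 ⊖ # 1) ⊗ v1 ⊗ (v2 ⊗ v3)) (s ∷ s′ ∷ q ∷ q′ ∷ []) refl)

    G≡ : P N * P N - P N₀ * P N′ ≡ δ * (q * q′)
    G≡ = trans (cong₂ _-_ (cong₂ _*_ P≡ (sym P-s′)) Y≡)
      (ring (v0 ⊗ v2 ⊗ ((v0 ⊕ v1 ⊖ # 1) ⊗ v3) ⊖ (v0 ⊖ # 1) ⊗ (v0 ⊕ v1) ⊗ (v2 ⊗ v3)) (v1 ⊗ (v2 ⊗ v3)) (s ∷ δ ∷ q ∷ q′ ∷ []) refl)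

    -- A quantitative form of positivity: the product equals n P(N)², and each of its factors is at
    -- least 1.
    gap-positive : ι 1 ≤ D * (s * (s′ - ι 1)) * (P N * P N - P N₀ * P N′)
    gap-positive = ≤-reflexiveʳ (≤-reflexiveˡ (sym (1* _)) (*-mono (0≤ι 1) (*-nonneg (0≤P N) (0≤P N)) n≥1
        (≤-reflexiveˡ (sym (1* _)) (*-mono (0≤ι 1) (0≤P N) (1≤P N) (1≤P N)))))
      (trans (cong₂ _*_ (sym Dδ) (cong₂ _*_ P≡ (sym P-s′)))
        (trans (ring (v0 ⊗ v1 ⊗ ((v2 ⊗ v3) ⊗ (v4 ⊗ v5))) (v0 ⊗ (v2 ⊗ v4) ⊗ (v1 ⊗ (v3 ⊗ v5))) (D ∷ δ ∷ s ∷ q ∷ s′ - ι 1 ∷ q′ ∷ []) refl)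
          (cong (D * (s * (s′ - ι 1)) *_) (sym G≡))))

    turán-strict : ¬ (P N * P N ≤ P N₀ * P N′)
    turán-strict h = 1≰0 (≤-trans gap-positive (0≤-⇒≤ (≤-reflexiveʳ
        (*-nonneg (*-nonneg (≤-trans (0≤ι 1) D≥1) (*-nonneg 0≤s (≤⇒0≤- 1≤s′))) (≤⇒0≤- h))
        (ring (v0 ⊗ (v2 ⊖ v1)) (# 0 ⊖ v0 ⊗ (v1 ⊖ v2)) (D * (s * (s′ - ι 1)) ∷ P N * P N ∷ P N₀ * P N′ ∷ []) refl))))

    s≤ιN : s ≤ ι N
    s≤ιN = ≤-reflexiveʳ N≥s (sym ιN)

    turán-gap : let Y = P N₀ * P N′ ; G = P N * P N - Y in ι 8 * s * (ι N * ι N * ι N) * (G * G) ≤ (ι 2 * A * s - ι 1) * (Y * Y)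
    turán-gap = ≤-reflexiveˡ (trans (cong₂ (λ z u → ι 8 * s * (z * z * z) * (u * u)) ιN G≡)
          (ring (# 8 ⊗ v0 ⊗ v1 ⊗ (v2 ⊗ v3 ⊗ (v2 ⊗ v3))) (v3 ⊗ v3 ⊗ (# 8 ⊗ v0 ⊗ (v1 ⊗ (v2 ⊗ v2)))) (s ∷ Nˢ * Nˢ * Nˢ ∷ δ ∷ q * q′ ∷ []) refl))
        (≤-reflexiveʳ (*-monoˡ (sq-nonneg (q * q′)) core)
          (trans (ring (v0 ⊗ v0 ⊗ (v1 ⊗ (v2 ⊗ v2 ⊗ (v3 ⊗ v3)))) (v1 ⊗ (v2 ⊗ v3 ⊗ v0 ⊗ (v2 ⊗ v3 ⊗ v0))) (q * q′ ∷ ι 2 * A * s - ι 1 ∷ s - ι 1 ∷ s′ ∷ []) refl)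
            (cong (λ u → (ι 2 * A * s - ι 1) * (u * u)) (sym Y≡))))
      where
      lead0 : ι 0 ≤ ι 2 * A * s - ι 1
      lead0 = ≤⇒0≤- (*-cancel (1≤ιsuc 99999999) (≤-trans (≤-reflexiveˡ (*-1 _) (ι-mono (ℕₚ.m≤m+n 100000000 13059472480)))
        (≤-trans (≤-reflexiveˡ (trans (ι-* 80 164493406) (*-comm _ _)) (≤-trans (*-monoʳ (0≤ι 80) A-lower) (≤-reflexiveˡ (ring (# 100000000 ⊗ v0 ⊗ # 80) (# 200000000 ⊗ v0 ⊗ # 40) (A ∷ []) refl) (*-monoˡ (*-nonneg (0≤ι 200000000) 0≤A) 40≤s))))
          (≡⇒≤ (ring (# 200000000 ⊗ v0 ⊗ v1) (# 100000000 ⊗ (# 2 ⊗ v0 ⊗ v1)) (A ∷ s ∷ []) refl)))))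
      core : ι 8 * s * (Nˢ * Nˢ * Nˢ * (δ * δ)) ≤ (ι 2 * A * s - ι 1) * ((s - ι 1) * (s - ι 1) * (s′ * s′))
      core = ≤-trans (*-cancel D≥1 (*-cancel D≥1 (≤-reflexiveˡ
          (trans (ring (v0 ⊗ (v0 ⊗ (# 8 ⊗ v1 ⊗ (v2 ⊗ (v3 ⊗ v3))))) (# 8 ⊗ v1 ⊗ (v2 ⊗ (v0 ⊗ v3 ⊗ (v0 ⊗ v3)))) (D ∷ s ∷ Nˢ * Nˢ * Nˢ ∷ δ ∷ []) refl) (cong (λ z → ι 8 * s * (Nˢ * Nˢ * Nˢ * (z * z))) Dδ))
          (≤-reflexiveʳ criterion (ring (v0 ⊗ v1 ⊗ (v2 ⊗ v2)) (v2 ⊗ (v2 ⊗ (v0 ⊗ v1))) (ι 2 * A * s - ι 1 ∷ (s - ι 1) * (s - ι 1) * (s * s) ∷ D ∷ []) refl)))))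
        (*-monoˡ lead0 (*-monoˡ (sq-nonneg (s - ι 1)) (*-mono 0≤s 0≤s′ s≤s′ s≤s′)))

  -- Small arguments

  divsum : ℕ → ℕ → ℕ → ℕ
  divsum zero l acc = acc
  divsum (suc j) l acc = divsum j l (if l % suc j ≡ᵇ 0 then suc j ℕ.+ acc else acc)

  σℕ : ℕ → ℕ
  σℕ l = divsum l l 0

  χ : ℕ → ℕ → F
  χ zero l = ι 0
  χ (suc j) l = if l % suc j ≡ᵇ 0 then ι 1 else ι 0

  divsum-spec : ∀ j l acc → ι (divsum j l acc) ≡ ι acc + ∑ j (λ i → ι i * χ i l)
  divsum-spec zero l acc = sym (+-0 _)
  divsum-spec (suc j) l acc with l % suc j ≡ᵇ 0
  ... | true = trans (divsum-spec j l (suc j ℕ.+ acc)) (trans (+-congʳ (ι-+ (suc j) acc))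
    (ring (v0 ⊕ v1 ⊕ v2) (v1 ⊕ (v2 ⊕ v0 ⊗ # 1)) (ι (suc j) ∷ ι acc ∷ ∑ j (λ i → ι i * χ i l) ∷ []) refl))
  ... | false = trans (divsum-spec j l acc) (+-congˡ (sym (trans (+-congˡ (*-0 _)) (+-0 _))))

  -- The indicator of multiples of j + 1, minus the indicator of 0, is an antidifference of `δ₀`
  -- with that step, and it vanishes at every remainder.
  multiples-δ₀ : ∀ L j l → suc l ℕ.≤ L → multiples L (suc j) δ₀ (suc l) ≡ χ (suc j) (suc l)
  multiples-δ₀ L j l q = trans (multiples-eval L j δ₀ β step (suc l) q) (trans (+-congˡ (cong -_ β%)) (trans (+-congˡ neg-0) (trans (+-0 _) (trans (+-congˡ neg-0) (+-0 _)))))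
    where
    β : Sq
    β y = χ (suc j) y - δ₀ y
    step : ∀ y → β (suc j ℕ.+ y) ≡ β y + δ₀ y
    step y = trans (cong₂ _-_ (cong (λ r → if r ≡ᵇ 0 then ι 1 else ι 0) (trans (cong (_% suc j) (ℕₚ.+-comm (suc j) y)) (DM.[m+n]%n≡m%n y (suc j)))) refl)
      (ring (v0 ⊖ # 0) (v0 ⊖ v1 ⊕ v1) (χ (suc j) y ∷ δ₀ y ∷ []) refl)
    β% : β (suc l % suc j) ≡ ι 0
    β% with suc l % suc j in e
    ... | zero = ring (# 1 ⊖ # 1) (# 0) [] refl
    ... | suc r = trans (cong (λ t → (if t ≡ᵇ 0 then ι 1 else ι 0) - ι 0) (DM.m<n⇒m%n≡m (subst (ℕ._< suc j) e (DM.m%n<n (suc l) (suc j)))))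
      (ring (# 0 ⊖ # 0) (# 0) [] refl)

  σ-spec : ∀ L l → l ℕ.≤ L → σ L l ≡ ι (σℕ l)
  σ-spec L zero q = trans (∑-cong L (λ { (suc j) _ _ → trans (cong (ι (suc j) *_) (trans (∑-cong L (λ { (suc m) _ _ → refl })) (∑-0 L))) (*-0 _) })) (∑-0 L)
  σ-spec L (suc l) q = trans (∑-cong L (λ { (suc j) _ _ → cong (ι (suc j) *_) (multiples-δ₀ L j l q) }))
    (trans (∑-trunc (λ j → ι j * χ j (suc l)) q beyond) (sym (trans (divsum-spec (suc l) (suc l) 0) (0+ _))))
    where
    beyond : ∀ i → suc l ℕ.< i → ι i * χ i (suc l) ≡ ι 0
    beyond (suc i) r = trans (cong (λ t → ι (suc i) * (if t ≡ᵇ 0 then ι 1 else ι 0)) (DM.m<n⇒m%n≡m r)) (*-0 _)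

  ι-injective : ∀ {m n} → ι m ≡ ι n → m ≡ n
  ι-injective e = ℕₚ.≤-antisym (fromℤ-reflects _ _ (≡⇒≤ e)) (fromℤ-reflects _ _ (≡⇒≤ (sym e)))

  -- Partition numbers from Euler's recurrence

  σlist : ℕ → ℕ → List ℕ
  σlist k zero = []
  σlist k (suc n) = σℕ k ∷ σlist (suc k) n

  dot : List ℕ → List ℕ → ℕ → ℕ
  dot [] bs acc = acc
  dot (a ∷ as) [] acc = acc
  dot (a ∷ as) (b ∷ bs) acc = dot as bs (a ℕ.* b ℕ.+ acc)

  -- The shorter table is an argument, so that it is shared between the product and the tail. The
  -- division is exact.
  extend : ℕ → List ℕ → List ℕ → List ℕ
  extend n ss ps = dot ss ps 0 / suc n ∷ ps

  pList : List ℕ → ℕ → List ℕ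
  pList ss zero = 1 ∷ []
  pList ss (suc n) = extend n ss (pList ss n)

  descending : ∀ {X : Set} → (ℕ → X) → ℕ → List X
  descending f zero = f 0 ∷ []
  descending f (suc n) = f (suc n) ∷ descending f n

  dot-spec : ∀ n k len acc → n ℕ.< len → ι (dot (σlist k len) (descending p n) acc) ≡ ι acc + conv (λ i → ι (σℕ (k ℕ.+ i))) P n
  dot-spec zero k (suc zero) acc q = trans (ι-+ (σℕ k ℕ.* p 0) acc) (trans (+-comm _ _) (+-congˡ (trans (ι-* (σℕ k) (p 0)) (cong (λ i → ι (σℕ i) * P 0) (sym (ℕₚ.+-identityʳ k))))))
  dot-spec zero k (suc (suc len)) acc q = trans (ι-+ (σℕ k ℕ.* p 0) acc) (trans (+-comm _ _) (+-congˡ (trans (ι-* (σℕ k) (p 0)) (cong (λ i → ι (σℕ i) * P 0) (sym (ℕₚ.+-identityʳ k))))))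
  dot-spec (suc n) k (suc len) acc (s≤s q) = trans (dot-spec n (suc k) len (σℕ k ℕ.* p (suc n) ℕ.+ acc) q)
    (trans (cong₂ _+_ (trans (ι-+ (σℕ k ℕ.* p (suc n)) acc) (trans (+-comm _ _) (+-congˡ (trans (ι-* (σℕ k) (p (suc n))) (cong (λ i → ι (σℕ i) * P (suc n)) (sym (ℕₚ.+-identityʳ k)))))))
      (conv-congˡ P n (λ m _ → cong (λ i → ι (σℕ i)) (sym (ℕₚ.+-suc k m))))) (+-assoc _ _ _))

  p-recurrence : ∀ n len → n ℕ.< len → dot (σlist 1 len) (descending p n) 0 ≡ p (suc n) ℕ.* suc n
  p-recurrence n len q = ι-injective (trans (dot-spec n 1 len 0 q) (trans (0+ _) (trans (sym eq) (trans (*-comm _ _) (sym (ι-* (p (suc n)) (suc n)))))))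
    where
    L = suc n
    eq : ι (suc n) * P (suc n) ≡ conv (λ i → ι (σℕ (1 ℕ.+ i))) P n
    eq = trans (nP-conv L (suc n) ℕₚ.≤-refl) (trans (+-congʳ (trans (cong (_* P (suc n)) (σ-spec L 0 z≤n)) (0* _)))
      (trans (0+ _) (conv-congˡ P n (λ m r → σ-spec L (suc m) (s≤s r)))))

  pList-spec : ∀ len n → n ℕ.≤ len → pList (σlist 1 len) n ≡ descending p n
  pList-spec len zero q = refl
  pList-spec len (suc n) q = trans (cong (extend n (σlist 1 len)) (pList-spec len n (ℕₚ.≤-trans (ℕₚ.n≤1+n n) q)))
    (cong (_∷ descending p n) (trans (cong (_/ suc n) (p-recurrence n len q)) (DM.m*n/n≡m (p (suc n)) (suc n))))

  -- Numerical bound on R up to 1600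

  ≤ᵇ-sound : ∀ m n → (m ≤ᵇ n) ≡ true → m ℕ.≤ n
  ≤ᵇ-sound m n e = ℕₚ.≤ᵇ⇒≤ m n (Equivalence.from T-≡ e)

  -- The two halves of |10 R| ≤ Q times 2.4 · 10⁹, where `t` is the threefold sum of σ. The first
  -- uses the lower eight-digit bound for A and the second the upper one.
  R-ok : ℕ → ℕ → Bool
  R-ok x t = (24000000000 ℕ.* t ℕ.+ 2000000000 ℕ.* (x ℕ.* (x ℕ.+ 1) ℕ.* (x ℕ.+ 2)) ≤ᵇ 1200000000 ℕ.* ((x ℕ.+ 1) ℕ.* (x ℕ.+ 2)) ℕ.+ 1644934060 ℕ.* (x ℕ.* (x ℕ.+ 1) ℕ.* (x ℕ.+ 2) ℕ.* (x ℕ.+ 3)))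
    ∧ (1644934070 ℕ.* (x ℕ.* (x ℕ.+ 1) ℕ.* (x ℕ.+ 2) ℕ.* (x ℕ.+ 3)) ≤ᵇ 1200000000 ℕ.* ((x ℕ.+ 1) ℕ.* (x ℕ.+ 2)) ℕ.+ (24000000000 ℕ.* t ℕ.+ 2000000000 ℕ.* (x ℕ.* (x ℕ.+ 1) ℕ.* (x ℕ.+ 2))))

  -- s₁, s₂, s₃ are the first three iterated partial sums of σ at x.
  scan scan′ scan″ : (ℕ → ℕ → Bool) → ℕ → ℕ → ℕ → ℕ → ℕ → Bool
  scan ok zero x s₁ s₂ s₃ = true
  scan ok (suc f) x s₁ s₂ s₃ = scan′ ok f (suc x) (s₁ ℕ.+ σℕ (suc x)) s₂ s₃
  scan′ ok f x s₁ s₂ s₃ = scan″ ok f x s₁ (s₂ ℕ.+ s₁) s₃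
  scan″ ok f x s₁ s₂ s₃ = ok x (s₃ ℕ.+ s₂) ∧ scan ok f x s₁ s₂ (s₃ ℕ.+ s₂)

  module _ (L : ℕ) (ok : ℕ → ℕ → Bool) (Good : ℕ → Set) (sound : ∀ x t → ι t ≡ S (S (S (σ L))) x → ok x t ≡ true → Good x) where

    scan-sound : ∀ f x s₁ s₂ s₃ → ι s₁ ≡ S (σ L) x → ι s₂ ≡ S (S (σ L)) x → ι s₃ ≡ S (S (S (σ L))) x → scan ok f x s₁ s₂ s₃ ≡ true →
      ∀ y → x ℕ.< y → y ℕ.≤ x ℕ.+ f → y ℕ.≤ L → Good y
    scan-sound zero x s₁ s₂ s₃ e₁ e₂ e₃ h y p q r = ⊥-elim (ℕₚ.<⇒≱ p (subst (y ℕ.≤_) (ℕₚ.+-identityʳ x) q))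
    scan-sound (suc f) x s₁ s₂ s₃ e₁ e₂ e₃ h y p q r = go (ℕₚ.m≤n⇒m<n∨m≡n p) (∧-true h)
      where
      t₁ t₂ t₃ : ℕ
      t₁ = s₁ ℕ.+ σℕ (suc x)
      t₂ = s₂ ℕ.+ t₁
      t₃ = s₃ ℕ.+ t₂
      E₁ : ι t₁ ≡ S (σ L) (suc x)
      E₁ = trans (ι-+ s₁ (σℕ (suc x))) (cong₂ _+_ e₁ (sym (σ-spec L (suc x) (ℕₚ.≤-trans p r))))
      E₂ : ι t₂ ≡ S (S (σ L)) (suc x)
      E₂ = trans (ι-+ s₂ t₁) (cong₂ _+_ e₂ E₁)
      E₃ : ι t₃ ≡ S (S (S (σ L))) (suc x)
      E₃ = trans (ι-+ s₃ t₂) (cong₂ _+_ e₃ E₂)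
      go : (suc x ℕ.< y) ⊎ (suc x ≡ y) → (ok (suc x) t₃ ≡ true) × (scan ok f (suc x) t₁ t₂ t₃ ≡ true) → Good y
      go (inj₂ refl) (h₀ , _) = sound (suc x) t₃ E₃ h₀
      go (inj₁ p′) (_ , h₁) = scan-sound f (suc x) t₁ t₂ t₃ E₁ E₂ E₃ h₁ y p′ (subst (y ℕ.≤_) (ℕₚ.+-suc x f) q) r

  module _ (A : F) (A≥ : ι 164493406 ≤ ι 100000000 * A) (A≤ : ι 100000000 * A ≤ ι 164493407) (L : ℕ) where

    private
      S³σ : Sq
      S³σ = S (S (S (σ L)))

    R-ok-sound : ∀ x t → ι t ≡ S³σ x → R-ok x t ≡ true → ∣ ι 10 * R A L x ∣≤ Q x
    R-ok-sound x t e h = upper , lower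
      where
      R≡ : R A L x ≡ S³σ x - S (S (S (τ A))) x
      R≡ = trans (sym (S³e L A x)) (trans (S-cong x (λ k _ → trans (S-cong k (λ l _ → S-sub (σ L) (τ A) l)) (S-sub (S (σ L)) (S (τ A)) k))) (S-sub (S (S (σ L))) (S (S (τ A))) x))
      ξ = ι x
      W = ξ * (ξ + ι 1) * (ξ + ι 2) * (ξ + ι 3)
      U = ξ * (ξ + ι 1) * (ξ + ι 2)
      V = (ξ + ι 1) * (ξ + ι 2)
      W0 : ι 0 ≤ W
      W0 = pos (# 0) (v0 ⊗ (v0 ⊕ # 1) ⊗ (v0 ⊕ # 2) ⊗ (v0 ⊕ # 3)) (ξ ∷ []) (0≤ι x , tt) refl
      ιU : ι (x ℕ.* (x ℕ.+ 1) ℕ.* (x ℕ.+ 2)) ≡ U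
      ιU = trans (ι-* (x ℕ.* (x ℕ.+ 1)) (x ℕ.+ 2)) (cong₂ _*_ (trans (ι-* x (x ℕ.+ 1)) (cong (ξ *_) (ι-+ x 1))) (ι-+ x 2))
      ιW : ι (x ℕ.* (x ℕ.+ 1) ℕ.* (x ℕ.+ 2) ℕ.* (x ℕ.+ 3)) ≡ W
      ιW = trans (ι-* (x ℕ.* (x ℕ.+ 1) ℕ.* (x ℕ.+ 2)) (x ℕ.+ 3)) (cong₂ _*_ ιU (ι-+ x 3))
      ιV : ι ((x ℕ.+ 1) ℕ.* (x ℕ.+ 2)) ≡ V
      ιV = trans (ι-* (x ℕ.+ 1) (x ℕ.+ 2)) (cong₂ _*_ (ι-+ x 1) (ι-+ x 2))
      scaled : ∀ k m → {z : F} → ι m ≡ z → ι (k ℕ.* m) ≡ ι k * z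
      scaled k m h = trans (ι-* k m) (cong (ι k *_) h)
      ιTU : ι (24000000000 ℕ.* t ℕ.+ 2000000000 ℕ.* (x ℕ.* (x ℕ.+ 1) ℕ.* (x ℕ.+ 2))) ≡ ι 24000000000 * S³σ x + ι 2000000000 * U
      ιTU = trans (ι-+ (24000000000 ℕ.* t) (2000000000 ℕ.* (x ℕ.* (x ℕ.+ 1) ℕ.* (x ℕ.+ 2)))) (cong₂ _+_ (scaled 24000000000 t e) (scaled 2000000000 (x ℕ.* (x ℕ.+ 1) ℕ.* (x ℕ.+ 2)) ιU))
      ιVV = scaled 1200000000 ((x ℕ.+ 1) ℕ.* (x ℕ.+ 2)) ιV
      h₁ : ι 24000000000 * S³σ x + ι 2000000000 * U ≤ ι 1200000000 * V + ι 1644934060 * W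
      h₁ = ≤-reflexiveˡ (sym ιTU) (≤-reflexiveʳ (ι-mono (≤ᵇ-sound _ _ (proj₁ (∧-true h)))) (trans (ι-+ (1200000000 ℕ.* ((x ℕ.+ 1) ℕ.* (x ℕ.+ 2))) _) (cong₂ _+_ ιVV (scaled 1644934060 (x ℕ.* (x ℕ.+ 1) ℕ.* (x ℕ.+ 2) ℕ.* (x ℕ.+ 3)) ιW))))
      h₂ : ι 1644934070 * W ≤ ι 1200000000 * V + (ι 24000000000 * S³σ x + ι 2000000000 * U)
      h₂ = ≤-reflexiveˡ (sym (scaled 1644934070 (x ℕ.* (x ℕ.+ 1) ℕ.* (x ℕ.+ 2) ℕ.* (x ℕ.+ 3)) ιW)) (≤-reflexiveʳ (ι-mono (≤ᵇ-sound _ _ (proj₂ (∧-true h))))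
        (trans (ι-+ (1200000000 ℕ.* ((x ℕ.+ 1) ℕ.* (x ℕ.+ 2))) _) (cong₂ _+_ ιVV ιTU)))
      Q≡ : ι 2400000000 * Q x ≡ ι 1200000000 * V
      Q≡ = trans (ring (# 2400000000 ⊗ v0) (# 300000000 ⊗ (# 8 ⊗ v0)) (Q x ∷ []) refl) (trans (cong (ι 300000000 *_) (Q-closed x))
        (ring (# 300000000 ⊗ ((# 2 ⊗ v0 ⊕ # 3) ⊗ (# 2 ⊗ v0 ⊕ # 3) ⊖ # 1)) (# 1200000000 ⊗ ((v0 ⊕ # 1) ⊗ (v0 ⊕ # 2))) (ξ ∷ []) refl))
      R₁₀ : ι 2400000000 * (ι 10 * R A L x) ≡ ι 24000000000 * S³σ x + ι 2000000000 * U - ι 10 * (ι 100000000 * A * W)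
      R₁₀ = trans (cong (λ z → ι 2400000000 * (ι 10 * z)) R≡) (trans (ring (# 2400000000 ⊗ (# 10 ⊗ (v0 ⊖ v1))) (# 24000000000 ⊗ v0 ⊖ # 1000000000 ⊗ (# 24 ⊗ v1)) (S³σ x ∷ S (S (S (τ A))) x ∷ []) refl)
        (trans (cong (λ z → ι 24000000000 * S³σ x - ι 1000000000 * z) (S³τ A x))
          (ring (# 24000000000 ⊗ v0 ⊖ # 1000000000 ⊗ (v1 ⊗ (v2 ⊗ (v2 ⊕ # 1) ⊗ (v2 ⊕ # 2) ⊗ (v2 ⊕ # 3)) ⊖ # 2 ⊗ (v2 ⊗ (v2 ⊕ # 1) ⊗ (v2 ⊕ # 2))))
            (# 24000000000 ⊗ v0 ⊕ # 2000000000 ⊗ (v2 ⊗ (v2 ⊕ # 1) ⊗ (v2 ⊕ # 2)) ⊖ # 10 ⊗ (# 100000000 ⊗ v1 ⊗ (v2 ⊗ (v2 ⊕ # 1) ⊗ (v2 ⊕ # 2) ⊗ (v2 ⊕ # 3)))) (S³σ x ∷ A ∷ ξ ∷ []) refl)))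
      upper : ι 10 * R A L x ≤ Q x
      upper = *-cancel (1≤ιsuc 2399999999) (≤-reflexiveˡ R₁₀ (≤-reflexiveʳ (≤-trans (+-mono h₁ (neg-mono (*-monoˡ (0≤ι 10) (*-monoʳ W0 A≥))))
        (≡⇒≤ (ring (# 1200000000 ⊗ v0 ⊕ # 1644934060 ⊗ v1 ⊖ # 10 ⊗ (# 164493406 ⊗ v1)) (# 1200000000 ⊗ v0) (V ∷ W ∷ []) refl))) (sym Q≡)))
      lower : - (ι 10 * R A L x) ≤ Q x
      lower = *-cancel (1≤ιsuc 2399999999) (≤-reflexiveˡ (trans (sym (neg-*ʳ _ _)) (cong -_ R₁₀)) (≤-reflexiveʳ (≤-trans
        (≤-reflexiveˡ (ring (⊝ (v0 ⊖ # 10 ⊗ (v1 ⊗ v2))) (# 10 ⊗ (v1 ⊗ v2) ⊖ v0) (ι 24000000000 * S³σ x + ι 2000000000 * U ∷ ι 100000000 * A ∷ W ∷ []) refl)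
          (+-mono (≤-trans (*-monoˡ (0≤ι 10) (*-monoʳ W0 A≤)) (≤-reflexiveˡ (ring (# 10 ⊗ (# 164493407 ⊗ v0)) (# 1644934070 ⊗ v0) (W ∷ []) refl) h₂)) ≤-refl))
        (≡⇒≤ (ring (v0 ⊕ v1 ⊖ v1) v0 (ι 1200000000 * V ∷ ι 24000000000 * S³σ x + ι 2000000000 * U ∷ []) refl))) (sym Q≡)))

    abstract
      R-check : scan R-ok 1600 0 0 0 0 ≡ true
      R-check = refl

    R-bound-small : ∀ y → 1 ℕ.≤ y → y ℕ.≤ 1600 → y ℕ.≤ L → ∣ ι 10 * R A L y ∣≤ Q y
    R-bound-small y = scan-sound L R-ok (λ x → ∣ ι 10 * R A L x ∣≤ Q x) R-ok-sound 1600 0 0 0 0 (sym (σ-spec L 0 z≤n)) (sym (σ-spec L 0 z≤n)) (sym (σ-spec L 0 z≤n)) R-check y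

  -- Partial sums of ∑ 1/k²

  recip : ℕ → F
  recip m = inv (ι m)

  recip-inverse : ∀ m → ι (suc m) * recip (suc m) ≡ ι 1
  recip-inverse m = inv-inverse (ι (suc m)) (1≤ιsuc m)

  0≤recip : ∀ m → ι 0 ≤ recip (suc m)
  0≤recip m = inv-nonneg (ι (suc m)) (1≤ιsuc m)

  -- Six times the Euler–Maclaurin approximation of π²/6 from the first M terms.
  β : ℕ → F
  β M = ι 6 * basel₂ M + (ι 6 * I - ι 3 * (I * I) + I * I * I)
    where I = recip M

  pow5 : F → F
  pow5 x = x * x * x * x * x

  module _ (m : ℕ) where
    private
      μ a c : F
      μ = ι (suc m)
      a = recip (suc m)
      c = recip (suc (suc m))
      u v : F
      u = μ * a
      v = (ι 1 + μ) * c
      u1 : u ≡ ι 1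
      u1 = recip-inverse m
      v1≡ : v ≡ ι 1
      v1≡ = trans (cong (_* c) (sym (ι-suc (suc m)))) (recip-inverse (suc m))
      a0 : ι 0 ≤ a
      a0 = 0≤recip m
      c0 : ι 0 ≤ c
      c0 = 0≤recip (suc m)

    -- The correction terms are such that one step leaves exactly 1/(m + 1)³(m + 2)³, so β
    -- decreases.
    β-step : β (suc m) - β (suc (suc m)) ≡ a * a * a * (c * c * c)
    β-step = trans (ring (# 6 ⊗ v0 ⊕ (# 6 ⊗ v1 ⊖ # 3 ⊗ (v1 ⊗ v1) ⊕ v1 ⊗ v1 ⊗ v1) ⊖ (# 6 ⊗ (v0 ⊕ v2 ⊗ v2) ⊕ (# 6 ⊗ v2 ⊖ # 3 ⊗ (v2 ⊗ v2) ⊕ v2 ⊗ v2 ⊗ v2)))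
        (e v1 v2 (# 1) (# 1)) (basel₂ (suc m) ∷ a ∷ c ∷ []) refl)
      -- Factors `u` and `v`, both equal to 1, make every term of degree 3 in `a` and in `c`; the
      -- claim is then an identity of polynomials.
      (trans (cong₂ (λ x y → ⟦ e v0 v1 v2 v3 ⟧ (a ∷ c ∷ x ∷ y ∷ [])) (sym u1) (sym v1≡))
        (ring (e v1 v2 (v0 ⊗ v1) ((# 1 ⊕ v0) ⊗ v2)) (v1 ⊗ v1 ⊗ v1 ⊗ (v2 ⊗ v2 ⊗ v2)) (μ ∷ a ∷ c ∷ []) refl))
      where
      e : ∀ {k} → Expr k → Expr k → Expr k → Expr k → Expr k
      e a c u v = # 6 ⊗ a ⊗ (u ⊗ u) ⊗ (v ⊗ v ⊗ v) ⊖ # 6 ⊗ c ⊗ (u ⊗ u ⊗ u) ⊗ (v ⊗ v) ⊖ # 3 ⊗ (a ⊗ a) ⊗ u ⊗ (v ⊗ v ⊗ v) ⊖ # 3 ⊗ (c ⊗ c) ⊗ (u ⊗ u ⊗ u) ⊗ v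
        ⊕ a ⊗ a ⊗ a ⊗ (v ⊗ v ⊗ v) ⊖ c ⊗ c ⊗ c ⊗ (u ⊗ u ⊗ u)

    -- With k = m + 1 this is the identity (k + 1)⁵ - k⁵ - 5k²(k + 1)² = 5k² + 5k + 1, divided by
    -- k⁵(k + 1)⁵. The right side telescopes.
    β-step-bound : ι 5 * (β (suc m) - β (suc (suc m))) ≤ pow5 a - pow5 c
    β-step-bound = ≤-reflexiveˡ (cong (ι 5 *_) β-step) (0≤-⇒≤ (≤-reflexiveʳ
        (pos (# 0) (f v1 ⊗ f v2 ⊗ (# 5 ⊗ (v0 ⊗ v0) ⊕ # 5 ⊗ v0 ⊕ # 1)) (μ ∷ a ∷ c ∷ []) (0≤ι (suc m) , a0 , c0 , tt) refl)
      (trans (ring (f v1 ⊗ f v2 ⊗ (# 5 ⊗ (v0 ⊗ v0) ⊕ # 5 ⊗ v0 ⊕ # 1)) (g v1 v2 (v0 ⊗ v1) ((# 1 ⊕ v0) ⊗ v2)) (μ ∷ a ∷ c ∷ []) refl)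
        (trans (cong₂ (λ x y → ⟦ g v0 v1 v2 v3 ⟧ (a ∷ c ∷ x ∷ y ∷ [])) u1 v1≡)
          (ring (g v0 v1 (# 1) (# 1)) (f v0 ⊖ f v1 ⊖ # 5 ⊗ (v0 ⊗ v0 ⊗ v0 ⊗ (v1 ⊗ v1 ⊗ v1))) (a ∷ c ∷ []) refl)))))
      where
      f : ∀ {k} → Expr k → Expr k
      f x = x ⊗ x ⊗ x ⊗ x ⊗ x
      g : ∀ {k} → Expr k → Expr k → Expr k → Expr k → Expr k
      g a c u v = f a ⊗ f v ⊖ f c ⊗ f u ⊖ # 5 ⊗ (a ⊗ a ⊗ a ⊗ (c ⊗ c ⊗ c) ⊗ (u ⊗ u) ⊗ (v ⊗ v))

    β-decreasing : ι 0 ≤ β (suc m) - β (suc (suc m))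
    β-decreasing = ≤-reflexiveʳ (pos (# 0) (v0 ⊗ v0 ⊗ v0 ⊗ (v1 ⊗ v1 ⊗ v1)) (a ∷ c ∷ []) (a0 , c0 , tt) refl) (sym β-step)

  β-gap : ∀ m k → (ι 0 ≤ β (suc m) - β (suc (m ℕ.+ k))) × (ι 5 * (β (suc m) - β (suc (m ℕ.+ k))) ≤ pow5 (recip (suc m)) - pow5 (recip (suc (m ℕ.+ k))))
  β-gap m zero = subst (λ j → (ι 0 ≤ β (suc m) - β (suc j)) × (ι 5 * (β (suc m) - β (suc j)) ≤ pow5 (recip (suc m)) - pow5 (recip (suc j)))) (sym (ℕₚ.+-identityʳ m))
    (≡⇒≤ (ring (# 0) (v0 ⊖ v0) (β (suc m) ∷ []) refl) , ≡⇒≤ (ring (# 5 ⊗ (v0 ⊖ v0)) (v1 ⊖ v1) (β (suc m) ∷ pow5 (recip (suc m)) ∷ []) refl))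
  β-gap m (suc k) = subst (λ j → (ι 0 ≤ β (suc m) - β (suc j)) × (ι 5 * (β (suc m) - β (suc j)) ≤ pow5 (recip (suc m)) - pow5 (recip (suc j)))) (sym (ℕₚ.+-suc m k))
    ( ≤-reflexiveʳ (+-nonneg (proj₁ ih) (β-decreasing (m ℕ.+ k))) (ring (v0 ⊖ v1 ⊕ (v1 ⊖ v2)) (v0 ⊖ v2) (β (suc m) ∷ β (suc (m ℕ.+ k)) ∷ β (suc (suc (m ℕ.+ k))) ∷ []) refl)
    , ≤-reflexiveˡ (ring (# 5 ⊗ (v0 ⊖ v2)) (# 5 ⊗ (v0 ⊖ v1) ⊕ # 5 ⊗ (v1 ⊖ v2)) (β (suc m) ∷ β (suc (m ℕ.+ k)) ∷ β (suc (suc (m ℕ.+ k))) ∷ []) refl)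
        (≤-reflexiveʳ (+-mono (proj₂ ih) (β-step-bound (m ℕ.+ k)))
          (ring (v0 ⊖ v1 ⊕ (v1 ⊖ v2)) (v0 ⊖ v2) (pow5 (recip (suc m)) ∷ pow5 (recip (suc (m ℕ.+ k))) ∷ pow5 (recip (suc (suc (m ℕ.+ k)))) ∷ []) refl)) )
    where ih = β-gap m k

  -- The rational substitute for π²/6. Since β decreases, comparing `β M` with `β L` for M ≤ L gives
  -- the defects their sign.
  A : ℕ → F
  A L = β L * inv (ι 6)

  6A : ∀ L → ι 6 * A L ≡ β L
  6A L = trans (*-left-swap _ _ _) (trans (cong (β L *_) (inv-inverse (ι 6) (1≤ιsuc 5))) (*-1 _))

  pow5-nonneg : ∀ {x} → ι 0 ≤ x → ι 0 ≤ pow5 x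
  pow5-nonneg h = *-nonneg (*-nonneg (*-nonneg (*-nonneg h h) h) h) h

  β-between : ∀ m L → suc m ℕ.≤ L → (ι 0 ≤ β (suc m) - β L) × (ι 5 * (β (suc m) - β L) ≤ pow5 (recip (suc m)))
  β-between m (suc L) (s≤s h) with subst (λ j → (ι 0 ≤ β (suc m) - β (suc j)) × (ι 5 * (β (suc m) - β (suc j)) ≤ pow5 (recip (suc m)) - pow5 (recip (suc j)))) (ℕₚ.m+[n∸m]≡n h) (β-gap m (L ∸ m))
  ... | p , q = p , ≤-trans q (0≤-⇒≤ (≤-reflexiveʳ (pow5-nonneg (0≤recip L)) (ring v0 (v1 ⊖ (v1 ⊖ v0)) (pow5 (recip (suc L)) ∷ pow5 (recip (suc m)) ∷ []) refl)))

  defect≡ : ∀ m L → defect (A L) (suc m) ≡ ι (suc m) * ι (suc m) * ι (suc m) * (β (suc m) - β L)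
  defect≡ m L = sym (trans (cong (λ z → μ * μ * μ * (β (suc m) - z)) (sym (6A L)))
    (trans (ring (v0 ⊗ v0 ⊗ v0 ⊗ (# 6 ⊗ v1 ⊕ (# 6 ⊗ v2 ⊖ # 3 ⊗ (v2 ⊗ v2) ⊕ v2 ⊗ v2 ⊗ v2) ⊖ # 6 ⊗ v3))
        (# 6 ⊗ (v0 ⊗ v0 ⊗ v0) ⊗ (v1 ⊖ v3) ⊕ # 6 ⊗ (v0 ⊗ v0) ⊗ (v0 ⊗ v2) ⊖ # 3 ⊗ v0 ⊗ ((v0 ⊗ v2) ⊗ (v0 ⊗ v2)) ⊕ (v0 ⊗ v2) ⊗ (v0 ⊗ v2) ⊗ (v0 ⊗ v2)) (μ ∷ basel₂ (suc m) ∷ recip (suc m) ∷ A L ∷ []) refl)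
      (trans (cong (λ u → ι 6 * (μ * μ * μ) * (basel₂ (suc m) - A L) + ι 6 * (μ * μ) * u - ι 3 * μ * (u * u) + u * u * u) (recip-inverse m))
        (ring (v0 ⊕ v1 ⊗ # 1 ⊖ v2 ⊗ (# 1 ⊗ # 1) ⊕ # 1 ⊗ # 1 ⊗ # 1) (v0 ⊕ v1 ⊖ v2 ⊕ # 1) (ι 6 * (μ * μ * μ) * (basel₂ (suc m) - A L) ∷ ι 6 * (μ * μ) ∷ ι 3 * μ ∷ []) refl))))
    where μ = ι (suc m)

  defect-bounds : ∀ m L → suc m ℕ.≤ L → (ι 0 ≤ defect (A L) (suc m)) × (ι 5 * (ι (suc m) * ι (suc m)) * defect (A L) (suc m) ≤ ι 1)
  defect-bounds m L h = ≤-reflexiveʳ (*-nonneg μ³ (proj₁ bounds)) (sym (defect≡ m L))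
    , ≤-reflexiveˡ (trans (cong (ι 5 * (μ * μ) *_) (defect≡ m L)) (ring (# 5 ⊗ (v0 ⊗ v0) ⊗ (v0 ⊗ v0 ⊗ v0 ⊗ v1)) (v0 ⊗ v0 ⊗ v0 ⊗ (v0 ⊗ v0) ⊗ (# 5 ⊗ v1)) (μ ∷ β (suc m) - β L ∷ []) refl))
        (≤-reflexiveʳ (*-monoˡ (*-nonneg μ³ (*-nonneg (0≤ι (suc m)) (0≤ι (suc m)))) (proj₂ bounds))
          (trans (ring (v0 ⊗ v0 ⊗ v0 ⊗ (v0 ⊗ v0) ⊗ (v1 ⊗ v1 ⊗ v1 ⊗ v1 ⊗ v1)) ((v0 ⊗ v1) ⊗ (v0 ⊗ v1) ⊗ (v0 ⊗ v1) ⊗ (v0 ⊗ v1) ⊗ (v0 ⊗ v1)) (μ ∷ recip (suc m) ∷ []) refl)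
            (trans (cong (λ u → u * u * u * u * u) (recip-inverse m)) (ring (# 1 ⊗ # 1 ⊗ # 1 ⊗ # 1 ⊗ # 1) (# 1) [] refl))))
    where
    μ = ι (suc m)
    bounds = β-between m L h
    μ³ : ι 0 ≤ μ * μ * μ
    μ³ = *-nonneg (*-nonneg (0≤ι (suc m)) (0≤ι (suc m))) (0≤ι (suc m))

  -- ∑_{k ≤ n} ⌊10¹³/k²⌋
  basel-floor : ℕ → ℕ
  basel-floor zero = 0
  basel-floor (suc n) = basel-floor n ℕ.+ 10000000000000 / (suc n ℕ.* suc n)

  floor-bounds : ∀ n → (ι (basel-floor n) ≤ ι 10000000000000 * basel₂ n) × (ι 10000000000000 * basel₂ n ≤ ι (basel-floor n ℕ.+ n))
  floor-bounds zero = ≡⇒≤ (sym (*-0 _)) , ≡⇒≤ (*-0 _)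
  floor-bounds (suc n) = ≤-reflexiveˡ (ι-+ (basel-floor n) d) (≤-reflexiveʳ (+-mono (proj₁ ih) lo) (sym (*-distribˡ _ _ _)))
    , ≤-reflexiveˡ (*-distribˡ _ _ _) (≤-reflexiveʳ (+-mono (proj₂ ih) hi) (trans (sym (ι-+ (basel-floor n ℕ.+ n) (d ℕ.+ 1))) (cong ι shuffle)))
    where
    ih = floor-bounds n
    k = suc n ℕ.* suc n
    d = 10000000000000 / k
    X = ι 10000000000000
    I = recip (suc n)
    kI : ∀ z → z ≡ ι k * z * (I * I)
    kI z = sym (trans (cong (λ t → t * z * (I * I)) (ι-* (suc n) (suc n))) (trans (ring (v0 ⊗ v0 ⊗ v1 ⊗ (v2 ⊗ v2)) ((v0 ⊗ v2) ⊗ (v0 ⊗ v2) ⊗ v1) (ι (suc n) ∷ z ∷ I ∷ []) refl)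
      (trans (cong (λ u → u * u * z) (recip-inverse n)) (ring (# 1 ⊗ # 1 ⊗ v0) v0 (z ∷ []) refl))))
    I² : ι 0 ≤ I * I
    I² = *-nonneg (0≤recip n) (0≤recip n)
    lo : ι d ≤ X * (I * I)
    lo = ≤-reflexiveˡ (kI (ι d)) (*-monoʳ I² (≤-reflexiveˡ (trans (*-comm _ _) (sym (ι-* d k))) (ι-mono (DM.m/n*n≤m 10000000000000 k))))
    hi : X * (I * I) ≤ ι (d ℕ.+ 1)
    hi = ≤-reflexiveʳ (*-monoʳ I² (≤-reflexiveʳ (ι-mono (ℕₚ.≤-trans (ℕₚ.≤-reflexive (DM.m≡m%n+[m/n]*n 10000000000000 k)) (ℕₚ.≤-trans (ℕₚ.+-monoˡ-≤ (d ℕ.* k) (ℕₚ.<⇒≤ (DM.m%n<n 10000000000000 k))) (ℕₚ.≤-reflexive (cong (ℕ._* k) (ℕₚ.+-comm 1 d)))))) (trans (ι-* (d ℕ.+ 1) k) (*-comm _ _)))) (sym (kI (ι (d ℕ.+ 1))))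
    shuffle : basel-floor n ℕ.+ n ℕ.+ (d ℕ.+ 1) ≡ basel-floor n ℕ.+ d ℕ.+ suc n
    shuffle = trans (ℕₚ.+-assoc (basel-floor n) n (d ℕ.+ 1)) (trans (cong (basel-floor n ℕ.+_) (trans (ℕₚ.+-comm n (d ℕ.+ 1)) (trans (ℕₚ.+-assoc d 1 n) refl))) (sym (ℕₚ.+-assoc (basel-floor n) d (suc n))))

  module _ (L : ℕ) (40≤L : 40 ℕ.≤ L) where

    private
      b₄₀ = β-between 39 L 40≤L
      I₄₀ : F
      I₄₀ = recip 40
      E : F
      E = ι 6 * I₄₀ - ι 3 * (I₄₀ * I₄₀) + I₄₀ * I₄₀ * I₄₀
      40J : ι 40 * I₄₀ ≡ ι 1
      40J = recip-inverse 39
      -- 6/40 - 3/40² + 1/40³ = (9600 - 120 + 1)/64000.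
      E≡ : ι 64000 * E ≡ ι 9481
      E≡ = trans (ring (# 64000 ⊗ (# 6 ⊗ v0 ⊖ # 3 ⊗ (v0 ⊗ v0) ⊕ v0 ⊗ v0 ⊗ v0)) (# 9600 ⊗ (# 40 ⊗ v0) ⊖ # 120 ⊗ ((# 40 ⊗ v0) ⊗ (# 40 ⊗ v0)) ⊕ (# 40 ⊗ v0) ⊗ (# 40 ⊗ v0) ⊗ (# 40 ⊗ v0)) (I₄₀ ∷ []) refl)
        (trans (cong (λ u → ι 9600 * u - ι 120 * (u * u) + u * u * u) 40J) (ring (# 9600 ⊗ # 1 ⊖ # 120 ⊗ (# 1 ⊗ # 1) ⊕ # 1 ⊗ # 1 ⊗ # 1) (# 9481) [] refl))
      gap : F
      gap = β 40 - β L
      -- 512000000 = 5 · 40⁵, from the telescoped bound on the decrease of β after 40.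
      gap-small : ι 512000000 * gap ≤ ι 1
      gap-small = ≤-reflexiveˡ (ring (# 512000000 ⊗ v0) (# 102400000 ⊗ (# 5 ⊗ v0)) (gap ∷ []) refl) (≤-reflexiveʳ (*-monoˡ (0≤ι 102400000) (proj₂ b₄₀))
        (trans (ring (# 102400000 ⊗ (v0 ⊗ v0 ⊗ v0 ⊗ v0 ⊗ v0)) ((# 40 ⊗ v0) ⊗ (# 40 ⊗ v0) ⊗ (# 40 ⊗ v0) ⊗ (# 40 ⊗ v0) ⊗ (# 40 ⊗ v0)) (I₄₀ ∷ []) refl)
          (trans (cong (λ u → u * u * u * u * u) 40J) (ring (# 1 ⊗ # 1 ⊗ # 1 ⊗ # 1 ⊗ # 1) (# 1) [] refl))))
      b′ = basel₂ 40
      X : F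
      X = ι 100000000 * A L
      X≡ : ι 38400000 * X ≡ ι 64 * (ι 10000000000000 * b′) * ι 6 + ι 10000000000 * (ι 64000 * E) - ι 640000000000000 * gap
      X≡ = trans (ring (# 38400000 ⊗ (# 100000000 ⊗ v0)) (# 640000000000000 ⊗ (# 6 ⊗ v0)) (A L ∷ []) refl) (trans (cong (ι 640000000000000 *_) (6A L))
        (ring (# 640000000000000 ⊗ v2) (# 64 ⊗ (# 10000000000000 ⊗ v0) ⊗ # 6 ⊕ # 10000000000 ⊗ (# 64000 ⊗ v1) ⊖ # 640000000000000 ⊗ (# 6 ⊗ v0 ⊕ v1 ⊖ v2)) (b′ ∷ E ∷ β L ∷ []) refl))

    private
      Y : F
      Y = ι 10000000000000 * b′
      floor₄₀ : basel-floor 40 ≡ 16202439630057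
      floor₄₀ = refl
      Y≥ : ι 16202439630057 ≤ Y
      Y≥ = subst (λ k → ι k ≤ Y) floor₄₀ (proj₁ (floor-bounds 40))
      Y≤ : Y ≤ ι 16202439630097
      Y≤ = subst (λ k → Y ≤ ι (k ℕ.+ 40)) floor₄₀ (proj₂ (floor-bounds 40))

    A≥ : ι 164493406 ≤ ι 100000000 * A L
    A≥ = *-cancel (1≤ιsuc 38399999) (≤-trans
      (pos (# 38400000 ⊗ # 164493406) (# 64 ⊗ # 16202439630057 ⊗ # 6 ⊕ # 10000000000 ⊗ # 9481 ⊖ # 1250000) [] tt refl)
      (≤-reflexiveʳ (+-mono (+-mono (*-monoʳ (0≤ι 6) (*-monoˡ (0≤ι 64) Y≥)) (*-monoˡ (0≤ι 10000000000) (≡⇒≤ (sym E≡))))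
        (neg-mono (≤-reflexiveˡ (ring (# 640000000000000 ⊗ v0) (# 1250000 ⊗ (# 512000000 ⊗ v0)) (gap ∷ []) refl) (≤-reflexiveʳ (*-monoˡ (0≤ι 1250000) gap-small) (*-1 _))))) (sym X≡)))

    A≤ : ι 100000000 * A L ≤ ι 164493407
    A≤ = *-cancel (1≤ιsuc 38399999) (≤-reflexiveˡ X≡ (≤-trans
      (+-mono (+-mono (*-monoʳ (0≤ι 6) (*-monoˡ (0≤ι 64) Y≤)) (*-monoˡ (0≤ι 10000000000) (≡⇒≤ E≡))) (≤-reflexiveʳ (neg-mono (*-nonneg (0≤ι 640000000000000) (proj₁ b₄₀))) neg-0))
      (pos (# 64 ⊗ # 16202439630097 ⊗ # 6 ⊕ # 10000000000 ⊗ # 9481 ⊕ # 0) (# 38400000 ⊗ # 164493407) [] tt refl)))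

  recip≤1 : ∀ m → recip (suc m) ≤ ι 1
  recip≤1 m = *-cancel (1≤ιsuc m) (≤-reflexiveˡ (recip-inverse m) (≤-reflexiveʳ (1≤ιsuc m) (sym (*-1 _))))

  basel₂≤A : ∀ L → basel₂ (suc L) ≤ A (suc L)
  basel₂≤A L = *-cancel (1≤ιsuc 5) (≤-reflexiveʳ (≤-reflexiveˡ (sym (+-0 _)) (+-mono ≤-refl
      (pos (# 0) (e (# 1 ⊖ v0) v1) (ι 1 - I ∷ I ∷ []) (≤⇒0≤- (recip≤1 L) , 0≤recip L , tt) refl)))
    (trans (+-congˡ (ring (e (# 1 ⊖ (# 1 ⊖ v0)) v0) (# 6 ⊗ v0 ⊖ # 3 ⊗ (v0 ⊗ v0) ⊕ v0 ⊗ v0 ⊗ v0) (I ∷ []) refl)) (sym (6A (suc L)))))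
    where
    I = recip (suc L)
    e : ∀ {k} → Expr k → Expr k → Expr k
    e x y = # 6 ⊗ y ⊖ # 3 ⊗ (x ⊗ y) ⊕ y ⊗ y ⊗ y

  A≤basel₂+1/L : ∀ L → A (suc L) ≤ basel₂ (suc L) + recip (suc L)
  A≤basel₂+1/L L = *-cancel (1≤ιsuc 5) (≤-reflexiveˡ (6A (suc L)) (0≤-⇒≤ (≤-reflexiveʳ
      (pos (# 0) (v1 ⊗ v1 ⊗ (# 2 ⊕ v0)) (ι 1 - I ∷ I ∷ []) (≤⇒0≤- (recip≤1 L) , 0≤recip L , tt) refl)
    (ring (v1 ⊗ v1 ⊗ (# 2 ⊕ (# 1 ⊖ v1))) (# 6 ⊗ (v0 ⊕ v1) ⊖ (# 6 ⊗ v0 ⊕ (# 6 ⊗ v1 ⊖ # 3 ⊗ (v1 ⊗ v1) ⊕ v1 ⊗ v1 ⊗ v1))) (basel₂ (suc L) ∷ I ∷ []) refl))))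
    where I = recip (suc L)

  sqrt-split : ∀ x → ∃[ M ] ∃[ j ] ((x ≡ M ℕ.* M ℕ.+ j) × (j ℕ.≤ 2 ℕ.* M))
  sqrt-split zero = 0 , 0 , refl , z≤n
  sqrt-split (suc x) with sqrt-split x
  ... | M , j , e , q with j ℕ.<? 2 ℕ.* M
  ... | yes r = M , suc j , trans (cong suc e) (sym (ℕₚ.+-suc (M ℕ.* M) j)) , r
  ... | no r = suc M , 0 , trans (cong suc (trans e (cong (M ℕ.* M ℕ.+_) (ℕₚ.≤-antisym q (ℕₚ.≮⇒≥ r))))) eq , z≤n
    where
    eq : suc (M ℕ.* M ℕ.+ 2 ℕ.* M) ≡ suc M ℕ.* suc M ℕ.+ 0
    eq = trans (cong suc (trans (cong (M ℕ.* M ℕ.+_) (cong (M ℕ.+_) (ℕₚ.+-identityʳ M))) (trans (sym (ℕₚ.+-assoc (M ℕ.* M) M M)) (ℕₚ.+-comm (M ℕ.* M ℕ.+ M) M))))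
      (trans (cong (λ t → suc (M ℕ.+ t)) (trans (ℕₚ.+-comm (M ℕ.* M) M) (sym (ℕₚ.*-suc M M)))) (sym (ℕₚ.+-identityʳ _)))

  setting : ∀ L → 40 ℕ.≤ L → Setting L (A L)
  setting (suc L₀) h = record { A-lower = A≥ L h ; A-upper = A≤ L h ; basel≤A = basel₂≤A L₀ ; R-small = small }
    where
    L = suc L₀
    small : ∀ x → x ℕ.≤ L → ∣ ι 10 * R (A L) L x ∣≤ Q x
    small zero q = abs-subst (sym (trans (cong (ι 10 *_) (R-0 L (A L))) (*-0 _))) (abs-weaken abs-0 (Q-nonneg 0))
    small (suc x) q with suc x ℕ.≤? 1600
    ... | yes r = R-bound-small (A L) (A≥ L h) (A≤ L h) L (suc x) (s≤s z≤n) r q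
    ... | no r with sqrt-split (suc x)
    ... | M , j , e , s = R-bound-large (A L) L M (suc x) (M ∸ 40) j bb (sym (ℕₚ.m+[n∸m]≡n 40≤M)) e s q M+2≤L
      where
      -- M ≤ 39 would give x ≤ 39² + 2 · 39 = 1599, which the scan has covered.
      40≤M : 40 ℕ.≤ M
      40≤M with 40 ℕ.≤? M
      ... | yes t = t
      ... | no t = ⊥-elim (r (ℕₚ.≤-trans (ℕₚ.≤-reflexive e) (ℕₚ.≤-trans (ℕₚ.+-mono-≤ (ℕₚ.*-mono-≤ M≤39 M≤39) (ℕₚ.≤-trans s (ℕₚ.*-monoʳ-≤ 2 M≤39))) (≤ᵇ-sound (39 ℕ.* 39 ℕ.+ 2 ℕ.* 39) 1600 refl))))
        where M≤39 = ℕₚ.≤-pred (ℕₚ.≰⇒> t)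
      M≤x : M ℕ.* M ℕ.≤ suc x
      M≤x = ℕₚ.≤-trans (ℕₚ.m≤m+n _ j) (ℕₚ.≤-reflexive (sym e))
      M+2≤MM : M ℕ.+ 2 ℕ.≤ M ℕ.* M
      M+2≤MM = ℕₚ.≤-trans (ℕₚ.+-monoʳ-≤ M (ℕₚ.≤-trans (≤ᵇ-sound 2 40 refl) 40≤M)) (ℕₚ.≤-trans (ℕₚ.≤-reflexive (cong (M ℕ.+_) (sym (ℕₚ.+-identityʳ M)))) (ℕₚ.*-monoˡ-≤ M (ℕₚ.≤-trans (≤ᵇ-sound 2 40 refl) 40≤M)))
      M+2≤L : M ℕ.+ 2 ℕ.≤ L
      M+2≤L = ℕₚ.≤-trans M+2≤MM (ℕₚ.≤-trans M≤x q)
      M≡ : M ≡ suc (M ∸ 1)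
      M≡ = sym (ℕₚ.m+[n∸m]≡n (ℕₚ.≤-trans (≤ᵇ-sound 1 40 refl) 40≤M))
      bb : BaselBounds (A L) M
      bb = subst (BaselBounds (A L)) (sym M≡) (record { A-lower = A≥ L h ; A-upper = A≤ L h
        ; defect-nonneg = proj₁ (defect-bounds (M ∸ 1) L M≤L) ; defect-small = proj₂ (defect-bounds (M ∸ 1) L M≤L) })
        where
        M≤L : suc (M ∸ 1) ℕ.≤ L
        M≤L = subst (ℕ._≤ L) M≡ (ℕₚ.≤-trans (ℕₚ.m≤m+n M 2) M+2≤L)

  -- The induction base at 2490

  p₂₄₉₀ p₂₄₈₉ q₂₄₉₀ : ℕ
  p₂₄₉₀ = 2229640203882390293040946390903966696602633829194840
  p₂₄₈₉ = 2173926744248147339669532102906132397617461595649235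
  q₂₄₉₀ = 55713459634242953371414287997834298985172233545605

  -- ⌊10⁶ V⌋ - 1 for the V of the state at 2490.
  V₆ : ℕ
  V₆ = 976135

  -- Lower bounds for b i · wⁱ · p(2490).
  start : ℕ → ℕ
  start 0 = 222964020388239029304094639090396669660263382919484000
  start 1 = 5571345963424295337141428799783429898517223354560500
  start 2 = 172626376128000000000000000000000000000000000000000
  start 3 = 4487459269010000000000000000000000000000000000000
  start 4 = 140815728006000000000000000000000000000000000000
  start 5 = 3822734701270000000000000000000000000000000000
  start _ = 0

  -- The lists descend to index 0, so the last entry is kept, in agreement with `Δ` at 0.
  Δℤ : List ℤ → List ℤ
  Δℤ [] = []
  Δℤ (a ∷ []) = a ∷ []
  Δℤ (a ∷ c ∷ r) = (a ℤ.- c) ∷ Δℤ (c ∷ r)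

  -- Each entry lies one step further below the top index, so the admissible size shrinks by one
  -- factor V per entry.
  decays : (ℕ → ℤ → Bool) → (ℕ → ℕ) → ℕ → List ℤ → Bool
  decays ok shrink h [] = true
  decays ok shrink h (d ∷ ds) = ok h d ∧ decays ok shrink (shrink h) ds

  all-decay : (ℕ → List ℤ → Bool) → ℕ → ℕ → List ℤ → Bool
  all-decay ok zero i ds = true
  all-decay ok (suc k) i ds = ok i ds ∧ all-decay ok k (suc i) (Δℤ ds)

  bounded : ℕ → ℤ → Bool
  bounded h d = 100 ℕ.* ℤ.∣ d ∣ ≤ᵇ h

  -- Both roundings, in `V₆` and in the division, go down and so only tighten the test.
  shrink₆ : ℕ → ℕ
  shrink₆ h = h ℕ.* V₆ ℕ./ 1000000

  decays-from-start : ℕ → List ℤ → Bool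
  decays-from-start i = decays bounded shrink₆ (start i)

  -- 4n³(b² - ac)² ≤ 1.6448 (ac)² and ac < b², for a, b, c = p(n+1), p(n), p(n-1).
  turán : ℕ → ℕ → ℕ → ℕ → Bool
  turán n a b c = (40000 ℕ.* (n ℕ.* n ℕ.* n) ℕ.* ((b ℕ.* b ∸ a ℕ.* c) ℕ.* (b ℕ.* b ∸ a ℕ.* c)) ≤ᵇ 16448 ℕ.* (a ℕ.* c ℕ.* (a ℕ.* c))) ∧ (a ℕ.* c <ᵇ b ℕ.* b)

  -- The index passed to the test is that of the middle entry, and it runs from `k + lo` down to
  -- `suc lo`; for 2446 and 44 this is 2490 down to 45.
  windows : (ℕ → ℕ → ℕ → ℕ → Bool) → ℕ → ℕ → List ℕ → Bool
  windows ok zero lo _ = true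
  windows ok (suc k) lo (a ∷ b ∷ c ∷ r) = ok (suc k ℕ.+ lo) a b c ∧ windows ok k lo (b ∷ c ∷ r)
  windows ok (suc k) lo _ = false

  heads : List ℕ → Bool
  heads (a ∷ b ∷ c ∷ r) = (b ≡ᵇ p₂₄₉₀) ∧ (c ≡ᵇ p₂₄₈₉)
  heads _ = false

  -- One list serves all three tests, so the partition numbers are computed only once.
  all-three : (List ℕ → Bool) → (List ℕ → Bool) → (List ℕ → Bool) → List ℕ → Bool
  all-three f g h l = f l ∧ (g l ∧ h l)

  abstract
    table-check : all-three heads (windows turán 2446 44) (λ l → all-decay decays-from-start 6 0 (map nat (drop 1 l))) (pList (σlist 1 2491) 2491) ≡ true
    table-check = refl

  -- Soundness of the table checks

  ≡ᵇ-sound : ∀ m n → (m ≡ᵇ n) ≡ true → m ≡ n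
  ≡ᵇ-sound m n e = ℕₚ.≡ᵇ⇒≡ m n (Equivalence.from T-≡ e)

  <ᵇ-sound : ∀ m n → (m <ᵇ n) ≡ true → m ℕ.< n
  <ᵇ-sound m n e = ℕₚ.<ᵇ⇒< m n (Equivalence.from T-≡ e)

  Represents : (ℕ → ℤ) → Sq → Set
  Represents f a = ∀ n → fromℤ (f n) ≡ a n

  Δf : (ℕ → ℤ) → ℕ → ℤ
  Δf f zero = f 0
  Δf f (suc n) = f (suc n) ℤ.- f n

  Δf-represents : ∀ {f a} → Represents f a → Represents (Δf f) (Δ a)
  Δf-represents h zero = h 0
  Δf-represents {f} h (suc n) = trans (fromℤ-+ (f (suc n)) (ℤ.- f n)) (cong₂ _+_ (h (suc n)) (trans (fromℤ-neg (f n)) (cong -_ (h n))))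

  Δℤ-descending : ∀ f n → Δℤ (descending f n) ≡ descending (Δf f) n
  Δℤ-descending f zero = refl
  Δℤ-descending f (suc zero) = refl
  Δℤ-descending f (suc (suc n)) = cong ((f (suc (suc n)) ℤ.- f (suc n)) ∷_) (Δℤ-descending f (suc n))

  abs-fromℤ : ∀ z → ∣ fromℤ z ∣≤ ι ℤ.∣ z ∣
  abs-fromℤ (nat k) = abs-nonneg (0≤ι k)
  abs-fromℤ (negsuc k) = abs-subst (sym (fromℤ-neg (nat (suc k)))) (abs-neg (abs-nonneg (0≤ι (suc k))))

  module _ (V : F) (V0 : ι 0 ≤ V) (ok : ℕ → ℤ → Bool) (shrink : ℕ → ℕ)
    (ok-sound : ∀ h d → ok h d ≡ true → ι 100 * ι ℤ.∣ d ∣ ≤ ι h) (shrink-sound : ∀ h → ι (shrink h) ≤ ι h * V) where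

    decays-sound : ∀ n f a h C → Represents f a → ι h ≤ C → decays ok shrink h (descending f n) ≡ true → ∀ m → m ℕ.≤ n → ∣ ι 100 * a m ∣≤ C * pow V (n ∸ m)
    decays-sound n f a h C rep hC e m q = go n q e
      where
      top : ∀ k → k ≡ 0 → ok h (f m) ≡ true → ∣ ι 100 * a m ∣≤ C * pow V k
      top _ refl t = abs-subst (cong (ι 100 *_) (rep m)) (abs-weaken (abs-*ˡ (0≤ι 100) (abs-fromℤ (f m)))
        (≤-trans (ok-sound h (f m) t) (≤-reflexiveʳ hC (sym (*-1 C)))))
      go : ∀ n → m ℕ.≤ n → decays ok shrink h (descending f n) ≡ true → ∣ ι 100 * a m ∣≤ C * pow V (n ∸ m)
      go zero z≤n t = top 0 refl (proj₁ (∧-true t))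
      go (suc n) q t with ℕₚ.m≤n⇒m<n∨m≡n q
      ... | inj₂ refl = top (suc n ∸ suc n) (ℕₚ.n∸n≡0 (suc n)) (proj₁ (∧-true t))
      ... | inj₁ (s≤s m≤n) = abs-weaken (decays-sound n f a (shrink h) (C * V) rep (≤-trans (shrink-sound h) (*-monoʳ V0 hC)) (proj₂ (∧-true t)) m m≤n)
        (≡⇒≤ (trans (*-assoc C V _) (cong (λ k → C * pow V k) (sym (ℕₚ.+-∸-assoc 1 m≤n)))))

  module _ (V : F) (n : ℕ) (C : ℕ → F) (ok : ℕ → List ℤ → Bool)
    (sound : ∀ i f a → Represents f a → ok i (descending f n) ≡ true → ∀ m → m ℕ.≤ n → ∣ ι 100 * a m ∣≤ C i * pow V (n ∸ m)) where

    all-decay-sound : ∀ k i f a → Represents f a → all-decay ok k i (descending f n) ≡ true →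
      ∀ d → d ℕ.< k → ∀ m → m ℕ.≤ n → ∣ ι 100 * Δ^ d a m ∣≤ C (i ℕ.+ d) * pow V (n ∸ m)
    all-decay-sound (suc k) i f a rep e zero q m r = abs-weaken (sound i f a rep (proj₁ (∧-true e)) m r)
      (≡⇒≤ (cong (λ j → C j * pow V (n ∸ m)) (sym (ℕₚ.+-identityʳ i))))
    all-decay-sound (suc k) i f a rep e (suc d) (s≤s q) m r = abs-subst (cong (ι 100 *_) (Δ-iter d m)) (abs-weaken
      (all-decay-sound k (suc i) (Δf f) (Δ a) (Δf-represents rep) (subst (λ l → all-decay ok k (suc i) l ≡ true) (Δℤ-descending f n) (proj₂ (∧-true e))) d q m r)
      (≡⇒≤ (cong (λ j → C j * pow V (n ∸ m)) (sym (ℕₚ.+-suc i d)))))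
      where
      Δ-iter : ∀ d m → Δ^ d (Δ a) m ≡ Δ (Δ^ d a) m
      Δ-iter zero m = refl
      Δ-iter (suc d) m = Δ-cong m (λ k _ → Δ-iter d k)

  windows-step : ∀ ok (f : ℕ → ℕ) k lo a b m → windows ok (suc k) lo (a ∷ b ∷ descending f m) ≡ true →
    (ok (suc k ℕ.+ lo) a b (f m) ≡ true) × (windows ok k lo (b ∷ descending f m) ≡ true)
  windows-step ok f k lo a b zero e = ∧-true e
  windows-step ok f k lo a b (suc m) e = ∧-true e

  windows-sound : ∀ ok f k lo N → N ≡ k ℕ.+ lo → windows ok k lo (descending f (suc N)) ≡ true →
    ∀ n → lo ℕ.≤ n → n ℕ.< N → ok (suc n) (f (suc (suc n))) (f (suc n)) (f n) ≡ true
  windows-sound ok f zero lo N refl e n q r = ⊥-elim (ℕₚ.<⇒≱ r q)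
  windows-sound ok f (suc k) lo (suc M) E e n q r with windows-step ok f k lo (f (suc (suc M))) (f (suc M)) M e | ℕₚ.m≤n⇒m<n∨m≡n (ℕₚ.≤-pred r)
  ... | t , _ | inj₂ refl = subst (λ i → ok i (f (suc (suc M))) (f (suc M)) (f M) ≡ true) (sym E) t
  ... | _ , t | inj₁ s = windows-sound ok f k lo M (ℕₚ.suc-injective E) t n q s

  map-descending : ∀ (f : ℕ → ℕ) n → map nat (descending f n) ≡ descending (λ m → nat (f m)) n
  map-descending f zero = refl
  map-descending f (suc n) = cong (nat (f (suc n)) ∷_) (map-descending f n)

  heads-sound : ∀ f n → heads (descending f (suc (suc n))) ≡ true → (f (suc n) ≡ p₂₄₉₀) × (f n ≡ p₂₄₈₉)
  heads-sound f zero e = ≡ᵇ-sound (f 1) p₂₄₉₀ (proj₁ (∧-true e)) , ≡ᵇ-sound (f 0) p₂₄₈₉ (proj₂ (∧-true e))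
  heads-sound f (suc n) e = ≡ᵇ-sound (f (suc (suc n))) p₂₄₉₀ (proj₁ (∧-true e)) , ≡ᵇ-sound (f (suc n)) p₂₄₈₉ (proj₂ (∧-true e))

  all-three-split : ∀ f g h l → all-three f g h l ≡ true → (f l ≡ true) × (g l ≡ true) × (h l ≡ true)
  all-three-split f g h l e = proj₁ (∧-true e) , ∧-true (proj₂ (∧-true {f l} e))

  record Table (f : ℕ → ℕ) (n : ℕ) : Set where
    field
      top : f (suc n) ≡ p₂₄₉₀
      below : f n ≡ p₂₄₈₉
      turáns : windows turán 2446 44 (descending f (suc (suc n))) ≡ true
      decay : all-decay decays-from-start 6 0 (descending (λ m → nat (f m)) (suc n)) ≡ true

  table-sound : ∀ f n l → descending f (suc (suc n)) ≡ l →
    all-three heads (windows turán 2446 44) (λ l → all-decay decays-from-start 6 0 (map nat (drop 1 l))) l ≡ true → Table f n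
  table-sound f n l refl e = record { top = proj₁ (heads-sound f n (proj₁ parts)) ; below = proj₂ (heads-sound f n (proj₁ parts)) ; turáns = proj₁ (proj₂ parts)
    ; decay = subst (λ l → all-decay decays-from-start 6 0 l ≡ true) (map-descending f (suc n)) (proj₂ (proj₂ parts)) }
    where
    parts : (heads l ≡ true) × (windows turán 2446 44 l ≡ true) × (all-decay decays-from-start 6 0 (map nat (drop 1 l)) ≡ true)
    parts = all-three-split heads (windows turán 2446 44) (λ l → all-decay decays-from-start 6 0 (map nat (drop 1 l))) l e

  -- Opaque, so that p (suc n₀) is never evaluated.
  abstract
    n₀ : ℕ
    n₀ = 2489

    n₀≡ : n₀ ≡ 2489
    n₀≡ = refl

  table : Table p n₀
  table = table-sound p n₀ (pList (σlist 1 2491) 2491) (trans (cong (λ k → descending p (suc (suc k))) n₀≡) (sym (pList-spec 2491 2491 ℕₚ.≤-refl))) table-check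

  -- Only the eight-digit interval for A is used, so one table serves every L.
  base-state : ∀ A → ι 164493406 ≤ ι 100000000 * A → ι 100000000 * A ≤ ι 164493407 → State A (suc n₀)
  base-state A A≥ A≤ = record
    { s = s ; w = w ; w*s = ws ; ΔP = ΔP ; 40≤s = 40≤s ; 0≤w = 0≤w ; shift-lower = low ; shift-upper = high ; smooth = smooth }
    where
    open Table table
    N = suc n₀
    P₁ P₀ q : F
    P₁ = ι p₂₄₉₀
    P₀ = ι p₂₄₈₉
    q = ι q₂₄₉₀
    1≤P₁ : ι 1 ≤ P₁
    1≤P₁ = ι-mono (≤ᵇ-sound 1 p₂₄₉₀ refl)
    1≤q : ι 1 ≤ q
    1≤q = ι-mono (≤ᵇ-sound 1 q₂₄₉₀ refl)
    PN : P N ≡ P₁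
    PN = cong ι top
    q+P₀ : P₁ ≡ q + P₀
    q+P₀ = trans (cong ι (≡ᵇ-sound p₂₄₉₀ (q₂₄₉₀ ℕ.+ p₂₄₈₉) refl)) (ι-+ q₂₄₉₀ p₂₄₈₉)
    s w : F
    s = P₁ * inv q
    w = q * inv P₁
    PI : P₁ * inv P₁ ≡ ι 1
    PI = inv-inverse P₁ 1≤P₁
    qI : q * inv q ≡ ι 1
    qI = inv-inverse q 1≤q
    sq : s * q ≡ P₁
    sq = trans (ring (v0 ⊗ v1 ⊗ v2) (v0 ⊗ (v2 ⊗ v1)) (P₁ ∷ inv q ∷ q ∷ []) refl) (trans (cong (P₁ *_) qI) (*-1 _))
    wP : w * P₁ ≡ q
    wP = trans (ring (v0 ⊗ v1 ⊗ v2) (v0 ⊗ (v2 ⊗ v1)) (q ∷ inv P₁ ∷ P₁ ∷ []) refl) (trans (cong (q *_) PI) (*-1 _))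
    ws : w * s ≡ ι 1
    ws = trans (ring (v0 ⊗ v1 ⊗ (v2 ⊗ v3)) (v2 ⊗ v1 ⊗ (v0 ⊗ v3)) (q ∷ inv P₁ ∷ P₁ ∷ inv q ∷ []) refl) (trans (cong₂ _*_ PI qI) (1* _))
    ΔP : Δ P N ≡ w * P N
    ΔP = trans (cong₂ _-_ (trans PN q+P₀) (cong ι below)) (trans (ring (v0 ⊕ v1 ⊖ v1) v0 (q ∷ P₀ ∷ []) refl) (sym (trans (cong (w *_) PN) wP)))
    0≤w : ι 0 ≤ w
    0≤w = *-nonneg (≤-trans (0≤ι 1) 1≤q) (inv-nonneg P₁ 1≤P₁)
    -- The ratio is about 40.02 at 2490.
    40≤s : ι 40 ≤ s
    40≤s = *-cancel 1≤q (≤-reflexiveˡ (trans (*-comm _ _) (sym (ι-* 40 q₂₄₉₀))) (≤-reflexiveʳ (ι-mono (≤ᵇ-sound (40 ℕ.* q₂₄₉₀) p₂₄₉₀ refl)) (sym (trans (*-comm _ _) sq))))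
    g : F
    g = ι N - (A * (s * s) - (ι 2 + A) * s)
    0≤PP : ι 0 ≤ P₁ * P₀
    0≤PP = *-nonneg (0≤ι p₂₄₉₀) (0≤ι p₂₄₈₉)
    qq : ι 1 ≤ q * q
    qq = ≤-reflexiveˡ (sym (1* _)) (*-mono (0≤ι 1) (≤-trans (0≤ι 1) 1≤q) 1≤q 1≤q)
    sq² : s * s * (q * q) ≡ P₁ * P₁
    sq² = trans (ring (v0 ⊗ v0 ⊗ (v1 ⊗ v1)) ((v0 ⊗ v1) ⊗ (v0 ⊗ v1)) (s ∷ q ∷ []) refl) (cong (λ z → z * z) sq)
    -- Writing one factor P₁ as q + P₀ cancels A P₁ q, so A occurs only once and its interval can be
    -- inserted.
    gqq : ι 100000000 * (q * q * (ι 100 * g)) ≡ ι 24900000000000 * (q * q) + ι 20000000000 * (P₁ * q) - ι 100 * (ι 100000000 * A * (P₁ * P₀))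
    gqq = trans (ring (# 100000000 ⊗ (v0 ⊗ v0 ⊗ (# 100 ⊗ (v1 ⊖ (v2 ⊗ (v3 ⊗ v3) ⊖ (# 2 ⊕ v2) ⊗ v3)))))
        (# 10000000000 ⊗ (v1 ⊗ (v0 ⊗ v0)) ⊕ # 10000000000 ⊗ ((# 2 ⊕ v2) ⊗ (v3 ⊗ v0) ⊗ v0) ⊖ # 10000000000 ⊗ (v2 ⊗ (v3 ⊗ v3 ⊗ (v0 ⊗ v0)))) (q ∷ ι N ∷ A ∷ s ∷ []) refl)
      (trans (cong₂ (λ x y → ι 10000000000 * (ι N * (q * q)) + ι 10000000000 * ((ι 2 + A) * x * q) - ι 10000000000 * (A * y)) sq sq²)
        (trans (cong₂ (λ n r → ι 10000000000 * (n * (q * q)) + ι 10000000000 * ((ι 2 + A) * P₁ * q) - ι 10000000000 * (A * (P₁ * r))) (cong (λ k → ι (suc k)) n₀≡) q+P₀)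
          (ring (# 10000000000 ⊗ (# 2490 ⊗ (v0 ⊗ v0)) ⊕ # 10000000000 ⊗ ((# 2 ⊕ v1) ⊗ v2 ⊗ v0) ⊖ # 10000000000 ⊗ (v1 ⊗ (v2 ⊗ (v0 ⊕ v3))))
            (# 24900000000000 ⊗ (v0 ⊗ v0) ⊕ # 20000000000 ⊗ (v2 ⊗ v0) ⊖ # 100 ⊗ (# 100000000 ⊗ v1 ⊗ (v2 ⊗ v3))) (q ∷ A ∷ P₁ ∷ P₀ ∷ []) refl)))
    qqℕ PPℕ Pqℕ : ℕ
    qqℕ = q₂₄₉₀ ℕ.* q₂₄₉₀
    PPℕ = p₂₄₉₀ ℕ.* p₂₄₈₉
    Pqℕ = p₂₄₉₀ ℕ.* q₂₄₉₀
    lin : ∀ a x b y → ι (a ℕ.* x ℕ.+ b ℕ.* y) ≡ ι a * ι x + ι b * ι y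
    lin a x b y = trans (ι-+ (a ℕ.* x) (b ℕ.* y)) (cong₂ _+_ (ι-* a x) (ι-* b y))
    low : ι 120 ≤ ι 100 * g
    low = *-cancel qq (*-cancel (1≤ιsuc 99999999) (≤-reflexiveʳ (0≤-⇒≤ (≤-reflexiveʳ (+-nonneg (≤⇒0≤- num) (*-nonneg (0≤ι 100) (*-nonneg (≤⇒0≤- A≤) 0≤PP)))
        (ring (# 24900000000000 ⊗ v0 ⊕ # 20000000000 ⊗ v1 ⊖ (# 12000000000 ⊗ v0 ⊕ # 16449340700 ⊗ v2) ⊕ # 100 ⊗ ((# 164493407 ⊖ # 100000000 ⊗ v3) ⊗ v2))
          (# 24900000000000 ⊗ v0 ⊕ # 20000000000 ⊗ v1 ⊖ # 100 ⊗ (# 100000000 ⊗ v3 ⊗ v2) ⊖ # 100000000 ⊗ (v0 ⊗ # 120)) (q * q ∷ P₁ * q ∷ P₁ * P₀ ∷ A ∷ []) refl))) (sym gqq)))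
      where
      num : ι 12000000000 * (q * q) + ι 16449340700 * (P₁ * P₀) ≤ ι 24900000000000 * (q * q) + ι 20000000000 * (P₁ * q)
      num = ≤-reflexiveˡ (sym (trans (lin 12000000000 qqℕ 16449340700 PPℕ) (cong₂ (λ x y → ι 12000000000 * x + ι 16449340700 * y) (ι-* q₂₄₉₀ q₂₄₉₀) (ι-* p₂₄₉₀ p₂₄₈₉))))
        (≤-reflexiveʳ (ι-mono (≤ᵇ-sound (12000000000 ℕ.* qqℕ ℕ.+ 16449340700 ℕ.* PPℕ) (24900000000000 ℕ.* qqℕ ℕ.+ 20000000000 ℕ.* Pqℕ) refl))
          (trans (lin 24900000000000 qqℕ 20000000000 Pqℕ) (cong₂ (λ x y → ι 24900000000000 * x + ι 20000000000 * y) (ι-* q₂₄₉₀ q₂₄₉₀) (ι-* p₂₄₉₀ q₂₄₉₀))))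
    high : ι 100 * g ≤ ι 169
    high = *-cancel qq (*-cancel (1≤ιsuc 99999999) (≤-reflexiveˡ gqq (0≤-⇒≤ (≤-reflexiveʳ (+-nonneg (≤⇒0≤- num) (*-nonneg (0≤ι 100) (*-nonneg (≤⇒0≤- A≥) 0≤PP)))
        (ring (# 16900000000 ⊗ v0 ⊕ # 16449340600 ⊗ v2 ⊖ (# 24900000000000 ⊗ v0 ⊕ # 20000000000 ⊗ v1) ⊕ # 100 ⊗ ((# 100000000 ⊗ v3 ⊖ # 164493406) ⊗ v2))
          (# 100000000 ⊗ (v0 ⊗ # 169) ⊖ (# 24900000000000 ⊗ v0 ⊕ # 20000000000 ⊗ v1 ⊖ # 100 ⊗ (# 100000000 ⊗ v3 ⊗ v2))) (q * q ∷ P₁ * q ∷ P₁ * P₀ ∷ A ∷ []) refl)))))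
      where
      num : ι 24900000000000 * (q * q) + ι 20000000000 * (P₁ * q) ≤ ι 16900000000 * (q * q) + ι 16449340600 * (P₁ * P₀)
      num = ≤-reflexiveˡ (sym (trans (lin 24900000000000 qqℕ 20000000000 Pqℕ) (cong₂ (λ x y → ι 24900000000000 * x + ι 20000000000 * y) (ι-* q₂₄₉₀ q₂₄₉₀) (ι-* p₂₄₉₀ q₂₄₉₀))))
        (≤-reflexiveʳ (ι-mono (≤ᵇ-sound (24900000000000 ℕ.* qqℕ ℕ.+ 20000000000 ℕ.* Pqℕ) (16900000000 ℕ.* qqℕ ℕ.+ 16449340600 ℕ.* PPℕ) refl))
          (trans (lin 16900000000 qqℕ 16449340600 PPℕ) (cong₂ (λ x y → ι 16900000000 * x + ι 16449340600 * y) (ι-* q₂₄₉₀ q₂₄₉₀) (ι-* p₂₄₉₀ p₂₄₈₉))))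
    V : F
    V = ι 1 - ν * w
    w≤1 : w ≤ ι 1
    w≤1 = *-cancel 1≤P₁ (≤-reflexiveˡ (trans (*-comm _ _) wP) (≤-reflexiveʳ (ι-mono (≤ᵇ-sound q₂₄₉₀ p₂₄₉₀ refl)) (sym (*-1 _))))
    0≤V : ι 0 ≤ V
    0≤V = ≤⇒0≤- (≤-reflexiveʳ (*-mono 0≤ν (0≤ι 1) ν≤1 w≤1) (1* _))
    V≥ : ι V₆ ≤ ι 1000000 * V
    V≥ = *-cancel 1≤P₁ (*-cancel (1≤ιsuc 199) (≤-reflexiveʳ (0≤-⇒≤ (≤-reflexiveʳ (≤⇒0≤- num)
        (ring (# 200000000 ⊗ v0 ⊖ (# 200 ⊗ (v1 ⊗ v0) ⊕ # 191000000 ⊗ v2)) (# 200000000 ⊗ v0 ⊖ # 191000000 ⊗ v2 ⊖ # 200 ⊗ (v0 ⊗ v1)) (P₁ ∷ ι V₆ ∷ q ∷ []) refl))) (sym VP)))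
      where
      VP : ι 200 * (P₁ * (ι 1000000 * V)) ≡ ι 200000000 * P₁ - ι 191000000 * q
      VP = trans (ring (# 200 ⊗ (v0 ⊗ (# 1000000 ⊗ (# 1 ⊖ v1 ⊗ v2)))) (# 200000000 ⊗ v0 ⊖ # 1000000 ⊗ ((# 200 ⊗ v1) ⊗ (v2 ⊗ v0))) (P₁ ∷ ν ∷ w ∷ []) refl)
        (trans (cong₂ (λ x y → ι 200000000 * P₁ - ι 1000000 * (x * y)) 200ν wP) (ring (# 200000000 ⊗ v0 ⊖ # 1000000 ⊗ (# 191 ⊗ v1)) (# 200000000 ⊗ v0 ⊖ # 191000000 ⊗ v1) (P₁ ∷ q ∷ []) refl))
      num : ι 200 * (ι V₆ * P₁) + ι 191000000 * q ≤ ι 200000000 * P₁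
      num = ≤-reflexiveˡ (sym (trans (lin 200 (V₆ ℕ.* p₂₄₉₀) 191000000 q₂₄₉₀) (+-congʳ (cong (ι 200 *_) (ι-* V₆ p₂₄₉₀)))))
        (≤-reflexiveʳ (ι-mono (≤ᵇ-sound (200 ℕ.* (V₆ ℕ.* p₂₄₉₀) ℕ.+ 191000000 ℕ.* q₂₄₉₀) (200000000 ℕ.* p₂₄₉₀) refl)) (ι-* 200000000 p₂₄₉₀))
    C : ℕ → F
    C i = ι (b i) * (pow w i * P₁)
    ι-pow : ∀ a k → ι (a ℕ.^ k) ≡ pow (ι a) k
    ι-pow a zero = refl
    ι-pow a (suc k) = trans (ι-* a (a ℕ.^ k)) (cong (ι a *_) (ι-pow a k))
    1≤pow : ∀ k → ι 1 ≤ pow P₁ k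
    1≤pow zero = ≤-refl
    1≤pow (suc k) = ≤-reflexiveˡ (sym (1* _)) (*-mono (0≤ι 1) (≤-trans (0≤ι 1) (1≤pow k)) 1≤P₁ (1≤pow k))
    start-by : ∀ i → (start i ℕ.* p₂₄₉₀ ℕ.^ i ≤ᵇ b i ℕ.* q₂₄₉₀ ℕ.^ i ℕ.* p₂₄₉₀) ≡ true → ι (start i) ≤ C i
    start-by i e = *-cancel (1≤pow i) (≤-reflexiveˡ (trans (*-comm _ _) (sym (trans (ι-* (start i) (p₂₄₉₀ ℕ.^ i)) (cong (ι (start i) *_) (ι-pow p₂₄₉₀ i)))))
      (≤-reflexiveʳ (ι-mono (≤ᵇ-sound (start i ℕ.* p₂₄₉₀ ℕ.^ i) (b i ℕ.* q₂₄₉₀ ℕ.^ i ℕ.* p₂₄₉₀) e))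
        (trans (trans (ι-* (b i ℕ.* q₂₄₉₀ ℕ.^ i) p₂₄₉₀) (cong (_* P₁) (trans (ι-* (b i) (q₂₄₉₀ ℕ.^ i)) (cong (ι (b i) *_) (trans (ι-pow q₂₄₉₀ i) (trans (cong (λ z → pow z i) (sym wP)) (pow-mul w P₁ i)))))))
          (ring (v0 ⊗ (v1 ⊗ v2) ⊗ v3) (v2 ⊗ (v0 ⊗ (v1 ⊗ v3))) (ι (b i) ∷ pow w i ∷ pow P₁ i ∷ P₁ ∷ []) refl))))
    start≤C : ∀ i → ι (start i) ≤ C i
    start≤C 0 = start-by 0 refl
    start≤C 1 = start-by 1 refl
    start≤C 2 = start-by 2 refl
    start≤C 3 = start-by 3 refl
    start≤C 4 = start-by 4 refl
    start≤C 5 = start-by 5 refl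
    start≤C (suc (suc (suc (suc (suc (suc i)))))) = *-nonneg (0≤ι 0) (*-nonneg (pow-nonneg (6 ℕ.+ i) 0≤w) (0≤ι p₂₄₉₀))
    shrink-sound : ∀ h → ι (shrink₆ h) ≤ ι h * V
    shrink-sound h = *-cancel (1≤ιsuc 999999) (≤-reflexiveˡ (trans (*-comm _ _) (sym (ι-* (shrink₆ h) 1000000)))
      (≤-trans (ι-mono (DM.m/n*n≤m (h ℕ.* V₆) 1000000)) (≤-reflexiveˡ (ι-* h V₆) (≤-reflexiveʳ (*-monoˡ (0≤ι h) V≥) (*-left-swap _ _ _)))))
    bounded-sound : ∀ h d → bounded h d ≡ true → ι 100 * ι ℤ.∣ d ∣ ≤ ι h
    bounded-sound h d e = ≤-reflexiveˡ (sym (ι-* 100 ℤ.∣ d ∣)) (ι-mono (≤ᵇ-sound (100 ℕ.* ℤ.∣ d ∣) h e))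
    start-sound : ∀ i f a → Represents f a → decays-from-start i (descending f N) ≡ true → ∀ m → m ℕ.≤ N → ∣ ι 100 * a m ∣≤ C i * pow V (N ∸ m)
    start-sound i f a rep e = decays-sound V 0≤V bounded shrink₆ bounded-sound shrink-sound N f a (start i) (C i) rep (start≤C i) e
    smooth : ∀ i m → i ℕ.≤ 5 → m ℕ.≤ N → ∣ Δ^ i P m ∣≤ B i * (pow w i * pow V (N ∸ m) * P N)
    smooth i m h q = cancel (abs-weaken (all-decay-sound V N C decays-from-start start-sound 6 0 (λ m → nat (p m)) P (λ n → refl) decay i (s≤s h) m q)
      (≡⇒≤ (trans (cong (λ z → z * (pow w i * P₁) * pow V (N ∸ m)) (sym (100B i)))
        (trans (ring (# 100 ⊗ v0 ⊗ (v1 ⊗ v2) ⊗ v3) (# 100 ⊗ (v0 ⊗ (v1 ⊗ v3 ⊗ v2))) (B i ∷ pow w i ∷ P₁ ∷ pow V (N ∸ m) ∷ []) refl)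
          (cong (λ z → ι 100 * (B i * (pow w i * pow V (N ∸ m) * z))) (sym PN))))))
      where
      cancel : ∀ {z y} → ∣ ι 100 * z ∣≤ ι 100 * y → ∣ z ∣≤ y
      cancel (x , y) = *-cancel (1≤ιsuc 99) x , *-cancel (1≤ιsuc 99) (≤-reflexiveˡ (sym (neg-*ʳ _ _)) y)

  -- From 1 - u to the theorem

  X Y gap ratio : Sq
  X m = P m * P m
  Y m = P (m ∸ 1) * P (suc m)
  gap m = X m - Y m
  ratio m = Y m * inv (X m)

  1≤product : ∀ {x y} → ι 1 ≤ x → ι 1 ≤ y → ι 1 ≤ x * y
  1≤product h k = ≤-reflexiveˡ (sym (1* _)) (*-mono (0≤ι 1) (≤-trans (0≤ι 1) k) h k)

  1≤X : ∀ m → ι 1 ≤ X m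
  1≤X m = 1≤product (1≤P m) (1≤P m)

  1≤Y : ∀ m → ι 1 ≤ Y m
  1≤Y m = 1≤product (1≤P (m ∸ 1)) (1≤P (suc m))

  -- `depth` selects a partial sum of ∑ 1/k² that exceeds 4 m³ (1/u(m) - 1)², where 1/u(m) - 1 =
  -- gap/Y.
  record Turán (m : ℕ) : Set where
    field
      gap≥1 : ι 1 ≤ gap m
      depth : ℕ
      criterion : ¬ (basel₂ depth * (Y m * Y m) ≤ ι 4 * (ι m * ι m * ι m) * (gap m * gap m))

  Claim : ℕ → Set
  Claim n = ∃[ c ] ((ι 0 ≤ c)
    × (∃[ K ] ¬ (ι 6 * basel₂ K ≤ ι 24 * ι n * ι n * ι n * c * c))
    × ¬ ((ι 1 + c) * ((ι 1 - ratio n * ratio (suc n)) * (ι 1 - ratio n * ratio (suc n))) ≤ ι 4 * (ι 1 - ratio n) * (ι 1 - ratio (suc n))))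

  X-ratio : ∀ m → X m * ratio m ≡ Y m
  X-ratio m = trans (*-left-swap _ _ _) (trans (cong (Y m *_) (inv-inverse (X m) (1≤X m))) (*-1 _))

  X-complement : ∀ m → X m * (ι 1 - ratio m) ≡ gap m
  X-complement m = trans (ring (v0 ⊗ (# 1 ⊖ v1)) (v0 ⊖ v0 ⊗ v1) (X m ∷ ratio m ∷ []) refl) (cong (_-_ (X m)) (X-ratio m))

  -- Both (1 + c) (1 - u) ≤ c and (1 + c) (1 - v) ≤ c, so with t = (1 - u) + (1 - v),
  -- 4 (1 + c) (1 - uv) ≥ (1 + c) t (4 - t) ≥ t (4 + 2c), while 4 (1 - u) (1 - v) ≤ t².
  module _ (n : ℕ) (c : F) (0≤c : ι 0 ≤ c) (gap₁ : ι 1 ≤ gap n) (gap₂ : ι 1 ≤ gap (suc n))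
    (h₁ : gap n ≤ c * Y n) (h₂ : gap (suc n) ≤ c * Y (suc n)) where

    private
      u v 1-u 1-v total 1-uv : F
      u = ratio n
      v = ratio (suc n)
      1-u = ι 1 - u
      1-v = ι 1 - v
      total = 1-u + 1-v
      1-uv = ι 1 - u * v

      complement-nonneg : ∀ m → ι 1 ≤ gap m → ι 0 ≤ ι 1 - ratio m
      complement-nonneg m g = *-cancel (1≤X m) (≤-reflexiveˡ (*-0 _) (≤-reflexiveʳ (≤-trans (0≤ι 1) g) (sym (X-complement m))))

      slack : ∀ m → gap m ≤ c * Y m → ι 0 ≤ c - (ι 1 + c) * (ι 1 - ratio m)
      slack m h = ≤-reflexiveʳ (≤⇒0≤- (*-cancel (1≤X m) (≤-reflexiveˡ (X-complement m) (≤-reflexiveʳ h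
          (trans (cong (c *_) (sym (X-ratio m))) (*-left-swap _ _ _))))))
        (ring (v0 ⊗ v1 ⊖ (# 1 ⊖ v1)) (v0 ⊖ (# 1 ⊕ v0) ⊗ (# 1 ⊖ v1)) (c ∷ ratio m ∷ []) refl)

      0≤total : ι 0 ≤ total
      0≤total = +-nonneg (complement-nonneg n gap₁) (complement-nonneg (suc n) gap₂)

      0≤1+c : ι 0 ≤ ι 1 + c
      0≤1+c = +-nonneg (0≤ι 1) 0≤c

      e-lower : total * (ι 4 + ι 2 * c) ≤ ι 4 * (ι 1 + c) * 1-uv
      e-lower = 0≤-⇒≤ (≤-reflexiveʳ (+-nonneg (*-nonneg 0≤1+c (sq-nonneg (1-u - 1-v))) (*-nonneg 0≤total (+-nonneg (slack n h₁) (slack (suc n) h₂))))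
        (ring (s₀ ⊗ ((A₀ ⊖ B₀) ⊗ (A₀ ⊖ B₀)) ⊕ (A₀ ⊕ B₀) ⊗ ((v2 ⊖ s₀ ⊗ A₀) ⊕ (v2 ⊖ s₀ ⊗ B₀)))
          (# 4 ⊗ s₀ ⊗ (# 1 ⊖ v0 ⊗ v1) ⊖ (A₀ ⊕ B₀) ⊗ (# 4 ⊕ # 2 ⊗ v2)) (u ∷ v ∷ c ∷ []) refl))
        where
        A₀ B₀ s₀ : Expr 3
        A₀ = # 1 ⊖ v0
        B₀ = # 1 ⊖ v1
        s₀ = # 1 ⊕ v2

      0≤lower : ι 0 ≤ total * (ι 4 + ι 2 * c)
      0≤lower = *-nonneg 0≤total (+-nonneg (0≤ι 4) (*-nonneg (0≤ι 2) 0≤c))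

    no-reverse : ¬ ((ι 1 + c) * (1-uv * 1-uv) ≤ ι 4 * (ι 1 - u) * (ι 1 - v))
    -- total · X and c · Y are at least 1, whereas the assumed inequality would force (total · c)² ≤
    -- 0.
    no-reverse h = 1≰0 (≤-trans (1≤product (1≤product 1≤total·X 1≤cY) (1≤product 1≤total·X 1≤cY)) (≤-reflexiveˡ
        (ring (v0 ⊗ v1 ⊗ (v2 ⊗ v3) ⊗ (v0 ⊗ v1 ⊗ (v2 ⊗ v3))) (v1 ⊗ v3 ⊗ (v1 ⊗ v3) ⊗ (v0 ⊗ v2 ⊗ (v0 ⊗ v2))) (total ∷ X n ∷ c ∷ Y n ∷ []) refl)
        (≤-reflexiveʳ (*-monoˡ (sq-nonneg (X n * Y n)) c·total≤0) (*-0 _))))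
      where
      squares : total * (ι 4 + ι 2 * c) * (total * (ι 4 + ι 2 * c)) ≤ ι 16 * (ι 1 + c) * (total * total)
      squares = ≤-trans (*-mono 0≤lower (≤-trans 0≤lower e-lower) e-lower e-lower)
        (≤-reflexiveˡ (ring (# 4 ⊗ v0 ⊗ v1 ⊗ (# 4 ⊗ v0 ⊗ v1)) (# 16 ⊗ v0 ⊗ (v0 ⊗ (v1 ⊗ v1))) (ι 1 + c ∷ 1-uv ∷ []) refl)
          (*-monoˡ (*-nonneg (0≤ι 16) 0≤1+c) (≤-trans h (0≤-⇒≤ (≤-reflexiveʳ (sq-nonneg (1-u - 1-v))
            (ring ((v0 ⊖ v1) ⊗ (v0 ⊖ v1)) ((v0 ⊕ v1) ⊗ (v0 ⊕ v1) ⊖ # 4 ⊗ v0 ⊗ v1) (1-u ∷ 1-v ∷ []) refl))))))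
      c·total≤0 : total * c * (total * c) ≤ ι 0
      c·total≤0 = *-cancel (1≤ιsuc 3) (0≤-⇒≤ (≤-reflexiveʳ (≤⇒0≤- squares)
        (ring (# 16 ⊗ (# 1 ⊕ v1) ⊗ (v0 ⊗ v0) ⊖ v0 ⊗ (# 4 ⊕ # 2 ⊗ v1) ⊗ (v0 ⊗ (# 4 ⊕ # 2 ⊗ v1))) (# 4 ⊗ # 0 ⊖ # 4 ⊗ (v0 ⊗ v1 ⊗ (v0 ⊗ v1))) (total ∷ c ∷ []) refl)))
      1≤total·X : ι 1 ≤ total * X n
      1≤total·X = ≤-trans gap₁ (≤-reflexiveˡ (sym (trans (*-comm _ _) (X-complement n))) (*-monoʳ (≤-trans (0≤ι 1) (1≤X n))
        (≤-reflexiveˡ (sym (+-0 _)) (+-mono ≤-refl (complement-nonneg (suc n) gap₂)))))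
      1≤cY : ι 1 ≤ c * Y n
      1≤cY = ≤-trans gap₁ h₁

  excess-ratio : Sq
  excess-ratio m = gap m * inv (Y m)

  excess-Y : ∀ m → excess-ratio m * Y m ≡ gap m
  excess-Y m = trans (ring (v0 ⊗ v1 ⊗ v2) (v0 ⊗ (v2 ⊗ v1)) (gap m ∷ inv (Y m) ∷ Y m ∷ []) refl) (trans (cong (gap m *_) (inv-inverse (Y m) (1≤Y m))) (*-1 _))

  excess-nonneg : ∀ m → ι 1 ≤ gap m → ι 0 ≤ excess-ratio m
  excess-nonneg m g = *-nonneg (≤-trans (0≤ι 1) g) (inv-nonneg (Y m) (1≤Y m))

  -- The chosen c may belong to n + 1 while the bound is wanted at n; n³ ≤ m³ covers both cases.
  excess-π² : ∀ n m → n ℕ.≤ m → (t : Turán m) → ¬ (ι 6 * basel₂ (Turán.depth t) ≤ ι 24 * ι n * ι n * ι n * excess-ratio m * excess-ratio m)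
  excess-π² n m n≤m t h = Turán.criterion t (*-cancel (1≤ιsuc 5) (≤-reflexiveˡ (sym (*-assoc _ _ _)) (≤-trans (*-monoʳ (sq-nonneg (Y m)) h)
    (≤-reflexiveˡ (ring (# 24 ⊗ v0 ⊗ v0 ⊗ v0 ⊗ v1 ⊗ v1 ⊗ (v2 ⊗ v2)) (# 24 ⊗ (v0 ⊗ v0 ⊗ v0) ⊗ ((v1 ⊗ v2) ⊗ (v1 ⊗ v2))) (ι n ∷ excess-ratio m ∷ Y m ∷ []) refl)
      (≤-reflexiveˡ (cong (λ z → ι 24 * (ι n * ι n * ι n) * (z * z)) (excess-Y m)) (≤-reflexiveʳ
        (*-monoʳ (sq-nonneg (gap m)) (*-monoˡ (0≤ι 24) (*-mono (*-nonneg (0≤ι n) (0≤ι n)) (0≤ι m) (*-mono (0≤ι n) (0≤ι m) n≤ n≤) n≤)))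
        (ring (# 24 ⊗ v0 ⊗ v1) (# 6 ⊗ (# 4 ⊗ v0 ⊗ v1)) (ι m * ι m * ι m ∷ gap m * gap m ∷ []) refl)))))))
    where
    n≤ : ι n ≤ ι m
    n≤ = ι-mono n≤m

  claim-from-turán : ∀ n → Turán n → Turán (suc n) → Claim n
  claim-from-turán n t₁ t₂ with ≤-total (excess-ratio n) (excess-ratio (suc n))
  ... | inj₁ q = c , 0≤c , (Turán.depth t₂ , excess-π² n (suc n) (ℕₚ.n≤1+n n) t₂)
      , no-reverse n c 0≤c (Turán.gap≥1 t₁) (Turán.gap≥1 t₂) (≤-reflexiveˡ (sym (excess-Y n)) (*-monoʳ (≤-trans (0≤ι 1) (1≤Y n)) q)) (≡⇒≤ (sym (excess-Y (suc n))))
    where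
    c = excess-ratio (suc n)
    0≤c = excess-nonneg (suc n) (Turán.gap≥1 t₂)
  ... | inj₂ q = c , 0≤c , (Turán.depth t₁ , excess-π² n n ℕₚ.≤-refl t₁)
      , no-reverse n c 0≤c (Turán.gap≥1 t₁) (Turán.gap≥1 t₂) (≡⇒≤ (sym (excess-Y n))) (≤-reflexiveˡ (sym (excess-Y (suc n))) (*-monoʳ (≤-trans (0≤ι 1) (1≤Y (suc n))) q))
    where
    c = excess-ratio n
    0≤c = excess-nonneg n (Turán.gap≥1 t₁)

  strict-gap : ∀ m → p (m ∸ 1) ℕ.* p (suc m) ℕ.< p m ℕ.* p m → ι 1 ≤ gap m
  strict-gap m h = 0≤-⇒≤ (≤-reflexiveʳ (≤⇒0≤- (≤-reflexiveˡ (sym (trans (ι-suc (p (m ∸ 1) ℕ.* p (suc m))) (+-congˡ (ι-* (p (m ∸ 1)) (p (suc m)))))) (≤-reflexiveʳ (ι-mono h) (ι-* (p m) (p m)))))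
    (ring (v0 ⊖ (# 1 ⊕ v1)) (v0 ⊖ v1 ⊖ # 1) (X m ∷ Y m ∷ []) refl))

  -- Ten thousand terms are not added up: the partial sum is at least A - 1/L, and A is known to
  -- eight digits. The index is a variable to prevent its evaluation.
  basel-lower-at : ∀ l → l ≡ 9999 → ι 164480001 ≤ ι 100000000 * basel₂ (suc l)
  basel-lower-at l l≡ = 0≤-⇒≤ (≤-reflexiveʳ
      (+-nonneg (≤⇒0≤- (A≥ (suc l) (subst (40 ℕ.≤_) (cong suc (sym l≡)) (≤ᵇ-sound 40 10000 refl))))
        (+-nonneg (*-nonneg (0≤ι 100000000) (≤⇒0≤- (A≤basel₂+1/L l))) (pos (# 0) (# 3405) [] tt refl)))
      (trans (ring (# 100000000 ⊗ v0 ⊖ # 164493406 ⊕ (# 100000000 ⊗ (v1 ⊕ v2 ⊖ v0) ⊕ # 3405))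
          (# 100000000 ⊗ v1 ⊕ # 10000 ⊗ (# 10000 ⊗ v2) ⊖ # 10000 ⊖ # 164480001) (A (suc l) ∷ basel₂ (suc l) ∷ recip (suc l) ∷ []) refl)
        (trans (cong (λ z → ι 100000000 * basel₂ (suc l) + ι 10000 * z - ι 10000 - ι 164480001) (trans (cong (λ k → ι (suc k) * recip (suc l)) (sym l≡)) (recip-inverse l)))
          (ring (# 100000000 ⊗ v0 ⊕ # 10000 ⊗ # 1 ⊖ # 10000 ⊖ # 164480001) (# 100000000 ⊗ v0 ⊖ # 164480001) (basel₂ (suc l) ∷ []) refl))))

  abstract
    basel-lower : ∃[ K ] (ι 164480001 ≤ ι 100000000 * basel₂ K)
    basel-lower = 10000 , basel-lower-at 9999 refl

  ι-cube : ∀ k n d → ι (k ℕ.* (n ℕ.* n ℕ.* n) ℕ.* (d ℕ.* d)) ≡ ι k * (ι n * ι n * ι n) * (ι d * ι d)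
  ι-cube k n d = trans (ι-* (k ℕ.* (n ℕ.* n ℕ.* n)) (d ℕ.* d)) (cong₂ _*_
    (trans (ι-* k (n ℕ.* n ℕ.* n)) (cong (ι k *_) (trans (ι-* (n ℕ.* n) n) (cong (_* ι n) (ι-* n n))))) (ι-* d d))

  turán-bounds : ∀ n a b c → turán n a b c ≡ true → (a ℕ.* c ℕ.< b ℕ.* b) ×
    (ι 40000 * (ι n * ι n * ι n) * ((ι (b ℕ.* b) - ι (a ℕ.* c)) * (ι (b ℕ.* b) - ι (a ℕ.* c))) ≤ ι 16448 * (ι (a ℕ.* c) * ι (a ℕ.* c)))
  turán-bounds n a b c e = y<x , ≤-reflexiveˡ (trans (cong (λ z → ι 40000 * (ι n * ι n * ι n) * (z * z)) ιd) (sym (ι-cube 40000 n d)))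
      (≤-reflexiveʳ (ι-mono (≤ᵇ-sound (40000 ℕ.* (n ℕ.* n ℕ.* n) ℕ.* ((b ℕ.* b ∸ a ℕ.* c) ℕ.* (b ℕ.* b ∸ a ℕ.* c))) (16448 ℕ.* (a ℕ.* c ℕ.* (a ℕ.* c))) (proj₁ (∧-true e))))
        (trans (ι-* 16448 (a ℕ.* c ℕ.* (a ℕ.* c))) (cong (ι 16448 *_) (ι-* (a ℕ.* c) (a ℕ.* c)))))
    where
    y<x : a ℕ.* c ℕ.< b ℕ.* b
    y<x = <ᵇ-sound (a ℕ.* c) (b ℕ.* b) (proj₂ (∧-true e))
    d : ℕ
    d = b ℕ.* b ∸ a ℕ.* c
    ιd : ι (b ℕ.* b) - ι (a ℕ.* c) ≡ ι d
    ιd = trans (cong (_- ι (a ℕ.* c)) (trans (cong ι (sym (ℕₚ.m+[n∸m]≡n (ℕₚ.<⇒≤ y<x)))) (ι-+ (a ℕ.* c) d)))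
      (ring (v0 ⊕ v1 ⊖ v0) v1 (ι (a ℕ.* c) ∷ ι d ∷ []) refl)

  turán-sound : ∀ n → turán (suc n) (p (suc (suc n))) (p (suc n)) (p n) ≡ true → Turán (suc n)
  turán-sound n e = record { gap≥1 = strict-gap m (subst (ℕ._< p m ℕ.* p m) (ℕₚ.*-comm (p (suc m)) (p n)) (proj₁ bounds))
    ; depth = proj₁ basel-lower ; criterion = λ h → ℕₚ.1+n≰n (fromℤ-reflects 164480001 164480000 (bound h)) }
    where
    m = suc n
    bounds = turán-bounds (suc n) (p (suc (suc n))) (p (suc n)) (p n) e
    table-bound : ι 40000 * (ι m * ι m * ι m) * (gap m * gap m) ≤ ι 16448 * (Y m * Y m)
    table-bound = subst₂ (λ x y → ι 40000 * (ι m * ι m * ι m) * ((x - y) * (x - y)) ≤ ι 16448 * (y * y))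
      (ι-* (p m) (p m)) (trans (ι-* (p (suc m)) (p n)) (*-comm (P (suc m)) (P n))) (proj₂ bounds)
    Z : F
    Z = Y m * Y m
    bound : basel₂ (proj₁ basel-lower) * Z ≤ ι 4 * (ι m * ι m * ι m) * (gap m * gap m) → ι 164480001 ≤ ι 164480000
    bound h = *-cancel (1≤product (1≤Y m) (1≤Y m)) (≤-trans (*-monoˡ (sq-nonneg (Y m)) (proj₂ basel-lower))
      (≤-reflexiveˡ (ring (v0 ⊗ (# 100000000 ⊗ v1)) (# 100000000 ⊗ (v1 ⊗ v0)) (Z ∷ basel₂ (proj₁ basel-lower) ∷ []) refl)
        (≤-trans (*-monoˡ (0≤ι 100000000) h)
          (≤-reflexiveˡ (ring (# 100000000 ⊗ (# 4 ⊗ v0 ⊗ v1)) (# 10000 ⊗ (# 40000 ⊗ v0 ⊗ v1)) (ι m * ι m * ι m ∷ gap m * gap m ∷ []) refl)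
            (≤-reflexiveʳ (*-monoˡ (0≤ι 10000) table-bound) (ring (# 10000 ⊗ (# 16448 ⊗ v0)) (v0 ⊗ # 164480000) (Z ∷ []) refl))))))

  turán-in-table : ∀ n → 44 ℕ.≤ n → n ℕ.≤ n₀ → Turán (suc n)
  turán-in-table n q r = turán-sound n (windows-sound turán p 2446 44 (suc n₀) (cong suc n₀≡) (Table.turáns table) n q (s≤s r))

  states : ∀ L → 40 ℕ.≤ L → ∀ k → suc (k ℕ.+ n₀) ℕ.≤ L → State (A L) (suc (k ℕ.+ n₀))
  states L h zero q = base-state (A L) (A≥ L h) (A≤ L h)
  states L h (suc k) q = Next.next L (A L) (setting L h) (k ℕ.+ n₀) (states L h k (ℕₚ.≤-trans (ℕₚ.n≤1+n _) q)) q

  -- The gap bound leaves a margin 1/(2s) below A, and A exceeds the partial sum by at most 1/L. If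
  -- the criterion failed, L ≤ 2s ≤ 2m would follow, against the choice L = 2m + 1.
  turán-from-state : ∀ n → 40 ℕ.≤ n → (∀ L → 40 ℕ.≤ L → suc (suc n) ℕ.≤ L → State (A L) (suc n)) → Turán (suc n)
  turán-from-state n 40≤n state = record { gap≥1 = strict-gap m lt ; depth = L ; criterion = λ h → ℕₚ.1+n≰n (fromℤ-reflects L (m ℕ.+ m) (bound h)) }
    where
    m = suc n
    L = suc (m ℕ.+ m)
    40≤L : 40 ℕ.≤ L
    40≤L = ℕₚ.≤-trans 40≤n (ℕₚ.≤-trans (ℕₚ.n≤1+n n) (ℕₚ.≤-trans (ℕₚ.m≤m+n m m) (ℕₚ.n≤1+n _)))
    m<L : suc m ℕ.≤ L
    m<L = s≤s (ℕₚ.m≤m+n m m)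
    st : State (A L) m
    st = state L 40≤L m<L
    open State st using (s; 40≤s)
    open Next L (A L) (setting L 40≤L) n st m<L using (turán-gap; turán-strict; s≤ιN)
    lt : p n ℕ.* p (suc m) ℕ.< p m ℕ.* p m
    lt with p n ℕ.* p (suc m) ℕ.<? p m ℕ.* p m
    ... | yes h = h
    ... | no h = ⊥-elim (turán-strict (≤-reflexiveˡ (sym (ι-* (p m) (p m))) (≤-reflexiveʳ (ι-mono (ℕₚ.≮⇒≥ h)) (ι-* (p n) (p (suc m))))))
    B₂ I Z : F
    B₂ = basel₂ L
    I = recip L
    Z = Y m * Y m
    0≤s : ι 0 ≤ s
    0≤s = ≤-trans (0≤ι 40) 40≤s
    bound : B₂ * Z ≤ ι 4 * (ι m * ι m * ι m) * (gap m * gap m) → ι L ≤ ι (m ℕ.+ m)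
    bound h = ≤-trans (≤-reflexiveʳ (≤-reflexiveˡ (sym (*-1 _)) (*-monoˡ (0≤ι L) 2sI≥1))
        (trans (ring (v0 ⊗ (# 2 ⊗ v1 ⊗ v2)) (# 2 ⊗ v1 ⊗ (v0 ⊗ v2)) (ι L ∷ s ∷ I ∷ []) refl) (trans (cong (ι 2 * s *_) (recip-inverse (m ℕ.+ m))) (*-1 _))))
      (≤-reflexiveʳ (*-monoˡ (0≤ι 2) s≤ιN) (trans (ring (# 2 ⊗ v0) (v0 ⊕ v0) (ι m ∷ []) refl) (sym (ι-+ m m))))
      where
      2sB₂ : ι 2 * s * B₂ ≤ ι 2 * A L * s - ι 1
      2sB₂ = *-cancel (1≤product (1≤Y m) (1≤Y m)) (≤-reflexiveˡ (ring (v0 ⊗ (# 2 ⊗ v1 ⊗ v2)) (# 2 ⊗ v1 ⊗ (v2 ⊗ v0)) (Z ∷ s ∷ B₂ ∷ []) refl)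
        (≤-trans (*-monoˡ (*-nonneg (0≤ι 2) 0≤s) h)
          (≤-reflexiveˡ (ring (# 2 ⊗ v0 ⊗ (# 4 ⊗ v1 ⊗ v2)) (# 8 ⊗ v0 ⊗ v1 ⊗ v2) (s ∷ ι m * ι m * ι m ∷ gap m * gap m ∷ []) refl)
            (≤-reflexiveʳ turán-gap (*-comm _ _)))))
      2sI≥1 : ι 1 ≤ ι 2 * s * I
      2sI≥1 = 0≤-⇒≤ (≤-reflexiveʳ (+-nonneg (≤⇒0≤- 2sB₂) (*-nonneg (*-nonneg (0≤ι 2) 0≤s) (≤⇒0≤- (A≤basel₂+1/L (m ℕ.+ m)))))
        (ring (# 2 ⊗ v1 ⊗ v0 ⊖ # 1 ⊖ # 2 ⊗ v0 ⊗ v2 ⊕ # 2 ⊗ v0 ⊗ (v2 ⊕ v3 ⊖ v1)) (# 2 ⊗ v0 ⊗ v3 ⊖ # 1) (s ∷ A L ∷ B₂ ∷ I ∷ []) refl))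

  turán-large : ∀ n → 44 ℕ.≤ n → Turán (suc n)
  turán-large n 44≤n with n ℕ.≤? n₀
  ... | yes q = turán-in-table n 44≤n q
  ... | no q = turán-from-state n (ℕₚ.≤-trans (≤ᵇ-sound 40 44 refl) 44≤n) (λ L h r → subst (λ j → State (A L) (suc j)) k+n₀ (states L h (n ∸ n₀) (subst (λ j → suc j ℕ.≤ L) (sym k+n₀) (ℕₚ.≤-trans (ℕₚ.n≤1+n _) r))))
    where
    k+n₀ : n ∸ n₀ ℕ.+ n₀ ≡ n
    k+n₀ = ℕₚ.m∸n+n≡m (ℕₚ.<⇒≤ (ℕₚ.≰⇒> q))

  -- The range 2 ≤ n ≤ 44 with explicit c

  separated : ℕ → ℕ → ℕ → ℕ → Bool
  separated k D E C = 40000 ℕ.* D ℕ.* (D ℕ.+ E) ℕ.+ (10000 ℕ.+ k) ℕ.* (2 ℕ.* D ℕ.* E) <ᵇ (10000 ℕ.+ k) ℕ.* (D ℕ.* D ℕ.+ E ℕ.* E) ℕ.+ 40000 ℕ.* D ℕ.* C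

  -- The inequality with c = k / 10⁴ and π²/6 replaced by 1.6448, cleared of denominators;
  -- a, b, c, d = p(n+2), p(n+1), p(n), p(n-1).
  direct : ℕ → ℕ → ℕ → ℕ → ℕ → ℕ → Bool
  direct k n a b c d = (4 ℕ.* (n ℕ.* n ℕ.* n) ℕ.* (k ℕ.* k) ≤ᵇ 164480000)
    ∧ separated k (c ℕ.* c ℕ.* (b ℕ.* b)) (d ℕ.* b ℕ.* (c ℕ.* a)) (c ℕ.* c ℕ.* (c ℕ.* a) ℕ.+ d ℕ.* b ℕ.* (b ℕ.* b))

  -- D + E - C stands for (X - Y)(X′ - Y′), with D = XX′, E = YY′ and C the mixed terms. Moving
  -- negative terms across keeps the test in the naturals.
  separated-sound : ∀ k D E C → separated k D E C ≡ true →
    ¬ ((ι 10000 + ι k) * ((ι D - ι E) * (ι D - ι E)) ≤ ι 40000 * ι D * (ι D + ι E - ι C))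
  separated-sound k D E C h e = ℕₚ.<⇒≱ (<ᵇ-sound (40000 ℕ.* D ℕ.* (D ℕ.+ E) ℕ.+ (10000 ℕ.+ k) ℕ.* (2 ℕ.* D ℕ.* E)) ((10000 ℕ.+ k) ℕ.* (D ℕ.* D ℕ.+ E ℕ.* E) ℕ.+ 40000 ℕ.* D ℕ.* C) h)
      (fromℤ-reflects ((10000 ℕ.+ k) ℕ.* (D ℕ.* D ℕ.+ E ℕ.* E) ℕ.+ 40000 ℕ.* D ℕ.* C) (40000 ℕ.* D ℕ.* (D ℕ.+ E) ℕ.+ (10000 ℕ.+ k) ℕ.* (2 ℕ.* D ℕ.* E))
        (≤-reflexiveˡ (ιrhs 40000 10000) (≤-reflexiveʳ (0≤-⇒≤ (≤-reflexiveʳ (≤⇒0≤- e)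
          (ring (# 40000 ⊗ v0 ⊗ (v0 ⊕ v1 ⊖ v2) ⊖ (# 10000 ⊕ v3) ⊗ ((v0 ⊖ v1) ⊗ (v0 ⊖ v1)))
            (# 40000 ⊗ v0 ⊗ (v0 ⊕ v1) ⊕ (# 10000 ⊕ v3) ⊗ (# 2 ⊗ v0 ⊗ v1) ⊖ ((# 10000 ⊕ v3) ⊗ (v0 ⊗ v0 ⊕ v1 ⊗ v1) ⊕ # 40000 ⊗ v0 ⊗ v2)) (ι D ∷ ι E ∷ ι C ∷ ι k ∷ []) refl)))
          (sym (ιlhs 40000 10000 2)))))
    where
    ιlhs : ∀ c₁ c₂ c₃ → ι (c₁ ℕ.* D ℕ.* (D ℕ.+ E) ℕ.+ (c₂ ℕ.+ k) ℕ.* (c₃ ℕ.* D ℕ.* E)) ≡ ι c₁ * ι D * (ι D + ι E) + (ι c₂ + ι k) * (ι c₃ * ι D * ι E)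
    ιlhs c₁ c₂ c₃ = trans (ι-+ (c₁ ℕ.* D ℕ.* (D ℕ.+ E)) ((c₂ ℕ.+ k) ℕ.* (c₃ ℕ.* D ℕ.* E))) (cong₂ _+_
      (trans (ι-* (c₁ ℕ.* D) (D ℕ.+ E)) (cong₂ _*_ (ι-* c₁ D) (ι-+ D E)))
      (trans (ι-* (c₂ ℕ.+ k) (c₃ ℕ.* D ℕ.* E)) (cong₂ _*_ (ι-+ c₂ k) (trans (ι-* (c₃ ℕ.* D) E) (cong (_* ι E) (ι-* c₃ D))))))
    ιrhs : ∀ c₁ c₂ → ι ((c₂ ℕ.+ k) ℕ.* (D ℕ.* D ℕ.+ E ℕ.* E) ℕ.+ c₁ ℕ.* D ℕ.* C) ≡ (ι c₂ + ι k) * (ι D * ι D + ι E * ι E) + ι c₁ * ι D * ι C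
    ιrhs c₁ c₂ = trans (ι-+ ((c₂ ℕ.+ k) ℕ.* (D ℕ.* D ℕ.+ E ℕ.* E)) (c₁ ℕ.* D ℕ.* C)) (cong₂ _+_
      (trans (ι-* (c₂ ℕ.+ k) (D ℕ.* D ℕ.+ E ℕ.* E)) (cong₂ _*_ (ι-+ c₂ k) (trans (ι-+ (D ℕ.* D) (E ℕ.* E)) (cong₂ _+_ (ι-* D D) (ι-* E E)))))
      (trans (ι-* (c₁ ℕ.* D) C) (cong (_* ι C) (ι-* c₁ D))))

  direct-bounds : ∀ k n a b c d → direct k n a b c d ≡ true → (ι 4 * (ι n * ι n * ι n) * (ι k * ι k) ≤ ι 164480000) ×
    (let x₁ = ι c * ι c ; y₁ = ι d * ι b ; x₂ = ι b * ι b ; y₂ = ι c * ι a ; D = x₁ * x₂ ; E = y₁ * y₂ in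
      ¬ ((ι 10000 + ι k) * ((D - E) * (D - E)) ≤ ι 40000 * D * ((x₁ - y₁) * (x₂ - y₂))))
  direct-bounds k n a b c d e = ≤-reflexiveˡ (sym (ι-cube 4 n k)) (ι-mono (≤ᵇ-sound (4 ℕ.* (n ℕ.* n ℕ.* n) ℕ.* (k ℕ.* k)) 164480000 (proj₁ (∧-true e))))
    , λ h → separated-sound k (c ℕ.* c ℕ.* (b ℕ.* b)) (d ℕ.* b ℕ.* (c ℕ.* a)) (c ℕ.* c ℕ.* (c ℕ.* a) ℕ.+ d ℕ.* b ℕ.* (b ℕ.* b)) (proj₂ (∧-true e))
      (subst₂ (λ x y → (ι 10000 + ι k) * ((x - y) * (x - y)) ≤ ι 40000 * x * (x + y - ι (c ℕ.* c ℕ.* (c ℕ.* a) ℕ.+ d ℕ.* b ℕ.* (b ℕ.* b)))) (sym (ι-*⁴ c c b b)) (sym (ι-*⁴ d b c a))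
        (≤-reflexiveʳ h (trans (ring (# 40000 ⊗ v4 ⊗ ((v0 ⊖ v1) ⊗ (v2 ⊖ v3))) (# 40000 ⊗ v4 ⊗ (v0 ⊗ v2 ⊕ v1 ⊗ v3 ⊖ (v0 ⊗ v3 ⊕ v1 ⊗ v2)))
            (ι c * ι c ∷ ι d * ι b ∷ ι b * ι b ∷ ι c * ι a ∷ ι c * ι c * (ι b * ι b) ∷ []) refl)
          (cong (λ z → ι 40000 * (ι c * ι c * (ι b * ι b)) * (ι c * ι c * (ι b * ι b) + ι d * ι b * (ι c * ι a) - z))
            (sym (trans (ι-+ (c ℕ.* c ℕ.* (c ℕ.* a)) (d ℕ.* b ℕ.* (b ℕ.* b))) (cong₂ _+_ (ι-*⁴ c c c a) (ι-*⁴ d b b b))))))))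
    where
    ι-*⁴ : ∀ a b c d → ι (a ℕ.* b ℕ.* (c ℕ.* d)) ≡ ι a * ι b * (ι c * ι d)
    ι-*⁴ a b c d = trans (ι-* (a ℕ.* b) (c ℕ.* d)) (cong₂ _*_ (ι-* a b) (ι-* c d))

  scan₄ : (ℕ → ℕ → ℕ → ℕ → ℕ → ℕ → Bool) → ℕ → List ℕ → List ℕ → Bool
  scan₄ ok _ [] _ = true
  scan₄ ok (suc n) (k ∷ ks) (a ∷ b ∷ c ∷ d ∷ r) = ok k (suc n) a b c d ∧ scan₄ ok n ks (b ∷ c ∷ d ∷ r)
  scan₄ ok _ _ _ = false

  -- Values k for n = 44, 43, …, 2.
  numerators : List ℕ
  numerators = 21 ∷ 22 ∷ 23 ∷ 24 ∷ 25 ∷ 26 ∷ 27 ∷ 28 ∷ 29 ∷ 30 ∷ 32 ∷ 33 ∷ 35 ∷ 37 ∷ 39 ∷ 41 ∷ 43 ∷ 45 ∷ 48 ∷ 51 ∷ 54 ∷ 58 ∷ 62 ∷ 66 ∷ 71 ∷ 77 ∷ 83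
    ∷ 91 ∷ 100 ∷ 110 ∷ 122 ∷ 136 ∷ 154 ∷ 175 ∷ 202 ∷ 237 ∷ 283 ∷ 346 ∷ 436 ∷ 573 ∷ 801 ∷ 1234 ∷ 2267 ∷ []

  along : ∀ (ok : List ℕ → Bool) l l′ → l ≡ l′ → ok l′ ≡ true → ok l ≡ true
  along ok l l′ refl e = e

  abstract
    direct-computed : scan₄ direct 44 numerators (pList (σlist 1 46) 46) ≡ true
    direct-computed = refl

  direct-check : ∀ n → suc (suc n) ≡ 46 → scan₄ direct 44 numerators (descending p (suc (suc n))) ≡ true
  direct-check n e = along (scan₄ direct 44 numerators) (descending p (suc (suc n))) (pList (σlist 1 46) 46)
    (trans (cong (descending p) e) (sym (pList-spec 46 46 ℕₚ.≤-refl))) direct-computed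

  scan₄-step : ∀ ok (f : ℕ → ℕ) n k ks a b c m → scan₄ ok (suc n) (k ∷ ks) (a ∷ b ∷ c ∷ descending f m) ≡ true →
    (ok k (suc n) a b c (f m) ≡ true) × (scan₄ ok n ks (b ∷ c ∷ descending f m) ≡ true)
  scan₄-step ok f n k ks a b c zero e = ∧-true e
  scan₄-step ok f n k ks a b c (suc m) e = ∧-true e

  scan₄-sound : ∀ ok f n ks → scan₄ ok n ks (descending f (suc (suc n))) ≡ true → ∀ m → suc m ℕ.≤ n → n ℕ.< suc m ℕ.+ length ks →
    ∃[ k ] ok k (suc m) (f (suc (suc (suc m)))) (f (suc (suc m))) (f (suc m)) (f m) ≡ true
  scan₄-sound ok f n [] e m q r = ⊥-elim (ℕₚ.<⇒≱ r (subst (ℕ._≤ n) (sym (ℕₚ.+-identityʳ (suc m))) q))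
  scan₄-sound ok f (suc n) (k ∷ ks) e m (s≤s q) r with scan₄-step ok f n k ks (f (suc (suc (suc n)))) (f (suc (suc n))) (f (suc n)) n e | ℕₚ.m≤n⇒m<n∨m≡n q
  ... | t , _ | inj₂ refl = k , t
  ... | _ , t | inj₁ q′ = scan₄-sound ok f n ks t m q′ (ℕₚ.≤-pred (subst (suc n ℕ.<_) (cong suc (ℕₚ.+-suc m (length ks))) r))

  -- No sign of 1 - u is assumed, since p is not log-concave here: p(25)² < p(24) p(26). The entries
  -- of `numerators` are the largest k with 4 n³ k² ≤ 1.6448 · 10⁸.
  direct-sound : ∀ n k → direct k (suc n) (p (suc (suc (suc n)))) (p (suc (suc n))) (p (suc n)) (p n) ≡ true → Claim (suc n)
  direct-sound n k h = c , *-nonneg (0≤ι k) (inv-nonneg (ι 10000) (1≤ιsuc 9999)) , (proj₁ basel-lower , π²-bound) , λ e → proj₂ bounds (cleared e)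
    where
    m = suc n
    bounds = direct-bounds k (suc n) (p (suc (suc (suc n)))) (p (suc (suc n))) (p (suc n)) (p n) h
    c : F
    c = ι k * inv (ι 10000)
    10⁴c : ι 10000 * c ≡ ι k
    10⁴c = trans (*-left-swap _ _ _) (trans (cong (ι k *_) (inv-inverse (ι 10000) (1≤ιsuc 9999))) (*-1 _))
    π²-bound : ¬ (ι 6 * basel₂ (proj₁ basel-lower) ≤ ι 24 * ι m * ι m * ι m * c * c)
    π²-bound e = ℕₚ.1+n≰n (fromℤ-reflects 164480001 164480000 (≤-trans (proj₂ basel-lower) (*-cancel (1≤ιsuc 5)
      (≤-reflexiveˡ (*-left-swap _ _ _) (≤-trans (*-monoˡ (0≤ι 100000000) e)
        (≤-reflexiveˡ (ring (# 100000000 ⊗ (# 24 ⊗ v0 ⊗ v0 ⊗ v0 ⊗ v1 ⊗ v1)) (# 6 ⊗ (# 4 ⊗ (v0 ⊗ v0 ⊗ v0) ⊗ ((# 10000 ⊗ v1) ⊗ (# 10000 ⊗ v1)))) (ι m ∷ c ∷ []) refl)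
          (*-monoˡ (0≤ι 6) (≤-reflexiveˡ (cong (λ z → ι 4 * (ι m * ι m * ι m) * (z * z)) 10⁴c) (proj₁ bounds)))))))))
    u v D E : F
    u = ratio m
    v = ratio (suc m)
    D = X m * X (suc m)
    E = Y m * Y (suc m)
    Duv : D * (u * v) ≡ E
    Duv = trans (ring (v0 ⊗ v1 ⊗ (v2 ⊗ v3)) (v0 ⊗ v2 ⊗ (v1 ⊗ v3)) (X m ∷ X (suc m) ∷ u ∷ v ∷ []) refl) (cong₂ _*_ (X-ratio m) (X-ratio (suc m)))
    cleared : (ι 1 + c) * ((ι 1 - u * v) * (ι 1 - u * v)) ≤ ι 4 * (ι 1 - u) * (ι 1 - v) → (ι 10000 + ι k) * ((D - E) * (D - E)) ≤ ι 40000 * D * (gap m * gap (suc m))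
    cleared e = ≤-reflexiveˡ (trans (cong₂ (λ z w → (ι 10000 + z) * ((D - w) * (D - w))) (sym 10⁴c) (sym Duv))
        (ring ((# 10000 ⊕ # 10000 ⊗ v0) ⊗ ((v1 ⊖ v1 ⊗ v2) ⊗ (v1 ⊖ v1 ⊗ v2))) (# 10000 ⊗ (v1 ⊗ v1) ⊗ ((# 1 ⊕ v0) ⊗ ((# 1 ⊖ v2) ⊗ (# 1 ⊖ v2)))) (c ∷ D ∷ u * v ∷ []) refl))
      (≤-reflexiveʳ (*-monoˡ (*-nonneg (0≤ι 10000) (sq-nonneg D)) e)
        (trans (ring (# 10000 ⊗ (v0 ⊗ v1 ⊗ (v0 ⊗ v1)) ⊗ (# 4 ⊗ v2 ⊗ v3)) (# 40000 ⊗ (v0 ⊗ v1) ⊗ ((v0 ⊗ v2) ⊗ (v1 ⊗ v3))) (X m ∷ X (suc m) ∷ ι 1 - u ∷ ι 1 - v ∷ []) refl)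
          (cong₂ (λ z w → ι 40000 * D * (z * w)) (X-complement m) (X-complement (suc m)))))

  claim : ∀ n → 2 ℕ.≤ n → Claim n
  claim (suc n) (s≤s 1≤n) with suc n ℕ.≤? 44
  ... | yes q = direct-sound n (proj₁ found) (proj₂ found)
    where found = scan₄-sound direct p 44 numerators (direct-check 44 refl) n q (s≤s (ℕₚ.+-monoˡ-≤ 43 1≤n))
  ... | no q = claim-from-turán (suc n) (turán-large n 44≤n) (turán-large (suc n) (ℕₚ.≤-trans 44≤n (ℕₚ.n≤1+n n)))
    where
    44≤n : 44 ℕ.≤ n
    44≤n = ℕₚ.≤-pred (ℕₚ.≰⇒> q)

  quotient-unique : ∀ {q} a d → 1 ℕ.≤ d → q * ι d ≡ ι a → q ≡ ι a * inv (ι d)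
  quotient-unique a d h e = *-cancel-≡ (ι-mono h) (trans (*-comm _ _) (trans e
    (sym (trans (*-left-swap _ _ _) (trans (cong (ι a *_) (inv-inverse (ι d) (ι-mono h))) (*-1 _))))))

  -- The operations are variables so that, in a concrete field, matching the
  -- conclusion against a given statement never unfolds arithmetic.
  transfer : (lt : F → F → Set) (mul add sub : F → F → F) (N : ℕ → F) (z o : F) (frac : ℕ → ℕ → F) (u b : ℕ → F) →
    (∀ {x y} → ¬ (y ≤ x) → lt x y) → mul ≡ _*_ → add ≡ _+_ → sub ≡ _-_ → N ≡ ι → z ≡ ι 0 → o ≡ ι 1 →
    (∀ a d → 1 ℕ.≤ d → mul (frac a d) (N d) ≡ N a) →
    (∀ n → u n ≡ frac (p (suc n) ℕ.* p (n ∸ 1)) (p n ℕ.* p n)) →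
    b 0 ≡ z → (∀ k → b (suc k) ≡ add (b k) (frac 1 (suc k ℕ.* suc k))) →
    ∀ n → 2 ℕ.≤ n → ∃[ c ] ((z ≤ c)
      × (∃[ K ] lt (mul (mul (mul (mul (mul (N 24) (N n)) (N n)) (N n)) c) c) (mul (N 6) (b K)))
      × lt (mul (mul (N 4) (sub o (u n))) (sub o (u (suc n))))
          (mul (add o c) (mul (sub o (mul (u n) (u (suc n)))) (sub o (mul (u n) (u (suc n)))))))
  transfer lt _ _ _ _ _ _ frac u b ≰⇒lt refl refl refl refl refl refl frac-mul u≡ b-0 b-suc n 2≤n with claim n 2≤n
  ... | c , 0≤c , (K , below) , main = c , 0≤c
    , (K , ≰⇒lt (subst (λ x → ¬ (ι 6 * x ≤ ι 24 * ι n * ι n * ι n * c * c)) (sym (b≡ K)) below))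
    , ≰⇒lt (subst₂ (λ x y → ¬ ((ι 1 + c) * ((ι 1 - x * y) * (ι 1 - x * y)) ≤ ι 4 * (ι 1 - x) * (ι 1 - y))) (sym (u-ratio n)) (sym (u-ratio (suc n))) main)
    where
    u-ratio : ∀ n → u n ≡ ratio n
    u-ratio n = trans (u≡ n) (trans (quotient-unique _ _ pp (frac-mul (p (suc n) ℕ.* p (n ∸ 1)) (p n ℕ.* p n) pp))
      (cong₂ (λ y x → y * inv x) (trans (ι-* (p (suc n)) (p (n ∸ 1))) (*-comm (P (suc n)) (P (n ∸ 1)))) (ι-* (p n) (p n))))
      where
      pp : 1 ℕ.≤ p n ℕ.* p n
      pp = ℕₚ.*-mono-≤ (p-pos n) (p-pos n)
    b≡ : ∀ K → b K ≡ basel₂ K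
    b≡ zero = b-0
    b≡ (suc k) = trans (b-suc k) (cong₂ _+_ (b≡ k) (*-cancel-≡ (1≤product h h)
      (trans (trans (cong (_* frac 1 (suc k ℕ.* suc k)) (sym (ι-* (suc k) (suc k)))) (trans (*-comm _ _) (frac-mul 1 (suc k ℕ.* suc k) (s≤s z≤n))))
        (sym (trans (ring (v0 ⊗ v0 ⊗ (v1 ⊗ v1)) ((v0 ⊗ v1) ⊗ (v0 ⊗ v1)) (ι (suc k) ∷ inv (ι (suc k)) ∷ []) refl)
          (trans (cong (λ x → x * x) (inv-inverse (ι (suc k)) h)) (1* _)))))))
      where
      h = 1≤ιsuc k

-- The rational numbers as an ordered field

module RationalField where

  open import Data.Integer using (+_)
  open import Data.Rational using (ℚ; 0ℚ; 1ℚ; 1/_)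

  int : ℤ → ℚ
  int z = z ℚ./ 1

  toℚᵘ-int : ∀ z → toℚᵘ (int z) ≃ mkℚᵘ z 0
  toℚᵘ-int z = ℚₚ.toℚᵘ-fromℚᵘ (mkℚᵘ z 0)

  int-+ : ∀ a b → int (a ℤ.+ b) ≡ int a ℚ.+ int b
  int-+ a b = ℚₚ.toℚᵘ-injective (ℚᵘₚ.≃-trans (toℚᵘ-int (a ℤ.+ b)) (ℚᵘₚ.≃-trans (*≡* eq) (ℚᵘₚ.≃-sym
    (ℚᵘₚ.≃-trans (ℚₚ.toℚᵘ-homo-+ (int a) (int b)) (ℚᵘₚ.+-cong (toℚᵘ-int a) (toℚᵘ-int b))))))
    where
    eq : (a ℤ.+ b) ℤ.* (+ 1 ℤ.* + 1) ≡ (a ℤ.* + 1 ℤ.+ b ℤ.* + 1) ℤ.* + 1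
    eq = cong (ℤ._* + 1) (sym (cong₂ ℤ._+_ (ℤₚ.*-identityʳ a) (ℤₚ.*-identityʳ b)))

  int-* : ∀ a b → int (a ℤ.* b) ≡ int a ℚ.* int b
  int-* a b = ℚₚ.toℚᵘ-injective (ℚᵘₚ.≃-trans (toℚᵘ-int (a ℤ.* b)) (ℚᵘₚ.≃-sym
    (ℚᵘₚ.≃-trans (ℚₚ.toℚᵘ-homo-* (int a) (int b)) (ℚᵘₚ.*-cong (toℚᵘ-int a) (toℚᵘ-int b)))))

  int-neg : ∀ a → int (ℤ.- a) ≡ ℚ.- int a
  int-neg a = ℚₚ.toℚᵘ-injective (ℚᵘₚ.≃-trans (toℚᵘ-int (ℤ.- a)) (ℚᵘₚ.≃-sym
    (ℚᵘₚ.≃-trans (ℚₚ.toℚᵘ-homo‿- (int a)) (ℚᵘₚ.-‿cong (toℚᵘ-int a)))))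

  int-mono : ∀ {a b} → a ℤ.≤ b → int a ℚ.≤ int b
  int-mono {a} {b} p = ℚₚ.toℚᵘ-cancel-≤ (ℚᵘₚ.≤-respˡ-≃ (ℚᵘₚ.≃-sym (toℚᵘ-int a)) (ℚᵘₚ.≤-respʳ-≃ (ℚᵘₚ.≃-sym (toℚᵘ-int b))
    (*≤* (ℤₚ.*-monoʳ-≤-nonNeg (+ 1) p))))

  int-reflects : ∀ {a b} → int a ℚ.≤ int b → a ℤ.≤ b
  int-reflects {a} {b} p with ℚᵘₚ.≤-respˡ-≃ (toℚᵘ-int a) (ℚᵘₚ.≤-respʳ-≃ (toℚᵘ-int b) (ℚₚ.toℚᵘ-mono-≤ p))
  ... | *≤* q = subst₂ ℤ._≤_ (ℤₚ.*-identityʳ a) (ℤₚ.*-identityʳ b) q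

  recip : (x : ℚ) → Dec (x ≡ 0ℚ) → ℚ
  -- A default value that makes the inverse total; the field laws concern only x ≥ 1.
  recip x (yes _) = 0ℚ
  recip x (no x≢0) = 1/_ x {{ℚ.≢-nonZero x≢0}}

  inverse : ℚ → ℚ
  inverse x = recip x (x ℚ.≟ 0ℚ)

  ≢0 : ∀ {x} → 1ℚ ℚ.≤ x → x ≢ 0ℚ
  ≢0 p refl with int-reflects {+ 1} {+ 0} p
  ... | ℤ.+≤+ ()

  inverse-inverse : ∀ x → 1ℚ ℚ.≤ x → x ℚ.* inverse x ≡ 1ℚ
  inverse-inverse x p with x ℚ.≟ 0ℚ
  ... | yes e = ⊥-elim (≢0 p e)
  ... | no x≢0 = ℚₚ.*-inverseʳ x {{ℚ.≢-nonZero x≢0}}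

  inverse-nonneg : ∀ x → 1ℚ ℚ.≤ x → 0ℚ ℚ.≤ inverse x
  inverse-nonneg x p with x ℚ.≟ 0ℚ
  ... | yes e = ℚₚ.≤-refl
  ... | no x≢0 = ℚₚ.<⇒≤ (ℚₚ.positive⁻¹ (1/_ x {{ℚ.≢-nonZero x≢0}}) {{ℚₚ.1/pos⇒pos x {{ℚ.positive (ℚₚ.<-≤-trans (ℚₚ.positive⁻¹ 1ℚ) p)}}}})

  *-nonneg : ∀ {x y} → 0ℚ ℚ.≤ x → 0ℚ ℚ.≤ y → 0ℚ ℚ.≤ x ℚ.* y
  *-nonneg {x} {y} p q = subst (ℚ._≤ x ℚ.* y) (ℚₚ.*-zeroʳ x) (ℚₚ.*-monoˡ-≤-nonNeg x {{ℚ.nonNegative p}} q)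

  ℚ-field : OrderedField
  ℚ-field = record
    { F = ℚ ; _+_ = ℚ._+_ ; _*_ = ℚ._*_ ; -_ = ℚ.-_ ; inv = inverse ; fromℤ = int ; _≤_ = ℚ._≤_
    ; +-assoc = ℚₚ.+-assoc ; +-comm = ℚₚ.+-comm ; *-assoc = ℚₚ.*-assoc ; *-comm = ℚₚ.*-comm ; *-distribˡ = ℚₚ.*-distribˡ-+
    ; fromℤ-+ = int-+ ; fromℤ-* = int-* ; fromℤ-neg = int-neg
    ; 0+ = ℚₚ.+-identityˡ ; 1* = ℚₚ.*-identityˡ ; -‿inverse = ℚₚ.+-inverseˡ
    ; inv-inverse = inverse-inverse ; inv-nonneg = inverse-nonneg
    ; ≤-refl = ℚₚ.≤-refl ; ≤-trans = ℚₚ.≤-trans ; ≤-total = ℚₚ.≤-total ; +-mono = ℚₚ.+-mono-≤ ; *-nonneg = *-nonneg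
    ; fromℤ-nonneg = λ n → int-mono {+ 0} {+ n} (ℤ.+≤+ ℕ.z≤n) ; fromℤ-reflects = λ m n p → ℤₚ.drop‿+≤+ (int-reflects {+ m} {+ n} p) }

-- The statement over the rational numbers

open import Defs
open import Data.Nat using (ℕ; suc; _≤_)
open import Data.Rational using (ℚ; 0ℚ; 1ℚ; _+_; _*_; _-_; _<_) renaming (_≤_ to _≤ℚ_)
open import Data.Product using (∃-syntax; _×_)
open import Data.Integer using (+_)
open RationalField using (ℚ-field; int; toℚᵘ-int)
open Development ℚ-field using (transfer)

frac-* : ∀ a d → 1 ℕ.≤ d → frac a d * ℕ→ℚ d ≡ ℕ→ℚ a
frac-* a (suc d) _ = ℚₚ.toℚᵘ-injective (ℚᵘₚ.≃-trans (ℚₚ.toℚᵘ-homo-* (frac a (suc d)) (int (+ suc d)))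
  (ℚᵘₚ.≃-trans (ℚᵘₚ.*-cong (ℚₚ.toℚᵘ-fromℚᵘ (mkℚᵘ (+ a) d)) (toℚᵘ-int (+ suc d)))
    (ℚᵘₚ.≃-trans (*≡* eq) (ℚᵘₚ.≃-sym (toℚᵘ-int (+ a))))))
  where
  eq : (+ a ℤ.* + suc d) ℤ.* + 1 ≡ + a ℤ.* (+ (suc d ℕ.* 1))
  eq = trans (ℤₚ.*-identityʳ _) (cong (λ k → + a ℤ.* + k) (sym (ℕₚ.*-identityʳ (suc d))))

theorem1p2 : (n : ℕ) → 2 ≤ n →
    ∃[ c ] ((0ℚ ≤ℚ c)
      × ((ℕ→ℚ 24 * ℕ→ℚ n * ℕ→ℚ n * ℕ→ℚ n * c * c) <π²)
      × (ℕ→ℚ 4 * (1ℚ - u n) * (1ℚ - u (suc n))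
          < (1ℚ + c) * ((1ℚ - u n * u (suc n)) * (1ℚ - u n * u (suc n)))))
theorem1p2 = transfer _<_ _*_ _+_ _-_ ℕ→ℚ 0ℚ 1ℚ frac u basel ℚₚ.≰⇒> refl refl refl refl refl refl
  frac-* (λ n → refl) refl (λ k → refl)
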